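{- Let $E_{222}$ be the elliptic curve over the function field $\mathbb{Q}(a)$ given by \[ y^2 = x^3 + \left(16a + \tfrac{942}{13}\right)x^2 + \left(\tfrac{10048}{13}a + \tfrac{293084}{169}\right)x + 1024a^2 + \tfrac{1620800}{169}a + \tfrac{30250696}{2197}. \] Then $E_{222}(\mathbb{Q}(a))$ has rank $2$ and is generated by the two independent points $P(a) = \left(-\tfrac{262}{13},\, 32a+8\right)$ and $Q(a) = \left(-\tfrac{366}{13},\, 32a+8\right)$.
   Context: $E_{222}$ is a Weierstrass model of the genus-one curve $V(z_2^2 + z_1 z_3 - z_0^2 - a z_3^2,\, z_2^2 + z_2 z_3 - z_1^2 - a z_3^2) \subset \mathbb{P}^3_{\mathbb{Q}(a)}$, which parametrizes (for $f_c(x) = x^2+c$) third pre-images of $a$; its discriminant is $(4a+1)^2(256a^3+368a^2+104a+23)$. -}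

module Defs where

open import Data.Nat using (ℕ; zero; suc)
open import Data.Integer as ℤ using (ℤ; +_; -[1+_])
open import Data.Rational as ℚ using (ℚ; 0ℚ; 1ℚ)
open import Data.Rational.Properties as ℚP using ()
open import Data.List using (List; []; _∷_; map)
open import Data.List.Relation.Unary.All using (All; all?)
open import Data.Product using (_×_; Σ; ∃-syntax; _,_)
open import Data.Unit using (⊤)
open import Data.Empty using (⊥)
open import Relation.Nullary using (¬_; Dec; yes; no)
open import Relation.Binary.PropositionalEquality using (_≡_)

-- Polynomials in ℚ[a], as coefficient lists (lowest degree first).
-- Trailing zeros are allowed; "zero" means all coefficients vanish.

Poly : Set
Poly = List ℚ

infixl 6 _+ₚ_ _-ₚ_
infixl 7 _*ₚ_

_+ₚ_ : Poly → Poly → Poly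
[]      +ₚ q       = q
(c ∷ p) +ₚ []      = c ∷ p
(c ∷ p) +ₚ (d ∷ q) = (c ℚ.+ d) ∷ (p +ₚ q)

negₚ : Poly → Poly
negₚ = map (λ c → ℚ.- c)

_-ₚ_ : Poly → Poly → Poly
p -ₚ q = p +ₚ negₚ q

_*ₚ_ : Poly → Poly → Poly
[]      *ₚ q = []
(c ∷ p) *ₚ q = map (c ℚ.*_) q +ₚ (0ℚ ∷ (p *ₚ q))

IsZeroₚ : Poly → Set
IsZeroₚ p = All (_≡ 0ℚ) p

isZeroₚ? : (p : Poly) → Dec (IsZeroₚ p)
isZeroₚ? p = all? (λ c → c ℚP.≟ 0ℚ) p

-- Elements of the function field ℚ(a) as fractions num/den.
-- A fraction is Valid when its denominator is a nonzero polynomial;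
-- equality of fractions is cross-multiplication.

record RF : Set where
  constructor _//_
  field
    num : Poly
    den : Poly
open RF public

Valid : RF → Set
Valid f = ¬ IsZeroₚ (den f)

infix 4 _≈_
_≈_ : RF → RF → Set
f ≈ g = IsZeroₚ (num f *ₚ den g -ₚ num g *ₚ den f)

_≈?_ : (f g : RF) → Dec (f ≈ g)
f ≈? g = isZeroₚ? (num f *ₚ den g -ₚ num g *ₚ den f)

infixl 6 _+ᶠ_ _-ᶠ_
infixl 7 _*ᶠ_ _/ᶠ_

_+ᶠ_ : RF → RF → RF
f +ᶠ g = (num f *ₚ den g +ₚ num g *ₚ den f) // (den f *ₚ den g)

-ᶠ_ : RF → RF
-ᶠ f = negₚ (num f) // den f

_-ᶠ_ : RF → RF → RF
f -ᶠ g = f +ᶠ (-ᶠ g)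

_*ᶠ_ : RF → RF → RF
f *ᶠ g = (num f *ₚ num g) // (den f *ₚ den g)

-- division (only used when the divisor is nonzero)
_/ᶠ_ : RF → RF → RF
f /ᶠ g = (num f *ₚ den g) // (den f *ₚ num g)

const : ℚ → RF
const c = (c ∷ []) // (1ℚ ∷ [])

aᶠ : RF
aᶠ = (0ℚ ∷ 1ℚ ∷ []) // (1ℚ ∷ [])

A₂ A₄ A₆ : RF
A₂ = const (+ 16 ℚ./ 1) *ᶠ aᶠ +ᶠ const (+ 942 ℚ./ 13)
A₄ = const (+ 10048 ℚ./ 13) *ᶠ aᶠ +ᶠ const (+ 293084 ℚ./ 169)
A₆ = const (+ 1024 ℚ./ 1) *ᶠ aᶠ *ᶠ aᶠ
     +ᶠ const (+ 1620800 ℚ./ 169) *ᶠ aᶠ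
     +ᶠ const (+ 30250696 ℚ./ 2197)

data Pt : Set where
  O   : Pt
  aff : RF → RF → Pt

OnCurve : Pt → Set
OnCurve O         = ⊤
OnCurve (aff x y) =
  Valid x × Valid y ×
  (y *ᶠ y ≈ x *ᶠ x *ᶠ x +ᶠ A₂ *ᶠ x *ᶠ x +ᶠ A₄ *ᶠ x +ᶠ A₆)

infix 4 _≈ₚₜ_
_≈ₚₜ_ : Pt → Pt → Set
O         ≈ₚₜ O           = ⊤
O         ≈ₚₜ aff _ _     = ⊥
aff _ _   ≈ₚₜ O           = ⊥
aff x y   ≈ₚₜ aff x′ y′   = (x ≈ x′) × (y ≈ y′)

-- chord–tangent group law (Weierstrass form with a₁ = a₃ = 0)
two three : RF
two   = const (+ 2 ℚ./ 1)
three = const (+ 3 ℚ./ 1)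

sumWith : RF → RF → RF → RF → RF → Pt
sumWith λ′ x₁ y₁ x₂ y₂ =
  let x₃ = λ′ *ᶠ λ′ -ᶠ A₂ -ᶠ x₁ -ᶠ x₂
  in  aff x₃ (-ᶠ (λ′ *ᶠ (x₃ -ᶠ x₁) +ᶠ y₁))

infixl 6 _⊕_
_⊕_ : Pt → Pt → Pt
O ⊕ R = R
aff x₁ y₁ ⊕ O = aff x₁ y₁
aff x₁ y₁ ⊕ aff x₂ y₂ with x₁ ≈? x₂
... | no _ = sumWith ((y₂ -ᶠ y₁) /ᶠ (x₂ -ᶠ x₁)) x₁ y₁ x₂ y₂
... | yes _ with (y₁ +ᶠ y₂) ≈? const 0ℚ
...   | yes _ = O
...   | no _  = sumWith ((three *ᶠ x₁ *ᶠ x₁ +ᶠ two *ᶠ A₂ *ᶠ x₁ +ᶠ A₄) /ᶠ (two *ᶠ y₁))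
                        x₁ y₁ x₂ y₂

⊖_ : Pt → Pt
⊖ O = O
⊖ aff x y = aff x (-ᶠ y)

mulℕ : ℕ → Pt → Pt
mulℕ zero    R = O
mulℕ (suc n) R = R ⊕ mulℕ n R

infixl 7 _·_
_·_ : ℤ → Pt → Pt
(+ n)    · R = mulℕ n R
-[1+ n ] · R = ⊖ (mulℕ (suc n) R)

Pₐ Qₐ : Pt
Pₐ = aff (const (ℚ.- (+ 262 ℚ./ 13))) (const (+ 32 ℚ./ 1) *ᶠ aᶠ +ᶠ const (+ 8 ℚ./ 1))
Qₐ = aff (const (ℚ.- (+ 366 ℚ./ 13))) (const (+ 32 ℚ./ 1) *ᶠ aᶠ +ᶠ const (+ 8 ℚ./ 1))

{-# OPTIONS --safe #-}
-- With t = 4a + 1, the substitution x = 4u - 262/13, y = 8v turns the curve into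
-- v² = u³ + (t + 2)u² + 2tu + t², and P, Q into (0, t), (-2, t), with P + Q = (-t, -t).
-- A root θ of the cubic is θ = z + z⁻¹ where t = -(z + 1)(z² + 1)/z², so the order
-- ℚ[t][z, z⁻¹] is the principal ideal domain ℚ[z, z⁻¹], whose units are the monomials c zⁱ.
--
-- For a point R with u = x/ζ² in lowest terms, a common divisor of x - θζ² and its
-- cofactor in y² divides the different. Norms and units then leave for x - θζ² modulo
-- squares only 1, -θ, -z and -(t + θ), the classes of O, P, Q and P + Q. If the class is
-- trivial, x - θζ² = h² and the coordinates of h yield R′ with R = ±2R′; comparing
-- degrees, the height of R′ is about a quarter of that of R. The other classes
-- are reduced to the trivial one by adding P, Q or P + Q, and the descent ends at the
-- finitely many abscissas of height 0.
--
-- The same halving shows that none of P, Q, P + Q is a double. As the cubic is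
-- irreducible there is no 2-torsion, so a relation mP + nQ = O has m and n even and can
-- be divided by 2 forever.

module Submission where

-- The parameter `z` arises because `θ³ + (t + 2)θ² + 2tθ + t² = 0` is quadratic in `t` with
-- discriminant `θ²(θ² - 4)`. The root becomes rational for `θ = z + z⁻¹`, and
-- `t = -(z + 1)(z² + 1)/z²` follows. So the cubic field is itself a rational function field, whose
-- ideals and units are under control. The order ℚ[t][θ] would be too small: it is singular over
-- `t = 0`, with conductor `z² + 1`, and this very prime separates the classes of `P` and `P + Q`
-- from those of `O` and `Q`.
--
-- Height `n` means `deg ζ ≤ n` and `deg x ≤ 2n + 2`. Halving leads from `n ≤ 4m + 3` to `m`, but a
-- translation may double the height and could spoil the gain. Membership in a class, however,
-- restricts degrees and divisibility by `t`, so that translates have height at most `2n` for `P`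
-- and `Q`, and `2n + 1` for `P + Q`. With `m = ⌊n/2⌋` this just fits. In height 0 halving itself
-- names the abscissa, except in the class of `P + Q`, where the points are solved for directly.

open import Algebra.Bundles using (CommutativeRing; AbelianGroup)
open import Data.Bool using (Bool; true; false; T; _∧_; if_then_else_)
open import Data.Empty using (⊥; ⊥-elim)
open import Data.Fin using (Fin)
open import Data.Integer as ℤ using (ℤ; +_; -[1+_])
open import Data.Integer.DivMod using (_/ℕ_; _%ℕ_; n%ℕd<d; a≡a%ℕn+[a/ℕn]*n)
open import Data.List using (List; []; _∷_; map)
open import Data.List.Relation.Unary.All as All using (All; []; _∷_)
open import Data.Nat as ℕ using (ℕ; zero; suc; z≤n; s≤s)
open import Data.Nat.Induction using (<-wellFounded)
open import Data.Nat.Solver using (module +-*-Solver)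
open import Data.Product using (_×_; Σ; ∃-syntax; _,_; proj₁; proj₂)
open import Data.Rational as ℚ using (ℚ; 0ℚ; 1ℚ)
open import Data.Sum using (_⊎_; inj₁; inj₂)
open import Data.Unit using (tt)
open import Data.Vec as Vec using (Vec; []; _∷_)
open import Induction.WellFounded using (Acc; acc)
open import Level using (0ℓ)
open import Relation.Binary.PropositionalEquality as ≡ using (_≡_; refl; cong; cong₂; subst)
open import Relation.Nullary using (¬_; Dec; yes; no)
open import Relation.Nullary.Decidable using (True; toWitness)
import Algebra.Properties.AbelianGroup
import Algebra.Properties.CommutativeSemigroup
import Algebra.Properties.Monoid.Mult
import Algebra.Properties.Ring
import Algebra.Properties.Semiring.Mult
import Data.Integer.Properties as ℤP
import Data.Nat.Properties as ℕP
import Data.Rational.Properties as ℚP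
import Data.Vec.Properties as VecP
import Relation.Binary.Reasoning.Setoid

-- Ring identities modulo hypotheses, by reflection

data Expr (n : ℕ) : Set where
  con : ℤ → Expr n
  var : Fin n → Expr n
  _:+_ _:-_ _:*_ : Expr n → Expr n → Expr n
  :-_ : Expr n → Expr n

infixl 6 _:+_ _:-_
infixl 7 _:*_
infix 8 :-_
infix 5 _:=_

#_ : ∀ {n} → ℕ → Expr n
# k = con (+ k)

infix 9 #_

data Eqn (n : ℕ) : Set where
  _:=_ : Expr n → Expr n → Eqn n

Fun : ℕ → Set → Set → Set
Fun zero    A B = B
Fun (suc n) A B = A → Fun n A B

applyAll : ∀ {A B : Set} n → Fun n A B → Vec A n → B
applyAll zero    f []       = f
applyAll (suc n) f (x ∷ xs) = applyAll n (f x) xs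

vars : ∀ n → Vec (Expr n) n
vars n = Vec.map var (Vec.allFin n)

-- Recursive dense representation: a polynomial in n + 1 variables is the
-- list of its coefficients with respect to the first one.
NF : ℕ → Set
NF zero    = ℤ
NF (suc n) = List (NF n)

0ₙ : ∀ n → NF n
0ₙ zero    = + 0
0ₙ (suc n) = []

conₙ : ∀ n → ℤ → NF n
conₙ zero    k = k
conₙ (suc n) k = conₙ n k ∷ []

varₙ : ∀ n → Fin n → NF n
varₙ (suc n) Fin.zero    = 0ₙ n ∷ conₙ n (+ 1) ∷ []
varₙ (suc n) (Fin.suc i) = varₙ n i ∷ []

isZeroₙ : ∀ n → NF n → Bool
isZeroₙ zero    (+ zero)      = true
isZeroₙ zero    (+ suc _)     = false
isZeroₙ zero    -[1+ _ ]      = false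
isZeroₙ (suc n) []            = true
isZeroₙ (suc n) (p ∷ ps)      = isZeroₙ n p ∧ isZeroₙ (suc n) ps

mutual
  addₙ : ∀ n → NF n → NF n → NF n
  addₙ zero    p q = p ℤ.+ q
  addₙ (suc n) p q = addsₙ n p q

  addsₙ : ∀ n → List (NF n) → List (NF n) → List (NF n)
  addsₙ n []       q        = q
  addsₙ n (a ∷ p)  []       = a ∷ p
  addsₙ n (a ∷ p)  (b ∷ q)  = addₙ n a b ∷ addsₙ n p q

negₙ : ∀ n → NF n → NF n
negₙ zero    p = ℤ.- p
negₙ (suc n) p = map (negₙ n) p

mutual
  mulₙ : ∀ n → NF n → NF n → NF n
  mulₙ zero    p q = p ℤ.* q
  mulₙ (suc n) p q = mulsₙ n p q

  mulsₙ : ∀ n → List (NF n) → List (NF n) → List (NF n)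
  mulsₙ n []      q = []
  -- Skipping zero coefficients keeps products of sparse polynomials small.
  mulsₙ n (a ∷ p) q = addsₙ n (if isZeroₙ n a then [] else scaleₙ n a q) (0ₙ n ∷ mulsₙ n p q)

  scaleₙ : ∀ n → NF n → List (NF n) → List (NF n)
  scaleₙ n a []      = []
  scaleₙ n a (b ∷ q) = mulₙ n a b ∷ scaleₙ n a q

norm : ∀ {n} → Expr n → NF n
norm {n} (con k)  = conₙ n k
norm {n} (var i)  = varₙ n i
norm {n} (e :+ f) = addₙ n (norm e) (norm f)
norm {n} (e :- f) = addₙ n (norm e) (negₙ n (norm f))
norm {n} (e :* f) = mulₙ n (norm e) (norm f)
norm {n} (:- e)   = negₙ n (norm e)

combination : ∀ {n} → List (Expr n × Eqn n) → Expr n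
combination []                     = # 0
combination ((c , (l := r)) ∷ hs) = c :* (l :- r) :+ combination hs

defect : ∀ {n} → Eqn n × List (Expr n × Eqn n) → NF n
defect ((l := r) , hs) = norm ((l :- r) :- combination hs)

module LinearSolver {c ℓ} (R : CommutativeRing c ℓ) where
  open CommutativeRing R
    renaming (sym to ≈-sym; trans to ≈-trans; refl to ≈-refl) hiding (zero)
  open Algebra.Properties.Ring ring
  open Algebra.Properties.Semiring.Mult semiring using (×1-homo-*; ×-homo-+) renaming (_×_ to _∙_)
  open Relation.Binary.Reasoning.Setoid setoid

  -- The separate clause for 1 makes the literal `# 1` evaluate to `1#` itself and not to `1# + 0#`,
  -- so that identities apply to terms containing `1#` as they stand.
  fromℕ : ℕ → Carrier
  fromℕ zero          = 0#
  fromℕ (suc zero)    = 1#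
  fromℕ (suc (suc n)) = 1# + fromℕ (suc n)

  fromℤ : ℤ → Carrier
  fromℤ (+ n)    = fromℕ n
  fromℤ -[1+ n ] = - fromℕ (suc n)

  private
    interchange : ∀ a b x y → (a + b) + (x + y) ≈ (a + x) + (b + y)
    interchange a b x y = begin
      (a + b) + (x + y) ≈⟨ +-assoc a b (x + y) ⟩
      a + (b + (x + y)) ≈⟨ +-congˡ (+-assoc b x y) ⟨
      a + ((b + x) + y) ≈⟨ +-congˡ (+-congʳ (+-comm b x)) ⟩
      a + ((x + b) + y) ≈⟨ +-congˡ (+-assoc x b y) ⟩
      a + (x + (b + y)) ≈⟨ +-assoc a x (b + y) ⟨
      (a + x) + (b + y) ∎

    fromℕ-∙ : ∀ n → fromℕ n ≈ n ∙ 1#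
    fromℕ-∙ zero          = ≈-refl
    fromℕ-∙ (suc zero)    = ≈-sym (+-identityʳ 1#)
    fromℕ-∙ (suc (suc n)) = +-congˡ (fromℕ-∙ (suc n))

    fromℕ-suc : ∀ n → fromℕ (suc n) ≈ 1# + fromℕ n
    fromℕ-suc zero    = ≈-sym (+-identityʳ 1#)
    fromℕ-suc (suc n) = ≈-refl

    fromℕ-+ : ∀ m n → fromℕ (m ℕ.+ n) ≈ fromℕ m + fromℕ n
    fromℕ-+ m n = begin
      fromℕ (m ℕ.+ n)   ≈⟨ fromℕ-∙ (m ℕ.+ n) ⟩
      (m ℕ.+ n) ∙ 1#    ≈⟨ ×-homo-+ 1# m n ⟩
      m ∙ 1# + n ∙ 1#   ≈⟨ +-cong (fromℕ-∙ m) (fromℕ-∙ n) ⟨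
      fromℕ m + fromℕ n ∎

    fromℕ-* : ∀ m n → fromℕ (m ℕ.* n) ≈ fromℕ m * fromℕ n
    fromℕ-* m n = begin
      fromℕ (m ℕ.* n)     ≈⟨ fromℕ-∙ (m ℕ.* n) ⟩
      (m ℕ.* n) ∙ 1#      ≈⟨ ×1-homo-* m n ⟩
      (m ∙ 1#) * (n ∙ 1#) ≈⟨ *-cong (fromℕ-∙ m) (fromℕ-∙ n) ⟨
      fromℕ m * fromℕ n   ∎

    fromℤ-⊖ : ∀ m n → fromℤ (m ℤ.⊖ n) ≈ fromℕ m - fromℕ n
    fromℤ-⊖ m       zero    = begin
      fromℤ (m ℤ.⊖ 0) ≡⟨ cong fromℤ (ℤP.⊖-≥ {m} ℕ.z≤n) ⟩
      fromℕ m         ≈⟨ +-identityʳ _ ⟨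
      fromℕ m + 0#    ≈⟨ +-congˡ -0#≈0# ⟨
      fromℕ m - 0#    ∎
    fromℤ-⊖ zero    (suc n) = ≈-sym (+-identityˡ _)
    fromℤ-⊖ (suc m) (suc n) = begin
      fromℤ (suc m ℤ.⊖ suc n)               ≡⟨ cong fromℤ (ℤP.[1+m]⊖[1+n]≡m⊖n m n) ⟩
      fromℤ (m ℤ.⊖ n)                       ≈⟨ fromℤ-⊖ m n ⟩
      fromℕ m - fromℕ n                     ≈⟨ +-identityˡ _ ⟨
      0# + (fromℕ m - fromℕ n)              ≈⟨ +-congʳ (-‿inverseʳ 1#) ⟨
      (1# - 1#) + (fromℕ m - fromℕ n)       ≈⟨ interchange _ _ _ _ ⟩
      (1# + fromℕ m) + (- 1# - fromℕ n)     ≈⟨ +-congˡ (-‿+-comm 1# (fromℕ n)) ⟩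
      (1# + fromℕ m) - (1# + fromℕ n)       ≈⟨ +-cong (fromℕ-suc m) (-‿cong (fromℕ-suc n)) ⟨
      fromℕ (suc m) - fromℕ (suc n)         ∎

    fromℤ-+ : ∀ x y → fromℤ (x ℤ.+ y) ≈ fromℤ x + fromℤ y
    fromℤ-+ (+ m)    (+ n)    = fromℕ-+ m n
    fromℤ-+ (+ m)    -[1+ n ] = fromℤ-⊖ m (suc n)
    fromℤ-+ -[1+ m ] (+ n)    = ≈-trans (fromℤ-⊖ n (suc m)) (+-comm _ _)
    fromℤ-+ -[1+ m ] -[1+ n ] = begin
      - fromℕ (suc (suc (m ℕ.+ n)))       ≡⟨ cong (λ k → - fromℕ (suc k)) (≡.sym (lemma m n)) ⟩
      - fromℕ (suc m ℕ.+ suc n)           ≈⟨ -‿cong (fromℕ-+ (suc m) (suc n)) ⟩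
      - (fromℕ (suc m) + fromℕ (suc n))   ≈⟨ -‿+-comm _ _ ⟨
      - fromℕ (suc m) - fromℕ (suc n)     ∎
      where
      lemma : ∀ m n → m ℕ.+ suc n ≡ suc (m ℕ.+ n)
      lemma zero    n = refl
      lemma (suc m) n = cong suc (lemma m n)

    fromℤ-neg : ∀ x → fromℤ (ℤ.- x) ≈ - fromℤ x
    fromℤ-neg (+ zero)  = ≈-sym -0#≈0#
    fromℤ-neg (+ suc n) = ≈-refl
    fromℤ-neg -[1+ n ]  = ≈-sym (-‿involutive _)

    -- ℤ-multiplication goes through signs, so the negative cases are reduced to the positive one.
    fromℤ-* : ∀ x y → fromℤ (x ℤ.* y) ≈ fromℤ x * fromℤ y
    fromℤ-* (+ m)    (+ n)    = begin
      fromℤ (+ m ℤ.* + n)   ≡⟨ cong fromℤ (≡.sym (ℤP.pos-* m n)) ⟩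
      fromℕ (m ℕ.* n)       ≈⟨ fromℕ-* m n ⟩
      fromℕ m * fromℕ n     ∎
    fromℤ-* (+ m)    -[1+ n ] = begin
      fromℤ (+ m ℤ.* ℤ.- (+ suc n))   ≡⟨ cong fromℤ (≡.sym (ℤP.neg-distribʳ-* (+ m) (+ suc n))) ⟩
      fromℤ (ℤ.- (+ m ℤ.* + suc n))   ≈⟨ fromℤ-neg (+ m ℤ.* + suc n) ⟩
      - fromℤ (+ m ℤ.* + suc n)       ≈⟨ -‿cong (fromℤ-* (+ m) (+ suc n)) ⟩
      - (fromℕ m * fromℕ (suc n))     ≈⟨ -‿distribʳ-* _ _ ⟩
      fromℕ m * - fromℕ (suc n)       ∎
    fromℤ-* -[1+ m ] (+ n)    = begin
      fromℤ (ℤ.- (+ suc m) ℤ.* + n)   ≡⟨ cong fromℤ (≡.sym (ℤP.neg-distribˡ-* (+ suc m) (+ n))) ⟩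
      fromℤ (ℤ.- (+ suc m ℤ.* + n))   ≈⟨ fromℤ-neg (+ suc m ℤ.* + n) ⟩
      - fromℤ (+ suc m ℤ.* + n)       ≈⟨ -‿cong (fromℤ-* (+ suc m) (+ n)) ⟩
      - (fromℕ (suc m) * fromℕ n)     ≈⟨ -‿distribˡ-* _ _ ⟩
      - fromℕ (suc m) * fromℕ n       ∎
    fromℤ-* -[1+ m ] -[1+ n ] = begin
      fromℤ (+ suc m ℤ.* + suc n)         ≈⟨ fromℤ-* (+ suc m) (+ suc n) ⟩
      fromℕ (suc m) * fromℕ (suc n)       ≈⟨ -‿involutive _ ⟨
      - - (fromℕ (suc m) * fromℕ (suc n)) ≈⟨ -‿cong (-‿distribˡ-* _ _) ⟩
      - (- fromℕ (suc m) * fromℕ (suc n)) ≈⟨ -‿distribʳ-* _ _ ⟩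
      - fromℕ (suc m) * - fromℕ (suc n)   ∎

  ⟦_⟧ : ∀ {n} → Expr n → Vec Carrier n → Carrier
  ⟦ con k ⟧  ρ = fromℤ k
  ⟦ var i ⟧  ρ = Vec.lookup ρ i
  ⟦ e :+ f ⟧ ρ = ⟦ e ⟧ ρ + ⟦ f ⟧ ρ
  ⟦ e :- f ⟧ ρ = ⟦ e ⟧ ρ - ⟦ f ⟧ ρ
  ⟦ e :* f ⟧ ρ = ⟦ e ⟧ ρ * ⟦ f ⟧ ρ
  ⟦ :- e ⟧   ρ = - ⟦ e ⟧ ρ

  Holds : ∀ {n} → Vec Carrier n → Eqn n → Set ℓ
  Holds ρ (l := r) = ⟦ l ⟧ ρ ≈ ⟦ r ⟧ ρ

  infixr 5 _∷_
  data AllHold {n} (ρ : Vec Carrier n) : List (Expr n × Eqn n) → Set ℓ where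
    []  : AllHold ρ []
    _∷_ : ∀ {c e hs} → Holds ρ e → AllHold ρ hs → AllHold ρ ((c , e) ∷ hs)

  private
    evalₙ : ∀ n → NF n → Vec Carrier n → Carrier
    evalₙ zero    k        []      = fromℤ k
    evalₙ (suc n) []       (x ∷ ρ) = 0#
    evalₙ (suc n) (p ∷ ps) (x ∷ ρ) = evalₙ n p ρ + x * evalₙ (suc n) ps (x ∷ ρ)

    isZero-sound : ∀ n p ρ → T (isZeroₙ n p) → evalₙ n p ρ ≈ 0#
    isZero-sound zero    (+ zero) []      _ = ≈-refl
    isZero-sound (suc n) []       (x ∷ ρ) _ = ≈-refl
    isZero-sound (suc n) (p ∷ ps) (x ∷ ρ) t with isZeroₙ n p in eq
    ... | true = begin
      evalₙ n p ρ + x * evalₙ (suc n) ps (x ∷ ρ)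
        ≈⟨ +-cong (isZero-sound n p ρ (subst T (≡.sym eq) tt)) (*-congˡ (isZero-sound (suc n) ps (x ∷ ρ) t)) ⟩
      0# + x * 0# ≈⟨ +-identityˡ _ ⟩
      x * 0#      ≈⟨ zeroʳ x ⟩
      0#          ∎

    eval-0 : ∀ n ρ → evalₙ n (0ₙ n) ρ ≈ 0#
    eval-0 zero    []      = ≈-refl
    eval-0 (suc n) (x ∷ ρ) = ≈-refl

    eval-con : ∀ n k ρ → evalₙ n (conₙ n k) ρ ≈ fromℤ k
    eval-con zero    k []      = ≈-refl
    eval-con (suc n) k (x ∷ ρ) = ≈-trans (+-cong (eval-con n k ρ) (zeroʳ x)) (+-identityʳ _)

    eval-var : ∀ n i ρ → evalₙ n (varₙ n i) ρ ≈ Vec.lookup ρ i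
    eval-var (suc n) Fin.zero    (x ∷ ρ) = begin
      evalₙ n (0ₙ n) ρ + x * (evalₙ n (conₙ n (+ 1)) ρ + x * 0#)
        ≈⟨ +-cong (eval-0 n ρ) (*-congˡ (+-cong (eval-con n (+ 1) ρ) (zeroʳ x))) ⟩
      0# + x * (1# + 0#) ≈⟨ +-identityˡ _ ⟩
      x * (1# + 0#)      ≈⟨ *-congˡ (+-identityʳ 1#) ⟩
      x * 1#             ≈⟨ *-identityʳ x ⟩
      x                  ∎
    eval-var (suc n) (Fin.suc i) (x ∷ ρ) = ≈-trans (+-cong (eval-var n i ρ) (zeroʳ x)) (+-identityʳ _)

    eval-add : ∀ n p q ρ → evalₙ n (addₙ n p q) ρ ≈ evalₙ n p ρ + evalₙ n q ρ
    eval-add zero    p       q       []      = fromℤ-+ p q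
    eval-add (suc n) []      q       (x ∷ ρ) = ≈-sym (+-identityˡ _)
    eval-add (suc n) (a ∷ p) []      (x ∷ ρ) = ≈-sym (+-identityʳ _)
    eval-add (suc n) (a ∷ p) (b ∷ q) (x ∷ ρ) = begin
      evalₙ n (addₙ n a b) ρ + x * evalₙ (suc n) (addsₙ n p q) (x ∷ ρ)
        ≈⟨ +-cong (eval-add n a b ρ) (*-congˡ (eval-add (suc n) p q (x ∷ ρ))) ⟩
      (a′ + b′) + x * (p′ + q′)       ≈⟨ +-congˡ (distribˡ x p′ q′) ⟩
      (a′ + b′) + (x * p′ + x * q′)   ≈⟨ interchange _ _ _ _ ⟩
      (a′ + x * p′) + (b′ + x * q′)   ∎
      where
      a′ = evalₙ n a ρ
      b′ = evalₙ n b ρ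
      p′ = evalₙ (suc n) p (x ∷ ρ)
      q′ = evalₙ (suc n) q (x ∷ ρ)

    eval-neg : ∀ n p ρ → evalₙ n (negₙ n p) ρ ≈ - evalₙ n p ρ
    eval-neg zero    p       []      = fromℤ-neg p
    eval-neg (suc n) []      (x ∷ ρ) = ≈-sym -0#≈0#
    eval-neg (suc n) (a ∷ p) (x ∷ ρ) = begin
      evalₙ n (negₙ n a) ρ + x * evalₙ (suc n) (map (negₙ n) p) (x ∷ ρ)
        ≈⟨ +-cong (eval-neg n a ρ) (*-congˡ (eval-neg (suc n) p (x ∷ ρ))) ⟩
      - a′ + x * - p′     ≈⟨ +-congˡ (-‿distribʳ-* x p′) ⟨
      - a′ - x * p′       ≈⟨ -‿+-comm a′ (x * p′) ⟩
      - (a′ + x * p′)     ∎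
      where
      a′ = evalₙ n a ρ
      p′ = evalₙ (suc n) p (x ∷ ρ)

    mutual
      eval-mul : ∀ n p q ρ → evalₙ n (mulₙ n p q) ρ ≈ evalₙ n p ρ * evalₙ n q ρ
      eval-mul zero    p       q []      = fromℤ-* p q
      eval-mul (suc n) []      q (x ∷ ρ) = ≈-sym (zeroˡ _)
      eval-mul (suc n) (a ∷ p) q (x ∷ ρ) = begin
        evalₙ (suc n) (addsₙ n (if isZeroₙ n a then [] else scaleₙ n a q) (0ₙ n ∷ mulsₙ n p q)) (x ∷ ρ)
          ≈⟨ eval-add (suc n) (if isZeroₙ n a then [] else scaleₙ n a q) (0ₙ n ∷ mulsₙ n p q) (x ∷ ρ) ⟩
        evalₙ (suc n) (if isZeroₙ n a then [] else scaleₙ n a q) (x ∷ ρ) + (evalₙ n (0ₙ n) ρ + x * evalₙ (suc n) (mulsₙ n p q) (x ∷ ρ))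
          ≈⟨ +-cong (eval-head n a q x ρ) (+-cong (eval-0 n ρ) (*-congˡ (eval-mul (suc n) p q (x ∷ ρ)))) ⟩
        a′ * q′ + (0# + x * (p′ * q′))   ≈⟨ +-congˡ (+-identityˡ _) ⟩
        a′ * q′ + x * (p′ * q′)          ≈⟨ +-congˡ (*-assoc x p′ q′) ⟨
        a′ * q′ + x * p′ * q′            ≈⟨ distribʳ q′ a′ (x * p′) ⟨
        (a′ + x * p′) * q′               ∎
        where
        a′ = evalₙ n a ρ
        p′ = evalₙ (suc n) p (x ∷ ρ)
        q′ = evalₙ (suc n) q (x ∷ ρ)

      eval-head : ∀ n a q x ρ →
        evalₙ (suc n) (if isZeroₙ n a then [] else scaleₙ n a q) (x ∷ ρ) ≈
        evalₙ n a ρ * evalₙ (suc n) q (x ∷ ρ)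
      eval-head n a q x ρ with isZeroₙ n a in eq
      ... | true  = ≈-sym (≈-trans (*-congʳ (isZero-sound n a ρ (subst T (≡.sym eq) tt))) (zeroˡ _))
      ... | false = eval-scale n a q x ρ

      eval-scale : ∀ n a q x ρ →
        evalₙ (suc n) (scaleₙ n a q) (x ∷ ρ) ≈ evalₙ n a ρ * evalₙ (suc n) q (x ∷ ρ)
      eval-scale n a []      x ρ = ≈-sym (zeroʳ _)
      eval-scale n a (b ∷ q) x ρ = begin
        evalₙ n (mulₙ n a b) ρ + x * evalₙ (suc n) (scaleₙ n a q) (x ∷ ρ)
          ≈⟨ +-cong (eval-mul n a b ρ) (*-congˡ (eval-scale n a q x ρ)) ⟩
        a′ * b′ + x * (a′ * q′)   ≈⟨ +-congˡ (*-assoc x a′ q′) ⟨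
        a′ * b′ + x * a′ * q′     ≈⟨ +-congˡ (*-congʳ (*-comm x a′)) ⟩
        a′ * b′ + a′ * x * q′     ≈⟨ +-congˡ (*-assoc a′ x q′) ⟩
        a′ * b′ + a′ * (x * q′)   ≈⟨ distribˡ a′ b′ (x * q′) ⟨
        a′ * (b′ + x * q′)        ∎
        where
        a′ = evalₙ n a ρ
        b′ = evalₙ n b ρ
        q′ = evalₙ (suc n) q (x ∷ ρ)

    norm-sound : ∀ {n} (e : Expr n) ρ → evalₙ n (norm e) ρ ≈ ⟦ e ⟧ ρ
    norm-sound {n} (con k)  ρ = eval-con n k ρ
    norm-sound {n} (var i)  ρ = eval-var n i ρ
    norm-sound {n} (e :+ f) ρ = ≈-trans (eval-add n (norm e) (norm f) ρ) (+-cong (norm-sound e ρ) (norm-sound f ρ))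
    norm-sound {n} (e :- f) ρ = ≈-trans (eval-add n (norm e) (negₙ n (norm f)) ρ)
      (+-cong (norm-sound e ρ) (≈-trans (eval-neg n (norm f) ρ) (-‿cong (norm-sound f ρ))))
    norm-sound {n} (e :* f) ρ = ≈-trans (eval-mul n (norm e) (norm f) ρ) (*-cong (norm-sound e ρ) (norm-sound f ρ))
    norm-sound {n} (:- e)   ρ = ≈-trans (eval-neg n (norm e) ρ) (-‿cong (norm-sound e ρ))

    combination-0 : ∀ {n} (ρ : Vec Carrier n) hs → AllHold ρ hs → ⟦ combination hs ⟧ ρ ≈ 0#
    combination-0 ρ [] _ = ≈-refl
    combination-0 ρ ((c , (l := r)) ∷ hs) (h ∷ rest) = begin
      ⟦ c ⟧ ρ * (⟦ l ⟧ ρ - ⟦ r ⟧ ρ) + ⟦ combination hs ⟧ ρ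
        ≈⟨ +-cong (*-congˡ (x≈y⇒x-y≈0 h)) (combination-0 ρ hs rest) ⟩
      ⟦ c ⟧ ρ * 0# + 0#   ≈⟨ +-identityʳ _ ⟩
      ⟦ c ⟧ ρ * 0#        ≈⟨ zeroʳ _ ⟩
      0#                  ∎
      where
      x≈y⇒x-y≈0 : ∀ {x y} → x ≈ y → x - y ≈ 0#
      x≈y⇒x-y≈0 {x} {y} x≈y = ≈-trans (+-congʳ x≈y) (-‿inverseʳ y)

  x-y≈0⇒x≈y : ∀ {x y} → x - y ≈ 0# → x ≈ y
  x-y≈0⇒x≈y {x} {y} eq = begin
    x             ≈⟨ +-identityʳ x ⟨
    x + 0#        ≈⟨ +-congˡ (-‿inverseˡ y) ⟨
    x + (- y + y) ≈⟨ +-assoc x (- y) y ⟨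
    (x - y) + y   ≈⟨ +-congʳ eq ⟩
    0# + y        ≈⟨ +-identityˡ y ⟩
    y             ∎

  norm-zero : ∀ {n} (e : Expr n) ρ → isZeroₙ n (norm e) ≡ true → ⟦ e ⟧ ρ ≈ 0#
  norm-zero {n} e ρ eq = ≈-trans (≈-sym (norm-sound e ρ)) (isZero-sound n (norm e) ρ (subst T (≡.sym eq) tt))

  private
    linear-sound : ∀ {n} (ρ : Vec Carrier n) (g : Eqn n) hs →
      T (isZeroₙ n (defect (g , hs))) → AllHold ρ hs → Holds ρ g
    linear-sound {n} ρ (l := r) hs t h = x-y≈0⇒x≈y (x-y≈0⇒x≈y (begin
      (⟦ l ⟧ ρ - ⟦ r ⟧ ρ) - 0#                      ≈⟨ +-congˡ (-‿cong (combination-0 ρ hs h)) ⟨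
      (⟦ l ⟧ ρ - ⟦ r ⟧ ρ) - ⟦ combination hs ⟧ ρ    ≈⟨ norm-sound ((l :- r) :- combination hs) ρ ⟨
      evalₙ n (defect ((l := r) , hs)) ρ            ≈⟨ isZero-sound n _ ρ t ⟩
      0#                                            ∎))

  -- From hypotheses lᵢ ≈ rᵢ and cofactors cᵢ, the equation l ≈ r whenever
  -- l - r = Σ cᵢ (lᵢ - rᵢ) is an identity of integer polynomials.
  linear : ∀ {n} (ρ : Vec Carrier n) (f : Fun n (Expr n) (Eqn n × List (Expr n × Eqn n))) →
    {T (isZeroₙ n (defect (applyAll n f (vars n))))} →
    AllHold ρ (proj₂ (applyAll n f (vars n))) → Holds ρ (proj₁ (applyAll n f (vars n)))
  linear {n} ρ f {t} = linear-sound ρ (proj₁ (applyAll n f (vars n))) (proj₂ (applyAll n f (vars n))) t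

  ringEq : ∀ {n} (ρ : Vec Carrier n) (f : Fun n (Expr n) (Eqn n)) →
    {T (isZeroₙ n (defect (applyAll n f (vars n) , [])))} → Holds ρ (applyAll n f (vars n))
  ringEq {n} ρ f {t} = linear-sound ρ (applyAll n f (vars n)) [] t []

-- Polynomial identities are pushed into the order along `ι` and into the fraction field along
-- `⌊_⌋`; `reflects` brings them back from the field, where division is available.
module Homomorphism {c ℓ c′ ℓ′} (R : CommutativeRing c ℓ) (S : CommutativeRing c′ ℓ′)
  (h : CommutativeRing.Carrier R → CommutativeRing.Carrier S)
  (h-cong : ∀ {x y} → CommutativeRing._≈_ R x y → CommutativeRing._≈_ S (h x) (h y))
  (h-+ : ∀ x y → CommutativeRing._≈_ S (h (CommutativeRing._+_ R x y)) (CommutativeRing._+_ S (h x) (h y)))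
  (h-* : ∀ x y → CommutativeRing._≈_ S (h (CommutativeRing._*_ R x y)) (CommutativeRing._*_ S (h x) (h y)))
  (h-neg : ∀ x → CommutativeRing._≈_ S (h (CommutativeRing.-_ R x)) (CommutativeRing.-_ S (h x)))
  (h-0 : CommutativeRing._≈_ S (h (CommutativeRing.0# R)) (CommutativeRing.0# S))
  (h-1 : CommutativeRing._≈_ S (h (CommutativeRing.1# R)) (CommutativeRing.1# S)) where
  private
    module R = CommutativeRing R
    module S = CommutativeRing S
    module RS = LinearSolver R
    module SS = LinearSolver S

    h-fromℕ : ∀ n → h (RS.fromℕ n) S.≈ SS.fromℕ n
    h-fromℕ zero          = h-0
    h-fromℕ (suc zero)    = h-1
    h-fromℕ (suc (suc n)) = S.trans (h-+ R.1# (RS.fromℕ (suc n))) (S.+-cong h-1 (h-fromℕ (suc n)))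

    h-expr : ∀ {n} (e : Expr n) (ρ : Vec R.Carrier n) → h (RS.⟦ e ⟧ ρ) S.≈ SS.⟦ e ⟧ (Vec.map h ρ)
    h-expr (con (+ n))    ρ = h-fromℕ n
    h-expr (con -[1+ n ]) ρ = S.trans (h-neg (RS.fromℕ (suc n))) (S.-‿cong (h-fromℕ (suc n)))
    h-expr (var i)  ρ = S.reflexive (≡.sym (VecP.lookup-map i h ρ))
    h-expr (e :+ f) ρ = S.trans (h-+ (RS.⟦ e ⟧ ρ) (RS.⟦ f ⟧ ρ)) (S.+-cong (h-expr e ρ) (h-expr f ρ))
    h-expr (e :- f) ρ = S.trans (h-+ (RS.⟦ e ⟧ ρ) (R.- RS.⟦ f ⟧ ρ))
      (S.+-cong (h-expr e ρ) (S.trans (h-neg (RS.⟦ f ⟧ ρ)) (S.-‿cong (h-expr f ρ))))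
    h-expr (e :* f) ρ = S.trans (h-* (RS.⟦ e ⟧ ρ) (RS.⟦ f ⟧ ρ)) (S.*-cong (h-expr e ρ) (h-expr f ρ))
    h-expr (:- e)   ρ = S.trans (h-neg (RS.⟦ e ⟧ ρ)) (S.-‿cong (h-expr e ρ))

  holds : ∀ {n} (ρ : Vec R.Carrier n) (f : Fun n (Expr n) (Eqn n)) →
    RS.Holds ρ (applyAll n f (vars n)) → SS.Holds (Vec.map h ρ) (applyAll n f (vars n))
  holds {n} ρ f e with applyAll n f (vars n)
  ... | l := r = S.trans (S.sym (h-expr l ρ)) (S.trans (h-cong e) (h-expr r ρ))

  value : ∀ {n} (ρ : Vec R.Carrier n) (f : Fun n (Expr n) (Expr n)) →
    h (RS.⟦ applyAll n f (vars n) ⟧ ρ) S.≈ SS.⟦ applyAll n f (vars n) ⟧ (Vec.map h ρ)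
  value {n} ρ f = h-expr (applyAll n f (vars n)) ρ

  reflects : (∀ {x y} → h x S.≈ h y → x R.≈ y) → ∀ {n} (ρ : Vec R.Carrier n) (f : Fun n (Expr n) (Eqn n)) →
    SS.Holds (Vec.map h ρ) (applyAll n f (vars n)) → RS.Holds ρ (applyAll n f (vars n))
  reflects injective {n} ρ f e with applyAll n f (vars n)
  ... | l := r = injective (S.trans (h-expr l ρ) (S.trans e (S.sym (h-expr r ρ))))

-- Bézout rings

module Divisibility {c ℓ} (R : CommutativeRing c ℓ) where
  open CommutativeRing R
    renaming (sym to ≈-sym; trans to ≈-trans; refl to ≈-refl) hiding (zero)
  open LinearSolver R

  -- Non-zero-divisors stand in for nonzero elements, so cancellation asks for neither a domain nor
  -- decidable equality; in the order, regularity can be read off the norm.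
  Regular : Carrier → Set _
  Regular a = ∀ x → a * x ≈ 0# → x ≈ 0#

  Divides : Carrier → Carrier → Set _
  Divides a b = ∃[ k ] b ≈ k * a

  record Gcd (a b : Carrier) : Set (c Level.⊔ ℓ) where
    field
      g x y u v : Carrier
      g-comb : g ≈ x * a + y * b
      a-mult : a ≈ u * g
      b-mult : b ≈ v * g

  cancel : ∀ {a} → Regular a → ∀ {x y} → a * x ≈ a * y → x ≈ y
  cancel {a} ra {x} {y} e = x-y≈0⇒x≈y (ra (x - y)
    (linear (a ∷ x ∷ y ∷ []) (λ a x y → (a :* (x :- y) := # 0) , (# 1 , a :* x := a :* y) ∷ []) (e ∷ [])))

  regular-factor : ∀ {a u g} → a ≈ u * g → Regular a → Regular g
  regular-factor {a} {u} {g} e ra x gx = ra x (linear (a ∷ u ∷ g ∷ x ∷ [])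
    (λ a u g x → (a :* x := # 0) , (x , a := u :* g) ∷ (u , g :* x := # 0) ∷ []) (e ∷ gx ∷ []))

  regular-cong : ∀ {a b} → a ≈ b → Regular a → Regular b
  regular-cong e ra x bx = ra x (≈-trans (*-congʳ e) bx)

  regular-* : ∀ {a b} → Regular a → Regular b → Regular (a * b)
  regular-* ra rb x e = rb x (ra _ (≈-trans (≈-sym (*-assoc _ _ _)) e))

  divides-trans : ∀ {a b c} → Divides a b → Divides b c → Divides a c
  divides-trans (k , p) (l , q) = l * k , ≈-trans q (≈-trans (*-congˡ p) (≈-sym (*-assoc l k _)))

  module _ (bezout : ∀ a b → Gcd a b) where

    -- Divided by the gcd `g`, the elements become coprime `u` and `v` with `u² k = v²`. Squaring
    -- `α u + β v = 1` exhibits `w` as an inverse of `u`, so `y = v g = n (v w)`.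
    square-divides : ∀ {n k y} → Regular n → n * n * k ≈ y * y → ∃[ s ] y ≈ n * s
    square-divides {n} {k} {y} rn e = v * w , linear (n ∷ y ∷ v ∷ u ∷ w ∷ g ∷ [])
        (λ n y v u w g → (y := n :* (v :* w)) ,
          (# 1 , y := v :* g) ∷ (:- (v :* w) , n := u :* g) ∷ (:- (v :* g) , w :* u := # 1) ∷ [])
        (b-mult ∷ a-mult ∷ wu ∷ [])
      where
      open Gcd (bezout n y) renaming (x to α; y to β)
      rg : Regular g
      rg = regular-factor a-mult rn
      coprime : α * u + β * v ≈ 1#
      coprime = cancel rg (linear (g ∷ α ∷ u ∷ β ∷ v ∷ n ∷ y ∷ [])
        (λ g α u β v n y → (g :* (α :* u :+ β :* v) := g :* # 1) ,
          (:- # 1 , g := α :* n :+ β :* y) ∷ (:- α , n := u :* g) ∷ (:- β , y := v :* g) ∷ [])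
        (g-comb ∷ a-mult ∷ b-mult ∷ []))
      v² : u * u * k ≈ v * v
      v² = cancel (regular-* rg rg) (linear (g ∷ u ∷ k ∷ v ∷ n ∷ y ∷ [])
        (λ g u k v n y → (g :* g :* (u :* u :* k) := g :* g :* (v :* v)) ,
          (# 1 , n :* n :* k := y :* y) ∷ (:- (k :* (n :+ u :* g)) , n := u :* g) ∷ (y :+ v :* g , y := v :* g) ∷ [])
        (e ∷ a-mult ∷ b-mult ∷ []))
      w = α * α * u + fromℕ 2 * α * β * v + β * β * k * u
      wu : w * u ≈ 1#
      wu = linear (α ∷ u ∷ β ∷ v ∷ k ∷ [])
        (λ α u β v k → ((α :* α :* u :+ # 2 :* α :* β :* v :+ β :* β :* k :* u) :* u := # 1) ,
          (α :* u :+ β :* v :+ # 1 , α :* u :+ β :* v := # 1) ∷ (β :* β , u :* u :* k := v :* v) ∷ [])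
        (coprime ∷ v² ∷ [])

    -- A substitute for unique factorisation: when `a a′` is a square, the primes of odd order in
    -- `a` also divide `a′`, and `d` collects them.
    record SquareSplit (a a′ : Carrier) : Set (c Level.⊔ ℓ) where
      field
        d k unit unit⁻¹ : Carrier
        split     : a ≈ unit * d * (k * k)
        unit-inv  : unit * unit⁻¹ ≈ 1#
        d-a       : Divides d a
        d-a′      : Divides d a′

    -- With (h) = (a, y) and (d) = (a, a′, y), the ideal (h²) = (a², a y, a a′)
    -- equals (a d).
    square-split : ∀ {a a′ y} → Regular a → a * a′ ≈ y * y → SquareSplit a a′
    square-split {a} {a′} {y} ra e = record
      { d = d ; k = h₁ ; unit = U′ ; unit⁻¹ = U
      ; split = cancel rd (linear (a ∷ d ∷ h ∷ h₁ ∷ U′ ∷ [])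
          (λ a d h h₁ U′ → (d :* a := d :* (U′ :* d :* (h₁ :* h₁))) ,
            (# 1 , a :* d := h :* h :* U′) ∷ (U′ :* (h :+ h₁ :* d) , h := h₁ :* d) ∷ [])
          (ad ∷ G₂.a-mult ∷ []))
      ; unit-inv = cancel rh (cancel rh (linear (h ∷ U ∷ U′ ∷ a ∷ d ∷ [])
          (λ h U U′ a d → (h :* (h :* (U′ :* U)) := h :* (h :* # 1)) ,
            (:- # 1 , h :* h := a :* d :* U) ∷ (:- U , a :* d := h :* h :* U′) ∷ [])
          (h² ∷ ad ∷ [])))
      ; d-a = divides-trans (h₁ , G₂.a-mult) (G₁.u , G₁.a-mult)
      ; d-a′ = G₂.v , G₂.b-mult }
      where
      module G₁ = Gcd (bezout a y)
      h = G₁.g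
      module G₂ = Gcd (bezout h a′)
      d  = G₂.g
      h₁ = G₂.u
      rh = regular-factor G₁.a-mult ra
      rd = regular-factor G₂.a-mult rh
      -- `U` and `U′` witness the two inclusions between `(h²)` and `(a d)`; cancelling `h²` makes
      -- them inverse to each other.
      U  = G₁.x * h₁ + G₁.x * G₁.y * G₁.v * h₁ + G₁.y * G₁.y * G₂.v
      U′ = G₂.x * G₁.u + G₂.y * (G₁.v * G₁.v)
      h² : h * h ≈ a * d * U
      h² = linear (a ∷ a′ ∷ y ∷ h ∷ d ∷ h₁ ∷ G₁.x ∷ G₁.y ∷ G₁.v ∷ G₂.v ∷ [])
        (λ a a′ y h d h₁ α β y₁ a₁′ →
          (h :* h := a :* d :* (α :* h₁ :+ α :* β :* y₁ :* h₁ :+ β :* β :* a₁′)) ,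
          (h :+ β :* y , h := α :* a :+ β :* y) ∷
          (α :* a :+ a :* α :* β :* y₁ , h := h₁ :* d) ∷
          (a :* α :* β , y := y₁ :* h) ∷
          (β :* β :* a , a′ := a₁′ :* d) ∷
          (:- (β :* β) , a :* a′ := y :* y) ∷ [])
        (G₁.g-comb ∷ G₂.a-mult ∷ G₁.b-mult ∷ G₂.b-mult ∷ e ∷ [])
      ad : a * d ≈ h * h * U′
      ad = linear (a ∷ a′ ∷ y ∷ h ∷ d ∷ G₂.x ∷ G₂.y ∷ G₁.u ∷ G₁.v ∷ [])
        (λ a a′ y h d r s a₁ y₁ → (a :* d := h :* h :* (r :* a₁ :+ s :* (y₁ :* y₁))) ,
          (a , d := r :* h :+ s :* a′) ∷ (r :* h , a := a₁ :* h) ∷ (s , a :* a′ := y :* y) ∷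
          (s :* (y :+ y₁ :* h) , y := y₁ :* h) ∷ [])
        (G₂.g-comb ∷ G₁.a-mult ∷ e ∷ G₁.b-mult ∷ [])

-- The order R[z, z⁻¹] with t = -(z + 1)(z² + 1)/z²

module Order {c ℓ} (R : CommutativeRing c ℓ) (t : CommutativeRing.Carrier R) where
  open Algebra.Properties.Ring (CommutativeRing.ring R) using (-0#≈0#)
  open CommutativeRing R
    renaming (sym to ≈-sym; trans to ≈-trans; refl to ≈-refl) hiding (zero)
  open LinearSolver R

  -- p + q z + r z⁻¹
  data Elt : Set c where
    elt : Carrier → Carrier → Carrier → Elt

  p₀ p₁ p₂ : Elt → Carrier
  p₀ (elt p q r) = p
  p₁ (elt p q r) = q
  p₂ (elt p q r) = r

  infix 4 _≈ᴮ_
  record _≈ᴮ_ (x y : Elt) : Set ℓ where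
    constructor eqs
    field
      e₀ : p₀ x ≈ p₀ y
      e₁ : p₁ x ≈ p₁ y
      e₂ : p₂ x ≈ p₂ y
  open _≈ᴮ_ public

  infixl 6 _+ᴮ_
  infixl 7 _*ᴮ_

  _+ᴮ_ : Elt → Elt → Elt
  elt p q r +ᴮ elt p′ q′ r′ = elt (p + p′) (q + q′) (r + r′)

  -ᴮ_ : Elt → Elt
  -ᴮ elt p q r = elt (- p) (- q) (- r)

  -- z² = -1 - (t + 1) z - z⁻¹ and z⁻² = -(t + 1) - z - z⁻¹
  _*ᴮ_ : Elt → Elt → Elt
  elt p q r *ᴮ elt p′ q′ r′ = elt
    (p * p′ + (q * r′ + r * q′) - q * q′ - (t + 1#) * (r * r′))
    (p * q′ + q * p′ - (t + 1#) * (q * q′) - r * r′)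
    (p * r′ + r * p′ - q * q′ - r * r′)

  opaque
    ι : Carrier → Elt
    ι x = elt x 0# 0#

  private
    M₀ M₁ M₂ : ∀ {n} → Expr n → Expr n → Expr n → Expr n → Expr n → Expr n → Expr n → Expr n
    M₀ t p q r p′ q′ r′ = p :* p′ :+ (q :* r′ :+ r :* q′) :- q :* q′ :- (t :+ # 1) :* (r :* r′)
    M₁ t p q r p′ q′ r′ = p :* q′ :+ q :* p′ :- (t :+ # 1) :* (q :* q′) :- r :* r′
    M₂ t p q r p′ q′ r′ = p :* r′ :+ r :* p′ :- q :* q′ :- r :* r′

  opaque
    unfolding ι

    +ᴮ-identityˡ : ∀ x → ι 0# +ᴮ x ≈ᴮ x
    +ᴮ-identityˡ (elt _ _ _) = eqs (+-identityˡ _) (+-identityˡ _) (+-identityˡ _)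
    +ᴮ-identityʳ : ∀ x → x +ᴮ ι 0# ≈ᴮ x
    +ᴮ-identityʳ (elt _ _ _) = eqs (+-identityʳ _) (+-identityʳ _) (+-identityʳ _)
    +ᴮ-inverseˡ : ∀ x → (-ᴮ x) +ᴮ x ≈ᴮ ι 0#
    +ᴮ-inverseˡ (elt _ _ _) = eqs (-‿inverseˡ _) (-‿inverseˡ _) (-‿inverseˡ _)
    +ᴮ-inverseʳ : ∀ x → x +ᴮ (-ᴮ x) ≈ᴮ ι 0#
    +ᴮ-inverseʳ (elt _ _ _) = eqs (-‿inverseʳ _) (-‿inverseʳ _) (-‿inverseʳ _)

    ≈ᴮ-trans : ∀ {x y z} → x ≈ᴮ y → y ≈ᴮ z → x ≈ᴮ z
    ≈ᴮ-trans (eqs a b c) (eqs a′ b′ c′) = eqs (≈-trans a a′) (≈-trans b b′) (≈-trans c c′)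
    +ᴮ-cong : ∀ {x y x′ y′} → x ≈ᴮ y → x′ ≈ᴮ y′ → x +ᴮ x′ ≈ᴮ y +ᴮ y′
    +ᴮ-cong {elt _ _ _} {elt _ _ _} {elt _ _ _} {elt _ _ _} (eqs a b c) (eqs a′ b′ c′) =
      eqs (+-cong a a′) (+-cong b b′) (+-cong c c′)
    *ᴮ-comm : ∀ x y → x *ᴮ y ≈ᴮ y *ᴮ x
    *ᴮ-comm (elt p q r) (elt p′ q′ r′) = eqs
      (ringEq ρ (λ t p q r p′ q′ r′ → M₀ t p q r p′ q′ r′ := M₀ t p′ q′ r′ p q r))
      (ringEq ρ (λ t p q r p′ q′ r′ → M₁ t p q r p′ q′ r′ := M₁ t p′ q′ r′ p q r))
      (ringEq ρ (λ t p q r p′ q′ r′ → M₂ t p q r p′ q′ r′ := M₂ t p′ q′ r′ p q r))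
      where
        ρ : Vec Carrier 7
        ρ = t ∷ p ∷ q ∷ r ∷ p′ ∷ q′ ∷ r′ ∷ []
    *ᴮ-assoc : ∀ x y z → (x *ᴮ y) *ᴮ z ≈ᴮ x *ᴮ (y *ᴮ z)
    *ᴮ-assoc (elt p q r) (elt p′ q′ r′) (elt p″ q″ r″) = eqs (ringEq ρ (F M₀)) (ringEq ρ (F M₁)) (ringEq ρ (F M₂))
      where
      ρ : Vec Carrier 10
      ρ = t ∷ p ∷ q ∷ r ∷ p′ ∷ q′ ∷ r′ ∷ p″ ∷ q″ ∷ r″ ∷ []
      F : (∀ {n} → Expr n → Expr n → Expr n → Expr n → Expr n → Expr n → Expr n → Expr n) → Fun 10 (Expr 10) (Eqn 10)
      F M t p q r p′ q′ r′ p″ q″ r″ =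
        M t (M₀ t p q r p′ q′ r′) (M₁ t p q r p′ q′ r′) (M₂ t p q r p′ q′ r′) p″ q″ r″ :=
        M t p q r (M₀ t p′ q′ r′ p″ q″ r″) (M₁ t p′ q′ r′ p″ q″ r″) (M₂ t p′ q′ r′ p″ q″ r″)
    *ᴮ-identityˡ : ∀ x → ι 1# *ᴮ x ≈ᴮ x
    *ᴮ-identityˡ (elt p q r) = eqs
      (ringEq ρ (λ t p q r → M₀ t (# 1) (# 0) (# 0) p q r := p))
      (ringEq ρ (λ t p q r → M₁ t (# 1) (# 0) (# 0) p q r := q))
      (ringEq ρ (λ t p q r → M₂ t (# 1) (# 0) (# 0) p q r := r))
      where
        ρ : Vec Carrier 4
        ρ = t ∷ p ∷ q ∷ r ∷ []
    *ᴮ-distribˡ : ∀ x y z → x *ᴮ (y +ᴮ z) ≈ᴮ x *ᴮ y +ᴮ x *ᴮ z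
    *ᴮ-distribˡ (elt p q r) (elt p′ q′ r′) (elt p″ q″ r″) = eqs (ringEq ρ (F M₀)) (ringEq ρ (F M₁)) (ringEq ρ (F M₂))
      where
      ρ : Vec Carrier 10
      ρ = t ∷ p ∷ q ∷ r ∷ p′ ∷ q′ ∷ r′ ∷ p″ ∷ q″ ∷ r″ ∷ []
      F : (∀ {n} → Expr n → Expr n → Expr n → Expr n → Expr n → Expr n → Expr n → Expr n) → Fun 10 (Expr 10) (Eqn 10)
      F M t p q r p′ q′ r′ p″ q″ r″ =
        M t p q r (p′ :+ p″) (q′ :+ q″) (r′ :+ r″) := M t p q r p′ q′ r′ :+ M t p q r p″ q″ r″

  orderRing : CommutativeRing c ℓ
  orderRing = record
    { Carrier = Elt ; _≈_ = _≈ᴮ_ ; _+_ = _+ᴮ_ ; _*_ = _*ᴮ_ ; -_ = -ᴮ_ ; 0# = ι 0# ; 1# = ι 1#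
    ; isCommutativeRing = record
      { isRing = record
        { +-isAbelianGroup = record
          { isGroup = record
            { isMonoid = record
              { isSemigroup = record
                { isMagma = record
                  { isEquivalence = record
                    { refl = eqs ≈-refl ≈-refl ≈-refl
                    ; sym = λ (eqs a b c) → eqs (≈-sym a) (≈-sym b) (≈-sym c)
                    ; trans = λ (eqs a b c) (eqs a′ b′ c′) → eqs (≈-trans a a′) (≈-trans b b′) (≈-trans c c′) }
                  ; ∙-cong = λ { {elt _ _ _} {elt _ _ _} {elt _ _ _} {elt _ _ _} (eqs a b c) (eqs a′ b′ c′) → eqs (+-cong a a′) (+-cong b b′) (+-cong c c′) } }
                ; assoc = λ { (elt _ _ _) (elt _ _ _) (elt _ _ _) → eqs (+-assoc _ _ _) (+-assoc _ _ _) (+-assoc _ _ _) } }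
              ; identity = +ᴮ-identityˡ
                         , +ᴮ-identityʳ }
            ; inverse = +ᴮ-inverseˡ
                      , +ᴮ-inverseʳ
            ; ⁻¹-cong = λ { {elt _ _ _} {elt _ _ _} (eqs a b c) → eqs (-‿cong a) (-‿cong b) (-‿cong c) } }
          ; comm = λ { (elt _ _ _) (elt _ _ _) → eqs (+-comm _ _) (+-comm _ _) (+-comm _ _) } }
        ; *-cong = λ { {elt _ _ _} {elt _ _ _} {elt _ _ _} {elt _ _ _} (eqs a b c) (eqs a′ b′ c′) → eqs
            (+-cong (+-cong (+-cong (*-cong a a′) (+-cong (*-cong b c′) (*-cong c b′))) (-‿cong (*-cong b b′))) (-‿cong (*-congˡ (*-cong c c′))))
            (+-cong (+-cong (+-cong (*-cong a b′) (*-cong b a′)) (-‿cong (*-congˡ (*-cong b b′)))) (-‿cong (*-cong c c′)))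
            (+-cong (+-cong (+-cong (*-cong a c′) (*-cong c a′)) (-‿cong (*-cong b b′))) (-‿cong (*-cong c c′))) }
        ; *-assoc = *ᴮ-assoc
        ; *-identity = *ᴮ-identityˡ , λ x → ≈ᴮ-trans (*ᴮ-comm x (ι 1#)) (*ᴮ-identityˡ x)
        ; distrib = *ᴮ-distribˡ , λ x y z → ≈ᴮ-trans (*ᴮ-comm (y +ᴮ z) x) (≈ᴮ-trans (*ᴮ-distribˡ x y z)
            (+ᴮ-cong (*ᴮ-comm x y) (*ᴮ-comm x z))) }
      ; *-comm = *ᴮ-comm } }

  opaque
    z z⁻¹ θ : Elt
    z   = elt 0# 1# 0#
    z⁻¹ = elt 0# 0# 1#
    θ   = elt 0# 1# 1#

  -- `π₂ = z³ - z - 2` is `dt/dz` up to sign and a power of `z`, hence generates the different of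
  -- ℚ[z, z⁻¹] over ℚ[t]; `π₁ = z² + 1` generates the conductor of ℚ[t][θ].
  π₁ π₂ : Elt
  π₁  = z *ᴮ z +ᴮ ι 1#
  π₂  = z *ᴮ z *ᴮ z +ᴮ -ᴮ z +ᴮ -ᴮ (ι (1# + 1#))

  -- The product of the two other conjugates: the first column of the adjugate of the matrix of
  -- multiplication by the element.
  adj : Elt → Elt
  adj (elt p q r) = elt
    ((p - (t + 1#) * q) * (p - r) - q * r)
    (- (q * (p - r) + r * r))
    ((t + 1#) * q * r - q * q - r * p)

  norm-of : Elt → Carrier
  norm-of (elt p q r) =
    p * ((p - (t + 1#) * q) * (p - r) - q * r)
    - (r - q) * (q * (p - r) + r * r)
    + (q - (t + 1#) * r) * ((t + 1#) * q * r - q * q - r * p)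

  private
    Nₑ : ∀ {n} → Expr n → Expr n → Expr n → Expr n → Expr n
    Nₑ t p q r =
      p :* ((p :- (t :+ # 1) :* q) :* (p :- r) :- q :* r)
      :- (r :- q) :* (q :* (p :- r) :+ r :* r)
      :+ (q :- (t :+ # 1) :* r) :* ((t :+ # 1) :* q :* r :- q :* q :- r :* p)
    A₀ A₁ A₂′ : ∀ {n} → Expr n → Expr n → Expr n → Expr n → Expr n
    A₀ t p q r = (p :- (t :+ # 1) :* q) :* (p :- r) :- q :* r
    A₁ t p q r = :- (q :* (p :- r) :+ r :* r)
    A₂′ t p q r = (t :+ # 1) :* q :* r :- q :* q :- r :* p

  opaque
    unfolding ι z

    *-adj : ∀ x → x *ᴮ adj x ≈ᴮ ι (norm-of x)
    *-adj (elt p q r) = eqs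
      (ringEq ρ (λ t p q r → M₀ t p q r (A₀ t p q r) (A₁ t p q r) (A₂′ t p q r) := Nₑ t p q r))
      (ringEq ρ (λ t p q r → M₁ t p q r (A₀ t p q r) (A₁ t p q r) (A₂′ t p q r) := # 0))
      (ringEq ρ (λ t p q r → M₂ t p q r (A₀ t p q r) (A₁ t p q r) (A₂′ t p q r) := # 0))
      where
        ρ : Vec Carrier 4
        ρ = t ∷ p ∷ q ∷ r ∷ []

  norm-* : ∀ x y → norm-of (x *ᴮ y) ≈ norm-of x * norm-of y
  norm-* (elt p q r) (elt p′ q′ r′) = ringEq (t ∷ p ∷ q ∷ r ∷ p′ ∷ q′ ∷ r′ ∷ []) λ t p q r p′ q′ r′ →
    Nₑ t (M₀ t p q r p′ q′ r′) (M₁ t p q r p′ q′ r′) (M₂ t p q r p′ q′ r′) := Nₑ t p q r :* Nₑ t p′ q′ r′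

  opaque
    unfolding ι z

    ι-* : ∀ x y → ι x *ᴮ y ≈ᴮ elt (x * p₀ y) (x * p₁ y) (x * p₂ y)
    ι-* x (elt p q r) = eqs
      (ringEq ρ (λ t x p q r → M₀ t x (# 0) (# 0) p q r := x :* p))
      (ringEq ρ (λ t x p q r → M₁ t x (# 0) (# 0) p q r := x :* q))
      (ringEq ρ (λ t x p q r → M₂ t x (# 0) (# 0) p q r := x :* r))
      where
        ρ : Vec Carrier 5
        ρ = t ∷ x ∷ p ∷ q ∷ r ∷ []

    ι-cong : ∀ {x y} → x ≈ y → ι x ≈ᴮ ι y
    ι-cong e = eqs e ≈-refl ≈-refl

    ι-homo-* : ∀ x y → ι x *ᴮ ι y ≈ᴮ ι (x * y)
    ι-homo-* x y = eqs (e₀ lemma) (≈-trans (e₁ lemma) (zeroʳ x)) (≈-trans (e₂ lemma) (zeroʳ x))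
      where
      lemma : ι x *ᴮ ι y ≈ᴮ elt (x * p₀ (ι y)) (x * p₁ (ι y)) (x * p₂ (ι y))
      lemma = ι-* x (ι y)

    ι-homo-+ : ∀ x y → ι x +ᴮ ι y ≈ᴮ ι (x + y)
    ι-homo-+ x y = eqs ≈-refl (+-identityˡ 0#) (+-identityˡ 0#)

    ι-neg : ∀ x → ι (- x) ≈ᴮ -ᴮ ι x
    ι-neg x = eqs ≈-refl (≈-sym -0#≈0#) (≈-sym -0#≈0#)

    ι-+-elt : ∀ x p q r → ι x +ᴮ elt p q r ≈ᴮ elt (x + p) q r
    ι-+-elt x p q r = eqs ≈-refl (+-identityˡ q) (+-identityˡ r)

    ι-injective : ∀ {x y} → ι x ≈ᴮ ι y → x ≈ y
    ι-injective = e₀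

    norm-ι : ∀ x → norm-of (ι x) ≈ x * x * x
    norm-ι x = ringEq (t ∷ x ∷ []) (λ t x → Nₑ t x (# 0) (# 0) := x :* x :* x)

  infixl 6 _⊞_
  infixl 7 _⊠_

  -- Elements whose coordinates are expressions; variable 0 stands for t.
  data EltExpr (n : ℕ) : Set where
    ⟪_,_,_⟫ : Expr (suc n) → Expr (suc n) → Expr (suc n) → EltExpr n

  _⊞_ _⊠_ : ∀ {n} → EltExpr n → EltExpr n → EltExpr n
  ⟪ p , q , r ⟫ ⊞ ⟪ p′ , q′ , r′ ⟫ = ⟪ p :+ p′ , q :+ q′ , r :+ r′ ⟫
  ⟪ p , q , r ⟫ ⊠ ⟪ p′ , q′ , r′ ⟫ =
    ⟪ M₀ (var Fin.zero) p q r p′ q′ r′ , M₁ (var Fin.zero) p q r p′ q′ r′ , M₂ (var Fin.zero) p q r p′ q′ r′ ⟫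

  ⊟_ : ∀ {n} → EltExpr n → EltExpr n
  ⊟ ⟪ p , q , r ⟫ = ⟪ :- p , :- q , :- r ⟫

  ιₑ : ∀ {n} → Expr (suc n) → EltExpr n
  ιₑ x = ⟪ x , # 0 , # 0 ⟫

  tₑ : ∀ {n} → Expr (suc n)
  tₑ = var Fin.zero

  ⟦_⟧ᴮ : ∀ {n} → EltExpr n → Vec Carrier n → Elt
  ⟦ ⟪ p , q , r ⟫ ⟧ᴮ ρ = elt (⟦ p ⟧ (t ∷ ρ)) (⟦ q ⟧ (t ∷ ρ)) (⟦ r ⟧ (t ∷ ρ))

  private
    isZeroᴮ : ∀ {n} → EltExpr n → Bool
    isZeroᴮ {n} ⟪ p , q , r ⟫ = isZeroₙ (suc n) (norm p) ∧ (isZeroₙ (suc n) (norm q) ∧ isZeroₙ (suc n) (norm r))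

  opaque
    unfolding ι z

    zeroᴮ : ∀ {n} (ρ : Vec Carrier n) (e : EltExpr n) → {T (isZeroᴮ e)} → ⟦ e ⟧ᴮ ρ ≈ᴮ ι 0#
    zeroᴮ {n} ρ ⟪ p , q , r ⟫ {w} with isZeroₙ (suc n) (norm p) in f | isZeroₙ (suc n) (norm q) in g | isZeroₙ (suc n) (norm r) in h
    ... | true | true | true = eqs (norm-zero p (t ∷ ρ) f) (norm-zero q (t ∷ ρ) g) (norm-zero r (t ∷ ρ) h)

  difference : ∀ {n} → EltExpr n × EltExpr n → EltExpr n
  difference (x , y) = x ⊞ ⊟ y

  opaque
    unfolding ι

    ringEqᴮ : ∀ {n} (ρ : Vec Carrier n) (f : Fun n (Expr (suc n)) (EltExpr n × EltExpr n)) →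
      {T (isZeroᴮ (difference (applyAll n f (Vec.map (λ i → var (Fin.suc i)) (Vec.allFin n)))))} →
      ⟦ proj₁ (applyAll n f (Vec.map (λ i → var (Fin.suc i)) (Vec.allFin n))) ⟧ᴮ ρ ≈ᴮ
      ⟦ proj₂ (applyAll n f (Vec.map (λ i → var (Fin.suc i)) (Vec.allFin n))) ⟧ᴮ ρ
    ringEqᴮ {n} ρ f {w} = go (proj₁ (applyAll n f xs)) (proj₂ (applyAll n f xs)) w
      where
      xs : Vec (Expr (suc n)) n
      xs = Vec.map (λ i → var (Fin.suc i)) (Vec.allFin n)
      go : ∀ x y → T (isZeroᴮ (difference (x , y))) → ⟦ x ⟧ᴮ ρ ≈ᴮ ⟦ y ⟧ᴮ ρ
      go x@(⟪ _ , _ , _ ⟫) y@(⟪ _ , _ , _ ⟫) w with zeroᴮ ρ (x ⊞ ⊟ y) {w}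
      ... | eqs a b c = eqs (x-y≈0⇒x≈y a) (x-y≈0⇒x≈y b) (x-y≈0⇒x≈y c)

  private
    zₑ iₑ θₑ π₁ₑ π₂ₑ : ∀ {n} → EltExpr n
    zₑ = ⟪ # 0 , # 1 , # 0 ⟫
    iₑ = ⟪ # 0 , # 0 , # 1 ⟫
    θₑ = ⟪ # 0 , # 1 , # 1 ⟫
    π₁ₑ = zₑ ⊠ zₑ ⊞ ιₑ (# 1)
    π₂ₑ = zₑ ⊠ zₑ ⊠ zₑ ⊞ ⊟ zₑ ⊞ ⊟ ιₑ (# 1 :+ # 1)

  opaque
    unfolding ι z

    zz⁻¹ : z *ᴮ z⁻¹ ≈ᴮ ι 1#
    zz⁻¹ = ringEqᴮ [] (zₑ ⊠ iₑ , ιₑ (# 1))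

    elt-x-θz : ∀ x y → elt x (- y) (- y) ≈ᴮ ι x +ᴮ -ᴮ (ι y *ᴮ θ)
    elt-x-θz x y = ringEqᴮ (x ∷ y ∷ []) (λ x y → ⟪ x , :- y , :- y ⟫ , ιₑ x ⊞ ⊟ (ιₑ y ⊠ θₑ))

    θ-def : θ ≈ᴮ z +ᴮ z⁻¹
    θ-def = ringEqᴮ [] (θₑ , zₑ ⊞ iₑ)

    z*-elt : ∀ p q r → z *ᴮ elt p q r ≈ᴮ elt (r - q) (p - (t + 1#) * q) (- q)
    z*-elt p q r = ringEqᴮ (p ∷ q ∷ r ∷ []) (λ p q r → zₑ ⊠ ⟪ p , q , r ⟫ , ⟪ r :- q , p :- (tₑ :+ # 1) :* q , :- q ⟫)

    -θ*-elt : ∀ p q r → (-ᴮ θ) *ᴮ elt p q r ≈ᴮ elt (t * r) ((t + 1#) * q + r - p) (q + r - p)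
    -θ*-elt p q r = ringEqᴮ (p ∷ q ∷ r ∷ []) (λ p q r → (⊟ θₑ) ⊠ ⟪ p , q , r ⟫ , ⟪ tₑ :* r , (tₑ :+ # 1) :* q :+ r :- p , q :+ r :- p ⟫)

    -z*-elt : ∀ p q r → (-ᴮ z) *ᴮ elt p q r ≈ᴮ elt (q - r) ((t + 1#) * q - p) q
    -z*-elt p q r = ringEqᴮ (p ∷ q ∷ r ∷ []) (λ p q r → (⊟ zₑ) ⊠ ⟪ p , q , r ⟫ , ⟪ q :- r , (tₑ :+ # 1) :* q :- p , q ⟫)

    -[t+θ]*-elt : ∀ p q r → (-ᴮ (ι t +ᴮ θ)) *ᴮ elt p q r ≈ᴮ elt (t * (r - p)) (q + r - p) (q + r - p - t * r)
    -[t+θ]*-elt p q r = ringEqᴮ (p ∷ q ∷ r ∷ []) (λ p q r → (⊟ (ιₑ tₑ ⊞ θₑ)) ⊠ ⟪ p , q , r ⟫ ,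
      ⟪ tₑ :* (r :- p) , q :+ r :- p , q :+ r :- p :- tₑ :* r ⟫)

    elt-expand : ∀ p q r → elt p q r ≈ᴮ ι p +ᴮ z *ᴮ ι q +ᴮ z⁻¹ *ᴮ ι r
    elt-expand p q r = ringEqᴮ (p ∷ q ∷ r ∷ []) (λ p q r → ⟪ p , q , r ⟫ , ιₑ p ⊞ zₑ ⊠ ιₑ q ⊞ iₑ ⊠ ιₑ r)

    z²t : z *ᴮ z *ᴮ ι t ≈ᴮ -ᴮ ((z +ᴮ ι 1#) *ᴮ π₁)
    z²t = ringEqᴮ [] (zₑ ⊠ zₑ ⊠ ιₑ tₑ , ⊟ ((zₑ ⊞ ιₑ (# 1)) ⊠ π₁ₑ))

    -- The different of R[θ], the derivative of its minimal polynomial at θ.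
    z³f′θ : z *ᴮ z *ᴮ z *ᴮ (ι (fromℕ 3) *ᴮ θ *ᴮ θ +ᴮ ι (fromℕ 2 * (t + fromℕ 2)) *ᴮ θ +ᴮ ι (fromℕ 2 * t)) ≈ᴮ π₁ *ᴮ π₂
    z³f′θ = ringEqᴮ [] (zₑ ⊠ zₑ ⊠ zₑ ⊠ (ιₑ (# 3) ⊠ θₑ ⊠ θₑ ⊞ ιₑ (# 2 :* (tₑ :+ # 2)) ⊠ θₑ ⊞ ιₑ (# 2 :* tₑ)) , π₁ₑ ⊠ π₂ₑ)

    θ-root : θ *ᴮ θ *ᴮ θ +ᴮ ι (t + fromℕ 2) *ᴮ θ *ᴮ θ +ᴮ ι (fromℕ 2 * t) *ᴮ θ +ᴮ ι (t * t) ≈ᴮ ι 0#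
    θ-root = ringEqᴮ [] (θₑ ⊠ θₑ ⊠ θₑ ⊞ ιₑ (tₑ :+ # 2) ⊠ θₑ ⊠ θₑ ⊞ ιₑ (# 2 :* tₑ) ⊠ θₑ ⊞ ιₑ (tₑ :* tₑ) , ιₑ (# 0))

    norm-z : norm-of z ≈ - 1#
    norm-z = ringEq (t ∷ []) (λ t → Nₑ t (# 0) (# 1) (# 0) := :- # 1)

    norm-z⁻¹ : norm-of z⁻¹ ≈ - 1#
    norm-z⁻¹ = ringEq (t ∷ []) (λ t → Nₑ t (# 0) (# 0) (# 1) := :- # 1)

    norm-1 : norm-of (ι 1#) ≈ 1#
    norm-1 = ringEq (t ∷ []) (λ t → Nₑ t (# 1) (# 0) (# 0) := # 1)

  private
    normₑ : EltExpr 0 → Expr 1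
    normₑ ⟪ p , q , r ⟫ = Nₑ tₑ p q r

  opaque
    unfolding ι z

    norm-π₁ : norm-of π₁ ≈ t * t
    norm-π₁ = ringEq (t ∷ []) (λ t → normₑ π₁ₑ := t :* t)

    norm-π₂ : norm-of π₂ ≈ - (fromℕ 4 * t * t * t + fromℕ 11 * t * t - fromℕ 8 * t + fromℕ 16)
    norm-π₂ = ringEq (t ∷ []) (λ t → normₑ π₂ₑ := :- (# 4 :* t :* t :* t :+ # 11 :* t :* t :- # 8 :* t :+ # 16))

    norm-x-θz : ∀ x y → norm-of (elt x (- y) (- y)) ≈
      x * x * x + (t + fromℕ 2) * x * x * y + fromℕ 2 * t * x * y * y + t * t * y * y * y
    norm-x-θz x y = ringEq (t ∷ x ∷ y ∷ []) (λ t x y → Nₑ t x (:- y) (:- y) :=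
      x :* x :* x :+ (t :+ # 2) :* x :* x :* y :+ # 2 :* t :* x :* y :* y :+ t :* t :* y :* y :* y)

  norm-cong : ∀ {x y} → x ≈ᴮ y → norm-of x ≈ norm-of y
  norm-cong {elt _ _ _} {elt _ _ _} (eqs a b c) = +-cong (+-cong
    (*-cong a (+-cong (*-cong (+-cong a (-‿cong (*-congˡ b))) (+-cong a (-‿cong c))) (-‿cong (*-cong b c))))
    (-‿cong (*-cong (+-cong c (-‿cong b)) (+-cong (*-cong b (+-cong a (-‿cong c))) (*-cong c c)))))
    (*-cong (+-cong b (-‿cong (*-congˡ c))) (+-cong (+-cong (*-cong (*-congˡ b) c) (-‿cong (*-cong b b))) (-‿cong (*-cong c a))))

  private
    module B = CommutativeRing orderRing
    module DR = Divisibility R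
    module DB = Divisibility orderRing

  opaque
    unfolding ι

    -- From `x y = 0` follows `N(x) y = adj x * x * y = 0`, and `N(x)` acts on each coordinate
    -- separately.
    regular-norm : ∀ {x} → DR.Regular (norm-of x) → DB.Regular x
    regular-norm {x} rN y@(elt _ _ _) xy = eqs (rN _ (e₀ all)) (rN _ (e₁ all)) (rN _ (e₂ all))
      where
      all : elt (norm-of x * p₀ y) (norm-of x * p₁ y) (norm-of x * p₂ y) ≈ᴮ ι 0#
      all = B.trans (B.sym (ι-* (norm-of x) y)) (B.trans (B.*-congʳ (B.sym (*-adj x)))
        (B.trans (B.*-congʳ (B.*-comm x (adj x))) (B.trans (B.*-assoc (adj x) x y)
          (B.trans (B.*-congˡ xy) (B.zeroʳ (adj x))))))

  open Homomorphism R orderRing ι ι-cong (λ x y → B.sym (ι-homo-+ x y)) (λ x y → B.sym (ι-homo-* x y)) ι-neg B.refl B.refl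
    using () renaming (holds to ι-holds; value to ι-value) public

  opaque
    unfolding ι

    elt-zero : ∀ {p q r} → elt p q r ≈ᴮ ι 0# → (p ≈ 0#) × (q ≈ 0#) × (r ≈ 0#)
    elt-zero (eqs a b c) = a , b , c

-- Collinear triples on a cubic y² = x³ + a₂ x² + a₄ x + a₆

module Cubic {c ℓ} (F : CommutativeRing c ℓ) (a₂ a₄ a₆ : CommutativeRing.Carrier F) where
  open CommutativeRing F
    renaming (sym to ≈-sym; trans to ≈-trans; refl to ≈-refl) hiding (zero)
  open LinearSolver F
  open Algebra.Properties.Ring ring using (-‿involutive; -0#≈0#)

  rhs : Carrier → Carrier
  rhs x = x * x * x + a₂ * x * x + a₄ * x + a₆

  -- The line y = l x + m meets the cubic exactly in three points, with multiplicity.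
  record Line (x₁ y₁ x₂ y₂ x₃ y₃ : Carrier) : Set (c Level.⊔ ℓ) where
    constructor mkLine
    field
      l m : Carrier
      on₁ : y₁ ≈ l * x₁ + m
      on₂ : y₂ ≈ l * x₂ + m
      on₃ : y₃ ≈ l * x₃ + m
      s₁ : x₁ + x₂ + x₃ ≈ l * l - a₂
      s₂ : x₁ * x₂ + x₁ * x₃ + x₂ * x₃ ≈ a₄ - fromℕ 2 * l * m
      s₃ : x₁ * x₂ * x₃ ≈ m * m - a₆

  swap₁₂ : ∀ {x₁ y₁ x₂ y₂ x₃ y₃} → Line x₁ y₁ x₂ y₂ x₃ y₃ → Line x₂ y₂ x₁ y₁ x₃ y₃
  swap₁₂ {x₁} {_} {x₂} {_} {x₃} (mkLine l m o₁ o₂ o₃ s₁ s₂ s₃) = mkLine l m o₂ o₁ o₃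
    (≈-trans (ringEq (x₁ ∷ x₂ ∷ x₃ ∷ []) (λ x y z → y :+ x :+ z := x :+ y :+ z)) s₁)
    (≈-trans (ringEq (x₁ ∷ x₂ ∷ x₃ ∷ []) (λ x y z → y :* x :+ y :* z :+ x :* z := x :* y :+ x :* z :+ y :* z)) s₂)
    (≈-trans (ringEq (x₁ ∷ x₂ ∷ x₃ ∷ []) (λ x y z → y :* x :* z := x :* y :* z)) s₃)

  swap₂₃ : ∀ {x₁ y₁ x₂ y₂ x₃ y₃} → Line x₁ y₁ x₂ y₂ x₃ y₃ → Line x₁ y₁ x₃ y₃ x₂ y₂
  swap₂₃ {x₁} {_} {x₂} {_} {x₃} (mkLine l m o₁ o₂ o₃ s₁ s₂ s₃) = mkLine l m o₁ o₃ o₂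
    (≈-trans (ringEq (x₁ ∷ x₂ ∷ x₃ ∷ []) (λ x y z → x :+ z :+ y := x :+ y :+ z)) s₁)
    (≈-trans (ringEq (x₁ ∷ x₂ ∷ x₃ ∷ []) (λ x y z → x :* z :+ x :* y :+ z :* y := x :* y :+ x :* z :+ y :* z)) s₂)
    (≈-trans (ringEq (x₁ ∷ x₂ ∷ x₃ ∷ []) (λ x y z → x :* z :* y := x :* y :* z)) s₃)

  negate : ∀ {x₁ y₁ x₂ y₂ x₃ y₃} → Line x₁ y₁ x₂ y₂ x₃ y₃ → Line x₁ (- y₁) x₂ (- y₂) x₃ (- y₃)
  negate {x₁} {y₁} {x₂} {y₂} {x₃} {y₃} (mkLine l m o₁ o₂ o₃ s₁ s₂ s₃) = mkLine (- l) (- m) (neg o₁) (neg o₂) (neg o₃)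
    (≈-trans s₁ (ringEq (l ∷ a₂ ∷ []) (λ l a → l :* l :- a := (:- l) :* (:- l) :- a)))
    (≈-trans s₂ (ringEq (l ∷ m ∷ a₄ ∷ []) (λ l m a → a :- # 2 :* l :* m := a :- # 2 :* (:- l) :* (:- m))))
    (≈-trans s₃ (ringEq (m ∷ a₆ ∷ []) (λ m a → m :* m :- a := (:- m) :* (:- m) :- a)))
    where
    neg : ∀ {x y} → y ≈ l * x + m → - y ≈ (- l) * x + (- m)
    neg {x} {y} o = linear (x ∷ y ∷ l ∷ m ∷ []) (λ x y l m → (:- y := (:- l) :* x :+ (:- m)) , (:- # 1 , y := l :* x :+ m) ∷ []) (o ∷ [])

  line-cong : ∀ {x₁ y₁ x₂ y₂ x₃ y₃ x₁′ y₁′ x₂′ y₂′ x₃′ y₃′} →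
    x₁ ≈ x₁′ → y₁ ≈ y₁′ → x₂ ≈ x₂′ → y₂ ≈ y₂′ → x₃ ≈ x₃′ → y₃ ≈ y₃′ →
    Line x₁ y₁ x₂ y₂ x₃ y₃ → Line x₁′ y₁′ x₂′ y₂′ x₃′ y₃′
  line-cong p₁ q₁ p₂ q₂ p₃ q₃ (mkLine l m o₁ o₂ o₃ s₁ s₂ s₃) = mkLine l m
    (on p₁ q₁ o₁) (on p₂ q₂ o₂) (on p₃ q₃ o₃)
    (≈-trans (+-cong (+-cong (≈-sym p₁) (≈-sym p₂)) (≈-sym p₃)) s₁)
    (≈-trans (+-cong (+-cong (*-cong (≈-sym p₁) (≈-sym p₂)) (*-cong (≈-sym p₁) (≈-sym p₃))) (*-cong (≈-sym p₂) (≈-sym p₃))) s₂)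
    (≈-trans (*-cong (*-cong (≈-sym p₁) (≈-sym p₂)) (≈-sym p₃)) s₃)
    where
    on : ∀ {x y x′ y′} → x ≈ x′ → y ≈ y′ → y ≈ l * x + m → y′ ≈ l * x′ + m
    on p q o = ≈-trans (≈-sym q) (≈-trans o (+-congʳ (*-congˡ p)))

  -- The symmetric functions say that `rhs x - (l x + m)²` equals `(x - x₁)(x - x₂)(x - x₃)`; this
  -- is its value at `x₁`.
  on-curve : ∀ {x₁ y₁ x₂ y₂ x₃ y₃} → Line x₁ y₁ x₂ y₂ x₃ y₃ → y₁ * y₁ ≈ rhs x₁
  on-curve {x₁} {y₁} {x₂} {_} {x₃} (mkLine l m o₁ o₂ o₃ s₁ s₂ s₃) =
    linear (x₁ ∷ y₁ ∷ x₂ ∷ x₃ ∷ l ∷ m ∷ a₂ ∷ a₄ ∷ a₆ ∷ [])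
      (λ x y x₂ x₃ l m a₂ a₄ a₆ → (y :* y := x :* x :* x :+ a₂ :* x :* x :+ a₄ :* x :+ a₆) ,
        (y :+ (l :* x :+ m) , y := l :* x :+ m) ∷
        (:- (x :* x) , x :+ x₂ :+ x₃ := l :* l :- a₂) ∷
        (x , x :* x₂ :+ x :* x₃ :+ x₂ :* x₃ := a₄ :- # 2 :* l :* m) ∷
        (:- # 1 , x :* x₂ :* x₃ := m :* m :- a₆) ∷ [])
      (o₁ ∷ s₁ ∷ s₂ ∷ s₃ ∷ [])

  -- The derivative of the same identity at `x₁`. It holds whether or not points coincide, and
  -- supplies the second condition on a line that is tangent.
  slope : ∀ {x₁ y₁ x₂ y₂ x₃ y₃} (L : Line x₁ y₁ x₂ y₂ x₃ y₃) →
    fromℕ 2 * y₁ * Line.l L ≈ fromℕ 3 * x₁ * x₁ + fromℕ 2 * a₂ * x₁ + a₄ - (x₁ - x₂) * (x₁ - x₃)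
  slope {x₁} {y₁} {x₂} {_} {x₃} (mkLine l m o₁ o₂ o₃ s₁ s₂ s₃) =
    linear (x₁ ∷ y₁ ∷ x₂ ∷ x₃ ∷ l ∷ m ∷ a₂ ∷ a₄ ∷ [])
      (λ x y x₂ x₃ l m a₂ a₄ → (# 2 :* y :* l := # 3 :* x :* x :+ # 2 :* a₂ :* x :+ a₄ :- (x :- x₂) :* (x :- x₃)) ,
        (# 2 :* l , y := l :* x :+ m) ∷ (:- (# 2 :* x) , x :+ x₂ :+ x₃ := l :* l :- a₂) ∷
        (# 1 , x :* x₂ :+ x :* x₃ :+ x₂ :* x₃ := a₄ :- # 2 :* l :* m) ∷ [])
      (o₁ ∷ s₁ ∷ s₂ ∷ [])

  -- As the line passes through a point of the curve over `x₁`, the third symmetric relation follows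
  -- from the first two.
  third-s₃ : ∀ {x₁ y₁ x₂ x₃ λ′} → y₁ * y₁ ≈ rhs x₁ → x₃ ≈ λ′ * λ′ - a₂ - x₁ - x₂ →
    x₁ * x₂ + x₁ * x₃ + x₂ * x₃ ≈ a₄ - fromℕ 2 * λ′ * (y₁ - λ′ * x₁) →
    Line x₁ y₁ x₂ (λ′ * (x₂ - x₁) + y₁) x₃ (λ′ * (x₃ - x₁) + y₁)
  third-s₃ {x₁} {y₁} {x₂} {x₃} {λ′} c₁ e₃ s₂ = mkLine λ′ (y₁ - λ′ * x₁)
    (ringEq (λ′ ∷ x₁ ∷ y₁ ∷ []) (λ l x y → y := l :* x :+ (y :- l :* x)))
    (ringEq (λ′ ∷ x₁ ∷ y₁ ∷ x₂ ∷ []) (λ l x y x′ → l :* (x′ :- x) :+ y := l :* x′ :+ (y :- l :* x)))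
    (ringEq (λ′ ∷ x₁ ∷ y₁ ∷ x₃ ∷ []) (λ l x y x′ → l :* (x′ :- x) :+ y := l :* x′ :+ (y :- l :* x)))
    (linear (x₁ ∷ x₂ ∷ x₃ ∷ λ′ ∷ a₂ ∷ []) (λ x₁ x₂ x₃ l a₂ → (x₁ :+ x₂ :+ x₃ := l :* l :- a₂) , (# 1 , x₃ := l :* l :- a₂ :- x₁ :- x₂) ∷ []) (e₃ ∷ []))
    s₂
    (linear (x₁ ∷ y₁ ∷ x₂ ∷ x₃ ∷ λ′ ∷ a₂ ∷ a₄ ∷ a₆ ∷ [])
      (λ x₁ y₁ x₂ x₃ l a₂ a₄ a₆ → (x₁ :* x₂ :* x₃ := (y₁ :- l :* x₁) :* (y₁ :- l :* x₁) :- a₆) ,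
        (x₁ , x₁ :* x₂ :+ x₁ :* x₃ :+ x₂ :* x₃ := a₄ :- # 2 :* l :* (y₁ :- l :* x₁)) ∷
        (:- (x₁ :* x₁) , x₃ := l :* l :- a₂ :- x₁ :- x₂) ∷
        (:- # 1 , y₁ :* y₁ := x₁ :* x₁ :* x₁ :+ a₂ :* x₁ :* x₁ :+ a₄ :* x₁ :+ a₆) ∷ [])
      (s₂ ∷ e₃ ∷ c₁ ∷ []))

  tangent : ∀ {x y x₃ λ′} → y * y ≈ rhs x → λ′ * (fromℕ 2 * y) ≈ fromℕ 3 * x * x + fromℕ 2 * a₂ * x + a₄ →
    x₃ ≈ λ′ * λ′ - a₂ - x - x → Line x y x (λ′ * (x - x) + y) x₃ (λ′ * (x₃ - x) + y)
  tangent {x} {y} {x₃} {λ′} c₁ h e₃ = third-s₃ c₁ e₃ (linear (x ∷ y ∷ x₃ ∷ λ′ ∷ a₂ ∷ a₄ ∷ [])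
    (λ x y x₃ l a₂ a₄ → (x :* x :+ x :* x₃ :+ x :* x₃ := a₄ :- # 2 :* l :* (y :- l :* x)) ,
      (# 1 , l :* (# 2 :* y) := # 3 :* x :* x :+ # 2 :* a₂ :* x :+ a₄) ∷ (# 2 :* x , x₃ := l :* l :- a₂ :- x :- x) ∷ [])
    (h ∷ e₃ ∷ []))

  -- A cubic without roots gives a curve without points of order 2. So tangents are never vertical,
  -- and two points determine their line even when they coincide.
  module GroupLaw
    (_≟_ : ∀ x y → Dec (x ≈ y))
    (inverse : ∀ {x} → ¬ x ≈ 0# → ∃[ y ] y * x ≈ 1#)
    (2≉0 : ¬ fromℕ 2 ≈ 0#)
    (no-root : ∀ x → ¬ rhs x ≈ 0#) where

    integral : ∀ {x y} → ¬ x ≈ 0# → x * y ≈ 0# → y ≈ 0#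
    integral {x} {y} x≉0 e = let (i , ix) = inverse x≉0 in
      linear (x ∷ y ∷ i ∷ []) (λ x y i → (y := # 0) , (:- y , i :* x := # 1) ∷ (i , x :* y := # 0) ∷ []) (ix ∷ e ∷ [])

    ≉-minus : ∀ {x y} → ¬ x ≈ y → ¬ x - y ≈ 0#
    ≉-minus x≉y e = x≉y (x-y≈0⇒x≈y e)

    y≉0 : ∀ {x y} → y * y ≈ rhs x → ¬ y ≈ 0#
    y≉0 {x} {y} e y≈0 = no-root x (≈-trans (≈-sym e) (≈-trans (*-congʳ y≈0) (zeroˡ y)))

    2y≉0 : ∀ {x y} → y * y ≈ rhs x → ¬ fromℕ 2 * y ≈ 0#
    2y≉0 e z = y≉0 e (integral 2≉0 z)

    chord : ∀ {x₁ y₁ x₂ y₂ x₃ λ′} → y₁ * y₁ ≈ rhs x₁ → y₂ * y₂ ≈ rhs x₂ → ¬ x₁ ≈ x₂ →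
      λ′ * (x₂ - x₁) ≈ y₂ - y₁ → x₃ ≈ λ′ * λ′ - a₂ - x₁ - x₂ →
      Line x₁ y₁ x₂ (λ′ * (x₂ - x₁) + y₁) x₃ (λ′ * (x₃ - x₁) + y₁)
    chord {x₁} {y₁} {x₂} {y₂} {x₃} {λ′} c₁ c₂ x₁≉x₂ h e₃ = third-s₃ c₁ e₃ (x-y≈0⇒x≈y (integral (≉-minus x₁≉x₂)
      (linear (x₁ ∷ y₁ ∷ x₂ ∷ y₂ ∷ x₃ ∷ λ′ ∷ a₂ ∷ a₄ ∷ a₆ ∷ [])
        (λ x₁ y₁ x₂ y₂ x₃ l a₂ a₄ a₆ → ((x₁ :- x₂) :* (x₁ :* x₂ :+ x₁ :* x₃ :+ x₂ :* x₃ :- (a₄ :- # 2 :* l :* (y₁ :- l :* x₁))) := # 0) ,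
          (# 1 , y₁ :* y₁ := x₁ :* x₁ :* x₁ :+ a₂ :* x₁ :* x₁ :+ a₄ :* x₁ :+ a₆) ∷
          (:- # 1 , y₂ :* y₂ := x₂ :* x₂ :* x₂ :+ a₂ :* x₂ :* x₂ :+ a₄ :* x₂ :+ a₆) ∷
          (:- (l :* (x₂ :- x₁) :+ y₁ :+ y₂) , l :* (x₂ :- x₁) := y₂ :- y₁) ∷
          (x₁ :* x₁ :- x₂ :* x₂ , x₃ := l :* l :- a₂ :- x₁ :- x₂) ∷ [])
        (c₁ ∷ c₂ ∷ h ∷ e₃ ∷ []))))

    -- Two points of the line with the same x coincide, and then the line is the tangent.
    line-determined : ∀ {x₁ y₁ x₂ y₂ x₃ y₃ x₃′ y₃′} (L : Line x₁ y₁ x₂ y₂ x₃ y₃) (L′ : Line x₁ y₁ x₂ y₂ x₃′ y₃′) →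
      Line.l L ≈ Line.l L′
    line-determined {x₁} {y₁} {x₂} {y₂} {x₃} {_} {x₃′} L L′ with x₁ ≟ x₂
    ... | no x₁≉x₂ = x-y≈0⇒x≈y (integral (≉-minus x₁≉x₂)
      (linear (x₁ ∷ y₁ ∷ x₂ ∷ y₂ ∷ L.l ∷ L.m ∷ L′.l ∷ L′.m ∷ [])
        (λ x₁ y₁ x₂ y₂ l m l′ m′ → ((x₁ :- x₂) :* (l :- l′) := # 0) ,
          (:- # 1 , y₁ := l :* x₁ :+ m) ∷ (# 1 , y₂ := l :* x₂ :+ m) ∷
          (# 1 , y₁ := l′ :* x₁ :+ m′) ∷ (:- # 1 , y₂ := l′ :* x₂ :+ m′) ∷ [])
        (L.on₁ ∷ L.on₂ ∷ L′.on₁ ∷ L′.on₂ ∷ [])))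
      where module L = Line L
            module L′ = Line L′
    ... | yes x₁≈x₂ = x-y≈0⇒x≈y (integral (2y≉0 (on-curve L))
      (linear (x₁ ∷ y₁ ∷ x₂ ∷ x₃ ∷ x₃′ ∷ Line.l L ∷ Line.l L′ ∷ a₂ ∷ a₄ ∷ [])
        (λ x y x₂ x₃ x₃′ l l′ a₂ a₄ → (# 2 :* y :* (l :- l′) := # 0) ,
          (# 1 , # 2 :* y :* l := # 3 :* x :* x :+ # 2 :* a₂ :* x :+ a₄ :- (x :- x₂) :* (x :- x₃)) ∷
          (:- # 1 , # 2 :* y :* l′ := # 3 :* x :* x :+ # 2 :* a₂ :* x :+ a₄ :- (x :- x₂) :* (x :- x₃′)) ∷
          (x₃ :- x₃′ , x := x₂) ∷ [])
        (slope L ∷ slope L′ ∷ x₁≈x₂ ∷ [])))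

    line-unique : ∀ {x₁ y₁ x₂ y₂ x₃ y₃ x₃′ y₃′} → Line x₁ y₁ x₂ y₂ x₃ y₃ → Line x₁ y₁ x₂ y₂ x₃′ y₃′ → x₃ ≈ x₃′ × y₃ ≈ y₃′
    line-unique {x₁} {y₁} {x₂} {y₂} {x₃} {y₃} {x₃′} {y₃′} L L′ = x₃≈ ,
      linear (x₁ ∷ y₁ ∷ x₃ ∷ y₃ ∷ x₃′ ∷ y₃′ ∷ L.l ∷ L.m ∷ L′.l ∷ L′.m ∷ [])
        (λ x₁ y₁ x₃ y₃ x₃′ y₃′ l m l′ m′ → (y₃ := y₃′) ,
          (# 1 , y₃ := l :* x₃ :+ m) ∷ (:- # 1 , y₃′ := l′ :* x₃′ :+ m′) ∷
          (:- # 1 , y₁ := l :* x₁ :+ m) ∷ (# 1 , y₁ := l′ :* x₁ :+ m′) ∷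
          (x₃ :- x₁ , l := l′) ∷ (l′ , x₃ := x₃′) ∷ [])
        (L.on₃ ∷ L′.on₃ ∷ L.on₁ ∷ L′.on₁ ∷ l≈ ∷ x₃≈ ∷ [])
      where
      module L = Line L
      module L′ = Line L′
      l≈ = line-determined L L′
      x₃≈ : x₃ ≈ x₃′
      x₃≈ = linear (x₁ ∷ x₂ ∷ x₃ ∷ x₃′ ∷ L.l ∷ L′.l ∷ a₂ ∷ [])
        (λ x₁ x₂ x₃ x₃′ l l′ a₂ → (x₃ := x₃′) ,
          (# 1 , x₁ :+ x₂ :+ x₃ := l :* l :- a₂) ∷ (:- # 1 , x₁ :+ x₂ :+ x₃′ := l′ :* l′ :- a₂) ∷ (l :+ l′ , l := l′) ∷ [])
        (L.s₁ ∷ L′.s₁ ∷ l≈ ∷ [])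

    -- The lines L₁ through A, B, D and L′ through -D, C, G satisfy
    -- L₁ + L′ = κ (x - d). If κ ≠ 0, the parabola
    -- V = L₁ + κ⁻¹ (x - a)(x - b) = L′ + κ⁻¹ (x - c)(x - g) passes through A, B, C, G;
    -- it also equals L₂ + κ⁻¹ (x - b)(x - c), and V - κ⁻¹ (x - a)(x - g) is the line sought.
    module Associativity {a ya b yb d yd c yc g yg e ye : Carrier}
      (L₁ : Line a ya b yb d yd) (L′ : Line d (- yd) c yc g yg) (L₂ : Line b yb c yc e ye) where

      module L₁ = Line L₁ renaming (l to l₁; m to m₁)
      module L′ = Line L′ renaming (l to l′; m to m′)
      module L₂ = Line L₂ renaming (l to l₂; m to m₂)
      open L₁ using (l₁; m₁)
      open L′ using (l′; m′)
      open L₂ using (l₂; m₂)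

      κd : (l₁ + l′) * d + (m₁ + m′) ≈ 0#
      κd = linear (l₁ ∷ m₁ ∷ l′ ∷ m′ ∷ d ∷ yd ∷ [])
        (λ l₁ m₁ l′ m′ d yd → ((l₁ :+ l′) :* d :+ (m₁ :+ m′) := # 0) ,
          (:- # 1 , yd := l₁ :* d :+ m₁) ∷ (:- # 1 , :- yd := l′ :* d :+ m′) ∷ [])
        (L₁.on₃ ∷ L′.on₁ ∷ [])

      sum-diff : (l₁ + l′) * (l₁ - l′) ≈ a + b - c - g
      sum-diff = linear (l₁ ∷ l′ ∷ a ∷ b ∷ c ∷ d ∷ g ∷ a₂ ∷ [])
        (λ l₁ l′ a b c d g a₂ → ((l₁ :+ l′) :* (l₁ :- l′) := a :+ b :- c :- g) ,
          (:- # 1 , a :+ b :+ d := l₁ :* l₁ :- a₂) ∷ (# 1 , d :+ c :+ g := l′ :* l′ :- a₂) ∷ [])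
        (L₁.s₁ ∷ L′.s₁ ∷ [])

      prod-diff : (l₁ + l′) * (m₁ - m′) ≈ c * g - a * b
      prod-diff = linear (l₁ ∷ m₁ ∷ l′ ∷ m′ ∷ a ∷ b ∷ c ∷ d ∷ g ∷ a₄ ∷ [])
        (λ l₁ m₁ l′ m′ a b c d g a₄ → ((l₁ :+ l′) :* (m₁ :- m′) := c :* g :- a :* b) ,
          (# 1 , a :* b :+ a :* d :+ b :* d := a₄ :- # 2 :* l₁ :* m₁) ∷
          (:- # 1 , d :* c :+ d :* g :+ c :* g := a₄ :- # 2 :* l′ :* m′) ∷
          (d , (l₁ :+ l′) :* (l₁ :- l′) := a :+ b :- c :- g) ∷
          (:- (l₁ :- l′) , (l₁ :+ l′) :* d :+ (m₁ :+ m′) := # 0) ∷ [])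
        (L₁.s₂ ∷ L′.s₂ ∷ sum-diff ∷ κd ∷ [])

      module Parabola (k : Carrier) (kκ : k * (l₁ + l′) ≈ 1#) where
        2kl₁ : fromℕ 2 * k * l₁ ≈ 1# + k * k * (a + b - c - g)
        2kl₁ = linear (k ∷ l₁ ∷ l′ ∷ a ∷ b ∷ c ∷ g ∷ [])
          (λ k l₁ l′ a b c g → (# 2 :* k :* l₁ := # 1 :+ k :* k :* (a :+ b :- c :- g)) ,
            (# 1 :- k :* (l₁ :- l′) , k :* (l₁ :+ l′) := # 1) ∷ (k :* k , (l₁ :+ l′) :* (l₁ :- l′) := a :+ b :- c :- g) ∷ [])
          (kκ ∷ sum-diff ∷ [])

        2km₁ : fromℕ 2 * k * m₁ ≈ k * k * (c * g - a * b) - d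
        2km₁ = linear (k ∷ l₁ ∷ m₁ ∷ l′ ∷ m′ ∷ a ∷ b ∷ c ∷ d ∷ g ∷ [])
          (λ k l₁ m₁ l′ m′ a b c d g → (# 2 :* k :* m₁ := k :* k :* (c :* g :- a :* b) :- d) ,
            (:- (k :* (m₁ :- m′)) :- d , k :* (l₁ :+ l′) := # 1) ∷
            (k :* k , (l₁ :+ l′) :* (m₁ :- m′) := c :* g :- a :* b) ∷
            (k , (l₁ :+ l′) :* d :+ (m₁ :+ m′) := # 0) ∷ [])
          (kκ ∷ prod-diff ∷ κd ∷ [])

        agree-c : l₁ * c + m₁ + k * (c - a) * (c - b) ≈ l₂ * c + m₂
        agree-c = linear (k ∷ l₁ ∷ m₁ ∷ l′ ∷ m′ ∷ l₂ ∷ m₂ ∷ a ∷ b ∷ c ∷ g ∷ yc ∷ [])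
          (λ k l₁ m₁ l′ m′ l₂ m₂ a b c g yc → (l₁ :* c :+ m₁ :+ k :* (c :- a) :* (c :- b) := l₂ :* c :+ m₂) ,
            (# 1 , yc := l₂ :* c :+ m₂) ∷ (:- # 1 , yc := l′ :* c :+ m′) ∷
            (:- (c :* (l₁ :- l′) :+ (m₁ :- m′)) , k :* (l₁ :+ l′) := # 1) ∷
            (k :* c , (l₁ :+ l′) :* (l₁ :- l′) := a :+ b :- c :- g) ∷
            (k , (l₁ :+ l′) :* (m₁ :- m′) := c :* g :- a :* b) ∷ [])
          (L₂.on₂ ∷ L′.on₂ ∷ kκ ∷ sum-diff ∷ prod-diff ∷ [])

        l₂-eq : l₂ ≈ l₁ + k * (c - a)
        l₂-eq with b ≟ c
        ... | no b≉c = x-y≈0⇒x≈y (integral (≉-minus b≉c)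
          (linear (k ∷ l₁ ∷ m₁ ∷ l₂ ∷ m₂ ∷ a ∷ b ∷ c ∷ yb ∷ [])
            (λ k l₁ m₁ l₂ m₂ a b c yb → ((b :- c) :* (l₂ :- (l₁ :+ k :* (c :- a))) := # 0) ,
              (# 1 , yb := l₁ :* b :+ m₁) ∷ (:- # 1 , yb := l₂ :* b :+ m₂) ∷
              (# 1 , l₁ :* c :+ m₁ :+ k :* (c :- a) :* (c :- b) := l₂ :* c :+ m₂) ∷ [])
            (L₁.on₂ ∷ L₂.on₁ ∷ agree-c ∷ [])))
        -- For `b = c` agreement of values at `b` and at `c` is a single condition; the slopes of
        -- `L₁` and `L₂` at `B` give the other one.
        ... | yes b≈c = x-y≈0⇒x≈y (integral (2y≉0 (on-curve L₂))
          (linear (k ∷ l₁ ∷ m₁ ∷ l₂ ∷ a ∷ b ∷ c ∷ d ∷ g ∷ e ∷ yb ∷ a₂ ∷ a₄ ∷ [])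
            (λ k l₁ m₁ l₂ a b c d g e y a₂ a₄ → (# 2 :* y :* (l₂ :- (l₁ :+ k :* (c :- a))) := # 0) ,
              (# 1 , # 2 :* y :* l₂ := # 3 :* b :* b :+ # 2 :* a₂ :* b :+ a₄ :- (b :- c) :* (b :- e)) ∷
              (:- # 1 , # 2 :* y :* l₁ := # 3 :* b :* b :+ # 2 :* a₂ :* b :+ a₄ :- (b :- a) :* (b :- d)) ∷
              (:- (# 2 :* k :* (c :- a)) , y := l₁ :* b :+ m₁) ∷
              (:- (c :- a) :* b , # 2 :* k :* l₁ := # 1 :+ k :* k :* (a :+ b :- c :- g)) ∷
              (:- (c :- a) , # 2 :* k :* m₁ := k :* k :* (c :* g :- a :* b) :- d) ∷
              (:- (b :- e) :+ (b :- d) :- (c :- a) :* k :* k :* (b :- g) , b := c) ∷ [])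
            (slope L₂ ∷ slope (swap₁₂ L₁) ∷ L₁.on₂ ∷ 2kl₁ ∷ 2km₁ ∷ b≈c ∷ [])))

        m₂-eq : m₂ ≈ m₁ - k * b * (c - a)
        m₂-eq = linear (k ∷ l₁ ∷ m₁ ∷ l₂ ∷ m₂ ∷ a ∷ b ∷ c ∷ yb ∷ [])
          (λ k l₁ m₁ l₂ m₂ a b c yb → (m₂ := m₁ :- k :* b :* (c :- a)) ,
            (# 1 , yb := l₁ :* b :+ m₁) ∷ (:- # 1 , yb := l₂ :* b :+ m₂) ∷ (:- b , l₂ := l₁ :+ k :* (c :- a)) ∷ [])
          (L₁.on₂ ∷ L₂.on₁ ∷ l₂-eq ∷ [])

        e-eq : e ≈ d + k * k * (a - c) * (g - b)
        e-eq = linear (k ∷ l₁ ∷ l₂ ∷ a ∷ b ∷ c ∷ d ∷ g ∷ e ∷ a₂ ∷ [])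
          (λ k l₁ l₂ a b c d g e a₂ → (e := d :+ k :* k :* (a :- c) :* (g :- b)) ,
            (# 1 , b :+ c :+ e := l₂ :* l₂ :- a₂) ∷ (:- # 1 , a :+ b :+ d := l₁ :* l₁ :- a₂) ∷
            (l₂ :+ l₁ :+ k :* (c :- a) , l₂ := l₁ :+ k :* (c :- a)) ∷
            (c :- a , # 2 :* k :* l₁ := # 1 :+ k :* k :* (a :+ b :- c :- g)) ∷ [])
          (L₂.s₁ ∷ L₁.s₁ ∷ l₂-eq ∷ 2kl₁ ∷ [])

        l₃ m₃ : Carrier
        l₃ = l₁ + k * (g - b)
        m₃ = m₁ - k * a * (g - b)

        -- κ⁻¹ (L₂ + L₃) = x - e
        at-e : - ye ≈ l₃ * e + m₃
        at-e = linear (k ∷ l₁ ∷ m₁ ∷ l₂ ∷ m₂ ∷ l′ ∷ a ∷ b ∷ c ∷ d ∷ g ∷ e ∷ ye ∷ [])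
          (λ k l₁ m₁ l₂ m₂ l′ a b c d g e y → (:- y := (l₁ :+ k :* (g :- b)) :* e :+ (m₁ :- k :* a :* (g :- b))) ,
            (:- # 1 , y := l₂ :* e :+ m₂) ∷ (:- e , l₂ := l₁ :+ k :* (c :- a)) ∷ (:- # 1 , m₂ := m₁ :- k :* b :* (c :- a)) ∷
            ((# 2 :* l₁ :+ k :* (c :- a) :+ k :* (g :- b)) :* e :+ # 2 :* m₁ :- k :* b :* (c :- a) :- k :* a :* (g :- b) , k :* (l₁ :+ l′) := # 1) ∷
            (:- ((l₁ :+ l′) :* e) , # 2 :* k :* l₁ := # 1 :+ k :* k :* (a :+ b :- c :- g)) ∷
            (:- (l₁ :+ l′) , # 2 :* k :* m₁ := k :* k :* (c :* g :- a :* b) :- d) ∷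
            (:- (l₁ :+ l′) , e := d :+ k :* k :* (a :- c) :* (g :- b)) ∷ [])
          (L₂.on₃ ∷ l₂-eq ∷ m₂-eq ∷ kκ ∷ 2kl₁ ∷ 2km₁ ∷ e-eq ∷ [])

        at-g : yg ≈ l₃ * g + m₃
        at-g = linear (k ∷ l₁ ∷ m₁ ∷ l′ ∷ m′ ∷ a ∷ b ∷ c ∷ g ∷ yg ∷ [])
          (λ k l₁ m₁ l′ m′ a b c g y → (y := (l₁ :+ k :* (g :- b)) :* g :+ (m₁ :- k :* a :* (g :- b))) ,
            (# 1 , y := l′ :* g :+ m′) ∷
            (g :* (l₁ :- l′) :+ (m₁ :- m′) , k :* (l₁ :+ l′) := # 1) ∷
            (:- (k :* g) , (l₁ :+ l′) :* (l₁ :- l′) := a :+ b :- c :- g) ∷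
            (:- k , (l₁ :+ l′) :* (m₁ :- m′) := c :* g :- a :* b) ∷ [])
          (L′.on₃ ∷ kκ ∷ sum-diff ∷ prod-diff ∷ [])

        result : Line a ya e (- ye) g yg
        result = mkLine l₃ m₃
          (linear (k ∷ l₁ ∷ m₁ ∷ a ∷ b ∷ g ∷ ya ∷ [])
            (λ k l₁ m₁ a b g y → (y := (l₁ :+ k :* (g :- b)) :* a :+ (m₁ :- k :* a :* (g :- b))) , (# 1 , y := l₁ :* a :+ m₁) ∷ [])
            (L₁.on₁ ∷ []))
          at-e at-g
          (linear (k ∷ l₁ ∷ a ∷ b ∷ c ∷ d ∷ g ∷ e ∷ a₂ ∷ [])
            (λ k l₁ a b c d g e a₂ → (a :+ e :+ g := (l₁ :+ k :* (g :- b)) :* (l₁ :+ k :* (g :- b)) :- a₂) ,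
              (# 1 , a :+ b :+ d := l₁ :* l₁ :- a₂) ∷ (# 1 , e := d :+ k :* k :* (a :- c) :* (g :- b)) ∷
              (:- (g :- b) , # 2 :* k :* l₁ := # 1 :+ k :* k :* (a :+ b :- c :- g)) ∷ [])
            (L₁.s₁ ∷ e-eq ∷ 2kl₁ ∷ []))
          (linear (k ∷ l₁ ∷ m₁ ∷ a ∷ b ∷ c ∷ d ∷ g ∷ e ∷ a₄ ∷ [])
            (λ k l₁ m₁ a b c d g e a₄ → (a :* e :+ a :* g :+ e :* g := a₄ :- # 2 :* (l₁ :+ k :* (g :- b)) :* (m₁ :- k :* a :* (g :- b))) ,
              (# 1 , a :* b :+ a :* d :+ b :* d := a₄ :- # 2 :* l₁ :* m₁) ∷
              (a :+ g , e := d :+ k :* k :* (a :- c) :* (g :- b)) ∷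
              (:- (a :* (g :- b)) , # 2 :* k :* l₁ := # 1 :+ k :* k :* (a :+ b :- c :- g)) ∷
              (g :- b , # 2 :* k :* m₁ := k :* k :* (c :* g :- a :* b) :- d) ∷ [])
            (L₁.s₂ ∷ e-eq ∷ 2kl₁ ∷ 2km₁ ∷ []))
          (linear (k ∷ m₁ ∷ a ∷ b ∷ c ∷ d ∷ g ∷ e ∷ a₆ ∷ [])
            (λ k m₁ a b c d g e a₆ → (a :* e :* g := (m₁ :- k :* a :* (g :- b)) :* (m₁ :- k :* a :* (g :- b)) :- a₆) ,
              (# 1 , a :* b :* d := m₁ :* m₁ :- a₆) ∷ (a :* g , e := d :+ k :* k :* (a :- c) :* (g :- b)) ∷
              (a :* (g :- b) , # 2 :* k :* m₁ := k :* k :* (c :* g :- a :* b) :- d) ∷ [])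
            (L₁.s₃ ∷ e-eq ∷ 2km₁ ∷ []))

      -- Now `L′` is the mirror image of `L₁`, so `C` and `G` are `-A` and `-B` in some order.
      -- `C = -B` contradicts the line `L₂` through `B` and `C`; hence `C = -A`, `G = -B`, and the
      -- line sought is the mirror image of `L₂`.
      degenerate : l₁ + l′ ≈ 0# → Line a ya e (- ye) g yg
      degenerate κ≈0 = cases (c ≟ b)
        where
        m-sum : m₁ + m′ ≈ 0#
        m-sum = linear (l₁ ∷ m₁ ∷ l′ ∷ m′ ∷ d ∷ [])
          (λ l₁ m₁ l′ m′ d → (m₁ :+ m′ := # 0) , (# 1 , (l₁ :+ l′) :* d :+ (m₁ :+ m′) := # 0) ∷ (:- d , l₁ :+ l′ := # 0) ∷ [])
          (κd ∷ κ≈0 ∷ [])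
        sums : a + b - c - g ≈ 0#
        sums = linear (l₁ ∷ l′ ∷ a ∷ b ∷ c ∷ g ∷ [])
          (λ l₁ l′ a b c g → (a :+ b :- c :- g := # 0) , (:- # 1 , (l₁ :+ l′) :* (l₁ :- l′) := a :+ b :- c :- g) ∷ (l₁ :- l′ , l₁ :+ l′ := # 0) ∷ [])
          (sum-diff ∷ κ≈0 ∷ [])
        products : c * g - a * b ≈ 0#
        products = linear (l₁ ∷ l′ ∷ m₁ ∷ m′ ∷ a ∷ b ∷ c ∷ g ∷ [])
          (λ l₁ l′ m₁ m′ a b c g → (c :* g :- a :* b := # 0) , (:- # 1 , (l₁ :+ l′) :* (m₁ :- m′) := c :* g :- a :* b) ∷ (m₁ :- m′ , l₁ :+ l′ := # 0) ∷ [])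
          (prod-diff ∷ κ≈0 ∷ [])
        cases : Dec (c ≈ b) → Line a ya e (- ye) g yg
        cases (yes c≈b) = ⊥-elim (2y≉0 (on-curve L₂)
          (linear (l₁ ∷ m₁ ∷ l′ ∷ m′ ∷ l₂ ∷ m₂ ∷ b ∷ c ∷ yb ∷ yc ∷ [])
            (λ l₁ m₁ l′ m′ l₂ m₂ b c yb yc → (# 2 :* yb := # 0) ,
              (# 1 , yb := l₁ :* b :+ m₁) ∷ (# 1 , yc := l′ :* c :+ m′) ∷
              (# 1 , yb := l₂ :* b :+ m₂) ∷ (:- # 1 , yc := l₂ :* c :+ m₂) ∷
              (b , l₁ :+ l′ := # 0) ∷ (# 1 , m₁ :+ m′ := # 0) ∷ (l′ :- l₂ , c := b) ∷ [])
            (L₁.on₂ ∷ L′.on₂ ∷ L₂.on₁ ∷ L₂.on₂ ∷ κ≈0 ∷ m-sum ∷ c≈b ∷ [])))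
        cases (no c≉b) = line-cong (≈-sym a≈c) -yc ≈-refl ≈-refl (≈-sym g≈b) -yb (swap₂₃ (swap₁₂ (negate L₂)))
          where
          a≈c : a ≈ c
          a≈c = ≈-sym (x-y≈0⇒x≈y (integral (≉-minus c≉b)
            (linear (a ∷ b ∷ c ∷ g ∷ []) (λ a b c g → ((c :- b) :* (c :- a) := # 0) ,
              (:- c , a :+ b :- c :- g := # 0) ∷ (:- # 1 , c :* g :- a :* b := # 0) ∷ []) (sums ∷ products ∷ []))))
          g≈b : g ≈ b
          g≈b = linear (a ∷ b ∷ c ∷ g ∷ []) (λ a b c g → (g := b) , (:- # 1 , a :+ b :- c :- g := # 0) ∷ (# 1 , a := c) ∷ []) (sums ∷ a≈c ∷ [])
          -yc : - yc ≈ ya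
          -yc = linear (l₁ ∷ m₁ ∷ l′ ∷ m′ ∷ a ∷ c ∷ ya ∷ yc ∷ []) (λ l₁ m₁ l′ m′ a c ya yc → (:- yc := ya) ,
            (:- # 1 , ya := l₁ :* a :+ m₁) ∷ (:- # 1 , yc := l′ :* c :+ m′) ∷ (:- # 1 , m₁ :+ m′ := # 0) ∷ (:- c , l₁ :+ l′ := # 0) ∷ (:- l₁ , a := c) ∷ [])
            (L₁.on₁ ∷ L′.on₂ ∷ m-sum ∷ κ≈0 ∷ a≈c ∷ [])
          -yb : - yb ≈ yg
          -yb = linear (l₁ ∷ m₁ ∷ l′ ∷ m′ ∷ b ∷ g ∷ yb ∷ yg ∷ []) (λ l₁ m₁ l′ m′ b g yb yg → (:- yb := yg) ,
            (:- # 1 , yb := l₁ :* b :+ m₁) ∷ (:- # 1 , yg := l′ :* g :+ m′) ∷ (:- # 1 , m₁ :+ m′ := # 0) ∷ (:- b , l₁ :+ l′ := # 0) ∷ (:- l′ , g := b) ∷ [])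
            (L₁.on₂ ∷ L′.on₃ ∷ m-sum ∷ κ≈0 ∷ g≈b ∷ [])

      line-assoc : Line a ya e (- ye) g yg
      line-assoc with (l₁ + l′) ≟ 0#
      ... | yes κ≈0 = degenerate κ≈0
      ... | no κ≉0  = let (k , kκ) = inverse κ≉0 in Parabola.result k kκ

    data Point : Set c where
      ∞  : Point
      pt : Carrier → Carrier → Point

    data _~_ : Point → Point → Set (c Level.⊔ ℓ) where
      ∞  : ∞ ~ ∞
      pt : ∀ {x y x′ y′} → x ≈ x′ → y ≈ y′ → pt x y ~ pt x′ y′

    neg : Point → Point
    neg ∞        = ∞
    neg (pt x y) = pt x (- y)

    -- A + B + C = O
    data Zero : Point → Point → Point → Set (c Level.⊔ ℓ) where
      z₀ : Zero ∞ ∞ ∞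
      z₁ : ∀ {x y x′ y′} → x ≈ x′ → y ≈ - y′ → Zero ∞ (pt x y) (pt x′ y′)
      z₂ : ∀ {x y x′ y′} → x ≈ x′ → y ≈ - y′ → Zero (pt x y) ∞ (pt x′ y′)
      z₃ : ∀ {x y x′ y′} → x ≈ x′ → y ≈ - y′ → Zero (pt x y) (pt x′ y′) ∞
      zL : ∀ {x₁ y₁ x₂ y₂ x₃ y₃} → Line x₁ y₁ x₂ y₂ x₃ y₃ → Zero (pt x₁ y₁) (pt x₂ y₂) (pt x₃ y₃)

    ~-refl : ∀ {A} → A ~ A
    ~-refl {∞}      = ∞
    ~-refl {pt x y} = pt ≈-refl ≈-refl

    ~-sym : ∀ {A B} → A ~ B → B ~ A
    ~-sym ∞        = ∞
    ~-sym (pt p q) = pt (≈-sym p) (≈-sym q)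

    ~-trans : ∀ {A B C} → A ~ B → B ~ C → A ~ C
    ~-trans ∞        ∞          = ∞
    ~-trans (pt p q) (pt p′ q′) = pt (≈-trans p p′) (≈-trans q q′)

    neg-cong : ∀ {A B} → A ~ B → neg A ~ neg B
    neg-cong ∞        = ∞
    neg-cong (pt p q) = pt p (-‿cong q)

    neg-neg : ∀ A → neg (neg A) ~ A
    neg-neg ∞        = ∞
    neg-neg (pt x y) = pt ≈-refl (-‿involutive y)

    private
      y≈-y′ : ∀ {y y′} → y ≈ - y′ → y′ ≈ - y
      y≈-y′ {y} {y′} e = ≈-trans (≈-sym (-‿involutive y′)) (-‿cong (≈-sym e))

      -cong : ∀ {y y′ v v′} → y ≈ v → y′ ≈ v′ → y ≈ - y′ → v ≈ - v′
      -cong p p′ e = ≈-trans (≈-sym p) (≈-trans e (-‿cong p′))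

    zero-12 : ∀ {A B C} → Zero A B C → Zero B A C
    zero-12 z₀       = z₀
    zero-12 (z₁ p q) = z₂ p q
    zero-12 (z₂ p q) = z₁ p q
    zero-12 (z₃ p q) = z₃ (≈-sym p) (y≈-y′ q)
    zero-12 (zL L)   = zL (swap₁₂ L)

    zero-23 : ∀ {A B C} → Zero A B C → Zero A C B
    zero-23 z₀       = z₀
    zero-23 (z₁ p q) = z₁ (≈-sym p) (y≈-y′ q)
    zero-23 (z₂ p q) = z₃ p q
    zero-23 (z₃ p q) = z₂ p q
    zero-23 (zL L)   = zL (swap₂₃ L)

    zero-cong : ∀ {A B C A′ B′ C′} → A ~ A′ → B ~ B′ → C ~ C′ → Zero A B C → Zero A′ B′ C′
    zero-cong ∞          ∞          ∞          z₀       = z₀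
    zero-cong ∞          (pt p q)   (pt p′ q′) (z₁ u v) = z₁ (≈-trans (≈-sym p) (≈-trans u p′)) (-cong q q′ v)
    zero-cong (pt p q)   ∞          (pt p′ q′) (z₂ u v) = z₂ (≈-trans (≈-sym p) (≈-trans u p′)) (-cong q q′ v)
    zero-cong (pt p q)   (pt p′ q′) ∞          (z₃ u v) = z₃ (≈-trans (≈-sym p) (≈-trans u p′)) (-cong q q′ v)
    zero-cong (pt p₁ q₁) (pt p₂ q₂) (pt p₃ q₃) (zL L)   = zL (line-cong p₁ q₁ p₂ q₂ p₃ q₃ L)

    zero-neg : ∀ {A B C} → Zero A B C → Zero (neg A) (neg B) (neg C)
    zero-neg z₀       = z₀
    zero-neg (z₁ p q) = z₁ p (-‿cong q)
    zero-neg (z₂ p q) = z₂ p (-‿cong q)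
    zero-neg (z₃ p q) = z₃ p (-‿cong q)
    zero-neg (zL L)   = zL (negate L)

    inverse-zero : ∀ A → Zero A (neg A) ∞
    inverse-zero ∞        = z₀
    inverse-zero (pt x y) = z₃ ≈-refl (≈-sym (-‿involutive y))

    private
      opposite-not-collinear : ∀ {x y x′ y′ x₃ y₃} → x ≈ x′ → y ≈ - y′ → ¬ Line x y x′ y′ x₃ y₃
      opposite-not-collinear {x} {y} {x′} {y′} p q L@(mkLine l m o₁ o₂ _ _ _ _) = 2y≉0 (on-curve L)
        (linear (x ∷ y ∷ x′ ∷ y′ ∷ l ∷ m ∷ [])
          (λ x y x′ y′ l m → (# 2 :* y := # 0) ,
            (# 1 , y := l :* x :+ m) ∷ (:- # 1 , y′ := l :* x′ :+ m) ∷ (l , x := x′) ∷ (# 1 , y := :- y′) ∷ [])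
          (o₁ ∷ o₂ ∷ p ∷ q ∷ []))

    zero-unique : ∀ {A B C C′} → Zero A B C → Zero A B C′ → C ~ C′
    zero-unique z₀       z₀         = ∞
    zero-unique (z₁ p q) (z₁ p′ q′) = pt (≈-trans (≈-sym p) p′) (≈-trans (y≈-y′ q) (≈-sym (y≈-y′ q′)))
    zero-unique (z₂ p q) (z₂ p′ q′) = pt (≈-trans (≈-sym p) p′) (≈-trans (y≈-y′ q) (≈-sym (y≈-y′ q′)))
    zero-unique (z₃ p q) (z₃ p′ q′) = ∞
    zero-unique (z₃ p q) (zL L)     = ⊥-elim (opposite-not-collinear p q L)
    zero-unique (zL L)   (z₃ p q)   = ⊥-elim (opposite-not-collinear p q L)
    zero-unique (zL L)   (zL L′)    = let (p , q) = line-unique L L′ in pt p q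

    zero-∞ : ∀ {A B} → Zero ∞ A B → A ~ neg B
    zero-∞ z₀       = ∞
    zero-∞ (z₁ p q) = pt p q

    ∞-zero : ∀ {A B} → A ~ neg B → Zero ∞ A B
    ∞-zero {B = ∞}      ∞        = z₀
    ∞-zero {B = pt _ _} (pt p q) = z₁ p q

    -- Read `-D` as `A + B`, `-E` as `B + C` and `-G` as `(A + B) + C`; the conclusion is
    -- `A + (B + C) = -G`. When one of the six points is at infinity no new line is needed, only
    -- uniqueness of the third point.
    zero-assoc : ∀ {A B C D E G} → Zero A B D → Zero (neg D) C G → Zero B C E → Zero A (neg E) G
    zero-assoc {∞} {B} {C} {D} {E} {G} h₁ h₂ h₃ =
      ∞-zero (neg-cong (zero-unique h₃ (zero-cong (~-sym (zero-∞ h₁)) ~-refl ~-refl h₂)))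
    zero-assoc {A} {∞} {C} {D} {E} {G} h₁ h₂ h₃ =
      zero-cong (~-sym (zero-∞ (zero-12 h₁))) (zero-∞ h₃) ~-refl h₂
    zero-assoc {A} {B} {∞} {D} {E} {G} h₁ h₂ h₃ =
      zero-cong ~-refl (zero-∞ (zero-12 h₃)) (zero-cong-∞ h₂) h₁
      where
      zero-cong-∞ : Zero (neg D) ∞ G → D ~ G
      zero-cong-∞ h = ~-trans (~-sym (neg-neg D)) (~-trans (neg-cong (zero-∞ (zero-12 h))) (neg-neg G))
    zero-assoc {A} {B} {C} {∞} {E} {G} h₁ h₂ h₃ =
      zero-cong (~-sym A~-B) ~-refl (~-sym G~-C) (zero-23 (zero-neg h₃))
      where
      A~-B : A ~ neg B
      A~-B = zero-∞ (zero-12 (zero-23 h₁))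
      G~-C : G ~ neg C
      G~-C = zero-∞ (zero-23 h₂)
    zero-assoc {A} {B} {C} {D} {∞} {G} h₁ h₂ h₃ =
      zero-12 (∞-zero (~-trans (~-sym (neg-neg A)) (neg-cong (zero-unique (zero-neg′ h₁) (zero-cong ~-refl (~-sym B~-C) ~-refl h₂)))))
      where
      B~-C : neg B ~ C
      B~-C = ~-trans (neg-cong (zero-∞ (zero-12 (zero-23 h₃)))) (neg-neg C)
      zero-neg′ : Zero A B D → Zero (neg D) (neg B) (neg A)
      zero-neg′ h = zero-neg (zero-12 (zero-23 (zero-12 h)))
    zero-assoc {A} {B} {C} {D} {E} {∞} h₁ h₂ h₃ =
      zero-23 (zero-12 (∞-zero (~-trans A~E (~-sym (neg-neg E)))))
      where
      D~C : D ~ C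
      D~C = ~-trans (~-sym (neg-neg D)) (~-trans (neg-cong (zero-∞ (zero-12 (zero-23 h₂)))) (neg-neg C))
      A~E : A ~ E
      A~E = zero-unique (zero-23 (zero-12 (zero-cong ~-refl ~-refl D~C h₁))) h₃
    zero-assoc {pt _ _} {pt _ _} {pt _ _} {pt _ _} {pt _ _} {pt _ _} (zL L₁) (zL L′) (zL L₂) =
      zL (Associativity.line-assoc L₁ L′ L₂)

-- The substitution x = 4 u - s, y = 8 v
module Rescale {c ℓ} (F : CommutativeRing c ℓ) where
  open CommutativeRing F hiding (zero)
  open LinearSolver F

  rescale : ∀ {s a₂ a₄ a₆ A₂ A₄ A₆} →
    A₂ ≈ fromℕ 3 * s + fromℕ 4 * a₂ →
    A₄ ≈ fromℕ 3 * s * s + fromℕ 8 * a₂ * s + fromℕ 16 * a₄ →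
    A₆ ≈ s * s * s + fromℕ 4 * a₂ * s * s + fromℕ 16 * a₄ * s + fromℕ 64 * a₆ →
    ∀ {u₁ v₁ u₂ v₂ u₃ v₃} → Cubic.Line F a₂ a₄ a₆ u₁ v₁ u₂ v₂ u₃ v₃ →
    Cubic.Line F A₂ A₄ A₆ (fromℕ 4 * u₁ - s) (fromℕ 8 * v₁) (fromℕ 4 * u₂ - s) (fromℕ 8 * v₂) (fromℕ 4 * u₃ - s) (fromℕ 8 * v₃)
  rescale {s} {a₂} {a₄} {a₆} {A₂} {A₄} {A₆} e₂ e₄ e₆ {u₁} {v₁} {u₂} {v₂} {u₃} {v₃} L = record
    { l = fromℕ 2 * l ; m = fromℕ 2 * l * s + fromℕ 8 * m
    ; on₁ = on on₁ ; on₂ = on on₂ ; on₃ = on on₃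
    ; s₁ = linear (s ∷ a₂ ∷ A₂ ∷ u₁ ∷ u₂ ∷ u₃ ∷ l ∷ [])
        (λ s a₂ A₂ u₁ u₂ u₃ l → (# 4 :* u₁ :- s :+ (# 4 :* u₂ :- s) :+ (# 4 :* u₃ :- s) := # 2 :* l :* (# 2 :* l) :- A₂) ,
          (# 4 , u₁ :+ u₂ :+ u₃ := l :* l :- a₂) ∷ (# 1 , A₂ := # 3 :* s :+ # 4 :* a₂) ∷ [])
        (s₁ ∷ e₂ ∷ [])
    ; s₂ = linear (s ∷ a₂ ∷ a₄ ∷ A₄ ∷ u₁ ∷ u₂ ∷ u₃ ∷ l ∷ m ∷ [])
        (λ s a₂ a₄ A₄ u₁ u₂ u₃ l m →
          ((# 4 :* u₁ :- s) :* (# 4 :* u₂ :- s) :+ (# 4 :* u₁ :- s) :* (# 4 :* u₃ :- s) :+ (# 4 :* u₂ :- s) :* (# 4 :* u₃ :- s)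
            := A₄ :- # 2 :* (# 2 :* l) :* (# 2 :* l :* s :+ # 8 :* m)) ,
          (# 16 , u₁ :* u₂ :+ u₁ :* u₃ :+ u₂ :* u₃ := a₄ :- # 2 :* l :* m) ∷
          (:- (# 8 :* s) , u₁ :+ u₂ :+ u₃ := l :* l :- a₂) ∷ (:- # 1 , A₄ := # 3 :* s :* s :+ # 8 :* a₂ :* s :+ # 16 :* a₄) ∷ [])
        (s₂ ∷ s₁ ∷ e₄ ∷ [])
    ; s₃ = linear (s ∷ a₂ ∷ a₄ ∷ a₆ ∷ A₆ ∷ u₁ ∷ u₂ ∷ u₃ ∷ l ∷ m ∷ [])
        (λ s a₂ a₄ a₆ A₆ u₁ u₂ u₃ l m →
          ((# 4 :* u₁ :- s) :* (# 4 :* u₂ :- s) :* (# 4 :* u₃ :- s)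
            := (# 2 :* l :* s :+ # 8 :* m) :* (# 2 :* l :* s :+ # 8 :* m) :- A₆) ,
          (# 64 , u₁ :* u₂ :* u₃ := m :* m :- a₆) ∷ (:- (# 16 :* s) , u₁ :* u₂ :+ u₁ :* u₃ :+ u₂ :* u₃ := a₄ :- # 2 :* l :* m) ∷
          (# 4 :* s :* s , u₁ :+ u₂ :+ u₃ := l :* l :- a₂) ∷
          (# 1 , A₆ := s :* s :* s :+ # 4 :* a₂ :* s :* s :+ # 16 :* a₄ :* s :+ # 64 :* a₆) ∷ [])
        (s₃ ∷ s₂ ∷ s₁ ∷ e₆ ∷ []) }
    where
    open Cubic.Line L
    on : ∀ {u v} → v ≈ l * u + m → fromℕ 8 * v ≈ fromℕ 2 * l * (fromℕ 4 * u - s) + (fromℕ 2 * l * s + fromℕ 8 * m)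
    on {u} {v} h = linear (s ∷ u ∷ v ∷ l ∷ m ∷ []) (λ s u v l m →
      (# 8 :* v := # 2 :* l :* (# 4 :* u :- s) :+ (# 2 :* l :* s :+ # 8 :* m)) , (# 8 , v := l :* u :+ m) ∷ []) (h ∷ [])

  rescale-rhs : ∀ {s a₂ a₄ a₆ A₂ A₄ A₆} →
    A₂ ≈ fromℕ 3 * s + fromℕ 4 * a₂ →
    A₄ ≈ fromℕ 3 * s * s + fromℕ 8 * a₂ * s + fromℕ 16 * a₄ →
    A₆ ≈ s * s * s + fromℕ 4 * a₂ * s * s + fromℕ 16 * a₄ * s + fromℕ 64 * a₆ →
    ∀ {x u} → x ≈ fromℕ 4 * u - s → Cubic.rhs F A₂ A₄ A₆ x ≈ fromℕ 64 * Cubic.rhs F a₂ a₄ a₆ u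
  rescale-rhs {s} {a₂} {a₄} {a₆} {A₂} {A₄} {A₆} e₂ e₄ e₆ {x} {u} e = linear (s ∷ a₂ ∷ a₄ ∷ a₆ ∷ A₂ ∷ A₄ ∷ A₆ ∷ x ∷ u ∷ [])
    (λ s a₂ a₄ a₆ A₂ A₄ A₆ x u →
      (x :* x :* x :+ A₂ :* x :* x :+ A₄ :* x :+ A₆ := # 64 :* (u :* u :* u :+ a₂ :* u :* u :+ a₄ :* u :+ a₆)) ,
      (x :* x , A₂ := # 3 :* s :+ # 4 :* a₂) ∷ (x , A₄ := # 3 :* s :* s :+ # 8 :* a₂ :* s :+ # 16 :* a₄) ∷
      (# 1 , A₆ := s :* s :* s :+ # 4 :* a₂ :* s :* s :+ # 16 :* a₄ :* s :+ # 64 :* a₆) ∷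
      ((x :+ s) :* (x :+ s) :+ (x :+ s) :* (# 4 :* u) :+ # 16 :* u :* u :+ # 4 :* a₂ :* (x :+ s :+ # 4 :* u) :+ # 16 :* a₄ , x := # 4 :* u :- s) ∷ [])
    (e₂ ∷ e₄ ∷ e₆ ∷ e ∷ [])

-- If x(R) - θ = (h / ζ)² with h = p + q z + r z⁻¹, then R = ±2 R′, where
-- h (θ - x′) = ζ (l θ + m) defines both x′ and the tangent y = l x + m at R′.
module Halving {c ℓ} (F : CommutativeRing c ℓ) (t : CommutativeRing.Carrier F) where
  open CommutativeRing F hiding (zero) renaming (refl to ≈-refl)
  open LinearSolver F
  open Cubic F (t + fromℕ 2) (fromℕ 2 * t) (t * t) using (Line; mkLine)

  halving : ∀ {p q r w w⁻¹ u x} → w⁻¹ * w ≈ 1# →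
    x * (q - r) ≈ - (t * q) → fromℕ 2 * p ≈ - (q * x) →
    w * w ≈ q * q + r * r - fromℕ 2 * p * r →
    u * (w * w) ≈ p * p + fromℕ 2 * q * r - q * q - (t + 1#) * r * r →
    let l = w⁻¹ * (p - q - r - x * r) ; m = w⁻¹ * (- (t * r) - x * p) in
    Line x (l * x + m) x (l * x + m) u (l * u + m)
  halving {p} {q} {r} {w} {w⁻¹} {u} {x} inv hA hB hW hX = mkLine _ _ ≈-refl ≈-refl ≈-refl
    (linear ρ (λ t p q r w i u x → (x :+ x :+ u := L p q r i x :* L p q r i x :- (t :+ # 2)) ,
      (:- (# 2 :* x :+ u :+ t :+ # 2) :* (i :* w :+ # 1) , i :* w := # 1) ∷
      (i :* i :* (# 2 :* x :+ t :+ # 2) , w :* w := q :* q :+ r :* r :- # 2 :* p :* r) ∷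
      (i :* i , u :* (w :* w) := p :* p :+ # 2 :* q :* r :- q :* q :- (t :+ # 1) :* r :* r) ∷
      (:- (i :* i) :* (:- q :- r :* x) , x :* (q :- r) := :- (t :* q)) ∷
      (:- (i :* i) :* (:- q :+ r :* t :+ r :* x :+ r) , # 2 :* p := :- (q :* x)) ∷ [])
      (inv ∷ hW ∷ hX ∷ hA ∷ hB ∷ []))
    (linear ρ (λ t p q r w i u x → (x :* x :+ x :* u :+ x :* u := # 2 :* t :- # 2 :* L p q r i x :* M t p r i x) ,
      (:- (x :* x :+ # 2 :* x :* u :- # 2 :* t) :* (i :* w :+ # 1) , i :* w := # 1) ∷
      (i :* i :* (x :* x :- # 2 :* t) , w :* w := q :* q :+ r :* r :- # 2 :* p :* r) ∷
      (# 2 :* i :* i :* x , u :* (w :* w) := p :* p :+ # 2 :* q :* r :- q :* q :- (t :+ # 1) :* r :* r) ∷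
      (i :* i :* (:- (# 2 :* q) :- r :* x :+ # 2 :* r) , x :* (q :- r) := :- (t :* q)) ∷
      (i :* i :* (q :* x :+ r :* t :+ r :* x) , # 2 :* p := :- (q :* x)) ∷ [])
      (inv ∷ hW ∷ hX ∷ hA ∷ hB ∷ []))
    (linear ρ (λ t p q r w i u x → (x :* x :* u := M t p r i x :* M t p r i x :- t :* t) ,
      (:- (x :* x :* u :+ t :* t) :* (i :* w :+ # 1) , i :* w := # 1) ∷
      (i :* i :* t :* t , w :* w := q :* q :+ r :* r :- # 2 :* p :* r) ∷
      (i :* i :* x :* x , u :* (w :* w) := p :* p :+ # 2 :* q :* r :- q :* q :- (t :+ # 1) :* r :* r) ∷
      (i :* i :* (q :* t :- q :* x :+ r :* t :* x :+ r :* x) , x :* (q :- r) := :- (t :* q)) ∷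
      (i :* i :* (:- (r :* t :* x) :- r :* t :* t) , # 2 :* p := :- (q :* x)) ∷ [])
      (inv ∷ hW ∷ hX ∷ hA ∷ hB ∷ []))
    where
    ρ = t ∷ p ∷ q ∷ r ∷ w ∷ w⁻¹ ∷ u ∷ x ∷ []
    L : ∀ {n} → Expr n → Expr n → Expr n → Expr n → Expr n → Expr n
    L p q r i x = i :* (p :- q :- r :- x :* r)
    M : ∀ {n} → Expr n → Expr n → Expr n → Expr n → Expr n → Expr n
    M t p r i x = i :* (:- (t :* r) :- x :* p)

open import Defs

-- The ring of polynomials

ℚRing : CommutativeRing 0ℓ 0ℓ
ℚRing = ℚP.+-*-commutativeRing

module ℚS = LinearSolver ℚRing

coeff : Poly → ℕ → ℚ
coeff []      i       = 0ℚ
coeff (c ∷ p) zero    = c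
coeff (c ∷ p) (suc i) = coeff p i

infix 4 _≃_
-- Coefficientwise, since representatives may differ by trailing zeros; a record, so that `p` and
-- `q` are recovered from the type.
record _≃_ (p q : Poly) : Set where
  constructor mk≃
  field at : ∀ i → coeff p i ≡ coeff q i
open _≃_ public

≃-refl : ∀ {p} → p ≃ p
≃-refl = mk≃ λ i → refl

≃-sym : ∀ {p q} → p ≃ q → q ≃ p
≃-sym e = mk≃ λ i → ≡.sym (at e i)

≃-trans : ∀ {p q r} → p ≃ q → q ≃ r → p ≃ r
≃-trans e f = mk≃ λ i → ≡.trans (at e i) (at f i)

scale : ℚ → Poly → Poly
scale c = map (c ℚ.*_)

coeff-+ : ∀ p q i → coeff (p +ₚ q) i ≡ coeff p i ℚ.+ coeff q i
coeff-+ []      q       i       = ≡.sym (ℚP.+-identityˡ _)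
coeff-+ (c ∷ p) []      i       = ≡.sym (ℚP.+-identityʳ _)
coeff-+ (c ∷ p) (d ∷ q) zero    = refl
coeff-+ (c ∷ p) (d ∷ q) (suc i) = coeff-+ p q i

coeff-neg : ∀ p i → coeff (negₚ p) i ≡ ℚ.- coeff p i
coeff-neg []      i       = refl
coeff-neg (c ∷ p) zero    = refl
coeff-neg (c ∷ p) (suc i) = coeff-neg p i

coeff-scale : ∀ c p i → coeff (scale c p) i ≡ c ℚ.* coeff p i
coeff-scale c []      i       = ≡.sym (ℚP.*-zeroʳ c)
coeff-scale c (d ∷ p) zero    = refl
coeff-scale c (d ∷ p) (suc i) = coeff-scale c p i

+ₚ-cong : ∀ {p p′ q q′} → p ≃ p′ → q ≃ q′ → p +ₚ q ≃ p′ +ₚ q′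
+ₚ-cong {p} {p′} {q} {q′} e f = mk≃ λ i → begin
  coeff (p +ₚ q) i            ≡⟨ coeff-+ p q i ⟩
  coeff p i ℚ.+ coeff q i     ≡⟨ cong₂ ℚ._+_ (at e i) (at f i) ⟩
  coeff p′ i ℚ.+ coeff q′ i   ≡⟨ coeff-+ p′ q′ i ⟨
  coeff (p′ +ₚ q′) i          ∎
  where open ≡.≡-Reasoning

+ₚ-assoc : ∀ p q r → (p +ₚ q) +ₚ r ≃ p +ₚ (q +ₚ r)
+ₚ-assoc p q r = mk≃ λ i → begin
  coeff ((p +ₚ q) +ₚ r) i                     ≡⟨ coeff-+ (p +ₚ q) r i ⟩
  coeff (p +ₚ q) i ℚ.+ coeff r i              ≡⟨ cong (ℚ._+ coeff r i) (coeff-+ p q i) ⟩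
  coeff p i ℚ.+ coeff q i ℚ.+ coeff r i       ≡⟨ ℚP.+-assoc (coeff p i) (coeff q i) (coeff r i) ⟩
  coeff p i ℚ.+ (coeff q i ℚ.+ coeff r i)     ≡⟨ cong (coeff p i ℚ.+_) (coeff-+ q r i) ⟨
  coeff p i ℚ.+ coeff (q +ₚ r) i              ≡⟨ coeff-+ p (q +ₚ r) i ⟨
  coeff (p +ₚ (q +ₚ r)) i                     ∎
  where open ≡.≡-Reasoning

+ₚ-comm : ∀ p q → p +ₚ q ≃ q +ₚ p
+ₚ-comm p q = mk≃ λ i → ≡.trans (coeff-+ p q i) (≡.trans (ℚP.+-comm (coeff p i) (coeff q i)) (≡.sym (coeff-+ q p i)))

negₚ-cong : ∀ {p q} → p ≃ q → negₚ p ≃ negₚ q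
negₚ-cong {p} {q} e = mk≃ λ i → ≡.trans (coeff-neg p i) (≡.trans (cong ℚ.-_ (at e i)) (≡.sym (coeff-neg q i)))

negₚ-inverseʳ : ∀ p → p +ₚ negₚ p ≃ []
negₚ-inverseʳ p = mk≃ λ i → ≡.trans (coeff-+ p (negₚ p) i)
  (≡.trans (cong (coeff p i ℚ.+_) (coeff-neg p i)) (ℚP.+-inverseʳ (coeff p i)))

+ₚ-identityʳ : ∀ p → p +ₚ [] ≃ p
+ₚ-identityʳ p = +ₚ-comm p []

scale-cong : ∀ c {p q} → p ≃ q → scale c p ≃ scale c q
scale-cong c {p} {q} e = mk≃ λ i → ≡.trans (coeff-scale c p i) (≡.trans (cong (c ℚ.*_) (at e i)) (≡.sym (coeff-scale c q i)))

infixr 5 0∷_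
0∷_ : Poly → Poly
0∷ p = 0ℚ ∷ p

shift-cong : ∀ {p q} → p ≃ q → 0∷ p ≃ 0∷ q
shift-cong e = mk≃ λ { zero → refl ; (suc i) → at e i }

*ₚ-congʳ : ∀ p {q r} → q ≃ r → p *ₚ q ≃ p *ₚ r
*ₚ-congʳ []      e = ≃-refl
*ₚ-congʳ (c ∷ p) e = +ₚ-cong (scale-cong c e) (shift-cong (*ₚ-congʳ p e))

+ₚ-swap : ∀ p q r → p +ₚ (q +ₚ r) ≃ q +ₚ (p +ₚ r)
+ₚ-swap p q r = ≃-trans (≃-sym (+ₚ-assoc p q r)) (≃-trans (+ₚ-cong (+ₚ-comm p q) ≃-refl) (+ₚ-assoc q p r))

*ₚ-zeroʳ : ∀ p → p *ₚ [] ≃ []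
*ₚ-zeroʳ []      = ≃-refl
*ₚ-zeroʳ (c ∷ p) = mk≃ λ { zero → refl ; (suc i) → at (*ₚ-zeroʳ p) i }

*ₚ-consʳ : ∀ p d q → p *ₚ (d ∷ q) ≃ scale d p +ₚ (0∷ (p *ₚ q))
*ₚ-consʳ []      d q = mk≃ λ { zero → refl ; (suc i) → refl }
*ₚ-consʳ (c ∷ p) d q = mk≃ λ
  { zero    → cong (ℚ._+ 0ℚ) (ℚP.*-comm c d)
  ; (suc i) → at tail i }
  where
  tail : scale c q +ₚ p *ₚ (d ∷ q) ≃ scale d p +ₚ (scale c q +ₚ (0∷ (p *ₚ q)))
  tail = ≃-trans (+ₚ-cong (≃-refl {scale c q}) (*ₚ-consʳ p d q)) (+ₚ-swap (scale c q) (scale d p) _)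

*ₚ-comm : ∀ p q → p *ₚ q ≃ q *ₚ p
*ₚ-comm []      q = ≃-sym (*ₚ-zeroʳ q)
*ₚ-comm (c ∷ p) q = ≃-trans (+ₚ-cong (≃-refl {scale c q}) (shift-cong (*ₚ-comm p q))) (≃-sym (*ₚ-consʳ q c p))

*ₚ-cong : ∀ {p p′ q q′} → p ≃ p′ → q ≃ q′ → p *ₚ q ≃ p′ *ₚ q′
*ₚ-cong {p} {p′} {q} {q′} e f = ≃-trans (*ₚ-congʳ p f)
  (≃-trans (*ₚ-comm p q′) (≃-trans (*ₚ-congʳ q′ e) (*ₚ-comm q′ p′)))

scale-+ : ∀ c p q → scale c (p +ₚ q) ≃ scale c p +ₚ scale c q
scale-+ c p q = mk≃ λ i → begin
  coeff (scale c (p +ₚ q)) i                        ≡⟨ coeff-scale c (p +ₚ q) i ⟩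
  c ℚ.* coeff (p +ₚ q) i                            ≡⟨ cong (c ℚ.*_) (coeff-+ p q i) ⟩
  c ℚ.* (coeff p i ℚ.+ coeff q i)                   ≡⟨ ℚP.*-distribˡ-+ c _ _ ⟩
  c ℚ.* coeff p i ℚ.+ c ℚ.* coeff q i               ≡⟨ cong₂ ℚ._+_ (coeff-scale c p i) (coeff-scale c q i) ⟨
  coeff (scale c p) i ℚ.+ coeff (scale c q) i       ≡⟨ coeff-+ (scale c p) (scale c q) i ⟨
  coeff (scale c p +ₚ scale c q) i                  ∎
  where open ≡.≡-Reasoning

+ₚ-interchange : ∀ p q r s → (p +ₚ q) +ₚ (r +ₚ s) ≃ (p +ₚ r) +ₚ (q +ₚ s)
+ₚ-interchange p q r s = ≃-trans (+ₚ-assoc p q (r +ₚ s))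
  (≃-trans (+ₚ-cong (≃-refl {p}) (+ₚ-swap q r s)) (≃-sym (+ₚ-assoc p r (q +ₚ s))))

*ₚ-distribˡ : ∀ p q r → p *ₚ (q +ₚ r) ≃ p *ₚ q +ₚ p *ₚ r
*ₚ-distribˡ []      q r = ≃-refl
*ₚ-distribˡ (c ∷ p) q r = ≃-trans
  (+ₚ-cong (scale-+ c q r) (shift-cong (*ₚ-distribˡ p q r)))
  (+ₚ-interchange (scale c q) (scale c r) (0∷ (p *ₚ q)) (0∷ (p *ₚ r)))

*ₚ-distribʳ : ∀ p q r → (q +ₚ r) *ₚ p ≃ q *ₚ p +ₚ r *ₚ p
*ₚ-distribʳ p q r = ≃-trans (*ₚ-comm (q +ₚ r) p)
  (≃-trans (*ₚ-distribˡ p q r) (+ₚ-cong (*ₚ-comm p q) (*ₚ-comm p r)))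

scale-* : ∀ c p q → scale c p *ₚ q ≃ scale c (p *ₚ q)
scale-* c []      q = ≃-refl
scale-* c (d ∷ p) q = ≃-sym (≃-trans (scale-+ c (scale d q) (0∷ (p *ₚ q)))
  (+ₚ-cong {scale c (scale d q)} {scale (c ℚ.* d) q} {scale c (0∷ (p *ₚ q))} {0∷ (scale c p *ₚ q)} (mk≃ scale-scale) (mk≃ λ { zero → ℚP.*-zeroʳ c ; (suc i) → at (≃-sym (scale-* c p q)) i })))
  where
  scale-scale : ∀ i → coeff (scale c (scale d q)) i ≡ coeff (scale (c ℚ.* d) q) i
  scale-scale i = ≡.trans (coeff-scale c (scale d q) i) (≡.trans (cong (c ℚ.*_) (coeff-scale d q i))
    (≡.trans (≡.sym (ℚP.*-assoc c d (coeff q i))) (≡.sym (coeff-scale (c ℚ.* d) q i))))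

shift-* : ∀ p q → (0∷ p) *ₚ q ≃ 0∷ (p *ₚ q)
shift-* p q = mk≃ λ i → ≡.trans (coeff-+ (scale 0ℚ q) (0∷ (p *ₚ q)) i)
  (≡.trans (cong (ℚ._+ coeff (0∷ (p *ₚ q)) i) (≡.trans (coeff-scale 0ℚ q i) (ℚP.*-zeroˡ (coeff q i))))
    (ℚP.+-identityˡ _))

*ₚ-assoc : ∀ p q r → (p *ₚ q) *ₚ r ≃ p *ₚ (q *ₚ r)
*ₚ-assoc []      q r = ≃-refl
*ₚ-assoc (c ∷ p) q r = ≃-trans (*ₚ-distribʳ r (scale c q) (0∷ (p *ₚ q)))
  (+ₚ-cong (scale-* c q r) (≃-trans (shift-* (p *ₚ q) r) (shift-cong (*ₚ-assoc p q r))))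

κ : ℚ → Poly
κ c = c ∷ []

κ-* : ∀ c p → κ c *ₚ p ≃ scale c p
κ-* c p = mk≃ λ i → ≡.trans (coeff-+ (scale c p) (0∷ []) i)
  (≡.trans (cong (coeff (scale c p) i ℚ.+_) (zeros i)) (ℚP.+-identityʳ _))
  where
  zeros : ∀ i → coeff (0∷ []) i ≡ 0ℚ
  zeros zero    = refl
  zeros (suc i) = refl

*ₚ-identityˡ : ∀ p → κ 1ℚ *ₚ p ≃ p
*ₚ-identityˡ p = ≃-trans (κ-* 1ℚ p) (mk≃ λ i → ≡.trans (coeff-scale 1ℚ p i) (ℚP.*-identityˡ _))

polyRing : CommutativeRing 0ℓ 0ℓ
polyRing = record
  { Carrier = Poly ; _≈_ = _≃_ ; _+_ = _+ₚ_ ; _*_ = _*ₚ_ ; -_ = negₚ ; 0# = [] ; 1# = κ 1ℚ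
  ; isCommutativeRing = record
    { isRing = record
      { +-isAbelianGroup = record
        { isGroup = record
          { isMonoid = record
            { isSemigroup = record
              { isMagma = record
                { isEquivalence = record { refl = ≃-refl ; sym = ≃-sym ; trans = ≃-trans }
                ; ∙-cong = +ₚ-cong }
              ; assoc = +ₚ-assoc }
            ; identity = (λ p → ≃-refl) , +ₚ-identityʳ }
          ; inverse = (λ p → ≃-trans (+ₚ-comm (negₚ p) p) (negₚ-inverseʳ p)) , negₚ-inverseʳ
          ; ⁻¹-cong = negₚ-cong }
        ; comm = +ₚ-comm }
      ; *-cong = *ₚ-cong
      ; *-assoc = *ₚ-assoc
      ; *-identity = *ₚ-identityˡ , λ p → ≃-trans (*ₚ-comm p (κ 1ℚ)) (*ₚ-identityˡ p)
      ; distrib = *ₚ-distribˡ , *ₚ-distribʳ }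
    ; *-comm = *ₚ-comm } }

module PS = LinearSolver polyRing
module ≃-Reasoning = Relation.Binary.Reasoning.Setoid (CommutativeRing.setoid polyRing)

isZero⇒≃ : ∀ {p} → IsZeroₚ p → p ≃ []
isZero⇒≃ []       = ≃-refl
isZero⇒≃ (e ∷ es) = mk≃ λ { zero → e ; (suc i) → at (isZero⇒≃ es) i }

≃⇒isZero : ∀ {p} → p ≃ [] → IsZeroₚ p
≃⇒isZero {[]}    e = []
≃⇒isZero {c ∷ p} e = at e 0 ∷ ≃⇒isZero (mk≃ λ i → at e (suc i))

zero? : ∀ p → Dec (p ≃ [])
zero? p with isZeroₚ? p
... | yes z = yes (isZero⇒≃ z)
... | no ¬z = no λ e → ¬z (≃⇒isZero e)

-- Degrees

-- A strict upper bound spares the zero polynomial any exception: it satisfies `Deg< 0`.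
record Deg< (n : ℕ) (p : Poly) : Set where
  constructor mkDeg
  field vanish : ∀ i → n ℕ.≤ i → coeff p i ≡ 0ℚ
open Deg< public

Deg<-mono : ∀ {m n p} → m ℕ.≤ n → Deg< m p → Deg< n p
Deg<-mono m≤n d = mkDeg λ i n≤i → vanish d i (ℕP.≤-trans m≤n n≤i)

Deg<-cong : ∀ {n p q} → p ≃ q → Deg< n p → Deg< n q
Deg<-cong e d = mkDeg λ i n≤i → ≡.trans (≡.sym (at e i)) (vanish d i n≤i)

Deg<-+ : ∀ {n p q} → Deg< n p → Deg< n q → Deg< n (p +ₚ q)
Deg<-+ {n} {p} {q} d e = mkDeg λ i n≤i → ≡.trans (coeff-+ p q i) (cong₂ ℚ._+_ (vanish d i n≤i) (vanish e i n≤i))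

Deg<-neg : ∀ {n p} → Deg< n p → Deg< n (negₚ p)
Deg<-neg {n} {p} d = mkDeg λ i n≤i → ≡.trans (coeff-neg p i) (cong ℚ.-_ (vanish d i n≤i))

Deg<-minus : ∀ {n p q} → Deg< n p → Deg< n q → Deg< n (p -ₚ q)
Deg<-minus d e = Deg<-+ d (Deg<-neg e)

Deg<-0⇒≃ : ∀ {p} → Deg< 0 p → p ≃ []
Deg<-0⇒≃ d = mk≃ λ i → vanish d i z≤n

Deg<-[] : ∀ {n} → Deg< n []
Deg<-[] = mkDeg λ i _ → refl

Deg<-zero : ∀ {n p} → p ≃ [] → Deg< n p
Deg<-zero e = Deg<-cong (≃-sym e) Deg<-[]

Deg<-tail : ∀ {n c p} → Deg< (suc n) (c ∷ p) → Deg< n p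
Deg<-tail d = mkDeg λ i n≤i → vanish d (suc i) (s≤s n≤i)

Deg<-cons : ∀ {n c p} → Deg< n p → Deg< (suc n) (c ∷ p)
Deg<-cons d = mkDeg λ { (suc i) (s≤s n≤i) → vanish d i n≤i }

finite-degree : ∀ p → ∃[ n ] Deg< n p
finite-degree []      = 0 , Deg<-[]
finite-degree (c ∷ p) = let (n , d) = finite-degree p in suc n , Deg<-cons d

Deg<-* : ∀ {m n} p {q} → Deg< (suc m) p → Deg< n q → Deg< (m ℕ.+ n) (p *ₚ q)
Deg<-* {m} {n} []      dp dq = Deg<-[]
Deg<-* {m} {n} (c ∷ p) {q} dp dq = mkDeg λ i m+n≤i → begin
  coeff (scale c q +ₚ (0∷ (p *ₚ q))) i               ≡⟨ coeff-+ (scale c q) _ i ⟩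
  coeff (scale c q) i ℚ.+ coeff (0∷ (p *ₚ q)) i      ≡⟨ cong₂ ℚ._+_ (head i (ℕP.≤-trans (ℕP.m≤n+m n m) m+n≤i)) (tail m dp i m+n≤i) ⟩
  0ℚ                                                 ∎
  where
  open ≡.≡-Reasoning
  head : ∀ i → n ℕ.≤ i → coeff (scale c q) i ≡ 0ℚ
  head i n≤i = ≡.trans (coeff-scale c q i) (≡.trans (cong (c ℚ.*_) (vanish dq i n≤i)) (ℚP.*-zeroʳ c))
  tail : ∀ m → Deg< (suc m) (c ∷ p) → ∀ i → m ℕ.+ n ℕ.≤ i → coeff (0∷ (p *ₚ q)) i ≡ 0ℚ
  tail m       d zero    _  = refl
  tail zero    d (suc i) _  = at (*ₚ-cong {p} {[]} {q} {q} (Deg<-0⇒≃ (Deg<-tail d)) ≃-refl) i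
  tail (suc m) d (suc i) (s≤s le) = vanish (Deg<-* p (Deg<-tail d) dq) i le

coeff-top : ∀ {m n} p {q} → Deg< (suc m) p → Deg< (suc n) q →
  coeff (p *ₚ q) (m ℕ.+ n) ≡ coeff p m ℚ.* coeff q n
coeff-top {m} {n} []      {q} dp dq = ≡.sym (ℚP.*-zeroˡ (coeff q n))
coeff-top {zero} {n} (c ∷ p) {q} dp dq = begin
  coeff (scale c q +ₚ (0∷ (p *ₚ q))) n               ≡⟨ coeff-+ (scale c q) _ n ⟩
  coeff (scale c q) n ℚ.+ coeff (0∷ (p *ₚ q)) n      ≡⟨ cong₂ ℚ._+_ (coeff-scale c q n) (tail n) ⟩
  c ℚ.* coeff q n ℚ.+ 0ℚ                             ≡⟨ ℚP.+-identityʳ _ ⟩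
  c ℚ.* coeff q n                                    ∎
  where
  open ≡.≡-Reasoning
  tail : ∀ i → coeff (0∷ (p *ₚ q)) i ≡ 0ℚ
  tail zero    = refl
  tail (suc i) = at (*ₚ-cong {p} {[]} {q} {q} (Deg<-0⇒≃ (Deg<-tail dp)) ≃-refl) i
coeff-top {suc m} {n} (c ∷ p) {q} dp dq = begin
  coeff (scale c q +ₚ (0∷ (p *ₚ q))) (suc (m ℕ.+ n))           ≡⟨ coeff-+ (scale c q) _ (suc (m ℕ.+ n)) ⟩
  coeff (scale c q) (suc (m ℕ.+ n)) ℚ.+ coeff (p *ₚ q) (m ℕ.+ n)
    ≡⟨ cong₂ ℚ._+_ (coeff-scale c q (suc (m ℕ.+ n))) (coeff-top p (Deg<-tail dp) dq) ⟩
  c ℚ.* coeff q (suc (m ℕ.+ n)) ℚ.+ coeff p m ℚ.* coeff q n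
    ≡⟨ cong (ℚ._+ coeff p m ℚ.* coeff q n) (≡.trans (cong (c ℚ.*_) (vanish dq _ (s≤s (ℕP.m≤n+m n m)))) (ℚP.*-zeroʳ c)) ⟩
  0ℚ ℚ.+ coeff p m ℚ.* coeff q n                               ≡⟨ ℚP.+-identityˡ _ ⟩
  coeff p m ℚ.* coeff q n                                      ∎
  where open ≡.≡-Reasoning

Deg<-drop : ∀ {n p} → Deg< (suc n) p → coeff p n ≡ 0ℚ → Deg< n p
Deg<-drop {n} d e = mkDeg λ i n≤i → lemma i (ℕP.m≤n⇒m<n∨m≡n n≤i)
  where
  lemma : ∀ i → n ℕ.< i ⊎ n ≡ i → _
  lemma i (inj₁ n<i)  = vanish d i n<i
  lemma i (inj₂ refl) = e

record Lead (n : ℕ) (p : Poly) : Set where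
  constructor mkLead
  field
    bound  : Deg< (suc n) p
    lead≢0 : ¬ coeff p n ≡ 0ℚ
open Lead public

lead : ∀ p → ¬ p ≃ [] → ∃[ n ] Lead n p
lead []      p≄0 = ⊥-elim (p≄0 ≃-refl)
lead (c ∷ p) p≄0 with zero? p
... | no p′≄0 = let (n , l) = lead p p′≄0 in suc n , mkLead (Deg<-cons (bound l)) (lead≢0 l)
... | yes p′≃0 = 0 , mkLead (Deg<-cons (Deg<-zero p′≃0)) λ c≡0 → p≄0 (mk≃ λ { zero → c≡0 ; (suc i) → at p′≃0 i })

Lead-≄0 : ∀ {n p} → Lead n p → ¬ p ≃ []
Lead-≄0 {n} l e = lead≢0 l (at e n)

Lead-< : ∀ {m n p} → Deg< n p → Lead m p → m ℕ.< n
Lead-< {m} {n} d l with m ℕ.<? n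
... | yes m<n = m<n
... | no m≮n  = ⊥-elim (lead≢0 l (vanish d m (ℕP.≮⇒≥ m≮n)))

ℚ-domain : ∀ {c d} → c ℚ.* d ≡ 0ℚ → ¬ c ≡ 0ℚ → d ≡ 0ℚ
ℚ-domain {c} {d} e c≢0 = begin
  d                       ≡⟨ ℚP.*-identityˡ d ⟨
  1ℚ ℚ.* d                ≡⟨ cong (ℚ._* d) (ℚP.*-inverseˡ c) ⟨
  (ℚ.1/ c) ℚ.* c ℚ.* d    ≡⟨ ℚP.*-assoc (ℚ.1/ c) c d ⟩
  (ℚ.1/ c) ℚ.* (c ℚ.* d)  ≡⟨ cong ((ℚ.1/ c) ℚ.*_) e ⟩
  (ℚ.1/ c) ℚ.* 0ℚ         ≡⟨ ℚP.*-zeroʳ (ℚ.1/ c) ⟩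
  0ℚ                      ∎
  where
  open ≡.≡-Reasoning
  instance _ = ℚ.≢-nonZero c≢0

Lead-* : ∀ {m n p q} → Lead m p → Lead n q → Lead (m ℕ.+ n) (p *ₚ q)
Lead-* {m} {n} {p} {q} l k = mkLead
  (subst (λ j → Deg< j (p *ₚ q)) (ℕP.+-suc m n) (Deg<-* p (bound l) (bound k)))
  λ e → lead≢0 k (ℚ-domain (≡.trans (≡.sym (coeff-top p (bound l) (bound k))) e) (lead≢0 l))

domain : ∀ p q → p *ₚ q ≃ [] → ¬ p ≃ [] → q ≃ []
domain p q e p≄0 with zero? q
... | yes z  = z
... | no q≄0 = ⊥-elim (Lead-≄0 (Lead-* (proj₂ (lead p p≄0)) (proj₂ (lead q q≄0))) e)

≄0-* : ∀ {p q} → ¬ p ≃ [] → ¬ q ≃ [] → ¬ p *ₚ q ≃ []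
≄0-* p≄0 q≄0 e = q≄0 (domain _ _ e p≄0)

Lead-cong : ∀ {n p q} → p ≃ q → Lead n p → Lead n q
Lead-cong {n} e l = mkLead (Deg<-cong e (bound l)) λ z → lead≢0 l (≡.trans (at e n) z)

Lead-unique : ∀ {m n p} → Lead m p → Lead n p → m ≡ n
Lead-unique l k = ℕP.≤-antisym (ℕP.≤-pred (Lead-< (bound k) l)) (ℕP.≤-pred (Lead-< (bound l) k))

Deg<-1⇒κ : ∀ {p} → Deg< 1 p → p ≃ κ (coeff p 0)
Deg<-1⇒κ d = mk≃ λ { zero → refl ; (suc i) → vanish d (suc i) (s≤s z≤n) }

Lead-κ : ∀ {c} → ¬ c ≡ 0ℚ → Lead 0 (κ c)
Lead-κ c≢0 = mkLead (Deg<-cons Deg<-[]) c≢0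

*-Deg<-1 : ∀ {p q c} → p *ₚ q ≃ κ c → ¬ c ≡ 0ℚ → Deg< 1 p
*-Deg<-1 {p} {q} {c} e c≢0 = result (lead p p≄0) (lead q q≄0)
  where
  pq≄0 : ¬ p *ₚ q ≃ []
  pq≄0 z = c≢0 (≡.trans (≡.sym (at e 0)) (at z 0))
  p≄0 : ¬ p ≃ []
  p≄0 z = pq≄0 (*ₚ-cong {p} {[]} {q} {q} z ≃-refl)
  q≄0 : ¬ q ≃ []
  q≄0 z = pq≄0 (≃-trans (*ₚ-congʳ p z) (*ₚ-zeroʳ p))
  result : ∃[ m ] Lead m p → ∃[ n ] Lead n q → Deg< 1 p
  result (m , l) (n , k) = Deg<-mono (s≤s (ℕP.≤-reflexive (ℕP.m+n≡0⇒m≡0 m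
    (Lead-unique (Lead-cong e (Lead-* l k)) (Lead-κ c≢0))))) (bound l)

-- Euclidean division and the Bézout property of ℚ[a]

module PD = Divisibility polyRing

byComputation : ∀ {p q} → {True (isZeroₚ? (p -ₚ q))} → p ≃ q
byComputation {p} {q} {w} = PS.x-y≈0⇒x≈y (isZero⇒≃ (toWitness w))

1ₚ : Poly
1ₚ = κ 1ℚ

opaque
  X : Poly
  X = 0ℚ ∷ 1ℚ ∷ []

  shift≃X : ∀ p → 0∷ p ≃ X *ₚ p
  shift≃X p = ≃-sym (≃-trans (shift-* (κ 1ℚ) p) (shift-cong (*ₚ-identityˡ p)))

  X≄0 : ¬ X ≃ []
  X≄0 e with at e 1
  ... | ()

cons≃ : ∀ c p → c ∷ p ≃ κ c +ₚ X *ₚ p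
cons≃ c p = ≃-trans (mk≃ λ { zero → ≡.sym (ℚP.+-identityʳ c) ; (suc i) → refl })
  (+ₚ-cong (≃-refl {κ c}) (shift≃X p))

κ-mult : ∀ c d → κ c *ₚ κ d ≃ κ (c ℚ.* d)
κ-mult c d = κ-* c (κ d)

κ-cong : ∀ {c d} → c ≡ d → κ c ≃ κ d
κ-cong refl = ≃-refl

κ-zero : κ 0ℚ ≃ []
κ-zero = isZero⇒≃ (refl All.∷ All.[])
  where import Data.List.Relation.Unary.All as All

coeff-κ* : ∀ c p i → coeff (κ c *ₚ p) i ≡ c ℚ.* coeff p i
coeff-κ* c p i = ≡.trans (at (κ-* c p) i) (coeff-scale c p i)

Deg<-κ* : ∀ {n} c {p} → Deg< n p → Deg< n (κ c *ₚ p)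
Deg<-κ* c {p} d = mkDeg λ i n≤i → ≡.trans (coeff-κ* c p i) (≡.trans (cong (c ℚ.*_) (vanish d i n≤i)) (ℚP.*-zeroʳ c))

Deg<-X* : ∀ {n p} → Deg< n p → Deg< (suc n) (X *ₚ p)
Deg<-X* {n} {p} d = Deg<-cong (shift≃X p) (Deg<-cons d)

coeff-minus : ∀ p q i → coeff (p -ₚ q) i ≡ coeff p i ℚ.- coeff q i
coeff-minus p q i = ≡.trans (coeff-+ p (negₚ q) i) (cong (coeff p i ℚ.+_) (coeff-neg q i))

≄0⇒regular : ∀ {p} → ¬ p ≃ [] → PD.Regular p
≄0⇒regular p≄0 q e = domain _ q e p≄0

≡-inverse : ∀ {c} → ¬ c ≡ 0ℚ → ∃[ d ] d ℚ.* c ≡ 1ℚ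
≡-inverse {c} c≢0 = ℚ.1/ c , ℚP.*-inverseˡ c
  where instance _ = ℚ.≢-nonZero c≢0

-- Horner's scheme: if `p` leaves `r`, then `c + X p` leaves `c + X r`, whose degree is at most that
-- of `d`, and one constant multiple of `d` removes its top coefficient.
division : ∀ {n d} → Lead n d → ∀ p → ∃[ q ] ∃[ r ] (p ≃ q *ₚ d +ₚ r) × Deg< n r
division l [] = [] , [] , ≃-refl , Deg<-[]
division {n} {d} l (c ∷ p) with division l p | ≡-inverse (lead≢0 l)
... | (q , r , e , dr) | (i , inv) = X *ₚ q +ₚ κ m , s -ₚ κ m *ₚ d , eq , Deg<-drop ds top
  where
  s = κ c +ₚ X *ₚ r
  m = coeff s n ℚ.* i
  eq : c ∷ p ≃ (X *ₚ q +ₚ κ m) *ₚ d +ₚ (s -ₚ κ m *ₚ d)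
  eq = ≃-trans (cons≃ c p) (PS.linear (κ c ∷ X ∷ p ∷ q ∷ r ∷ d ∷ κ m ∷ [])
    (λ c X p q r d m → (c :+ X :* p := (X :* q :+ m) :* d :+ ((c :+ X :* r) :- m :* d)) ,
      (X , p := q :* d :+ r) ∷ []) (e PS.∷ PS.[]))
  ds : Deg< (suc n) (s -ₚ κ m *ₚ d)
  ds = Deg<-minus (Deg<-+ (Deg<-cons Deg<-[]) (Deg<-X* dr)) (Deg<-κ* m (bound l))
  top : coeff (s -ₚ κ m *ₚ d) n ≡ 0ℚ
  top = ≡.trans (coeff-minus s (κ m *ₚ d) n) (≡.trans (cong (λ x → coeff s n ℚ.- x) (coeff-κ* m d n))
    (ℚS.linear (coeff s n ∷ i ∷ coeff d n ∷ [])
      (λ s i d → (s :- s :* i :* d := # 0) , (:- s , i :* d := # 1) ∷ []) (inv ℚS.∷ ℚS.[])))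

opaque
  bezout : ∀ p q → PD.Gcd p q
  bezout p q = go (suc (Data.List.length q)) p q (long q)
    where
    import Data.List
    long : ∀ q → Deg< (suc (Data.List.length q)) q
    long []      = Deg<-[]
    long (c ∷ q) = Deg<-cons (long q)
    trivial : ∀ p {q} → q ≃ [] → PD.Gcd p q
    trivial p z = record { g = p ; x = 1ₚ ; y = [] ; u = 1ₚ ; v = []
      ; g-comb = PS.ringEq (p ∷ []) (λ p → p := # 1 :* p :+ # 0)
      ; a-mult = PS.ringEq (p ∷ []) (λ p → p := # 1 :* p) ; b-mult = z }
    go : ∀ n p q → Deg< n q → PD.Gcd p q
    go zero    p q d = trivial p (Deg<-0⇒≃ d)
    go (suc n) p q d with zero? q
    ... | yes z  = trivial p z
    ... | no q≄0 with lead q q≄0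
    ...   | (m , l) with division l p
    ...     | (s , r , e , dr) with go n q r (Deg<-mono (ℕP.≤-pred (Lead-< d l)) dr)
    ...       | G = record { g = g ; x = y ; y = x -ₚ s *ₚ y ; u = s *ₚ u +ₚ v ; v = u
      ; g-comb = PS.linear (g ∷ x ∷ y ∷ p ∷ q ∷ s ∷ r ∷ [])
          (λ g x y p q s r → (g := y :* p :+ (x :- s :* y) :* q) ,
            (# 1 , g := x :* q :+ y :* r) ∷ (:- y , p := s :* q :+ r) ∷ [])
          (g-comb PS.∷ e PS.∷ PS.[])
      ; a-mult = PS.linear (g ∷ u ∷ v ∷ p ∷ q ∷ s ∷ r ∷ [])
          (λ g u v p q s r → (p := (s :* u :+ v) :* g) ,
            (# 1 , p := s :* q :+ r) ∷ (s , q := u :* g) ∷ (# 1 , r := v :* g) ∷ [])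
          (e PS.∷ a-mult PS.∷ b-mult PS.∷ PS.[])
      ; b-mult = a-mult }
      where open PD.Gcd G

-- Derivatives

der : Poly → Poly
der []      = []
der (c ∷ p) = p +ₚ (0∷ der p)

der-zero : ∀ {p} → p ≃ [] → der p ≃ []
der-zero {[]}    e = ≃-refl
der-zero {c ∷ p} e = ≃-trans (+ₚ-cong tail (shift-cong (der-zero tail))) (mk≃ λ { zero → refl ; (suc i) → refl })
  where
  tail : p ≃ []
  tail = mk≃ λ i → at e (suc i)

der-+ : ∀ p q → der (p +ₚ q) ≃ der p +ₚ der q
der-+ []      q       = ≃-refl
der-+ (c ∷ p) []      = ≃-sym (+ₚ-identityʳ _)
der-+ (c ∷ p) (d ∷ q) = ≃-trans (+ₚ-cong (≃-refl {p +ₚ q}) (shift-cong (der-+ p q)))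
  (+ₚ-interchange p q (0∷ der p) (0∷ der q))

der-scale : ∀ c p → der (scale c p) ≃ scale c (der p)
der-scale c []      = ≃-refl
der-scale c (d ∷ p) = ≃-trans (+ₚ-cong (≃-refl {scale c p}) (≃-trans (shift-cong (der-scale c p))
  (mk≃ λ { zero → ≡.sym (ℚP.*-zeroʳ c) ; (suc i) → refl }))) (≃-sym (scale-+ c p (0∷ der p)))

der-neg : ∀ p → der (negₚ p) ≃ negₚ (der p)
der-neg p = PS.x-y≈0⇒x≈y (≃-trans (PS.ringEq (der (negₚ p) ∷ der p ∷ []) (λ x y → x :- :- y := x :+ y))
  (≃-trans (≃-sym (der-+ (negₚ p) p)) (der-zero (≃-trans (+ₚ-comm (negₚ p) p) (negₚ-inverseʳ p)))))

der-cong : ∀ {p q} → p ≃ q → der p ≃ der q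
der-cong {p} {q} e = PS.x-y≈0⇒x≈y (≃-trans (+ₚ-cong (≃-refl {der p}) (≃-sym (der-neg q)))
  (≃-trans (≃-sym (der-+ p (negₚ q))) (der-zero (≃-trans (+ₚ-cong e ≃-refl) (negₚ-inverseʳ q)))))

der-* : ∀ p q → der (p *ₚ q) ≃ der p *ₚ q +ₚ p *ₚ der q
der-* []      q = ≃-refl
der-* (c ∷ p) q = begin
  der (scale c q +ₚ (0∷ (p *ₚ q)))                     ≈⟨ der-+ (scale c q) _ ⟩
  der (scale c q) +ₚ (p *ₚ q +ₚ (0∷ der (p *ₚ q)))
    ≈⟨ +ₚ-cong (≃-trans (der-scale c q) (≃-sym (κ-* c (der q)))) (+ₚ-cong ≃-refl (≃-trans (shift≃X _) (*ₚ-congʳ X (der-* p q)))) ⟩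
  κ c *ₚ der q +ₚ (p *ₚ q +ₚ X *ₚ (der p *ₚ q +ₚ p *ₚ der q))
    ≈⟨ PS.ringEq (κ c ∷ X ∷ p ∷ q ∷ der p ∷ der q ∷ []) (λ c X p q p′ q′ →
         c :* q′ :+ (p :* q :+ X :* (p′ :* q :+ p :* q′)) := (p :+ X :* p′) :* q :+ (c :+ X :* p) :* q′) ⟩
  (p +ₚ X *ₚ der p) *ₚ q +ₚ (κ c +ₚ X *ₚ p) *ₚ der q
    ≈⟨ +ₚ-cong (*ₚ-cong (+ₚ-cong (≃-refl {p}) (shift≃X (der p))) ≃-refl) (*ₚ-cong (cons≃ c p) ≃-refl) ⟨
  der (c ∷ p) *ₚ q +ₚ (c ∷ p) *ₚ der q                 ∎
  where open ≃-Reasoning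

-- The parameter t = 4a + 1

four : ℚ
four = + 4 ℚ./ 1

opaque
  unfolding X

  t : Poly
  t = 1ℚ ∷ four ∷ []

  t-Lead : Lead 1 t
  t-Lead = mkLead (Deg<-cons (Deg<-cons Deg<-[])) λ ()

  t≃4X+1 : t ≃ PS.fromℕ 4 *ₚ X +ₚ 1ₚ
  t≃4X+1 = byComputation

-- With `t = 4a + 1` this is `256 a³ + 368 a² + 104 a + 23`, so that `t² δ` is the discriminant of
-- the curve.
δ : Poly
δ = PS.fromℕ 4 *ₚ t *ₚ t *ₚ t +ₚ PS.fromℕ 11 *ₚ t *ₚ t -ₚ PS.fromℕ 8 *ₚ t +ₚ PS.fromℕ 16

t≄0 : ¬ t ≃ []
t≄0 = Lead-≄0 t-Lead

factor-of-t : ∀ {s w} → t ≃ s *ₚ w → Deg< 1 s ⊎ (∃[ c ] (t ≃ κ c *ₚ s))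
factor-of-t {s} {w} e = result (lead s s≄0) (lead w w≄0)
  where
  s≄0 : ¬ s ≃ []
  s≄0 z = t≄0 (≃-trans e (*ₚ-cong {s} {[]} {w} {w} z ≃-refl))
  w≄0 : ¬ w ≃ []
  w≄0 z = t≄0 (≃-trans e (≃-trans (*ₚ-congʳ s z) (*ₚ-zeroʳ s)))
  result : ∃[ m ] Lead m s → ∃[ n ] Lead n w → _
  result (zero , l)  _         = inj₁ (bound l)
  result (suc m , l) (n , k) with Lead-unique (Lead-cong (≃-sym e) (Lead-* l k)) t-Lead
  ... | eq = inj₂ (coeff w 0 , ≃-trans e (≃-trans (*ₚ-comm s w) (*ₚ-cong (Deg<-1⇒κ w-const) ≃-refl)))
    where
    w-const : Deg< 1 w
    w-const = Deg<-mono (s≤s (ℕP.≤-reflexive (ℕP.m+n≡0⇒n≡0 m (ℕP.suc-injective eq)))) (bound k)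

t²δ : Poly
t²δ = t *ₚ t *ₚ δ

private
  -- Bézout cofactors from the extended Euclidean algorithm for `t² δ` and its derivative with
  -- respect to `a`, scaled to integers; `scal` is the factor that the gcd `t` acquires.
  cof₁ cof₂ : Poly
  cof₁ = κ (ℤ.-[1+ 1048543 ] ℚ./ 1) +ₚ t *ₚ (κ (+ 1437264 ℚ./ 1) +ₚ t *ₚ κ (+ 651120 ℚ./ 1))
  cof₂ = κ (ℤ.-[1+ 70303 ] ℚ./ 1) +ₚ t *ₚ (κ (+ 78340 ℚ./ 1) +ₚ t *ₚ (κ (ℤ.-[1+ 89768 ] ℚ./ 1) +ₚ t *ₚ κ (ℤ.-[1+ 32555 ] ℚ./ 1)))
  scal scal⁻¹ : ℚ
  scal = ℤ.-[1+ 8998911 ] ℚ./ 1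
  scal⁻¹ = ℤ.-[1+ 0 ] ℚ./ 8998912

  opaque
    unfolding t
    combination-t : κ scal *ₚ t ≃ cof₁ *ₚ t²δ +ₚ cof₂ *ₚ der t²δ
    combination-t = byComputation

-- A square factor divides the derivative as well, and gcd(t² δ, (t² δ)′) = t.
square-factor : ∀ {s e} → t²δ ≃ s *ₚ s *ₚ e → Deg< 1 s ⊎ (∃[ c ] (t ≃ κ c *ₚ s))
square-factor {s} {e} eq = factor-of-t {s} {w}
    (PS.linear (κ scal⁻¹ ∷ κ scal ∷ t ∷ cof₁ ∷ cof₂ ∷ t²δ ∷ der t²δ ∷ s ∷ e ∷ der s ∷ der e ∷ [])
      (λ k⁻¹ k t A B F F′ s e s′ e′ → (t := s :* (k⁻¹ :* (A :* (s :* e) :+ B :* (# 2 :* s′ :* e :+ s :* e′)))) ,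
        (t , # 1 := k⁻¹ :* k) ∷
        (k⁻¹ , k :* t := A :* F :+ B :* F′) ∷ (k⁻¹ :* A , F := s :* s :* e) ∷
        (k⁻¹ :* B , F′ := # 2 :* s :* s′ :* e :+ s :* s :* e′) ∷ [])
      (inv PS.∷ combination-t PS.∷ eq PS.∷ der-eq PS.∷ PS.[]))
  where
  w = κ scal⁻¹ *ₚ (cof₁ *ₚ (s *ₚ e) +ₚ cof₂ *ₚ (PS.fromℕ 2 *ₚ der s *ₚ e +ₚ s *ₚ der e))
  inv : κ 1ℚ ≃ κ scal⁻¹ *ₚ κ scal
  inv = byComputation
  der-eq : der t²δ ≃ PS.fromℕ 2 *ₚ s *ₚ der s *ₚ e +ₚ s *ₚ s *ₚ der e
  der-eq = ≃-trans (der-cong eq) (≃-trans (der-* (s *ₚ s) e) (≃-trans (+ₚ-cong (*ₚ-cong (der-* s s) ≃-refl) ≃-refl)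
    (PS.ringEq (s ∷ e ∷ der s ∷ der e ∷ []) (λ s e s′ e′ →
      (s′ :* s :+ s :* s′) :* e :+ s :* s :* e′ := # 2 :* s :* s′ :* e :+ s :* s :* e′))))

-- The order over ℚ[a]; it is the ring ℚ[z, z⁻¹]

open Order polyRing t
module B = CommutativeRing orderRing
module BS = LinearSolver orderRing
module BD = Divisibility orderRing
module B-Reasoning = Relation.Binary.Reasoning.Setoid B.setoid

ev : Poly → Elt
ev []      = ι []
ev (c ∷ w) = ι (κ c) +ᴮ z *ᴮ ev w

ev-zero : ∀ {w} → w ≃ [] → ev w ≈ᴮ ι []
ev-zero {[]}    e = B.refl
ev-zero {c ∷ w} e = B.trans
  (B.+-cong (ι-cong (≃-trans (κ-cong (at e 0)) κ-zero)) (B.*-congˡ (ev-zero {w} (mk≃ λ i → at e (suc i)))))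
  (BS.ringEq (z ∷ []) (λ z → # 0 :+ z :* # 0 := # 0))

ev-+ : ∀ p q → ev (p +ₚ q) ≈ᴮ ev p +ᴮ ev q
ev-+ []      q       = B.sym (B.+-identityˡ (ev q))
ev-+ (c ∷ p) []      = B.sym (B.+-identityʳ (ev (c ∷ p)))
ev-+ (c ∷ p) (d ∷ q) = B.trans (B.+-cong (B.sym (ι-homo-+ (κ c) (κ d))) (B.*-congˡ (ev-+ p q)))
  (BS.ringEq (ι (κ c) ∷ ι (κ d) ∷ z ∷ ev p ∷ ev q ∷ [])
    (λ c d z p q → c :+ d :+ z :* (p :+ q) := (c :+ z :* p) :+ (d :+ z :* q)))

ev-scale : ∀ c p → ev (scale c p) ≈ᴮ ι (κ c) *ᴮ ev p
ev-scale c []      = B.sym (B.zeroʳ (ι (κ c)))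
ev-scale c (d ∷ p) = B.trans (B.+-cong (B.trans (ι-cong (≃-sym (κ-mult c d))) (B.sym (ι-homo-* (κ c) (κ d)))) (B.*-congˡ (ev-scale c p)))
  (BS.ringEq (ι (κ c) ∷ ι (κ d) ∷ z ∷ ev p ∷ [])
    (λ c d z p → c :* d :+ z :* (c :* p) := c :* (d :+ z :* p)))

ev-shift : ∀ p → ev (0∷ p) ≈ᴮ z *ᴮ ev p
ev-shift p = B.trans (B.+-congʳ (ι-cong κ-zero)) (B.+-identityˡ (z *ᴮ ev p))

ev-* : ∀ p q → ev (p *ₚ q) ≈ᴮ ev p *ᴮ ev q
ev-* []      q = B.sym (B.zeroˡ (ev q))
ev-* (c ∷ p) q = B.trans (ev-+ (scale c q) _) (B.trans
  (B.+-cong (ev-scale c q) (B.trans (ev-shift (p *ₚ q)) (B.*-congˡ (ev-* p q))))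
  (BS.ringEq (ι (κ c) ∷ z ∷ ev p ∷ ev q ∷ []) (λ c z p q → c :* q :+ z :* (p :* q) := (c :+ z :* p) :* q)))

ev-cong : ∀ {p q} → p ≃ q → ev p ≈ᴮ ev q
ev-cong {p} {q} e = BS.linear (ev p ∷ ev q ∷ ev (negₚ q) ∷ [])
  (λ p q n → (p := q) , (# 1 , p :+ n := # 0) ∷ (:- # 1 , n :+ q := # 0) ∷ [])
  (B.trans (B.sym (ev-+ p (negₚ q))) (ev-zero (≃-trans (+ₚ-cong e ≃-refl) (negₚ-inverseʳ q))) BS.∷
   B.trans (B.sym (ev-+ (negₚ q) q)) (ev-zero (≃-trans (+ₚ-comm (negₚ q) q) (negₚ-inverseʳ q))) BS.∷ BS.[])

zpow z⁻pow : ℕ → Elt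
zpow zero     = ι 1ₚ
zpow (suc n)  = z *ᴮ zpow n
z⁻pow zero    = ι 1ₚ
z⁻pow (suc n) = z⁻¹ *ᴮ z⁻pow n

zpow-+ : ∀ m n → zpow (m ℕ.+ n) ≈ᴮ zpow m *ᴮ zpow n
zpow-+ zero    n = B.sym (B.*-identityˡ (zpow n))
zpow-+ (suc m) n = B.trans (B.*-congˡ (zpow-+ m n)) (B.sym (B.*-assoc z (zpow m) (zpow n)))

zpow-inverse : ∀ n → zpow n *ᴮ z⁻pow n ≈ᴮ ι 1ₚ
zpow-inverse zero    = B.*-identityˡ (ι 1ₚ)
zpow-inverse (suc n) = BS.linear (z ∷ z⁻¹ ∷ zpow n ∷ z⁻pow n ∷ [])
  (λ z i p q → ((z :* p) :* (i :* q) := # 1) , (p :* q , z :* i := # 1) ∷ (# 1 , p :* q := # 1) ∷ [])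
  (zz⁻¹ BS.∷ zpow-inverse n BS.∷ BS.[])

xpow : ℕ → Poly
xpow zero    = 1ₚ
xpow (suc n) = 0∷ xpow n

ev-κ : ∀ c → ev (κ c) ≈ᴮ ι (κ c)
ev-κ c = B.trans (B.+-congˡ (B.zeroʳ z)) (B.+-identityʳ (ι (κ c)))

ev-xpow : ∀ n → ev (xpow n) ≈ᴮ zpow n
ev-xpow zero    = ev-κ 1ℚ
ev-xpow (suc n) = B.trans (ev-shift (xpow n)) (B.*-congˡ (ev-xpow n))

Liftable : Elt → Set
Liftable b = ∃[ k ] ∃[ p ] zpow k *ᴮ b ≈ᴮ ev p

lift-cong : ∀ {b c} → b ≈ᴮ c → Liftable b → Liftable c
lift-cong e (k , p , h) = k , p , B.trans (B.*-congˡ (B.sym e)) h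

lift-+ : ∀ {b c} → Liftable b → Liftable c → Liftable (b +ᴮ c)
lift-+ {b} {c} (k , p , h) (l , q , h′) = k ℕ.+ l , xpow l *ₚ p +ₚ xpow k *ₚ q , (begin
  zpow (k ℕ.+ l) *ᴮ (b +ᴮ c)                    ≈⟨ B.*-congʳ (zpow-+ k l) ⟩
  zpow k *ᴮ zpow l *ᴮ (b +ᴮ c)
    ≈⟨ BS.linear (zpow k ∷ zpow l ∷ b ∷ c ∷ ev p ∷ ev q ∷ ev (xpow k) ∷ ev (xpow l) ∷ [])
         (λ zk zl b c p q xk xl → (zk :* zl :* (b :+ c) := xl :* p :+ xk :* q) ,
           (zl , zk :* b := p) ∷ (zk , zl :* c := q) ∷ (:- q , xk := zk) ∷ (:- p , xl := zl) ∷ [])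
         (h BS.∷ h′ BS.∷ ev-xpow k BS.∷ ev-xpow l BS.∷ BS.[]) ⟩
  ev (xpow l) *ᴮ ev p +ᴮ ev (xpow k) *ᴮ ev q    ≈⟨ B.+-cong (ev-* (xpow l) p) (ev-* (xpow k) q) ⟨
  ev (xpow l *ₚ p) +ᴮ ev (xpow k *ₚ q)          ≈⟨ ev-+ (xpow l *ₚ p) (xpow k *ₚ q) ⟨
  ev (xpow l *ₚ p +ₚ xpow k *ₚ q)               ∎)
  where open B-Reasoning

lift-* : ∀ {b c} → Liftable b → Liftable c → Liftable (b *ᴮ c)
lift-* {b} {c} (k , p , h) (l , q , h′) = k ℕ.+ l , p *ₚ q , (begin
  zpow (k ℕ.+ l) *ᴮ (b *ᴮ c)                    ≈⟨ B.*-congʳ (zpow-+ k l) ⟩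
  zpow k *ᴮ zpow l *ᴮ (b *ᴮ c)
    ≈⟨ BS.ringEq (zpow k ∷ zpow l ∷ b ∷ c ∷ []) (λ k l b c → k :* l :* (b :* c) := (k :* b) :* (l :* c)) ⟩
  (zpow k *ᴮ b) *ᴮ (zpow l *ᴮ c)                ≈⟨ B.*-cong h h′ ⟩
  ev p *ᴮ ev q                                  ≈⟨ ev-* p q ⟨
  ev (p *ₚ q)                                   ∎)
  where open B-Reasoning

lift-ev : ∀ p → Liftable (ev p)
lift-ev p = 0 , p , B.*-identityˡ (ev p)

lift-κ : ∀ c → Liftable (ι (κ c))
lift-κ c = lift-cong (ev-κ c) (lift-ev (κ c))

lift-z : Liftable z
lift-z = lift-cong (B.trans (ev-xpow 1) (B.*-identityʳ z)) (lift-ev (xpow 1))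

lift-z⁻¹ : Liftable z⁻¹
lift-z⁻¹ = 1 , 1ₚ , B.trans (B.*-congʳ (B.*-identityʳ z)) (B.trans zz⁻¹ (B.sym (ev-κ 1ℚ)))

-- The decisive generator: `t` is a Laurent polynomial in `z` over ℚ, and `a = (t - 1)/4`. Thus
-- coefficients in ℚ[a] are absorbed, and the order is no more than ℚ[z, z⁻¹].
lift-X : Liftable (ι X)
lift-X = lift-cong quarter (lift-* (lift-κ (+ 1 ℚ./ 4)) lift-4X)
  where
  4X = ι t +ᴮ ι (negₚ 1ₚ)
  lift-t : Liftable (ι t)
  lift-t = lift-cong
    (BS.linear (ι (κ (ℚ.- 1ℚ)) ∷ z ∷ z⁻¹ ∷ ι t ∷ [])
      (λ m z i t → (m :* ((z :+ # 1) :* (z :* z :+ # 1) :* (i :* i)) := t) ,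
        ((z :+ # 1) :* (z :* z :+ # 1) :* (i :* i) , m := :- # 1) ∷
        (:- (i :* i) , z :* z :* t := :- ((z :+ # 1) :* (z :* z :+ # 1))) ∷
        (t :* (z :* i :+ # 1) , z :* i := # 1) ∷ [])
      (ι-neg 1ₚ BS.∷ z²t BS.∷ zz⁻¹ BS.∷ BS.[]))
    (lift-* (lift-κ (ℚ.- 1ℚ)) (lift-*
      (lift-* (lift-+ lift-z (lift-κ 1ℚ)) (lift-+ (lift-* lift-z lift-z) (lift-κ 1ℚ)))
      (lift-* lift-z⁻¹ lift-z⁻¹)))
  lift-4X : Liftable 4X
  lift-4X = lift-+ lift-t (lift-κ (ℚ.- 1ℚ))
  quarter : ι (κ (+ 1 ℚ./ 4)) *ᴮ 4X ≈ᴮ ι X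
  quarter = B.trans (B.*-congˡ (ι-homo-+ t (negₚ 1ₚ))) (B.trans (ι-homo-* (κ (+ 1 ℚ./ 4)) (t -ₚ 1ₚ)) (ι-cong
    (PS.linear (κ (+ 1 ℚ./ 4) ∷ t ∷ X ∷ [])
      (λ q t X → (q :* (t :- # 1) := X) , (q , t := # 4 :* X :+ # 1) ∷ (X , # 4 :* q := # 1) ∷ [])
      (t≃4X+1 PS.∷ byComputation PS.∷ PS.[]))))

lift-ι : ∀ p → Liftable (ι p)
lift-ι []      = lift-cong (ι-cong κ-zero) (lift-κ 0ℚ)
lift-ι (c ∷ p) = lift-cong
  (B.trans (B.+-congˡ (ι-homo-* X p)) (B.trans (ι-homo-+ (κ c) (X *ₚ p)) (ι-cong (≃-sym (cons≃ c p)))))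
  (lift-+ (lift-κ c) (lift-* lift-X (lift-ι p)))

liftable : ∀ b → Liftable b
liftable (elt p q r) = lift-cong (B.sym (elt-expand p q r))
  (lift-+ (lift-+ (lift-ι p) (lift-* lift-z (lift-ι q))) (lift-* lift-z⁻¹ (lift-ι r)))

opaque
  -- Powers of `z` are units, so `b` and `c` may be replaced by polynomials in `z` over ℚ, where
  -- Euclid's algorithm runs.
  bezoutᴮ : ∀ b c → BD.Gcd b c
  bezoutᴮ b c with liftable b | liftable c
  ... | (k , p , h) | (l , q , h′) = record
    { g = ev g ; x = ev x *ᴮ zpow k ; y = ev y *ᴮ zpow l ; u = z⁻pow k *ᴮ ev u ; v = z⁻pow l *ᴮ ev v
    ; g-comb = B.trans (ev-cong g-comb) (B.trans (ev-+ (x *ₚ p) (y *ₚ q))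
        (BS.linear (ev (x *ₚ p) ∷ ev (y *ₚ q) ∷ ev x ∷ ev y ∷ ev p ∷ ev q ∷ zpow k ∷ zpow l ∷ b ∷ c ∷ [])
          (λ xp yq x y p q zk zl b c → (xp :+ yq := x :* zk :* b :+ y :* zl :* c) ,
            (# 1 , xp := x :* p) ∷ (# 1 , yq := y :* q) ∷ (:- x , zk :* b := p) ∷ (:- y , zl :* c := q) ∷ [])
          (ev-* x p BS.∷ ev-* y q BS.∷ h BS.∷ h′ BS.∷ BS.[])))
    ; a-mult = mult {u = u} k h a-mult
    ; b-mult = mult {u = v} l h′ b-mult }
    where
    open PD.Gcd (bezout p q)
    mult : ∀ {b p u} k → zpow k *ᴮ b ≈ᴮ ev p → p ≃ u *ₚ g → b ≈ᴮ z⁻pow k *ᴮ ev u *ᴮ ev g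
    mult {b} {p} {u} k h e = BS.linear (zpow k ∷ z⁻pow k ∷ b ∷ ev p ∷ ev u ∷ ev g ∷ [])
      (λ zk ik b p u g → (b := ik :* u :* g) ,
        (:- b , zk :* ik := # 1) ∷ (ik , zk :* b := p) ∷ (ik , p := u :* g) ∷ [])
      (zpow-inverse k BS.∷ h BS.∷ B.trans (ev-cong e) (ev-* u g) BS.∷ BS.[])

-- ℚ[z] embeds into the order, and the units are the monomials c zⁱ

Lead-+ : ∀ {n p q} → Lead n p → Deg< n q → Lead n (p +ₚ q)
Lead-+ {n} {p} {q} l d = mkLead (Deg<-+ (bound l) (Deg<-mono (ℕP.n≤1+n n) d)) λ e → lead≢0 l
  (≡.trans (≡.sym (ℚP.+-identityʳ (coeff p n)))
    (≡.trans (cong (coeff p n ℚ.+_) (≡.sym (vanish d n ℕP.≤-refl))) (≡.trans (≡.sym (coeff-+ p q n)) e)))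

Lead-neg : ∀ {n p} → Lead n p → Lead n (negₚ p)
Lead-neg {n} {p} l = mkLead (Deg<-neg (bound l)) λ e → lead≢0 l
  (ℚS.linear (coeff p n ∷ []) (λ x → (x := # 0) , (:- # 1 , :- x := # 0) ∷ []) (≡.trans (≡.sym (coeff-neg p n)) e ℚS.∷ ℚS.[]))

Lead-tail : ∀ {n c p} → Lead (suc n) (c ∷ p) → Lead n p
Lead-tail l = mkLead (Deg<-tail (bound l)) (lead≢0 l)

t+1-Lead : Lead 1 (t +ₚ 1ₚ)
t+1-Lead = Lead-+ t-Lead (Deg<-cons Deg<-[])

ev-const : ∀ {w} → Deg< 1 w → ev w ≈ᴮ ι w
ev-const {w} d = B.trans (ev-cong (Deg<-1⇒κ d)) (B.trans (ev-κ (coeff w 0)) (ι-cong (≃-sym (Deg<-1⇒κ d))))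

-- Multiplication by `z` turns the `z`-coordinate `q` into `p - (t + 1) q`. Its degree in `a` grows
-- by one at each step and the other coordinates never exceed it, so a nonzero polynomial in `z`
-- cannot vanish.
ev-Lead : ∀ {n} w → Lead (suc n) w →
  ∃[ p ] ∃[ q ] ∃[ r ] (ev w ≈ᴮ elt p q r) × Deg< (suc n) p × Lead n q × Deg< (suc n) r
ev-Lead []      l = ⊥-elim (lead≢0 l refl)
ev-Lead {zero} (c ∷ w) l = κ c , w , [] ,
  B.trans (B.+-congˡ (B.*-congˡ (ev-const (bound (Lead-tail l)))))
    (B.sym (B.trans (elt-expand (κ c) w []) (BS.ringEq (ι (κ c) ∷ z ∷ ι w ∷ z⁻¹ ∷ [])
      (λ c z w i → c :+ z :* w :+ i :* # 0 := c :+ z :* w)))) ,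
  Deg<-cons Deg<-[] , Lead-tail l , Deg<-[]
ev-Lead {suc n} (c ∷ w) l with ev-Lead w (Lead-tail l)
... | p , q , r , e , dp , lq , dr =
  κ c +ₚ (r -ₚ q) , p -ₚ (t +ₚ 1ₚ) *ₚ q , negₚ q ,
  B.trans (B.+-congˡ (B.trans (B.*-congˡ e) (z*-elt p q r))) (ι-+-elt (κ c) _ _ _) ,
  Deg<-+ (Deg<-cons Deg<-[]) (Deg<-mono (ℕP.n≤1+n _) (Deg<-minus dr (bound lq))) ,
  Lead-cong (+ₚ-comm (negₚ ((t +ₚ 1ₚ) *ₚ q)) p) (Lead-+ (Lead-neg (Lead-* t+1-Lead lq)) dp) ,
  Deg<-neg (Deg<-mono (ℕP.n≤1+n _) (bound lq))

ev-injective-zero : ∀ w → ev w ≈ᴮ ι [] → w ≃ []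
ev-injective-zero w e with zero? w
... | yes w≃0 = w≃0
... | no w≄0 = ⊥-elim (contradiction (lead w w≄0))
  where
  contradiction : ∃[ n ] Lead n w → ⊥
  contradiction (zero , l)  = w≄0 (ι-injective (B.trans (B.sym (ev-const (bound l))) e))
  contradiction (suc n , l) = let (p , q , r , e′ , _ , lq , _) = ev-Lead w l in
    Lead-≄0 lq (proj₁ (proj₂ (elt-zero (B.trans (B.sym e′) e))))

ev-injective : ∀ p q → ev p ≈ᴮ ev q → p ≃ q
ev-injective p q e = PS.x-y≈0⇒x≈y (ev-injective-zero (p -ₚ q) (B.trans (ev-+ p (negₚ q))
  (B.trans (B.+-congʳ e) (B.trans (B.sym (ev-+ q (negₚ q))) (ev-zero (negₚ-inverseʳ q))))))

coeff-*-0 : ∀ p q → coeff (p *ₚ q) 0 ≡ coeff p 0 ℚ.* coeff q 0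
coeff-*-0 []      q = ≡.sym (ℚP.*-zeroˡ (coeff q 0))
coeff-*-0 (c ∷ p) q = ≡.trans (coeff-+ (scale c q) _ 0) (≡.trans (ℚP.+-identityʳ _) (coeff-scale c q 0))

X-divides : ∀ p → coeff p 0 ≡ 0ℚ → ∃[ p′ ] p ≃ X *ₚ p′
X-divides []      e = [] , ≃-sym (*ₚ-zeroʳ X)
X-divides (c ∷ p) e = p , ≃-trans (mk≃ λ { zero → e ; (suc i) → refl }) (shift≃X p)

xpow-Lead : ∀ n → Lead n (xpow n)
xpow-Lead zero    = mkLead (Deg<-cons Deg<-[]) λ ()
xpow-Lead (suc n) = mkLead (Deg<-cons (bound (xpow-Lead n))) (lead≢0 (xpow-Lead n))

-- A factor with constant term 0 gives up one `X`; if `p` is not such a factor, then `q` is.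
xpow-factor : ∀ n p q → p *ₚ q ≃ xpow n → ∃[ i ] ∃[ c ] (¬ c ≡ 0ℚ) × (p ≃ κ c *ₚ xpow i)
xpow-factor zero p q e = 0 , coeff p 0 , c≢0 , ≃-trans p-const (≃-sym (CommutativeRing.*-identityʳ polyRing (κ (coeff p 0))))
  where
  p-const : p ≃ κ (coeff p 0)
  p-const = Deg<-1⇒κ (*-Deg<-1 e (λ ()))
  c≢0 : ¬ coeff p 0 ≡ 0ℚ
  c≢0 z = Lead-≄0 (xpow-Lead 0) (≃-trans (≃-sym e)
    (*ₚ-cong {p} {[]} {q} {q} (≃-trans p-const (≃-trans (κ-cong z) κ-zero)) ≃-refl))
xpow-factor (suc n) p q e = split (coeff p 0 ℚP.≟ 0ℚ)
  where
  Result : Set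
  Result = ∃[ i ] ∃[ c ] (¬ c ≡ 0ℚ) × (p ≃ κ c *ₚ xpow i)
  cancel-X : ∀ {r} → X *ₚ r ≃ p *ₚ q → r ≃ xpow n
  cancel-X h = PD.cancel {X} (≄0⇒regular X≄0) (≃-trans h (≃-trans e (shift≃X (xpow n))))
  shift-p : ∀ {p′} → p ≃ X *ₚ p′ → ∃[ i ] ∃[ c ] (¬ c ≡ 0ℚ) × (p′ ≃ κ c *ₚ xpow i) → Result
  shift-p {p′} ep (i , c , c≢0 , ep′) = suc i , c , c≢0 , PS.linear (X ∷ p ∷ p′ ∷ κ c ∷ xpow i ∷ xpow (suc i) ∷ [])
    (λ X p p′ c x x′ → (p := c :* x′) , (# 1 , p := X :* p′) ∷ (X , p′ := c :* x) ∷ (:- c , x′ := X :* x) ∷ [])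
    (ep PS.∷ ep′ PS.∷ shift≃X (xpow i) PS.∷ PS.[])
  left : ∃[ p′ ] p ≃ X *ₚ p′ → Result
  left (p′ , ep) = shift-p ep (xpow-factor n p′ q (cancel-X
    (PS.linear (X ∷ p ∷ p′ ∷ q ∷ []) (λ X p p′ q → (X :* (p′ :* q) := p :* q) , (:- q , p := X :* p′) ∷ []) (ep PS.∷ PS.[]))))
  right : ∃[ q′ ] q ≃ X *ₚ q′ → Result
  right (q′ , eq) = xpow-factor n p q′ (cancel-X
    (PS.linear (X ∷ p ∷ q ∷ q′ ∷ []) (λ X p q q′ → (X :* (p :* q′) := p :* q) , (:- p , q := X :* q′) ∷ []) (eq PS.∷ PS.[])))
  split : Dec (coeff p 0 ≡ 0ℚ) → Result
  split (yes z)   = left (X-divides p z)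
  split (no p≢0) = right (X-divides q (ℚ-domain (≡.trans (≡.sym (coeff-*-0 p q)) (at e 0)) p≢0))

-- Units of the order modulo squares

record NormOne (w : Elt) : Set where
  constructor mkNormOne
  field norm² : norm-of w *ₚ norm-of w ≃ 1ₚ
open NormOne

-- Stands for a monomial `zⁱ`, sorted by the parity of `i`. Of the root `w` only `N(w) = ±1`
-- matters, and `NormOne` records it as `N(w)² = 1` so that no sign has to be tracked.
data HalfPower (b : Elt) : Set where
  even : ∀ w → NormOne w → b ≈ᴮ w *ᴮ w → HalfPower b
  odd  : ∀ w → NormOne w → b ≈ᴮ z *ᴮ (w *ᴮ w) → HalfPower b

norm²-* : ∀ {v w} → NormOne v → NormOne w → NormOne (v *ᴮ w)
norm²-* {v} {w} (mkNormOne e) (mkNormOne f) = mkNormOne (PS.linear (norm-of (v *ᴮ w) ∷ norm-of v ∷ norm-of w ∷ [])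
  (λ vw v w → (vw :* vw := # 1) ,
    (vw :+ v :* w , vw := v :* w) ∷ (w :* w , v :* v := # 1) ∷ (# 1 , w :* w := # 1) ∷ [])
  (norm-* v w PS.∷ e PS.∷ f PS.∷ PS.[]))

norm²-unit : ∀ {w} → norm-of w ≃ negₚ 1ₚ → NormOne w
norm²-unit {w} e = mkNormOne (PS.linear (norm-of w ∷ []) (λ w → (w :* w := # 1) , (w :- # 1 , w := :- # 1) ∷ []) (e PS.∷ PS.[]))

norm²-1 : NormOne (ι 1ₚ)
norm²-1 = mkNormOne (PS.linear (norm-of (ι 1ₚ) ∷ []) (λ w → (w :* w := # 1) , (w :+ # 1 , w := # 1) ∷ []) (norm-1 PS.∷ PS.[]))

half-* : ∀ {b c} → HalfPower b → HalfPower c → HalfPower (b *ᴮ c)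
half-* {b} {c} (even v nv e) (even w nw f) = even (v *ᴮ w) (norm²-* nv nw) (BS.linear (b ∷ c ∷ v ∷ w ∷ [])
  (λ b c v w → (b :* c := v :* w :* (v :* w)) , (c , b := v :* v) ∷ (v :* v , c := w :* w) ∷ []) (e BS.∷ f BS.∷ BS.[]))
half-* {b} {c} (even v nv e) (odd w nw f) = odd (v *ᴮ w) (norm²-* nv nw) (BS.linear (z ∷ b ∷ c ∷ v ∷ w ∷ [])
  (λ z b c v w → (b :* c := z :* (v :* w :* (v :* w))) , (c , b := v :* v) ∷ (v :* v , c := z :* (w :* w)) ∷ []) (e BS.∷ f BS.∷ BS.[]))
half-* {b} {c} (odd v nv e) (even w nw f) = odd (v *ᴮ w) (norm²-* nv nw) (BS.linear (z ∷ b ∷ c ∷ v ∷ w ∷ [])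
  (λ z b c v w → (b :* c := z :* (v :* w :* (v :* w))) , (c , b := z :* (v :* v)) ∷ (z :* (v :* v) , c := w :* w) ∷ []) (e BS.∷ f BS.∷ BS.[]))
half-* {b} {c} (odd v nv e) (odd w nw f) = even (z *ᴮ (v *ᴮ w)) (norm²-* (norm²-unit norm-z) (norm²-* nv nw)) (BS.linear (z ∷ b ∷ c ∷ v ∷ w ∷ [])
  (λ z b c v w → (b :* c := z :* (v :* w) :* (z :* (v :* w))) , (c , b := z :* (v :* v)) ∷ (z :* (v :* v) , c := z :* (w :* w)) ∷ []) (e BS.∷ f BS.∷ BS.[]))

half-1 : HalfPower (ι 1ₚ)
half-1 = even (ι 1ₚ) norm²-1 (B.sym (B.*-identityˡ (ι 1ₚ)))

half-z : HalfPower z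
half-z = odd (ι 1ₚ) norm²-1 (BS.ringEq (z ∷ []) (λ z → z := z :* (# 1 :* # 1)))

half-z⁻¹ : HalfPower z⁻¹
half-z⁻¹ = odd z⁻¹ (norm²-unit norm-z⁻¹) (BS.linear (z ∷ z⁻¹ ∷ []) (λ z i → (i := z :* (i :* i)) , (:- i , z :* i := # 1) ∷ []) (zz⁻¹ BS.∷ BS.[]))

half-zpow : ∀ n → HalfPower (zpow n)
half-zpow zero    = half-1
half-zpow (suc n) = half-* half-z (half-zpow n)

half-z⁻pow : ∀ n → HalfPower (z⁻pow n)
half-z⁻pow zero    = half-1
half-z⁻pow (suc n) = half-* half-z⁻¹ (half-z⁻pow n)

unit-form : ∀ {u u′} → u *ᴮ u′ ≈ᴮ ι 1ₚ → ∃[ c ] (¬ c ≡ 0ℚ) × ∃[ b ] HalfPower b × (u ≈ᴮ ι (κ c) *ᴮ b)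
unit-form {u} {u′} e = from-lifts (liftable u) (liftable u′)
  where
  Result : Set
  Result = ∃[ c ] (¬ c ≡ 0ℚ) × ∃[ b ] HalfPower b × (u ≈ᴮ ι (κ c) *ᴮ b)
  from-factor : ∀ {k p} → zpow k *ᴮ u ≈ᴮ ev p → ∃[ i ] ∃[ c ] (¬ c ≡ 0ℚ) × (p ≃ κ c *ₚ xpow i) → Result
  from-factor {k} {p} h (i , c , c≢0 , ep) = c , c≢0 , zpow i *ᴮ z⁻pow k , half-* (half-zpow i) (half-z⁻pow k) ,
    BS.linear (u ∷ zpow k ∷ z⁻pow k ∷ ev p ∷ ι (κ c) ∷ zpow i ∷ ev (κ c) ∷ ev (xpow i) ∷ [])
      (λ u k k⁻ p c i c′ i′ → (u := c :* (i :* k⁻)) ,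
        (:- u , k :* k⁻ := # 1) ∷ (k⁻ , k :* u := p) ∷ (k⁻ , p := c′ :* i′) ∷
        (k⁻ :* i′ , c′ := c) ∷ (k⁻ :* c , i′ := i) ∷ [])
      (zpow-inverse k BS.∷ h BS.∷ B.trans (ev-cong ep) (ev-* (κ c) (xpow i)) BS.∷ ev-κ c BS.∷ ev-xpow i BS.∷ BS.[])
  from-lifts : Liftable u → Liftable u′ → Result
  from-lifts (k , p , h) (l , q , h′) = from-factor {k} {p} h (xpow-factor (k ℕ.+ l) p q (ev-injective (p *ₚ q) (xpow (k ℕ.+ l)) (begin
    ev (p *ₚ q)               ≈⟨ ev-* p q ⟩
    ev p *ᴮ ev q              ≈⟨ BS.linear (u ∷ u′ ∷ zpow k ∷ zpow l ∷ ev p ∷ ev q ∷ [])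
      (λ u u′ k l p q → (p :* q := k :* l) , (k :* l , u :* u′ := # 1) ∷ (:- (l :* u′) , k :* u := p) ∷ (:- p , l :* u′ := q) ∷ [])
      (e BS.∷ h BS.∷ h′ BS.∷ BS.[]) ⟩
    zpow k *ᴮ zpow l          ≈⟨ zpow-+ k l ⟨
    zpow (k ℕ.+ l)            ≈⟨ ev-xpow (k ℕ.+ l) ⟨
    ev (xpow (k ℕ.+ l))       ∎)))
    where open B-Reasoning

SquareClass : Elt → Elt → Set
SquareClass d b = ∃[ k ] b ≈ᴮ d *ᴮ (k *ᴮ k)

-- A unit c zⁱ has norm c³ (-1)ⁱ; if that is s² then c (-1)ⁱ = (s / c)².
unit-class : ∀ {u u′ s} → u *ᴮ u′ ≈ᴮ ι 1ₚ → norm-of u ≃ κ s *ₚ κ s →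
  SquareClass (ι 1ₚ) u ⊎ SquareClass (-ᴮ z) u
unit-class {u} {u′} {s} e ns = from-form (unit-form e)
 where
 from-form : ∃[ c ] (¬ c ≡ 0ℚ) × ∃[ b ] HalfPower b × (u ≈ᴮ ι (κ c) *ᴮ b) → SquareClass (ι 1ₚ) u ⊎ SquareClass (-ᴮ z) u
 from-form (c , c≢0 , b , half , eu) = result half
  where
  i : ℚ
  i = proj₁ (≡-inverse c≢0)
  ic′ : κ i *ₚ κ c ≃ 1ₚ
  ic′ = ≃-trans (κ-mult i c) (κ-cong (proj₂ (≡-inverse c≢0)))
  result : HalfPower b → SquareClass (ι 1ₚ) u ⊎ SquareClass (-ᴮ z) u
  result (even w (mkNormOne nw) eb) = inj₁ (ι (κ s) *ᴮ ι (κ i) *ᴮ w , BS.linear (u ∷ ι (κ c) ∷ b ∷ w ∷ ι (κ s) ∷ ι (κ i) ∷ [])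
      (λ u c b w s i → (u := # 1 :* (s :* i :* w :* (s :* i :* w))) ,
        (# 1 , u := c :* b) ∷ (c , b := w :* w) ∷ (w :* w , c := s :* i :* (s :* i)) ∷ [])
      (eu BS.∷ eb BS.∷ ι-holds (κ c ∷ κ s ∷ κ i ∷ []) (λ c s i → c := s :* i :* (s :* i)) c-square BS.∷ BS.[]))
    where
    c-square : κ c ≃ κ s *ₚ κ i *ₚ (κ s *ₚ κ i)
    c-square = PS.linear (κ c ∷ κ s ∷ κ i ∷ norm-of u ∷ norm-of b ∷ norm-of w ∷ norm-of (ι (κ c)) ∷ [])
      (λ c s i u b w c′ → (c := s :* i :* (s :* i)) ,
        (i :* i , u := s :* s) ∷ (:- (i :* i) , u := c′ :* b) ∷ (:- (i :* i :* c′) , b := w :* w) ∷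
        (:- (i :* i :* c′) , w :* w := # 1) ∷ (:- (i :* i) , c′ := c :* c :* c) ∷
        (:- (c :* (i :* c :+ # 1)) , i :* c := # 1) ∷ [])
      (ns PS.∷ ≃-trans (norm-cong eu) (norm-* (ι (κ c)) b) PS.∷ ≃-trans (norm-cong eb) (norm-* w w) PS.∷
       nw PS.∷ norm-ι (κ c) PS.∷ ic′ PS.∷ PS.[])
  result (odd w (mkNormOne nw) eb) = inj₂ (ι (κ s) *ᴮ ι (κ i) *ᴮ w , BS.linear (z ∷ u ∷ ι (κ c) ∷ b ∷ w ∷ ι (κ s) ∷ ι (κ i) ∷ [])
      (λ z u c b w s i → (u := (:- z) :* (s :* i :* w :* (s :* i :* w))) ,
        (# 1 , u := c :* b) ∷ (c , b := z :* (w :* w)) ∷ (z :* (w :* w) , c := :- (s :* i :* (s :* i))) ∷ [])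
      (eu BS.∷ eb BS.∷ ι-holds (κ c ∷ κ s ∷ κ i ∷ []) (λ c s i → c := :- (s :* i :* (s :* i))) c-square BS.∷ BS.[]))
    where
    c-square : κ c ≃ negₚ (κ s *ₚ κ i *ₚ (κ s *ₚ κ i))
    c-square = PS.linear (κ c ∷ κ s ∷ κ i ∷ norm-of u ∷ norm-of b ∷ norm-of w ∷ norm-of (ι (κ c)) ∷ norm-of z ∷ norm-of (w *ᴮ w) ∷ [])
      (λ c s i u b w c′ z w² → (c := :- (s :* i :* (s :* i))) ,
        (:- (i :* i) , u := s :* s) ∷ (i :* i , u := c′ :* b) ∷ (i :* i :* c′ , b := z :* w²) ∷
        (i :* i :* c′ :* z , w² := w :* w) ∷ (i :* i :* c′ :* w :* w , z := :- # 1) ∷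
        (:- (i :* i :* c′) , w :* w := # 1) ∷ (:- (i :* i) , c′ := c :* c :* c) ∷
        (:- (c :* (i :* c :+ # 1)) , i :* c := # 1) ∷ [])
      (ns PS.∷ ≃-trans (norm-cong eu) (norm-* (ι (κ c)) b) PS.∷ ≃-trans (norm-cong eb) (norm-* z (w *ᴮ w)) PS.∷
       norm-* w w PS.∷ norm-z PS.∷ nw PS.∷ norm-ι (κ c) PS.∷ ic′ PS.∷ PS.[])

-- The 2-descent map

-- The point (x / z′², y / z′³), in lowest terms.
record PolyPoint : Set where
  field
    x y z′ α β : Poly
    coprime : α *ₚ x +ₚ β *ₚ z′ ≃ 1ₚ
    z′≄0 : ¬ z′ ≃ []
    y≄0 : ¬ y ≃ []
    curve : y *ₚ y ≃ x *ₚ x *ₚ x +ₚ (t +ₚ PS.fromℕ 2) *ₚ x *ₚ x *ₚ (z′ *ₚ z′)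
      +ₚ PS.fromℕ 2 *ₚ t *ₚ x *ₚ (z′ *ₚ z′) *ₚ (z′ *ₚ z′) +ₚ t *ₚ t *ₚ (z′ *ₚ z′) *ₚ (z′ *ₚ z′) *ₚ (z′ *ₚ z′)

x-θ : Poly → Poly → Elt
x-θ x w = elt x (negₚ w) (negₚ w)

-- Up to squares the nontrivial representatives are `c - θ` for `c = 0, -2, -t`, where
-- `-2 - θ = -z ((z + 1)/z)²`. Modulo squares they lie in the group generated by `-z` and `π₁`,
-- because `-θ = -z π₁ / z²` and `-(t + θ) = π₁ / z²`.
data DescentClass (a : Elt) : Set where
  class-O : SquareClass (ι 1ₚ) a → DescentClass a
  class-P : SquareClass (-ᴮ θ) a → DescentClass a
  class-Q : SquareClass (-ᴮ z) a → DescentClass a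
  class-S : SquareClass (-ᴮ (ι t +ᴮ θ)) a → DescentClass a

bezout-t²δ : (t *ₚ t) *ₚ (negₚ (PS.fromℕ 14) -ₚ PS.fromℕ 19 *ₚ t -ₚ PS.fromℕ 4 *ₚ t *ₚ t) +ₚ δ *ₚ (t +ₚ PS.fromℕ 2) ≃ PS.fromℕ 32
bezout-t²δ = PS.ringEq (t ∷ []) (λ t →
  (t :* t) :* (:- # 14 :- # 19 :* t :- # 4 :* t :* t) :+
  (# 4 :* t :* t :* t :+ # 11 :* t :* t :- # 8 :* t :+ # 16) :* (t :+ # 2) := # 32)

thirty-second : ∃[ c ] κ c *ₚ PS.fromℕ 32 ≃ 1ₚ
thirty-second = (+ 1 ℚ./ 32) , byComputation

≄0-factor : ∀ {a b c} → a ≃ b *ₚ c → ¬ a ≃ [] → ¬ c ≃ []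
≄0-factor {a} {b} {c} e a≄0 z = a≄0 (≃-trans e (≃-trans (*ₚ-congʳ b z) (*ₚ-zeroʳ b)))

θ-rootᴮ : θ *ᴮ θ *ᴮ θ +ᴮ (ι t +ᴮ BS.fromℕ 2) *ᴮ θ *ᴮ θ +ᴮ BS.fromℕ 2 *ᴮ ι t *ᴮ θ +ᴮ ι t *ᴮ ι t ≈ᴮ ι []
θ-rootᴮ = B.trans (B.+-cong (B.+-cong (B.+-congˡ (B.*-congʳ (B.*-congʳ (B.sym (ι-value (t ∷ []) (λ t → t :+ # 2))))))
       (B.*-congʳ (B.sym (ι-value (t ∷ []) (λ t → # 2 :* t))))) (B.sym (ι-value (t ∷ []) (λ t → t :* t)))) θ-root

module Descent (pt : PolyPoint) where
  open PolyPoint pt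
  w : Poly
  w = z′ *ₚ z′
  a a′ f′ : Elt
  a  = x-θ x w
  f′ = ι (PS.fromℕ 3) *ᴮ θ *ᴮ θ +ᴮ ι (PS.fromℕ 2 *ₚ (t +ₚ PS.fromℕ 2)) *ᴮ θ +ᴮ ι (PS.fromℕ 2 *ₚ t)
  -- The cofactor of `a` in the homogenised cubic, expanded at `θ`: modulo `a` it is `f′(θ) z′⁴`, so
  -- a common divisor of `a` and `a′` divides that.
  a′ = f′ *ᴮ (ι z′ *ᴮ ι z′ *ᴮ ι z′ *ᴮ ι z′) +ᴮ
       a *ᴮ (ι x +ᴮ (BS.fromℕ 2 *ᴮ θ +ᴮ (ι t +ᴮ BS.fromℕ 2)) *ᴮ (ι z′ *ᴮ ι z′))

  a-def : a ≈ᴮ ι x +ᴮ -ᴮ ((ι z′ *ᴮ ι z′) *ᴮ θ)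
  a-def = B.trans (elt-x-θz x w) (B.+-congˡ (B.-‿cong (B.*-congʳ (B.sym (ι-homo-* z′ z′)))))

  norm-a : norm-of a ≃ y *ₚ y
  norm-a = ≃-trans (norm-x-θz x w) (≃-sym curve)

  f′-def : f′ ≈ᴮ BS.fromℕ 3 *ᴮ θ *ᴮ θ +ᴮ BS.fromℕ 2 *ᴮ (ι t +ᴮ BS.fromℕ 2) *ᴮ θ +ᴮ BS.fromℕ 2 *ᴮ ι t
  f′-def = B.+-cong (B.+-cong
    (B.*-congʳ (B.*-congʳ (ι-value (t ∷ []) (λ t → # 3))))
    (B.*-congʳ (ι-value (t ∷ []) (λ t → # 2 :* (t :+ # 2)))))
    (ι-value (t ∷ []) (λ t → # 2 :* t))

  aa′ : a *ᴮ a′ ≈ᴮ ι y *ᴮ ι y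
  aa′ = BS.linear (a ∷ f′ ∷ ι x ∷ ι y ∷ ι z′ ∷ ι t ∷ θ ∷ [])
    (λ a f′ x y z t θ →
      (a :* (f′ :* (z :* z :* z :* z) :+ a :* (x :+ (# 2 :* θ :+ (t :+ # 2)) :* (z :* z))) := y :* y) ,
      (F a x z t θ , a := x :+ :- ((z :* z) :* θ)) ∷
      (a :* (z :* z :* z :* z) , f′ := # 3 :* θ :* θ :+ # 2 :* (t :+ # 2) :* θ :+ # 2 :* t) ∷
      (:- # 1 , y :* y := C x z t) ∷
      (:- (z :* z :* z :* z :* z :* z) , θ :* θ :* θ :+ (t :+ # 2) :* θ :* θ :+ # 2 :* t :* θ :+ t :* t := # 0) ∷ [])
    (a-def BS.∷ f′-def BS.∷
     ι-holds (x ∷ y ∷ z′ ∷ t ∷ []) (λ x y z t → y :* y := C x z t) curve BS.∷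
     θ-rootᴮ BS.∷ BS.[])
    where
    C : ∀ {n} → Expr n → Expr n → Expr n → Expr n
    C x z t = x :* x :* x :+ (t :+ # 2) :* x :* x :* (z :* z)
      :+ # 2 :* t :* x :* (z :* z) :* (z :* z) :+ t :* t :* (z :* z) :* (z :* z) :* (z :* z)
    F : ∀ {n} → Expr n → Expr n → Expr n → Expr n → Expr n → Expr n
    F a x z t θ = (# 3 :* θ :* θ :+ # 2 :* (t :+ # 2) :* θ :+ # 2 :* t) :* (z :* z :* z :* z)
      :+ (a :+ (x :- z :* z :* θ)) :* (x :+ (# 2 :* θ :+ (t :+ # 2)) :* (z :* z))

  regular-a : BD.Regular a
  regular-a = regular-norm (PD.regular-cong (≃-sym norm-a) (≄0⇒regular (≄0-* y≄0 y≄0)))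

  opaque
    squareSplit : BD.SquareSplit bezoutᴮ a a′
    squareSplit = BD.square-split bezoutᴮ regular-a aa′

  open BD.SquareSplit squareSplit renaming (d to D; k to h; unit to U; unit⁻¹ to U′)

  -- Since z′ is invertible modulo a, every common divisor of a and c z′ divides c.
  remove-z′ : ∀ {c} → BD.Divides D (c *ᴮ ι z′) → BD.Divides D c
  remove-z′ {c} (k , e) = c *ᴮ ι α *ᴮ proj₁ d-a +ᴮ k *ᴮ (ι α *ᴮ θ *ᴮ ι z′ +ᴮ ι β) ,
    BS.linear (c ∷ D ∷ k ∷ a ∷ ι x ∷ ι z′ ∷ ι α ∷ ι β ∷ θ ∷ proj₁ d-a ∷ [])
      (λ c D k a x z α β θ l → (c := (c :* α :* l :+ k :* (α :* θ :* z :+ β)) :* D) ,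
        (c :* α , a := l :* D) ∷ (α :* θ :* z :+ β , c :* z := k :* D) ∷
        (:- c , α :* x :+ β :* z := # 1) ∷ (:- (c :* α) , a := x :+ :- (z :* z :* θ)) ∷ [])
      (proj₂ d-a BS.∷ e BS.∷ ι-holds (α ∷ x ∷ β ∷ z′ ∷ []) (λ α x β z → α :* x :+ β :* z := # 1) coprime BS.∷ a-def BS.∷ BS.[])

  opaque
    D-f′ : BD.Divides D f′
    D-f′ = remove-z′ (remove-z′ (remove-z′ (remove-z′ (proj₁ d-a′ +ᴮ -ᴮ (proj₁ d-a *ᴮ g) ,
      BS.linear (D ∷ a ∷ a′ ∷ f′ ∷ ι z′ ∷ g ∷ proj₁ d-a ∷ proj₁ d-a′ ∷ [])
        (λ D a a′ f′ z g k k′ → (f′ :* z :* z :* z :* z := (k′ :+ :- (k :* g)) :* D) ,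
          (:- # 1 , a′ := f′ :* (z :* z :* z :* z) :+ a :* g) ∷ (# 1 , a′ := k′ :* D) ∷ (:- g , a := k :* D) ∷ [])
        (B.refl BS.∷ proj₂ d-a′ BS.∷ proj₂ d-a BS.∷ BS.[])))))
      where
      g : Elt
      g = ι x +ᴮ (BS.fromℕ 2 *ᴮ θ +ᴮ (ι t +ᴮ BS.fromℕ 2)) *ᴮ (ι z′ *ᴮ ι z′)

  E : Elt
  E = z *ᴮ z *ᴮ z *ᴮ proj₁ D-f′

  π₁π₂ : π₁ *ᴮ π₂ ≈ᴮ E *ᴮ D
  π₁π₂ = B.trans (B.sym z³f′θ) (B.trans (B.*-congˡ (proj₂ D-f′)) (B.sym (B.*-assoc (z *ᴮ z *ᴮ z) (proj₁ D-f′) D)))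

  n u : Poly
  n = norm-of h
  u = norm-of U

  norm-unit : u *ₚ norm-of U′ ≃ 1ₚ
  norm-unit = ≃-trans (≃-sym (norm-* U U′)) (≃-trans (norm-cong unit-inv) norm-1)

  norm-split : n *ₚ n *ₚ (u *ₚ norm-of D) ≃ y *ₚ y
  norm-split = PS.linear (n ∷ u ∷ norm-of D ∷ y ∷ norm-of a ∷ norm-of (U *ᴮ D) ∷ norm-of (h *ᴮ h) ∷ [])
    (λ n u d y a ud hh → (n :* n :* (u :* d) := y :* y) ,
      (# 1 , a := y :* y) ∷ (:- # 1 , a := ud :* hh) ∷ (:- hh , ud := u :* d) ∷ (:- (u :* d) , hh := n :* n) ∷ [])
    (norm-a PS.∷ ≃-trans (norm-cong split) (norm-* (U *ᴮ D) (h *ᴮ h)) PS.∷ norm-* U D PS.∷ norm-* h h PS.∷ PS.[])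

  n≄0 : ¬ n ≃ []
  n≄0 e = ≄0-* y≄0 y≄0 (≃-trans (≃-sym norm-split) (*ₚ-cong {n *ₚ n} {[]} {u *ₚ norm-of D} {u *ₚ norm-of D} (*ₚ-cong {n} {[]} {n} {n} e ≃-refl) ≃-refl))

  opaque
    s-exists : ∃[ s ] y ≃ n *ₚ s
    s-exists = PD.square-divides bezout {n} {u *ₚ norm-of D} {y} (≄0⇒regular n≄0) norm-split

  s : Poly
  s = proj₁ s-exists

  s² : u *ₚ norm-of D ≃ s *ₚ s
  s² = PD.cancel {n *ₚ n} (≄0⇒regular (≄0-* n≄0 n≄0)) (PS.linear (n ∷ u ∷ norm-of D ∷ y ∷ s ∷ [])
    (λ n u d y s → (n :* n :* (u :* d) := n :* n :* (s :* s)) ,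
      (# 1 , n :* n :* (u :* d) := y :* y) ∷ (y :+ n :* s , y := n :* s) ∷ [])
    (norm-split PS.∷ proj₂ s-exists PS.∷ PS.[]))

  s≄0 : ¬ s ≃ []
  s≄0 = ≄0-factor {y} {n} {s} (proj₂ s-exists) y≄0

  norm-DE : norm-of E *ₚ norm-of D ≃ negₚ t²δ
  norm-DE = PS.linear (norm-of E ∷ norm-of D ∷ norm-of (E *ᴮ D) ∷ norm-of (π₁ *ᴮ π₂) ∷ norm-of π₁ ∷ norm-of π₂ ∷ t ∷ δ ∷ t²δ ∷ [])
    (λ e d ed pp p₁ p₂ t δ F → (e :* d := :- F) ,
      (:- # 1 , ed := e :* d) ∷ (:- # 1 , pp := ed) ∷ (# 1 , pp := p₁ :* p₂) ∷ (p₂ , p₁ := t :* t) ∷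
      (t :* t , p₂ := :- δ) ∷ (# 1 , F := t :* t :* δ) ∷ [])
    (norm-* E D PS.∷ norm-cong π₁π₂ PS.∷ norm-* π₁ π₂ PS.∷ norm-π₁ PS.∷ norm-π₂ PS.∷ ≃-refl PS.∷ PS.[])

  -- Since `u` is a unit, `s² = u N(D)` inherits divisibility of `N(π₁ π₂) = -t² δ` from `N(D)`; the
  -- only square factors available there come from `t`.
  s-square-factor : t²δ ≃ s *ₚ s *ₚ negₚ (norm-of U′ *ₚ norm-of E)
  s-square-factor = PS.linear (norm-of E ∷ norm-of D ∷ u ∷ norm-of U′ ∷ s ∷ t²δ ∷ [])
    (λ e d u u′ s F → (F := s :* s :* (:- (u′ :* e))) ,
      (# 1 , e :* d := :- F) ∷ (:- (u′ :* e) , u :* d := s :* s) ∷ (e :* d , u :* u′ := # 1) ∷ [])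
    (norm-DE PS.∷ s² PS.∷ norm-unit PS.∷ PS.[])

  -- `N(D)` is a nonzero constant, so `D` is a unit, and `a` is a square times a unit whose norm is
  -- a square.
  module UnitCase {c} (s≃c : s ≃ κ c) (inverse : ∃[ d ] d ℚ.* c ≡ 1ℚ) where
    c⁻¹ : ℚ
    c⁻¹ = proj₁ inverse
    inv : c⁻¹ ℚ.* c ≡ 1ℚ
    inv = proj₂ inverse
    unit′ : (U *ᴮ D) *ᴮ (U′ *ᴮ (adj D *ᴮ ι (u *ₚ (κ c⁻¹ *ₚ κ c⁻¹)))) ≈ᴮ ι 1ₚ
    unit′ = BS.linear (U ∷ D ∷ U′ ∷ adj D ∷ ι (u *ₚ (κ c⁻¹ *ₚ κ c⁻¹)) ∷ ι (norm-of D) ∷ [])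
      (λ U D U′ D′ i N → ((U :* D) :* (U′ :* (D′ :* i)) := # 1) ,
        (D :* D′ :* i , U :* U′ := # 1) ∷ (i , D :* D′ := N) ∷ (# 1 , N :* i := # 1) ∷ [])
      (unit-inv BS.∷ *-adj D BS.∷ B.trans (ι-homo-* (norm-of D) _) (ι-cong (PS.linear (norm-of D ∷ u ∷ κ c⁻¹ ∷ κ c ∷ s ∷ [])
        (λ d u i c s → (d :* (u :* (i :* i)) := # 1) ,
          (i :* i , u :* d := s :* s) ∷ (i :* i :* (s :+ c) , s := c) ∷ (i :* c :+ # 1 , i :* c := # 1) ∷ [])
        (s² PS.∷ s≃c PS.∷ ≃-trans (κ-mult c⁻¹ c) (κ-cong inv) PS.∷ PS.[]))) BS.∷ BS.[])
    result : DescentClass a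
    result = from-unit (unit-class {U *ᴮ D} {_} {c} unit′
      (≃-trans (norm-* U D) (≃-trans s² (*ₚ-cong s≃c s≃c))))
      where
      multiply : ∀ {d} → SquareClass d (U *ᴮ D) → SquareClass d a
      multiply {d} (k , e) = k *ᴮ h , BS.linear (a ∷ U *ᴮ D ∷ d ∷ k ∷ h ∷ [])
        (λ a v d k h → (a := d :* (k :* h :* (k :* h))) , (# 1 , a := v :* (h :* h)) ∷ (h :* h , v := d :* (k :* k)) ∷ [])
        (split BS.∷ e BS.∷ BS.[])
      from-unit : SquareClass (ι 1ₚ) (U *ᴮ D) ⊎ SquareClass (-ᴮ z) (U *ᴮ D) → DescentClass a
      from-unit (inj₁ c) = class-O (multiply c)
      from-unit (inj₂ c) = class-Q (multiply c)

  -- Now `N(D)` and `N(π₁) = t²` agree up to a unit. Once `D` is seen to divide `π₁`, the quotient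
  -- `e` must be a unit, and `a` is a unit times `π₁` times a square.
  module RamifiedCase {c} (t≃cs : t ≃ κ c *ₚ s) where
    -- 32 = t² A + δ (t + 2), where t² ~ N(D) and δ π₁ ~ π₁ π₂ are multiples of D.
    e : Elt
    e = ι (κ (proj₁ thirty-second)) *ᴮ (ι (κ c) *ᴮ ι (κ c) *ᴮ ι u *ᴮ adj D *ᴮ ι A *ᴮ π₁ +ᴮ -ᴮ (E *ᴮ adj π₂ *ᴮ (ι t +ᴮ BS.fromℕ 2)))
      where
      A : Poly
      A = negₚ (PS.fromℕ 14) -ₚ PS.fromℕ 19 *ₚ t -ₚ PS.fromℕ 4 *ₚ t *ₚ t
    π₁-split : π₁ ≈ᴮ e *ᴮ D
    π₁-split = BS.linear (ι (κ (proj₁ thirty-second)) ∷ ι (κ c) ∷ ι u ∷ adj D ∷ ι A ∷ π₁ ∷ E ∷ adj π₂ ∷ ι t ∷ D ∷ ι (norm-of D) ∷ ι δ ∷ π₂ ∷ ι s ∷ ι (norm-of π₂) ∷ [])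
      (λ i c u D′ A p E p₂′ t D N δ p₂ s N₂ →
        (p := i :* (c :* c :* u :* D′ :* A :* p :+ :- (E :* p₂′ :* (t :+ # 2))) :* D) ,
        (:- p , i :* # 32 := # 1) ∷
        (:- (i :* p) , t :* t :* A :+ δ :* (t :+ # 2) := # 32) ∷
        (i :* p :* A :* (t :+ c :* s) , t := c :* s) ∷
        (:- (i :* p :* A :* c :* c) , u :* N := s :* s) ∷
        (:- (i :* p :* A :* c :* c :* u) , D :* D′ := N) ∷
        (i :* p :* (t :+ # 2) , N₂ := :- δ) ∷
        (:- (i :* p :* (t :+ # 2)) , N₂ := p₂ :* p₂′) ∷
        (:- (i :* p₂′ :* (t :+ # 2)) , p :* p₂ := E :* D) ∷ [])
      (ι-holds (κ (proj₁ thirty-second) ∷ []) (λ i → i :* # 32 := # 1) (proj₂ thirty-second) BS.∷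
       ι-holds (t ∷ A ∷ δ ∷ []) (λ t A δ → t :* t :* A :+ δ :* (t :+ # 2) := # 32) bezout-t²δ BS.∷
       ι-holds (t ∷ κ c ∷ s ∷ []) (λ t c s → t := c :* s) t≃cs BS.∷
       ι-holds (u ∷ norm-of D ∷ s ∷ []) (λ u N s → u :* N := s :* s) s² BS.∷
       *-adj D BS.∷
       ι-holds (norm-of π₂ ∷ δ ∷ []) (λ N δ → N := :- δ) norm-π₂ BS.∷
       B.sym (*-adj π₂) BS.∷ π₁π₂ BS.∷ BS.[])
      where
      A : Poly
      A = negₚ (PS.fromℕ 14) -ₚ PS.fromℕ 19 *ₚ t -ₚ PS.fromℕ 4 *ₚ t *ₚ t

    -- N(e) N(D) = t² = c² s² = c² u N(D)
    norm-D≄0 : ¬ norm-of D ≃ []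
    norm-D≄0 = ≄0-factor {s *ₚ s} {u} (≃-sym s²) (≄0-* s≄0 s≄0)

    norm-e : norm-of e ≃ κ c *ₚ κ c *ₚ u
    norm-e = PD.cancel {norm-of D} (≄0⇒regular norm-D≄0) (PS.linear (norm-of e ∷ norm-of D ∷ norm-of π₁ ∷ t ∷ κ c ∷ s ∷ u ∷ [])
      (λ e D p t c s u → (D :* e := D :* (c :* c :* u)) ,
        (:- # 1 , p := e :* D) ∷ (# 1 , p := t :* t) ∷ (t :+ c :* s , t := c :* s) ∷ (:- (c :* c) , u :* D := s :* s) ∷ [])
      (≃-trans (norm-cong π₁-split) (norm-* e D) PS.∷ norm-π₁ PS.∷ t≃cs PS.∷ s² PS.∷ PS.[]))

    c≢0 : ¬ c ≡ 0ℚ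
    c≢0 z = t≄0 (≃-trans t≃cs (*ₚ-cong {κ c} {[]} {s} {s} (≃-trans (κ-cong z) κ-zero) ≃-refl))

    i : ℚ
    i = proj₁ (≡-inverse c≢0)

    ic : κ i *ₚ κ c ≃ 1ₚ
    ic = ≃-trans (κ-mult i c) (κ-cong (proj₂ (≡-inverse c≢0)))

    e⁻¹ : Elt
    e⁻¹ = adj e *ᴮ (ι (κ i) *ᴮ ι (κ i) *ᴮ ι (norm-of U′))

    e-inverse : e *ᴮ e⁻¹ ≈ᴮ ι 1ₚ
    e-inverse = BS.linear (e ∷ adj e ∷ ι (κ i) ∷ ι (κ c) ∷ ι u ∷ ι (norm-of U′) ∷ ι (norm-of e) ∷ [])
      (λ e e′ i c u u′ N → (e :* (e′ :* (i :* i :* u′)) := # 1) ,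
        (i :* i :* u′ , e :* e′ := N) ∷ (i :* i :* u′ , N := c :* c :* u) ∷
        (i :* i :* c :* c , u :* u′ := # 1) ∷ (i :* c :+ # 1 , i :* c := # 1) ∷ [])
      (*-adj e BS.∷ ι-holds (norm-of e ∷ κ c ∷ u ∷ []) (λ N c u → N := c :* c :* u) norm-e BS.∷
       ι-holds (u ∷ norm-of U′ ∷ []) (λ u u′ → u :* u′ := # 1) norm-unit BS.∷
       ι-holds (κ i ∷ κ c ∷ []) (λ i c → i :* c := # 1) ic BS.∷ BS.[])

    V : Elt
    V = U *ᴮ e⁻¹

    V-inverse : V *ᴮ (U′ *ᴮ e) ≈ᴮ ι 1ₚ
    V-inverse = BS.linear (U ∷ U′ ∷ e ∷ e⁻¹ ∷ [])
      (λ U U′ e e⁻ → (U :* e⁻ :* (U′ :* e) := # 1) , (e :* e⁻ , U :* U′ := # 1) ∷ (# 1 , e :* e⁻ := # 1) ∷ [])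
      (unit-inv BS.∷ e-inverse BS.∷ BS.[])

    norm-V : norm-of V ≃ κ i *ₚ κ i
    norm-V = PS.linear (norm-of V ∷ u ∷ norm-of e⁻¹ ∷ norm-of e ∷ κ i ∷ κ c ∷ norm-of (e *ᴮ e⁻¹) ∷ [])
      (λ V u e⁻ e i c ee → (V := i :* i) ,
        (# 1 , V := u :* e⁻) ∷ (:- (u :* e⁻ :* (i :* c :+ # 1)) , i :* c := # 1) ∷
        (:- (i :* i :* e⁻) , e := c :* c :* u) ∷ (:- (i :* i) , ee := e :* e⁻) ∷ (i :* i , ee := # 1) ∷ [])
      (norm-* U e⁻¹ PS.∷ ic PS.∷ norm-e PS.∷ norm-* e e⁻¹ PS.∷ ≃-trans (norm-cong e-inverse) norm-1 PS.∷ PS.[])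

    a-split : a ≈ᴮ V *ᴮ π₁ *ᴮ (h *ᴮ h)
    a-split = BS.linear (a ∷ U ∷ D ∷ h ∷ e ∷ e⁻¹ ∷ π₁ ∷ [])
      (λ a U D h e e⁻ p → (a := U :* e⁻ :* p :* (h :* h)) ,
        (# 1 , a := U :* D :* (h :* h)) ∷ (:- (U :* e⁻ :* h :* h) , p := e :* D) ∷ (:- (U :* D :* h :* h) , e :* e⁻ := # 1) ∷ [])
      (split BS.∷ π₁-split BS.∷ e-inverse BS.∷ BS.[])

    result : DescentClass a
    result = from-unit (unit-class {V} {_} {i} V-inverse norm-V)
      where
      from-unit : SquareClass (ι 1ₚ) V ⊎ SquareClass (-ᴮ z) V → DescentClass a
      -- `π₁ = -(t + θ) z²`, so a square unit gives the class of `P + Q`; and `-z π₁ = -θ z²`, so a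
      -- unit in the class of `-z` gives that of `P`.
      from-unit (inj₁ (k , ek)) = class-S (z *ᴮ (k *ᴮ h) , BS.linear (a ∷ V ∷ z ∷ z⁻¹ ∷ ι t ∷ θ ∷ k ∷ h ∷ [])
        (λ a V z i t θ k h → (a := (:- (t :+ θ)) :* (z :* (k :* h) :* (z :* (k :* h)))) ,
          (# 1 , a := V :* (z :* z :+ # 1) :* (h :* h)) ∷ ((z :* z :+ # 1) :* (h :* h) , V := # 1 :* (k :* k)) ∷
          (z :* z :* k :* k :* h :* h , θ := z :+ i) ∷
          (k :* k :* h :* h , z :* z :* t := :- ((z :+ # 1) :* (z :* z :+ # 1))) ∷
          (z :* k :* k :* h :* h , z :* i := # 1) ∷ [])
        (a-split BS.∷ ek BS.∷ θ-def BS.∷ z²t BS.∷ zz⁻¹ BS.∷ BS.[]))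
      from-unit (inj₂ (k , ek)) = class-P (k *ᴮ h *ᴮ z , BS.linear (a ∷ V ∷ z ∷ z⁻¹ ∷ θ ∷ k ∷ h ∷ [])
        (λ a V z i θ k h → (a := (:- θ) :* (k :* h :* z :* (k :* h :* z))) ,
          (# 1 , a := V :* (z :* z :+ # 1) :* (h :* h)) ∷ ((z :* z :+ # 1) :* (h :* h) , V := (:- z) :* (k :* k)) ∷
          (k :* h :* z :* (k :* h :* z) , θ := z :+ i) ∷ (k :* h :* z :* (k :* h) , z :* i := # 1) ∷ [])
        (a-split BS.∷ ek BS.∷ θ-def BS.∷ zz⁻¹ BS.∷ BS.[]))

  classify : DescentClass a
  classify = from-factor (square-factor {s} s-square-factor)
    where
    from-factor : Deg< 1 s ⊎ (∃[ c ] (t ≃ κ c *ₚ s)) → DescentClass a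
    from-factor (inj₁ d) = UnitCase.result {coeff s 0} (Deg<-1⇒κ d)
      (≡-inverse (λ z → s≄0 (≃-trans (Deg<-1⇒κ d) (≃-trans (κ-cong z) κ-zero))))
    from-factor (inj₂ (c , e)) = RamifiedCase.result {c} e

-- The field ℚ(a)

order-domain : ∀ b c → b *ᴮ c ≈ᴮ ι [] → (b ≈ᴮ ι []) ⊎ (c ≈ᴮ ι [])
order-domain b c e = from-lifts (liftable b) (liftable c)
  where
  lower : ∀ {b} k {p} → zpow k *ᴮ b ≈ᴮ ev p → p ≃ [] → b ≈ᴮ ι []
  lower {b} k {p} h p≃0 = BS.linear (b ∷ zpow k ∷ z⁻pow k ∷ ev p ∷ [])
    (λ b k k⁻ p → (b := # 0) , (:- b , k :* k⁻ := # 1) ∷ (k⁻ , k :* b := p) ∷ (k⁻ , p := # 0) ∷ [])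
    (zpow-inverse k BS.∷ h BS.∷ ev-zero p≃0 BS.∷ BS.[])
  from-lifts : Liftable b → Liftable c → (b ≈ᴮ ι []) ⊎ (c ≈ᴮ ι [])
  from-lifts (k , p , h) (l , q , h′) = from-zero (zero? p)
    where
    pq≃0 : p *ₚ q ≃ []
    pq≃0 = ev-injective-zero (p *ₚ q) (B.trans (ev-* p q) (BS.linear (b ∷ c ∷ zpow k ∷ zpow l ∷ ev p ∷ ev q ∷ [])
      (λ b c k l p q → (p :* q := # 0) , (k :* l , b :* c := # 0) ∷ (:- (l :* c) , k :* b := p) ∷ (:- p , l :* c := q) ∷ [])
      (e BS.∷ h BS.∷ h′ BS.∷ BS.[])))
    from-zero : Dec (p ≃ []) → (b ≈ᴮ ι []) ⊎ (c ≈ᴮ ι [])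
    from-zero (yes p≃0) = inj₁ (lower k h p≃0)
    from-zero (no p≄0)  = inj₂ (lower l h′ (domain p q pq≃0 p≄0))

square-zero : ∀ {p} → p *ₚ p ≃ [] → p ≃ []
square-zero {p} e with zero? p
... | yes z  = z
... | no p≄0 = domain p p e p≄0

-- x - θ z is a nonzero element of a domain, so its norm does not vanish.
no-root-poly : ∀ x z → x *ₚ x *ₚ x +ₚ (t +ₚ PS.fromℕ 2) *ₚ x *ₚ x *ₚ z +ₚ PS.fromℕ 2 *ₚ t *ₚ x *ₚ z *ₚ z +ₚ t *ₚ t *ₚ z *ₚ z *ₚ z ≃ [] → z ≃ []
no-root-poly x z e = from-domain (order-domain (x-θ x z) (adj (x-θ x z))
    (B.trans (*-adj (x-θ x z)) (ι-cong (≃-trans (norm-x-θz x z) e))))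
  where
  from-domain : (x-θ x z ≈ᴮ ι []) ⊎ (adj (x-θ x z) ≈ᴮ ι []) → z ≃ []
  from-domain (inj₁ h) = PS.linear (z ∷ []) (λ z → (z := # 0) , (:- # 1 , :- z := # 0) ∷ []) (proj₁ (proj₂ (elt-zero h)) PS.∷ PS.[])
  -- The last two coordinates of the adjoint differ by `t z²`.
  from-domain (inj₂ h) = square-zero (domain t (z *ₚ z) (PS.linear (t ∷ x ∷ z ∷ [])
    (λ t x z → (t :* (z :* z) := # 0) ,
      (# 1 , :- ((:- z) :* (x :- :- z) :+ (:- z) :* (:- z)) := # 0) ∷
      (# 1 , (t :+ # 1) :* (:- z) :* (:- z) :- (:- z) :* (:- z) :- (:- z) :* x := # 0) ∷
      (:- # 2 , :- ((:- z) :* (x :- :- z) :+ (:- z) :* (:- z)) := # 0) ∷ [])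
    (proj₁ (proj₂ (elt-zero h)) PS.∷ proj₂ (proj₂ (elt-zero h)) PS.∷ proj₁ (proj₂ (elt-zero h)) PS.∷ PS.[])) t≄0)

-- A nonzero denominator is what makes cross-multiplication transitive, so it is bundled with the
-- fraction.
record K : Set where
  constructor mkK
  field
    rf    : RF
    den≄0 : ¬ den rf ≃ []
open K public

infix 4 _≈ᴷ_
record _≈ᴷ_ (f g : K) : Set where
  constructor mk≈
  field cross : num (rf f) *ₚ den (rf g) ≃ num (rf g) *ₚ den (rf f)
open _≈ᴷ_ public

to≈ : ∀ {f g} → f ≈ᴷ g → rf f ≈ rf g
to≈ {f} {g} (mk≈ e) = ≃⇒isZero (PS.linear (num (rf f) *ₚ den (rf g) ∷ num (rf g) *ₚ den (rf f) ∷ [])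
  (λ p q → (p :- q := # 0) , (# 1 , p := q) ∷ []) (e PS.∷ PS.[]))

from≈ : ∀ {f g} → rf f ≈ rf g → f ≈ᴷ g
from≈ e = mk≈ (PS.x-y≈0⇒x≈y (isZero⇒≃ e))

κ≄0 : ¬ κ 1ℚ ≃ []
κ≄0 = Lead-≄0 (xpow-Lead 0)

infixl 6 _+ᴷ_
infixl 7 _*ᴷ_

opaque
  _+ᴷ_ _*ᴷ_ : K → K → K
  f +ᴷ g = mkK (rf f +ᶠ rf g) (≄0-* (den≄0 f) (den≄0 g))
  f *ᴷ g = mkK (rf f *ᶠ rf g) (≄0-* (den≄0 f) (den≄0 g))

  -ᴷ_ : K → K
  -ᴷ f = mkK (-ᶠ rf f) (den≄0 f)

  constᴷ : ℚ → K
  constᴷ c = mkK (const c) κ≄0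

private
  nums dens : K → Poly
  nums f = num (rf f)
  dens f = den (rf f)

≈ᴷ-trans : ∀ {f g h} → f ≈ᴷ g → g ≈ᴷ h → f ≈ᴷ h
≈ᴷ-trans {f} {g} {h} (mk≈ e) (mk≈ e′) = mk≈ (PD.cancel {dens g} (≄0⇒regular (den≄0 g))
  (PS.linear (nums f ∷ dens f ∷ nums g ∷ dens g ∷ nums h ∷ dens h ∷ [])
    (λ a b c d e f → (d :* (a :* f) := d :* (e :* b)) , (f , a :* d := c :* b) ∷ (b , c :* f := e :* d) ∷ [])
    (e PS.∷ e′ PS.∷ PS.[])))

opaque
  unfolding _+ᴷ_

  +ᴷ-cong : ∀ {f f′ g g′} → f ≈ᴷ f′ → g ≈ᴷ g′ → f +ᴷ g ≈ᴷ f′ +ᴷ g′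
  +ᴷ-cong {f} {f′} {g} {g′} (mk≈ e) (mk≈ e′) = mk≈ (PS.linear (nums f ∷ dens f ∷ nums f′ ∷ dens f′ ∷ nums g ∷ dens g ∷ nums g′ ∷ dens g′ ∷ [])
                    (λ a b a′ b′ c d c′ d′ → ((a :* d :+ c :* b) :* (b′ :* d′) := (a′ :* d′ :+ c′ :* b′) :* (b :* d)) ,
                      (d :* d′ , a :* b′ := a′ :* b) ∷ (b :* b′ , c :* d′ := c′ :* d) ∷ []) (e PS.∷ e′ PS.∷ PS.[]))
  *ᴷ-cong : ∀ {f f′ g g′} → f ≈ᴷ f′ → g ≈ᴷ g′ → f *ᴷ g ≈ᴷ f′ *ᴷ g′
  *ᴷ-cong {f} {f′} {g} {g′} (mk≈ e) (mk≈ e′) = mk≈ (PS.linear (nums f ∷ dens f ∷ nums f′ ∷ dens f′ ∷ nums g ∷ dens g ∷ nums g′ ∷ dens g′ ∷ [])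
          (λ a b a′ b′ c d c′ d′ → ((a :* c) :* (b′ :* d′) := (a′ :* c′) :* (b :* d)) ,
            (c :* d′ , a :* b′ := a′ :* b) ∷ (a′ :* b , c :* d′ := c′ :* d) ∷ []) (e PS.∷ e′ PS.∷ PS.[]))
  -ᴷ-cong : ∀ {f g} → f ≈ᴷ g → -ᴷ f ≈ᴷ -ᴷ g
  -ᴷ-cong {f} {g} (mk≈ e) = mk≈ (PS.linear (nums f ∷ dens f ∷ nums g ∷ dens g ∷ [])
              (λ a b c d → (:- a :* d := :- c :* b) , (:- # 1 , a :* d := c :* b) ∷ []) (e PS.∷ PS.[]))
  +ᴷ-assoc : ∀ f g h → (f +ᴷ g) +ᴷ h ≈ᴷ f +ᴷ (g +ᴷ h)
  +ᴷ-assoc f g h = mk≈ (PS.ringEq (nums f ∷ dens f ∷ nums g ∷ dens g ∷ nums h ∷ dens h ∷ [])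
                  (λ a b c d e f → ((a :* d :+ c :* b) :* f :+ e :* (b :* d)) :* (b :* (d :* f)) :=
                    (a :* (d :* f) :+ (c :* f :+ e :* d) :* b) :* (b :* d :* f)))
  *ᴷ-assoc : ∀ f g h → (f *ᴷ g) *ᴷ h ≈ᴷ f *ᴷ (g *ᴷ h)
  *ᴷ-assoc f g h = mk≈ (PS.ringEq (nums f ∷ dens f ∷ nums g ∷ dens g ∷ nums h ∷ dens h ∷ [])
          (λ a b c d e f → (a :* c :* e) :* (b :* (d :* f)) := (a :* (c :* e)) :* (b :* d :* f)))
  +ᴷ-comm : ∀ f g → f +ᴷ g ≈ᴷ g +ᴷ f
  +ᴷ-comm f g = mk≈ (PS.ringEq (nums f ∷ dens f ∷ nums g ∷ dens g ∷ [])
    (λ a b c d → (a :* d :+ c :* b) :* (d :* b) := (c :* b :+ a :* d) :* (b :* d)))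
  *ᴷ-comm : ∀ f g → f *ᴷ g ≈ᴷ g *ᴷ f
  *ᴷ-comm f g = mk≈ (PS.ringEq (nums f ∷ dens f ∷ nums g ∷ dens g ∷ [])
    (λ a b c d → (a :* c) :* (d :* b) := (c :* a) :* (b :* d)))
  +ᴷ-identityˡ : ∀ f → constᴷ 0ℚ +ᴷ f ≈ᴷ f
  +ᴷ-identityˡ f = mk≈ (PS.linear (nums f ∷ dens f ∷ κ 0ℚ ∷ []) (λ a b z → ((z :* b :+ a :* # 1) :* b := a :* (# 1 :* b)) , (b :* b , z := # 0) ∷ []) (κ-zero PS.∷ PS.[]))
  *ᴷ-identityˡ : ∀ f → constᴷ 1ℚ *ᴷ f ≈ᴷ f
  *ᴷ-identityˡ f = mk≈ (PS.ringEq (nums f ∷ dens f ∷ []) (λ a b → (# 1 :* a) :* b := a :* (# 1 :* b)))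
  +ᴷ-inverseˡ : ∀ f → (-ᴷ f) +ᴷ f ≈ᴷ constᴷ 0ℚ
  +ᴷ-inverseˡ f = mk≈ (PS.linear (nums f ∷ dens f ∷ κ 0ℚ ∷ []) (λ a b z → (((:- a) :* b :+ a :* b) :* # 1 := z :* (b :* b)) , (:- (b :* b) , z := # 0) ∷ []) (κ-zero PS.∷ PS.[]))
  *ᴷ-distribˡ : ∀ f g h → f *ᴷ (g +ᴷ h) ≈ᴷ f *ᴷ g +ᴷ f *ᴷ h
  *ᴷ-distribˡ f g h = mk≈ (PS.ringEq (nums f ∷ dens f ∷ nums g ∷ dens g ∷ nums h ∷ dens h ∷ [])
    (λ a b c d e f → (a :* (c :* f :+ e :* d)) :* (b :* d :* (b :* f)) := (a :* c :* (b :* f) :+ a :* e :* (b :* d)) :* (b :* (d :* f))))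

  *ᴷ-distribʳ : ∀ f g h → (g +ᴷ h) *ᴷ f ≈ᴷ g *ᴷ f +ᴷ h *ᴷ f
  *ᴷ-distribʳ f g h = ≈ᴷ-trans (*ᴷ-comm (g +ᴷ h) f) (≈ᴷ-trans (*ᴷ-distribˡ f g h) (mk≈ (PS.ringEq (nums f ∷ dens f ∷ nums g ∷ dens g ∷ nums h ∷ dens h ∷ [])
          (λ a b c d e f → (a :* c :* (b :* f) :+ a :* e :* (b :* d)) :* (d :* b :* (f :* b)) := (c :* a :* (f :* b) :+ e :* a :* (d :* b)) :* (b :* d :* (b :* f))))))

fieldRing : CommutativeRing 0ℓ 0ℓ
fieldRing = record
  { Carrier = K ; _≈_ = _≈ᴷ_ ; _+_ = _+ᴷ_ ; _*_ = _*ᴷ_ ; -_ = -ᴷ_ ; 0# = constᴷ 0ℚ ; 1# = constᴷ 1ℚ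
  ; isCommutativeRing = record
    { isRing = record
      { +-isAbelianGroup = record
        { isGroup = record
          { isMonoid = record
            { isSemigroup = record
              { isMagma = record
                { isEquivalence = record { refl = mk≈ ≃-refl ; sym = λ (mk≈ e) → mk≈ (≃-sym e) ; trans = ≈ᴷ-trans }
                ; ∙-cong = +ᴷ-cong }
              ; assoc = +ᴷ-assoc }
            ; identity = +ᴷ-identityˡ , λ f → ≈ᴷ-trans (+ᴷ-comm f (constᴷ 0ℚ)) (+ᴷ-identityˡ f) }
          ; inverse = +ᴷ-inverseˡ , λ f → ≈ᴷ-trans (+ᴷ-comm f (-ᴷ f)) (+ᴷ-inverseˡ f)
          ; ⁻¹-cong = -ᴷ-cong }
        ; comm = +ᴷ-comm }
      ; *-cong = *ᴷ-cong
      ; *-assoc = *ᴷ-assoc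
      ; *-identity = *ᴷ-identityˡ , λ f → ≈ᴷ-trans (*ᴷ-comm f (constᴷ 1ℚ)) (*ᴷ-identityˡ f)
      ; distrib = *ᴷ-distribˡ , *ᴷ-distribʳ }
    ; *-comm = *ᴷ-comm } }

module KS = LinearSolver fieldRing
module KR = CommutativeRing fieldRing

opaque
  unfolding _+ᴷ_

  num-zero : ∀ {f} → num (rf f) ≃ [] → f ≈ᴷ constᴷ 0ℚ
  num-zero {f} e = mk≈ (PS.linear (nums f ∷ dens f ∷ κ 0ℚ ∷ []) (λ a b z → (a :* # 1 := z :* b) , (# 1 , a := # 0) ∷ (:- b , z := # 0) ∷ []) (e PS.∷ κ-zero PS.∷ PS.[]))

  zero-num : ∀ {f} → f ≈ᴷ constᴷ 0ℚ → num (rf f) ≃ []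
  zero-num {f} (mk≈ e) = PS.linear (nums f ∷ dens f ∷ κ 0ℚ ∷ []) (λ a b z → (a := # 0) , (# 1 , a :* # 1 := z :* b) ∷ (b , z := # 0) ∷ []) (e PS.∷ κ-zero PS.∷ PS.[])

opaque
  _≟ᴷ_ : ∀ f g → Dec (f ≈ᴷ g)
  f ≟ᴷ g with rf f ≈? rf g
  ... | yes e = yes (from≈ e)
  ... | no ¬e = no λ e → ¬e (to≈ e)

-- The underlying fraction is literally `/ᶠ`, so slopes formed here coincide with those computed by
-- `_⊕_`.
divᴷ : ∀ f g → ¬ g ≈ᴷ constᴷ 0ℚ → K
divᴷ f g g≉0 = mkK (rf f /ᶠ rf g) (≄0-* (den≄0 f) (λ e → g≉0 (num-zero e)))

opaque
  unfolding _+ᴷ_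

  div-* : ∀ f g g≉0 → divᴷ f g g≉0 *ᴷ g ≈ᴷ f
  div-* f g _ = mk≈ (PS.ringEq (nums f ∷ dens f ∷ nums g ∷ dens g ∷ [])
    (λ a b c d → (a :* d :* c) :* b := a :* (b :* c :* d)))

⌊_⌋ : Poly → K
⌊ p ⌋ = mkK (p // κ 1ℚ) κ≄0

⌊⌋-cong : ∀ {p q} → p ≃ q → ⌊ p ⌋ ≈ᴷ ⌊ q ⌋
⌊⌋-cong e = mk≈ (*ₚ-cong e ≃-refl)

⌊⌋-injective : ∀ {p q} → ⌊ p ⌋ ≈ᴷ ⌊ q ⌋ → p ≃ q
⌊⌋-injective {p} {q} (mk≈ e) = PS.linear (p ∷ q ∷ []) (λ p q → (p := q) , (# 1 , p :* # 1 := q :* # 1) ∷ []) (e PS.∷ PS.[])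

opaque
  unfolding _+ᴷ_

  ⌊⌋-+ : ∀ p q → ⌊ p +ₚ q ⌋ ≈ᴷ ⌊ p ⌋ +ᴷ ⌊ q ⌋
  ⌊⌋-+ p q = mk≈ (PS.ringEq (p ∷ q ∷ []) (λ p q → (p :+ q) :* (# 1 :* # 1) := (p :* # 1 :+ q :* # 1) :* # 1))
  ⌊⌋-* : ∀ p q → ⌊ p *ₚ q ⌋ ≈ᴷ ⌊ p ⌋ *ᴷ ⌊ q ⌋
  ⌊⌋-* p q = mk≈ (PS.ringEq (p ∷ q ∷ []) (λ p q → (p :* q) :* (# 1 :* # 1) := (p :* q) :* # 1))
  ⌊⌋-neg : ∀ p → ⌊ negₚ p ⌋ ≈ᴷ -ᴷ ⌊ p ⌋
  ⌊⌋-neg p = mk≈ ≃-refl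
  ⌊⌋-1 : ⌊ 1ₚ ⌋ ≈ᴷ constᴷ 1ℚ
  ⌊⌋-1 = mk≈ ≃-refl

open Homomorphism polyRing fieldRing ⌊_⌋ ⌊⌋-cong ⌊⌋-+ ⌊⌋-* ⌊⌋-neg (num-zero ≃-refl) ⌊⌋-1
  using () renaming (holds to ⌊⌋-holds; value to ⌊⌋-value; reflects to ⌊⌋-reflects) public

opaque
  unfolding _+ᴷ_

  fraction : ∀ f → f *ᴷ ⌊ den (rf f) ⌋ ≈ᴷ ⌊ num (rf f) ⌋
  fraction f = mk≈ (PS.ringEq (nums f ∷ dens f ∷ []) (λ a b → (a :* b) :* # 1 := a :* (b :* # 1)))

opaque
  inverseᴷ : ∀ {f} → ¬ f ≈ᴷ constᴷ 0ℚ → ∃[ g ] g *ᴷ f ≈ᴷ constᴷ 1ℚ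
  inverseᴷ {f} f≉0 = divᴷ (constᴷ 1ℚ) f f≉0 , div-* (constᴷ 1ℚ) f f≉0

⌊⌋≉0 : ∀ {p} → ¬ p ≃ [] → ¬ ⌊ p ⌋ ≈ᴷ constᴷ 0ℚ
⌊⌋≉0 p≄0 e = p≄0 (zero-num e)

opaque
  unfolding _+ᴷ_

  2≉0ᴷ : ¬ KS.fromℕ 2 ≈ᴷ constᴷ 0ℚ
  2≉0ᴷ e = absurd (at (zero-num {KS.fromℕ 2} e) 0)
    where
    absurd : ¬ coeff (num (rf (KS.fromℕ 2))) 0 ≡ 0ℚ
    absurd ()

-- The group of points

validᴷ : ∀ f → Valid f → ¬ den f ≃ []
validᴷ f v e = v (≃⇒isZero e)

K-computation : ∀ {f g} → {True (rf f ≈? rf g)} → f ≈ᴷ g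
K-computation {f} {g} {w} = from≈ (toWitness w)

A₂ᴷ A₄ᴷ A₆ᴷ sᴷ : K
A₂ᴷ = mkK A₂ λ e → absurd (at e 0)
  where absurd : ¬ coeff (den A₂) 0 ≡ 0ℚ
        absurd ()
A₄ᴷ = mkK A₄ λ e → absurd (at e 0)
  where absurd : ¬ coeff (den A₄) 0 ≡ 0ℚ
        absurd ()
A₆ᴷ = mkK A₆ λ e → absurd (at e 0)
  where absurd : ¬ coeff (den A₆) 0 ≡ 0ℚ
        absurd ()
sᴷ = constᴷ (+ 262 ℚ./ 13)

tᴷ a₂ᴷ a₄ᴷ a₆ᴷ : K
tᴷ  = ⌊ t ⌋
a₂ᴷ = tᴷ +ᴷ KS.fromℕ 2
a₄ᴷ = KS.fromℕ 2 *ᴷ tᴷ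
a₆ᴷ = tᴷ *ᴷ tᴷ

opaque
  unfolding t _+ᴷ_

  A₂-eq : A₂ᴷ ≈ᴷ KS.fromℕ 3 *ᴷ sᴷ +ᴷ KS.fromℕ 4 *ᴷ a₂ᴷ
  A₂-eq = K-computation
  A₄-eq : A₄ᴷ ≈ᴷ KS.fromℕ 3 *ᴷ sᴷ *ᴷ sᴷ +ᴷ KS.fromℕ 8 *ᴷ a₂ᴷ *ᴷ sᴷ +ᴷ KS.fromℕ 16 *ᴷ a₄ᴷ
  A₄-eq = K-computation
  A₆-eq : A₆ᴷ ≈ᴷ sᴷ *ᴷ sᴷ *ᴷ sᴷ +ᴷ KS.fromℕ 4 *ᴷ a₂ᴷ *ᴷ sᴷ *ᴷ sᴷ +ᴷ KS.fromℕ 16 *ᴷ a₄ᴷ *ᴷ sᴷ +ᴷ KS.fromℕ 64 *ᴷ a₆ᴷ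
  A₆-eq = K-computation

open Rescale fieldRing public
module CL = Cubic fieldRing a₂ᴷ a₄ᴷ a₆ᴷ
module OL = Cubic fieldRing A₂ᴷ A₄ᴷ A₆ᴷ

integralᴷ : ∀ {x y} → ¬ x ≈ᴷ constᴷ 0ℚ → x *ᴷ y ≈ᴷ constᴷ 0ℚ → y ≈ᴷ constᴷ 0ℚ
integralᴷ {x} {y} x≉0 e = from-inverse (inverseᴷ x≉0)
  where
  from-inverse : ∃[ i ] i *ᴷ x ≈ᴷ constᴷ 1ℚ → y ≈ᴷ constᴷ 0ℚ
  from-inverse (i , ix) = KS.linear (x ∷ y ∷ i ∷ []) (λ x y i → (y := # 0) , (:- y , i :* x := # 1) ∷ (i , x :* y := # 0) ∷ []) (ix KS.∷ e KS.∷ KS.[])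

opaque
  no-root-clean : ∀ u → ¬ CL.rhs u ≈ᴷ constᴷ 0ℚ
  no-root-clean u e = den≄0 u (no-root-poly n d (⌊⌋-injective (KR.trans
      (⌊⌋-value (t ∷ n ∷ d ∷ []) (λ t n d → n :* n :* n :+ (t :+ # 2) :* n :* n :* d :+ # 2 :* t :* n :* d :* d :+ t :* t :* d :* d :* d))
      (KR.trans (KS.linear (tᴷ ∷ ⌊ n ⌋ ∷ ⌊ d ⌋ ∷ u ∷ [])
        (λ t n d u → (n :* n :* n :+ (t :+ # 2) :* n :* n :* d :+ # 2 :* t :* n :* d :* d :+ t :* t :* d :* d :* d := # 0) ,
          (d :* d :* d , u :* u :* u :+ (t :+ # 2) :* u :* u :+ # 2 :* t :* u :+ t :* t := # 0) ∷
          (:- (n :* n :+ n :* (u :* d) :+ (u :* d) :* (u :* d) :+ (t :+ # 2) :* d :* (n :+ u :* d) :+ # 2 :* t :* d :* d) , u :* d := n) ∷ [])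
        (e KS.∷ fraction u KS.∷ KS.[])) (KR.sym (num-zero {⌊ [] ⌋} ≃-refl))))))
    where
    n d : Poly
    n = num (rf u)
    d = den (rf u)

opaque
  unfolding _+ᴷ_

  quarter : ∃[ q ] q *ᴷ KS.fromℕ 4 ≈ᴷ constᴷ 1ℚ
  quarter = constᴷ (+ 1 ℚ./ 4) , K-computation

opaque
  no-root : ∀ x → ¬ OL.rhs x ≈ᴷ constᴷ 0ℚ
  no-root x e = no-root-clean u (KS.linear (CL.rhs u ∷ q ∷ [])
      (λ r q → (r := # 0) , (q :* q :* q , # 64 :* r := # 0) ∷ (:- (r :* (# 16 :* q :* q :+ # 4 :* q :+ # 1)) , q :* # 4 := # 1) ∷ [])
      (KR.trans (KR.sym (rescale-rhs A₂-eq A₄-eq A₆-eq x-u)) e KS.∷ proj₂ quarter KS.∷ KS.[]))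
    where
    q u : K
    q = proj₁ quarter
    u = q *ᴷ (x +ᴷ sᴷ)
    x-u : x ≈ᴷ KS.fromℕ 4 *ᴷ u +ᴷ -ᴷ sᴷ
    x-u = KS.linear (x ∷ q ∷ sᴷ ∷ []) (λ x q s → (x := # 4 :* (q :* (x :+ s)) :- s) , (:- (x :+ s) , q :* # 4 := # 1) ∷ []) (proj₂ quarter KS.∷ KS.[])

module OG = OL.GroupLaw _≟ᴷ_ inverseᴷ 2≉0ᴷ no-root
module CG = CL.GroupLaw _≟ᴷ_ inverseᴷ 2≉0ᴷ no-root-clean
open OG using (Point; ∞; pt; _~_; neg; Zero) public

record Elem : Set where
  constructor mkElem
  field
    point : Pt
    onCurve : OnCurve point
open Elem public

⌜_⌝ : Elem → Point
⌜ mkElem O         _             ⌝ = ∞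
⌜ mkElem (aff x y) (vx , vy , _) ⌝ = pt (mkK x (validᴷ x vx)) (mkK y (validᴷ y vy))

opaque
  unfolding _+ᴷ_

  point-on-curve : ∀ {x y} → y *ᴷ y ≈ᴷ OL.rhs x → OnCurve (aff (rf x) (rf y))
  point-on-curve {x} {y} e = (λ z → den≄0 x (isZero⇒≃ z)) , (λ z → den≄0 y (isZero⇒≃ z)) , to≈ e

-- The given chord and tangent addition in terms of collinear triples

sumPoint : RF → RF → RF → RF → Pt
sumPoint l x₃ x₁ y₁ = aff x₃ (-ᶠ (l *ᶠ (x₃ -ᶠ x₁) +ᶠ y₁))

-- The predicates are opaque because case analysis normalises the types involved.
opaque
  ChordSlope : RF → RF → RF → RF → RF → Set
  ChordSlope x₁ y₁ x₂ y₂ l = l ≡ (y₂ -ᶠ y₁) /ᶠ (x₂ -ᶠ x₁)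

  chordSlope : ∀ x₁ y₁ x₂ y₂ → ChordSlope x₁ y₁ x₂ y₂ ((y₂ -ᶠ y₁) /ᶠ (x₂ -ᶠ x₁))
  chordSlope _ _ _ _ = refl

  TangentSlope : RF → RF → RF → Set
  TangentSlope x₁ y₁ l = l ≡ (three *ᶠ x₁ *ᶠ x₁ +ᶠ two *ᶠ A₂ *ᶠ x₁ +ᶠ A₄) /ᶠ (two *ᶠ y₁)

  tangentSlope : ∀ x₁ y₁ → TangentSlope x₁ y₁ ((three *ᶠ x₁ *ᶠ x₁ +ᶠ two *ᶠ A₂ *ᶠ x₁ +ᶠ A₄) /ᶠ (two *ᶠ y₁))
  tangentSlope _ _ = refl

  ThirdAbscissa : RF → RF → RF → RF → Set
  ThirdAbscissa l x₁ x₂ x₃ = x₃ ≡ l *ᶠ l -ᶠ A₂ -ᶠ x₁ -ᶠ x₂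

  thirdAbscissa : ∀ l x₁ x₂ → ThirdAbscissa l x₁ x₂ (l *ᶠ l -ᶠ A₂ -ᶠ x₁ -ᶠ x₂)
  thirdAbscissa _ _ _ = refl

data SumView (x₁ y₁ x₂ y₂ : RF) : Pt → Set where
  by-chord   : ¬ x₁ ≈ x₂ → ∀ l x₃ → ChordSlope x₁ y₁ x₂ y₂ l → ThirdAbscissa l x₁ x₂ x₃ →
    SumView x₁ y₁ x₂ y₂ (sumPoint l x₃ x₁ y₁)
  opposite   : x₁ ≈ x₂ → y₁ +ᶠ y₂ ≈ const 0ℚ → SumView x₁ y₁ x₂ y₂ O
  by-tangent : x₁ ≈ x₂ → ¬ y₁ +ᶠ y₂ ≈ const 0ℚ →
    ∀ l x₃ → TangentSlope x₁ y₁ l → ThirdAbscissa l x₁ x₂ x₃ → SumView x₁ y₁ x₂ y₂ (sumPoint l x₃ x₁ y₁)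

sumView : ∀ x₁ y₁ x₂ y₂ → SumView x₁ y₁ x₂ y₂ (aff x₁ y₁ ⊕ aff x₂ y₂)
sumView x₁ y₁ x₂ y₂ with x₁ ≈? x₂
... | no x≉ = by-chord x≉ ((y₂ -ᶠ y₁) /ᶠ (x₂ -ᶠ x₁)) _ (chordSlope x₁ y₁ x₂ y₂) (thirdAbscissa ((y₂ -ᶠ y₁) /ᶠ (x₂ -ᶠ x₁)) x₁ x₂)
... | yes x≈ with (y₁ +ᶠ y₂) ≈? const 0ℚ
...   | yes s≈0 = opposite x≈ s≈0
...   | no s≉0  = by-tangent x≈ s≉0 ((three *ᶠ x₁ *ᶠ x₁ +ᶠ two *ᶠ A₂ *ᶠ x₁ +ᶠ A₄) /ᶠ (two *ᶠ y₁)) _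
        (tangentSlope x₁ y₁) (thirdAbscissa ((three *ᶠ x₁ *ᶠ x₁ +ᶠ two *ᶠ A₂ *ᶠ x₁ +ᶠ A₄) /ᶠ (two *ᶠ y₁)) x₁ x₂)

twoᴷ threeᴷ : K
twoᴷ   = mkK two κ≄0
threeᴷ = mkK three κ≄0

opaque
  unfolding _+ᴷ_

  three-eq : threeᴷ ≈ᴷ KS.fromℕ 3
  three-eq = K-computation

  two-eq : twoᴷ ≈ᴷ KS.fromℕ 2
  two-eq = K-computation

module Sum (X₁ Y₁ X₂ Y₂ : K) (C₁ : Y₁ *ᴷ Y₁ ≈ᴷ OL.rhs X₁) (C₂ : Y₂ *ᴷ Y₂ ≈ᴷ OL.rhs X₂) where
  X₃ : K → K
  X₃ l = l *ᴷ l +ᴷ -ᴷ A₂ᴷ +ᴷ -ᴷ X₁ +ᴷ -ᴷ X₂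

  SumLine : K → Set
  SumLine l = OL.Line X₁ Y₁ X₂ Y₂ (X₃ l) (l *ᴷ (X₃ l +ᴷ -ᴷ X₁) +ᴷ Y₁)

  d≉0 : ¬ X₁ ≈ᴷ X₂ → ¬ X₂ +ᴷ -ᴷ X₁ ≈ᴷ constᴷ 0ℚ
  d≉0 x≉ e = x≉ (KR.sym (KS.x-y≈0⇒x≈y e))

  chord-line : (x≉ : ¬ X₁ ≈ᴷ X₂) → SumLine (divᴷ (Y₂ +ᴷ -ᴷ Y₁) (X₂ +ᴷ -ᴷ X₁) (d≉0 x≉))
  chord-line x≉ = OL.line-cong KR.refl KR.refl KR.refl
    (KS.linear (l ∷ X₁ ∷ X₂ ∷ Y₁ ∷ Y₂ ∷ []) (λ l x₁ x₂ y₁ y₂ → (l :* (x₂ :- x₁) :+ y₁ := y₂) , (# 1 , l :* (x₂ :- x₁) := y₂ :- y₁) ∷ []) (h KS.∷ KS.[]))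
    KR.refl KR.refl (OG.chord C₁ C₂ x≉ h KR.refl)
    where
    l : K
    l = divᴷ (Y₂ +ᴷ -ᴷ Y₁) (X₂ +ᴷ -ᴷ X₁) (d≉0 x≉)
    h : l *ᴷ (X₂ +ᴷ -ᴷ X₁) ≈ᴷ Y₂ +ᴷ -ᴷ Y₁
    h = div-* (Y₂ +ᴷ -ᴷ Y₁) (X₂ +ᴷ -ᴷ X₁) (d≉0 x≉)

  2y≉0 : ¬ twoᴷ *ᴷ Y₁ ≈ᴷ constᴷ 0ℚ
  2y≉0 e = OG.2y≉0 C₁ (KR.trans (KR.*-congʳ (KR.sym two-eq)) e)

  same-y : X₁ ≈ᴷ X₂ → ¬ Y₁ +ᴷ Y₂ ≈ᴷ constᴷ 0ℚ → Y₁ ≈ᴷ Y₂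
  same-y x≈ s≉0 = KS.x-y≈0⇒x≈y (integralᴷ s≉0 (KS.linear (X₁ ∷ X₂ ∷ Y₁ ∷ Y₂ ∷ A₂ᴷ ∷ A₄ᴷ ∷ A₆ᴷ ∷ [])
    (λ x₁ x₂ y₁ y₂ a₂ a₄ a₆ → ((y₁ :+ y₂) :* (y₁ :- y₂) := # 0) ,
      (# 1 , y₁ :* y₁ := x₁ :* x₁ :* x₁ :+ a₂ :* x₁ :* x₁ :+ a₄ :* x₁ :+ a₆) ∷
      (:- # 1 , y₂ :* y₂ := x₂ :* x₂ :* x₂ :+ a₂ :* x₂ :* x₂ :+ a₄ :* x₂ :+ a₆) ∷
      (x₁ :* x₁ :+ x₁ :* x₂ :+ x₂ :* x₂ :+ a₂ :* (x₁ :+ x₂) :+ a₄ , x₁ := x₂) ∷ [])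
    (C₁ KS.∷ C₂ KS.∷ x≈ KS.∷ KS.[])))

  tangentNum : K
  tangentNum = threeᴷ *ᴷ X₁ *ᴷ X₁ +ᴷ twoᴷ *ᴷ A₂ᴷ *ᴷ X₁ +ᴷ A₄ᴷ

  tangent-line : X₁ ≈ᴷ X₂ → ¬ Y₁ +ᴷ Y₂ ≈ᴷ constᴷ 0ℚ → SumLine (divᴷ tangentNum (twoᴷ *ᴷ Y₁) 2y≉0)
  tangent-line x≈ s≉0 = OL.line-cong KR.refl KR.refl x≈
    (KS.linear (l ∷ X₁ ∷ Y₁ ∷ Y₂ ∷ []) (λ l x y y₂ → (l :* (x :- x) :+ y := y₂) , (# 1 , y := y₂) ∷ []) (same-y x≈ s≉0 KS.∷ KS.[]))
    KR.refl KR.refl (OL.tangent C₁ h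
      (KS.linear (l ∷ A₂ᴷ ∷ X₁ ∷ X₂ ∷ []) (λ l a x x₂ → (l :* l :- a :- x :- x₂ := l :* l :- a :- x :- x) , (# 1 , x := x₂) ∷ []) (x≈ KS.∷ KS.[])))
    where
    l : K
    l = divᴷ tangentNum (twoᴷ *ᴷ Y₁) 2y≉0
    h : l *ᴷ (KS.fromℕ 2 *ᴷ Y₁) ≈ᴷ KS.fromℕ 3 *ᴷ X₁ *ᴷ X₁ +ᴷ KS.fromℕ 2 *ᴷ A₂ᴷ *ᴷ X₁ +ᴷ A₄ᴷ
    h = KS.linear (l ∷ twoᴷ ∷ threeᴷ ∷ X₁ ∷ Y₁ ∷ A₂ᴷ ∷ A₄ᴷ ∷ [])
      (λ l two three x y a₂ a₄ → (l :* (# 2 :* y) := # 3 :* x :* x :+ # 2 :* a₂ :* x :+ a₄) ,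
        (# 1 , l :* (two :* y) := three :* x :* x :+ two :* a₂ :* x :+ a₄) ∷
        (a₂ :* x :- l :* y , two := # 2) ∷ (x :* x , three := # 3) ∷ [])
      (div-* tangentNum (twoᴷ *ᴷ Y₁) 2y≉0 KS.∷ two-eq KS.∷ three-eq KS.∷ KS.[])

  third : K → K → K
  third l x₃ = -ᴷ (l *ᴷ (x₃ +ᴷ -ᴷ X₁) +ᴷ Y₁)

  third-on-curve : ∀ {l} → SumLine l → third l (X₃ l) *ᴷ third l (X₃ l) ≈ᴷ OL.rhs (X₃ l)
  third-on-curve L = OL.on-curve (OL.negate (OL.swap₁₂ (OL.swap₂₃ L)))

  third-zero : ∀ {l} → SumLine l → Zero (pt X₁ Y₁) (pt X₂ Y₂) (neg (pt (X₃ l) (third l (X₃ l))))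
  third-zero {l} L = OG.zL (OL.line-cong KR.refl KR.refl KR.refl KR.refl KR.refl
    (KR.sym (Algebra.Properties.Ring.-‿involutive KR.ring (l *ᴷ (X₃ l +ᴷ -ᴷ X₁) +ᴷ Y₁))) L)

  opposite-zero : X₁ ≈ᴷ X₂ → Y₁ +ᴷ Y₂ ≈ᴷ constᴷ 0ℚ → Zero (pt X₁ Y₁) (pt X₂ Y₂) ∞
  opposite-zero x≈ s≈ = OG.z₃ x≈ (KS.linear (Y₁ ∷ Y₂ ∷ []) (λ y₁ y₂ → (y₁ := :- y₂) , (# 1 , y₁ :+ y₂ := # 0) ∷ []) (s≈ KS.∷ KS.[]))

opaque
  unfolding _+ᴷ_ ChordSlope TangentSlope ThirdAbscissa

  add-aff : ∀ {x₁ y₁ x₂ y₂} (vx₁ : Valid x₁) (vy₁ : Valid y₁) (vx₂ : Valid x₂) (vy₂ : Valid y₂) →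
    let X₁ = mkK x₁ (validᴷ x₁ vx₁) ; Y₁ = mkK y₁ (validᴷ y₁ vy₁) ; X₂ = mkK x₂ (validᴷ x₂ vx₂) ; Y₂ = mkK y₂ (validᴷ y₂ vy₂) in
    y₁ *ᶠ y₁ ≈ x₁ *ᶠ x₁ *ᶠ x₁ +ᶠ A₂ *ᶠ x₁ *ᶠ x₁ +ᶠ A₄ *ᶠ x₁ +ᶠ A₆ →
    y₂ *ᶠ y₂ ≈ x₂ *ᶠ x₂ *ᶠ x₂ +ᶠ A₂ *ᶠ x₂ *ᶠ x₂ +ᶠ A₄ *ᶠ x₂ +ᶠ A₆ →
    Σ (OnCurve (aff x₁ y₁ ⊕ aff x₂ y₂)) λ o → Zero (pt X₁ Y₁) (pt X₂ Y₂) (neg ⌜ mkElem (aff x₁ y₁ ⊕ aff x₂ y₂) o ⌝)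
  add-aff {x₁} {y₁} {x₂} {y₂} vx₁ vy₁ vx₂ vy₂ c₁ c₂ = from-view (sumView x₁ y₁ x₂ y₂)
    where
    X₁ Y₁ X₂ Y₂ : K
    X₁ = mkK x₁ (validᴷ x₁ vx₁)
    Y₁ = mkK y₁ (validᴷ y₁ vy₁)
    X₂ = mkK x₂ (validᴷ x₂ vx₂)
    Y₂ = mkK y₂ (validᴷ y₂ vy₂)
    C₁ : Y₁ *ᴷ Y₁ ≈ᴷ OL.rhs X₁
    C₁ = from≈ {Y₁ *ᴷ Y₁} {OL.rhs X₁} c₁
    C₂ : Y₂ *ᴷ Y₂ ≈ᴷ OL.rhs X₂
    C₂ = from≈ {Y₂ *ᴷ Y₂} {OL.rhs X₂} c₂
    module S = Sum X₁ Y₁ X₂ Y₂ C₁ C₂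
    ≉ᴷ : ¬ x₁ ≈ x₂ → ¬ X₁ ≈ᴷ X₂
    ≉ᴷ x≉ e = x≉ (to≈ {X₁} {X₂} e)
    sum≉0 : ¬ y₁ +ᶠ y₂ ≈ const 0ℚ → ¬ Y₁ +ᴷ Y₂ ≈ᴷ constᴷ 0ℚ
    sum≉0 s≉ e = s≉ (to≈ {Y₁ +ᴷ Y₂} {constᴷ 0ℚ} e)
    line-case : ∀ l x₃ L → rf L ≡ l → ThirdAbscissa l x₁ x₂ x₃ → S.SumLine L →
      Σ (OnCurve (sumPoint l x₃ x₁ y₁)) λ o → Zero (pt X₁ Y₁) (pt X₂ Y₂) (neg ⌜ mkElem (sumPoint l x₃ x₁ y₁) o ⌝)
    line-case _ _ L refl refl line = point-on-curve {S.X₃ L} {S.third L (S.X₃ L)} (S.third-on-curve {L} line) ,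
      OG.zero-cong OG.~-refl OG.~-refl (pt (mk≈ ≃-refl) (mk≈ ≃-refl)) (S.third-zero {L} line)
    from-view : ∀ {S} → SumView x₁ y₁ x₂ y₂ S → Σ (OnCurve S) λ o → Zero (pt X₁ Y₁) (pt X₂ Y₂) (neg ⌜ mkElem S o ⌝)
    from-view (by-chord x≉ l x₃ e e₃)      = line-case l x₃ (divᴷ (Y₂ +ᴷ -ᴷ Y₁) (X₂ +ᴷ -ᴷ X₁) (S.d≉0 (≉ᴷ x≉))) (≡.sym e) e₃ (S.chord-line (≉ᴷ x≉))
    from-view (by-tangent x≈ s≉ l x₃ e e₃) = line-case l x₃ (divᴷ S.tangentNum (twoᴷ *ᴷ Y₁) S.2y≉0) (≡.sym e) e₃
      (S.tangent-line (from≈ {X₁} {X₂} x≈) (sum≉0 s≉))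
    from-view (opposite x≈ s≈) = tt , S.opposite-zero (from≈ {X₁} {X₂} x≈) (from≈ {Y₁ +ᴷ Y₂} {constᴷ 0ℚ} s≈)

add : ∀ A B → Σ (OnCurve (point A ⊕ point B)) λ o → Zero ⌜ A ⌝ ⌜ B ⌝ (neg ⌜ mkElem (point A ⊕ point B) o ⌝)
add (mkElem O _) (mkElem O o)         = o , OG.z₀
add (mkElem O _) (mkElem (aff x y) o) = o , OG.z₁ KR.refl (KR.sym (Algebra.Properties.Ring.-‿involutive KR.ring _))
add (mkElem (aff x y) o) (mkElem O _) = o , OG.z₂ KR.refl (KR.sym (Algebra.Properties.Ring.-‿involutive KR.ring _))
add (mkElem (aff x₁ y₁) (vx₁ , vy₁ , c₁)) (mkElem (aff x₂ y₂) (vx₂ , vy₂ , c₂)) = add-aff vx₁ vy₁ vx₂ vy₂ c₁ c₂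

-- The abelian group of points

infix 4 _≋_
infixl 6 _∙_

opaque
  _≋_ : Elem → Elem → Set
  A ≋ B = ⌜ A ⌝ ~ ⌜ B ⌝

  mk≋ : ∀ {A B} → ⌜ A ⌝ ~ ⌜ B ⌝ → A ≋ B
  mk≋ e = e

  same : ∀ {A B} → A ≋ B → ⌜ A ⌝ ~ ⌜ B ⌝
  same e = e

opaque
  _∙_ : Elem → Elem → Elem
  A ∙ B = mkElem (point A ⊕ point B) (proj₁ (add A B))

  point-∙ : ∀ A B → point (A ∙ B) ≡ point A ⊕ point B
  point-∙ A B = refl

  ∙-zero : ∀ A B → Zero ⌜ A ⌝ ⌜ B ⌝ (neg ⌜ A ∙ B ⌝)
  ∙-zero A B = proj₂ (add A B)

zero⇒~ : ∀ A B {C} → Zero ⌜ A ⌝ ⌜ B ⌝ C → ⌜ A ∙ B ⌝ ~ neg C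
zero⇒~ A B {C} h = OG.~-trans (OG.~-sym (OG.neg-neg ⌜ A ∙ B ⌝)) (OG.neg-cong (OG.zero-unique (∙-zero A B) h))

opaque
  unfolding _+ᴷ_

  inv : Elem → Elem
  inv (mkElem O _) = mkElem O tt
  inv (mkElem (aff x y) (vx , vy , c)) = mkElem (aff x (-ᶠ y)) (point-on-curve {X′} { -ᴷ Y}
    (KR.trans (KS.ringEq (Y ∷ []) (λ y → :- y :* :- y := y :* y)) (from≈ {Y *ᴷ Y} {OL.rhs X′} c)))
    where
    X′ Y : K
    X′ = mkK x (validᴷ x vx)
    Y = mkK y (validᴷ y vy)

  point-inv : ∀ A → point (inv A) ≡ ⊖ point A
  point-inv (mkElem O _)         = refl
  point-inv (mkElem (aff x y) _) = refl

  inv-neg : ∀ A → ⌜ inv A ⌝ ~ neg ⌜ A ⌝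
  inv-neg (mkElem O _)         = ∞
  inv-neg (mkElem (aff x y) _) = pt (mk≈ ≃-refl) (mk≈ ≃-refl)

ε : Elem
ε = mkElem O tt

∙-assoc : ∀ A B C → (A ∙ B) ∙ C ≋ A ∙ (B ∙ C)
∙-assoc A B C = mk≋ (OG.~-sym (OG.~-trans
  (zero⇒~ A (B ∙ C) (OG.zero-cong OG.~-refl (OG.neg-neg ⌜ B ∙ C ⌝) OG.~-refl
    (OG.zero-assoc (∙-zero A B) (OG.zero-cong (OG.~-sym (OG.neg-neg ⌜ A ∙ B ⌝)) OG.~-refl OG.~-refl (∙-zero (A ∙ B) C)) (∙-zero B C))))
  (OG.neg-neg ⌜ (A ∙ B) ∙ C ⌝)))

∙-comm : ∀ A B → A ∙ B ≋ B ∙ A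
∙-comm A B = mk≋ (OG.~-trans (zero⇒~ A B (OG.zero-12 (∙-zero B A))) (OG.neg-neg ⌜ B ∙ A ⌝))

∙-cong : ∀ {A A′ B B′} → A ≋ A′ → B ≋ B′ → A ∙ B ≋ A′ ∙ B′
∙-cong {A} {A′} {B} {B′} e f = mk≋ (OG.~-trans
  (zero⇒~ A B (OG.zero-cong (OG.~-sym (same e)) (OG.~-sym (same f)) OG.~-refl (∙-zero A′ B′))) (OG.neg-neg ⌜ A′ ∙ B′ ⌝))

∙-identityˡ : ∀ A → ε ∙ A ≋ A
∙-identityˡ A = mk≋ (OG.~-trans (zero⇒~ ε A (OG.∞-zero (OG.~-sym (OG.neg-neg ⌜ A ⌝)))) (OG.neg-neg ⌜ A ⌝))

∙-inverseʳ : ∀ A → A ∙ inv A ≋ ε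
∙-inverseʳ A = mk≋ (zero⇒~ A (inv A) (OG.zero-cong OG.~-refl (OG.~-sym (inv-neg A)) OG.~-refl (OG.inverse-zero ⌜ A ⌝)))

inv-cong : ∀ {A B} → A ≋ B → inv A ≋ inv B
inv-cong {A} {B} e = mk≋ (OG.~-trans (inv-neg A) (OG.~-trans (OG.neg-cong (same e)) (OG.~-sym (inv-neg B))))

≋-trans : ∀ {A B C} → A ≋ B → B ≋ C → A ≋ C
≋-trans e f = mk≋ (OG.~-trans (same e) (same f))

pointGroup : AbelianGroup 0ℓ 0ℓ
pointGroup = record
  { Carrier = Elem ; _≈_ = _≋_ ; _∙_ = _∙_ ; ε = ε ; _⁻¹ = inv
  ; isAbelianGroup = record
    { isGroup = record
      { isMonoid = record
        { isSemigroup = record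
          { isMagma = record
            { isEquivalence = record { refl = mk≋ OG.~-refl ; sym = λ e → mk≋ (OG.~-sym (same e)) ; trans = ≋-trans }
            ; ∙-cong = ∙-cong }
          ; assoc = ∙-assoc }
        ; identity = ∙-identityˡ , λ A → ≋-trans (∙-comm A ε) (∙-identityˡ A) }
      ; inverse = (λ A → ≋-trans (∙-comm (inv A) A) (∙-inverseʳ A)) , ∙-inverseʳ
      ; ⁻¹-cong = inv-cong }
    ; comm = ∙-comm } }

module PG = AbelianGroup pointGroup

-- Integer multiples

module Multiples {c ℓ} (G : AbelianGroup c ℓ) where
  open AbelianGroup G renaming (_≈_ to _≈ᴳ_; _∙_ to _⊹_; ε to 0ᴳ; ∙-cong to ⊹-cong; ∙-congˡ to ⊹-congˡ; ∙-congʳ to ⊹-congʳ)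
    hiding (refl; sym; trans)
  open Algebra.Properties.AbelianGroup G using (⁻¹-∙-comm; ⁻¹-involutive; ε⁻¹≈ε)
  open Algebra.Properties.CommutativeSemigroup commutativeSemigroup using (interchange)
  open Algebra.Properties.Monoid.Mult monoid using (×-homo-+) renaming (_×_ to _×ᴳ_)
  open Relation.Binary.Reasoning.Setoid setoid

  infixr 8 _⊡_
  _⊡_ : ℤ → Carrier → Carrier
  (+ n)    ⊡ x = n ×ᴳ x
  -[1+ n ] ⊡ x = (suc n ×ᴳ x) ⁻¹

  ⊡-⊖ : ∀ m n x → (m ℤ.⊖ n) ⊡ x ≈ᴳ (m ×ᴳ x) ⊹ (n ×ᴳ x) ⁻¹
  ⊡-⊖ m zero x = begin
    (m ℤ.⊖ 0) ⊡ x         ≡⟨ cong (_⊡ x) (ℤP.⊖-≥ {m} z≤n) ⟩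
    m ×ᴳ x                ≈⟨ identityʳ (m ×ᴳ x) ⟨
    (m ×ᴳ x) ⊹ 0ᴳ         ≈⟨ ⊹-congˡ ε⁻¹≈ε ⟨
    (m ×ᴳ x) ⊹ 0ᴳ ⁻¹      ∎
  ⊡-⊖ zero (suc n) x = AbelianGroup.sym G (identityˡ _)
  ⊡-⊖ (suc m) (suc n) x = begin
    (suc m ℤ.⊖ suc n) ⊡ x                       ≡⟨ cong (_⊡ x) (ℤP.[1+m]⊖[1+n]≡m⊖n m n) ⟩
    (m ℤ.⊖ n) ⊡ x                               ≈⟨ ⊡-⊖ m n x ⟩
    (m ×ᴳ x) ⊹ (n ×ᴳ x) ⁻¹                      ≈⟨ identityˡ _ ⟨
    0ᴳ ⊹ ((m ×ᴳ x) ⊹ (n ×ᴳ x) ⁻¹)               ≈⟨ ⊹-congʳ (inverseʳ x) ⟨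
    (x ⊹ x ⁻¹) ⊹ ((m ×ᴳ x) ⊹ (n ×ᴳ x) ⁻¹)       ≈⟨ interchange x (x ⁻¹) (m ×ᴳ x) ((n ×ᴳ x) ⁻¹) ⟩
    (x ⊹ (m ×ᴳ x)) ⊹ (x ⁻¹ ⊹ (n ×ᴳ x) ⁻¹)       ≈⟨ ⊹-congˡ (⁻¹-∙-comm x (n ×ᴳ x)) ⟩
    (x ⊹ (m ×ᴳ x)) ⊹ (x ⊹ (n ×ᴳ x)) ⁻¹          ∎

  ⊡-+ : ∀ m n x → (m ℤ.+ n) ⊡ x ≈ᴳ m ⊡ x ⊹ n ⊡ x
  ⊡-+ (+ m)    (+ n)    x = ×-homo-+ x m n
  ⊡-+ (+ m)    -[1+ n ] x = ⊡-⊖ m (suc n) x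
  ⊡-+ -[1+ m ] (+ n)    x = AbelianGroup.trans G (⊡-⊖ n (suc m) x) (comm _ _)
  ⊡-+ -[1+ m ] -[1+ n ] x = begin
    (suc (suc (m ℕ.+ n)) ×ᴳ x) ⁻¹               ≡⟨ cong (λ k → (suc k ×ᴳ x) ⁻¹) (ℕP.+-suc m n) ⟨
    ((suc m ℕ.+ suc n) ×ᴳ x) ⁻¹                 ≈⟨ ⁻¹-cong (×-homo-+ x (suc m) (suc n)) ⟩
    ((suc m ×ᴳ x) ⊹ (suc n ×ᴳ x)) ⁻¹            ≈⟨ ⁻¹-∙-comm (suc m ×ᴳ x) (suc n ×ᴳ x) ⟨
    (suc m ×ᴳ x) ⁻¹ ⊹ (suc n ×ᴳ x) ⁻¹           ∎

  ⊡-neg : ∀ m x → (ℤ.- m) ⊡ x ≈ᴳ (m ⊡ x) ⁻¹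
  ⊡-neg (+ zero)  x = AbelianGroup.sym G ε⁻¹≈ε
  ⊡-neg (+ suc n) x = AbelianGroup.refl G
  ⊡-neg -[1+ n ]  x = AbelianGroup.sym G (⁻¹-involutive (suc n ×ᴳ x))

  Span : Carrier → Carrier → Carrier → Set ℓ
  Span x y v = ∃[ m ] ∃[ n ] v ≈ᴳ m ⊡ x ⊹ n ⊡ y

  span-cong : ∀ {x y v w} → v ≈ᴳ w → Span x y v → Span x y w
  span-cong e (m , n , h) = m , n , AbelianGroup.trans G (AbelianGroup.sym G e) h

  span-+ : ∀ {x y v w} → Span x y v → Span x y w → Span x y (v ⊹ w)
  span-+ {x} {y} {v} {w} (m , n , h) (m′ , n′ , h′) = m ℤ.+ m′ , n ℤ.+ n′ , (begin
    v ⊹ w                                          ≈⟨ ⊹-cong h h′ ⟩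
    (m ⊡ x ⊹ n ⊡ y) ⊹ (m′ ⊡ x ⊹ n′ ⊡ y)            ≈⟨ interchange _ _ _ _ ⟩
    (m ⊡ x ⊹ m′ ⊡ x) ⊹ (n ⊡ y ⊹ n′ ⊡ y)            ≈⟨ ⊹-cong (⊡-+ m m′ x) (⊡-+ n n′ y) ⟨
    (m ℤ.+ m′) ⊡ x ⊹ (n ℤ.+ n′) ⊡ y                ∎)

  span-neg : ∀ {x y v} → Span x y v → Span x y (v ⁻¹)
  span-neg {x} {y} {v} (m , n , h) = ℤ.- m , ℤ.- n , (begin
    v ⁻¹                                ≈⟨ ⁻¹-cong h ⟩
    (m ⊡ x ⊹ n ⊡ y) ⁻¹                  ≈⟨ ⁻¹-∙-comm (m ⊡ x) (n ⊡ y) ⟨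
    (m ⊡ x) ⁻¹ ⊹ (n ⊡ y) ⁻¹             ≈⟨ ⊹-cong (⊡-neg m x) (⊡-neg n y) ⟨
    (ℤ.- m) ⊡ x ⊹ (ℤ.- n) ⊡ y           ∎)

  span-0 : ∀ {x y} → Span x y 0ᴳ
  span-0 = + 0 , + 0 , AbelianGroup.sym G (identityˡ 0ᴳ)

  span-x : ∀ {x y} → Span x y x
  span-x {x} {y} = + 1 , + 0 , AbelianGroup.sym G (AbelianGroup.trans G (identityʳ (x ⊹ 0ᴳ)) (identityʳ x))

  span-y : ∀ {x y} → Span x y y
  span-y {x} {y} = + 0 , + 1 , AbelianGroup.sym G (AbelianGroup.trans G (identityˡ (y ⊹ 0ᴳ)) (identityʳ y))

module PM = Multiples pointGroup
open PM using (_⊡_) public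

point-× : ∀ n A → point ((+ n) ⊡ A) ≡ mulℕ n (point A)
point-× zero    A = refl
point-× (suc n) A = ≡.trans (point-∙ A ((+ n) ⊡ A)) (cong (point A ⊕_) (point-× n A))

point-⊡ : ∀ m A → point (m ⊡ A) ≡ m · point A
point-⊡ (+ n)    A = point-× n A
point-⊡ -[1+ n ] A = ≡.trans (point-inv ((+ suc n) ⊡ A)) (cong ⊖_ (point-× (suc n) A))

~⇒≈ₚₜ : ∀ A B → ⌜ A ⌝ ~ ⌜ B ⌝ → point A ≈ₚₜ point B
~⇒≈ₚₜ (mkElem O _)         (mkElem O _)         _        = tt
~⇒≈ₚₜ (mkElem (aff _ _) _) (mkElem (aff _ _) _) (pt e f) = to≈ e , to≈ f

≈ₚₜ-ε⇒≋ : ∀ A → point A ≈ₚₜ O → A ≋ ε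
≈ₚₜ-ε⇒≋ (mkElem O _) _ = mk≋ ∞

-- The subgroup generated by P and Q, in the coordinates u, v with x = 4 u - 262/13, y = 8 v

φ : K → K → Point
φ u v = pt (KS.fromℕ 4 *ᴷ u +ᴷ -ᴷ sᴷ) (KS.fromℕ 8 *ᴷ v)

φ-cong : ∀ {u v u′ v′} → u ≈ᴷ u′ → v ≈ᴷ v′ → φ u v ~ φ u′ v′
φ-cong e f = pt (KR.+-congʳ (KR.*-congˡ e)) (KR.*-congˡ f)

φ-zero : ∀ {u₁ v₁ u₂ v₂ u₃ v₃} → CL.Line u₁ v₁ u₂ v₂ u₃ v₃ → Zero (φ u₁ v₁) (φ u₂ v₂) (φ u₃ v₃)
φ-zero L = OG.zL (rescale A₂-eq A₄-eq A₆-eq L)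

opaque
  unfolding _+ᴷ_ t

  P-on-curve : OnCurve Pₐ
  P-on-curve = (λ z → absurd (at (isZero⇒≃ z) 0)) , (λ z → absurd (at (isZero⇒≃ z) 0)) , toWitness {a? = (yₚ *ᶠ yₚ) ≈? (xₚ *ᶠ xₚ *ᶠ xₚ +ᶠ A₂ *ᶠ xₚ *ᶠ xₚ +ᶠ A₄ *ᶠ xₚ +ᶠ A₆)} tt
    where
    xₚ yₚ : RF
    xₚ = const (ℚ.- (+ 262 ℚ./ 13))
    yₚ = const (+ 32 ℚ./ 1) *ᶠ aᶠ +ᶠ const (+ 8 ℚ./ 1)
    absurd : ¬ 1ℚ ≡ 0ℚ
    absurd ()

  Q-on-curve : OnCurve Qₐ
  Q-on-curve = (λ z → absurd (at (isZero⇒≃ z) 0)) , (λ z → absurd (at (isZero⇒≃ z) 0)) , toWitness {a? = (yₚ *ᶠ yₚ) ≈? (xₚ *ᶠ xₚ *ᶠ xₚ +ᶠ A₂ *ᶠ xₚ *ᶠ xₚ +ᶠ A₄ *ᶠ xₚ +ᶠ A₆)} tt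
    where
    xₚ yₚ : RF
    xₚ = const (ℚ.- (+ 366 ℚ./ 13))
    yₚ = const (+ 32 ℚ./ 1) *ᶠ aᶠ +ᶠ const (+ 8 ℚ./ 1)
    absurd : ¬ 1ℚ ≡ 0ℚ
    absurd ()

P Q : Elem
P = mkElem Pₐ P-on-curve
Q = mkElem Qₐ Q-on-curve

opaque
  unfolding _+ᴷ_ t

  P~φ : ⌜ P ⌝ ~ φ (constᴷ 0ℚ) tᴷ
  P~φ = pt K-computation K-computation

  Q~φ : ⌜ Q ⌝ ~ φ (-ᴷ KS.fromℕ 2) tᴷ
  Q~φ = pt K-computation K-computation

-- Couples coordinates with a spanning witness. Since `member-line` closes it under collinearity,
-- the descent handles lines only and never the addition of points.
Member : K → K → Set
Member u v = ∃[ A ] (⌜ A ⌝ ~ φ u v) × PM.Span P Q A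

member-cong : ∀ {u v u′ v′} → u ≈ᴷ u′ → v ≈ᴷ v′ → Member u v → Member u′ v′
member-cong e f (A , h , s) = A , OG.~-trans h (φ-cong e f) , s

member-neg : ∀ {u v} → Member u v → Member u (-ᴷ v)
member-neg {u} {v} (A , h , s) = inv A , OG.~-trans (inv-neg A) (OG.~-trans (OG.neg-cong h)
  (pt KR.refl (KS.ringEq (v ∷ []) (λ v → :- (# 8 :* v) := # 8 :* :- v)))) , PM.span-neg s

member-line : ∀ {u₁ v₁ u₂ v₂ u₃ v₃} → CL.Line u₁ v₁ u₂ v₂ u₃ v₃ → Member u₁ v₁ → Member u₂ v₂ → Member u₃ v₃
member-line {u₃ = u₃} {v₃} L (A , h , s) (B , h′ , s′) = inv (A ∙ B) ,
  OG.~-trans (inv-neg (A ∙ B)) (OG.~-trans (OG.neg-cong (zero⇒~ A B (OG.zero-cong (OG.~-sym h) (OG.~-sym h′) OG.~-refl (φ-zero L)))) (OG.neg-neg (φ u₃ v₃))) ,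
  PM.span-neg (PM.span-+ s s′)

member-P : Member (constᴷ 0ℚ) tᴷ
member-P = P , P~φ , PM.span-x

member-Q : Member (-ᴷ KS.fromℕ 2) tᴷ
member-Q = Q , Q~φ , PM.span-y

-- The horizontal line `v = t` meets the cubic where `u (u + 2)(u + t) = 0`; its three points
-- represent the three nontrivial classes.
line-PQ : CL.Line (constᴷ 0ℚ) tᴷ (-ᴷ KS.fromℕ 2) tᴷ (-ᴷ tᴷ) tᴷ
line-PQ = CL.mkLine (constᴷ 0ℚ) tᴷ
  (KS.ringEq (tᴷ ∷ []) (λ t → t := # 0 :* # 0 :+ t))
  (KS.ringEq (tᴷ ∷ []) (λ t → t := # 0 :* :- # 2 :+ t))
  (KS.ringEq (tᴷ ∷ []) (λ t → t := # 0 :* :- t :+ t))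
  (KS.ringEq (tᴷ ∷ []) (λ t → # 0 :+ :- # 2 :+ :- t := # 0 :* # 0 :- (t :+ # 2)))
  (KS.ringEq (tᴷ ∷ []) (λ t → # 0 :* :- # 2 :+ # 0 :* :- t :+ :- # 2 :* :- t := # 2 :* t :- # 2 :* # 0 :* t))
  (KS.ringEq (tᴷ ∷ []) (λ t → # 0 :* :- # 2 :* :- t := t :* t :- t :* t))

member-S : Member (-ᴷ tᴷ) tᴷ
member-S = member-line line-PQ member-P member-Q

equal-squares : ∀ {x y} → x *ᴷ x ≈ᴷ y *ᴷ y → (x ≈ᴷ y) ⊎ (x ≈ᴷ -ᴷ y)
equal-squares {x} {y} e = split ((x +ᴷ -ᴷ y) ≟ᴷ constᴷ 0ℚ)
  where
  split : Dec ((x +ᴷ -ᴷ y) ≈ᴷ constᴷ 0ℚ) → (x ≈ᴷ y) ⊎ (x ≈ᴷ -ᴷ y)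
  split (yes z) = inj₁ (KS.x-y≈0⇒x≈y z)
  split (no nz) = inj₂ (KS.linear (x ∷ y ∷ []) (λ x y → (x := :- y) , (# 1 , x :+ y := # 0) ∷ [])
    (integralᴷ nz (KS.linear (x ∷ y ∷ []) (λ x y → ((x :- y) :* (x :+ y) := # 0) , (# 1 , x :* x := y :* y) ∷ []) (e KS.∷ KS.[])) KS.∷ KS.[]))

-- An abscissa fixes the point up to sign, so the descent has to match abscissas only.
member-± : ∀ {u v v′} → v *ᴷ v ≈ᴷ v′ *ᴷ v′ → Member u v → Member u v′
member-± {u} {v} {v′} e m = choose (equal-squares e)
  where
  choose : (v ≈ᴷ v′) ⊎ (v ≈ᴷ -ᴷ v′) → Member u v′
  choose (inj₁ h) = member-cong KR.refl h m
  choose (inj₂ h) = member-cong KR.refl (KS.linear (v ∷ v′ ∷ []) (λ v w → (:- v := w) , (:- # 1 , v := :- w) ∷ []) (h KS.∷ KS.[])) (member-neg m)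

-- Coprime representatives

record Rep (pp : PolyPoint) (u v : K) : Set where
  open PolyPoint pp
  field
    u-eq : u *ᴷ (⌊ z′ ⌋ *ᴷ ⌊ z′ ⌋) ≈ᴷ ⌊ x ⌋
    v-eq : v *ᴷ (⌊ z′ ⌋ *ᴷ ⌊ z′ ⌋ *ᴷ ⌊ z′ ⌋) ≈ᴷ ⌊ y ⌋

-- With `u = ν / μ` in lowest terms, `μ F` is the square of `w = v μ²`, and `μ` is coprime to `F`
-- because `F` is `ν³` modulo `μ`. Hence `μ = c k²` with a unit `c`, and `c⁻¹` moves into the
-- numerators.
module Normalise (u v : K) (curve′ : v *ᴷ v ≈ᴷ CL.rhs u) where
  n d m e : Poly
  n = num (rf u)
  d = den (rf u)
  m = num (rf v)
  e = den (rf v)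

  opaque
    G : PD.Gcd n d
    G = bezout n d
  open PD.Gcd G using (g) renaming (x to α; y to β; u to ν; v to μ; g-comb to comb; a-mult to n-eq; b-mult to d-eq)

  g≄0 : ¬ g ≃ []
  g≄0 = ≄0-factor {d} {μ} {g} d-eq (den≄0 u)

  coprime : α *ₚ ν +ₚ β *ₚ μ ≃ 1ₚ
  coprime = PD.cancel {g} (≄0⇒regular g≄0) (PS.linear (g ∷ α ∷ ν ∷ β ∷ μ ∷ n ∷ d ∷ [])
    (λ g α ν β μ n d → (g :* (α :* ν :+ β :* μ) := g :* # 1) ,
      (:- # 1 , g := α :* n :+ β :* d) ∷ (:- α , n := ν :* g) ∷ (:- β , d := μ :* g) ∷ [])
    (comb PS.∷ n-eq PS.∷ d-eq PS.∷ PS.[]))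

  μ≄0 : ¬ μ ≃ []
  μ≄0 = ≄0-factor {d} {g} {μ} (≃-trans d-eq (*ₚ-comm μ g)) (den≄0 u)

  uμ : u *ᴷ ⌊ μ ⌋ ≈ᴷ ⌊ ν ⌋
  uμ = KS.x-y≈0⇒x≈y (integralᴷ (⌊⌋≉0 g≄0) (KS.linear (u ∷ ⌊ g ⌋ ∷ ⌊ μ ⌋ ∷ ⌊ ν ⌋ ∷ ⌊ n ⌋ ∷ ⌊ d ⌋ ∷ [])
    (λ u g μ ν n d → (g :* (u :* μ :- ν) := # 0) , (# 1 , u :* d := n) ∷ (# 1 , n := ν :* g) ∷ (:- u , d := μ :* g) ∷ [])
    (fraction u KS.∷ ⌊⌋-holds (n ∷ ν ∷ g ∷ []) (λ n ν g → n := ν :* g) n-eq KS.∷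
     ⌊⌋-holds (d ∷ μ ∷ g ∷ []) (λ d μ g → d := μ :* g) d-eq KS.∷ KS.[])))

  F : Poly
  F = ν *ₚ ν *ₚ ν +ₚ (t +ₚ PS.fromℕ 2) *ₚ ν *ₚ ν *ₚ μ +ₚ PS.fromℕ 2 *ₚ t *ₚ ν *ₚ μ *ₚ μ +ₚ t *ₚ t *ₚ μ *ₚ μ *ₚ μ

  Fₑ : ∀ {n} → Expr n → Expr n → Expr n → Expr n
  Fₑ t ν μ = ν :* ν :* ν :+ (t :+ # 2) :* ν :* ν :* μ :+ # 2 :* t :* ν :* μ :* μ :+ t :* t :* μ :* μ :* μ

  e²μF : e *ₚ e *ₚ (μ *ₚ F) ≃ (m *ₚ μ *ₚ μ) *ₚ (m *ₚ μ *ₚ μ)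
  e²μF = ⌊⌋-reflects ⌊⌋-injective (e ∷ m ∷ t ∷ ν ∷ μ ∷ []) (λ e m t ν μ → e :* e :* (μ :* Fₑ t ν μ) := (m :* μ :* μ) :* (m :* μ :* μ))
    (KS.linear (⌊ e ⌋ ∷ ⌊ m ⌋ ∷ tᴷ ∷ ⌊ ν ⌋ ∷ ⌊ μ ⌋ ∷ u ∷ v ∷ [])
      (λ e m t ν μ u v → (e :* e :* (μ :* Fₑ t ν μ) := (m :* μ :* μ) :* (m :* μ :* μ)) ,
        ((m :+ v :* e) :* μ :* μ :* μ :* μ , v :* e := m) ∷
        (:- (e :* e :* μ :* μ :* μ :* μ) , v :* v := u :* u :* u :+ (t :+ # 2) :* u :* u :+ # 2 :* t :* u :+ t :* t) ∷
        (:- (e :* e :* μ :* (ν :* ν :+ ν :* (u :* μ) :+ (u :* μ) :* (u :* μ) :+ (t :+ # 2) :* μ :* (ν :+ u :* μ) :+ # 2 :* t :* μ :* μ)) , u :* μ := ν) ∷ [])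
      (fraction v KS.∷ curve′ KS.∷ uμ KS.∷ KS.[]))

  opaque
    w-exists : ∃[ w ] m *ₚ μ *ₚ μ ≃ e *ₚ w
    w-exists = PD.square-divides bezout {e} {μ *ₚ F} {m *ₚ μ *ₚ μ} (≄0⇒regular (den≄0 v)) e²μF

  w : Poly
  w = proj₁ w-exists

  vμ² : v *ᴷ (⌊ μ ⌋ *ᴷ ⌊ μ ⌋) ≈ᴷ ⌊ w ⌋
  vμ² = KS.x-y≈0⇒x≈y (integralᴷ (⌊⌋≉0 (den≄0 v)) (KS.linear (⌊ e ⌋ ∷ ⌊ m ⌋ ∷ ⌊ μ ⌋ ∷ ⌊ w ⌋ ∷ v ∷ [])
    (λ e m μ w v → (e :* (v :* (μ :* μ) :- w) := # 0) , (μ :* μ , v :* e := m) ∷ (# 1 , m :* μ :* μ := e :* w) ∷ [])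
    (fraction v KS.∷ ⌊⌋-holds (m ∷ μ ∷ e ∷ w ∷ []) (λ m μ e w → m :* μ :* μ := e :* w) (proj₂ w-exists) KS.∷ KS.[])))

  μF : μ *ₚ F ≃ w *ₚ w
  μF = PD.cancel {e *ₚ e} (≄0⇒regular (≄0-* (den≄0 v) (den≄0 v))) (PS.linear (e ∷ m ∷ μ ∷ F ∷ w ∷ [])
    (λ e m μ F w → (e :* e :* (μ :* F) := e :* e :* (w :* w)) ,
      (# 1 , e :* e :* (μ :* F) := (m :* μ :* μ) :* (m :* μ :* μ)) ∷ (m :* μ :* μ :+ e :* w , m :* μ :* μ := e :* w) ∷ [])
    (e²μF PS.∷ proj₂ w-exists PS.∷ PS.[]))

  opaque
    squareSplit : PD.SquareSplit bezout μ F
    squareSplit = PD.square-split bezout {μ} {F} {w} (≄0⇒regular μ≄0) μF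

  open PD.SquareSplit squareSplit renaming (d to D; k to k; unit to U; unit⁻¹ to U⁻¹)

  -- a common divisor of μ and F divides ν³
  D⁻¹ : Poly
  D⁻¹ = α *ₚ α *ₚ α *ₚ (proj₁ d-a′ -ₚ proj₁ d-a *ₚ ((t +ₚ PS.fromℕ 2) *ₚ ν *ₚ ν +ₚ PS.fromℕ 2 *ₚ t *ₚ ν *ₚ μ +ₚ t *ₚ t *ₚ μ *ₚ μ))
    +ₚ proj₁ d-a *ₚ β *ₚ (1ₚ +ₚ α *ₚ ν +ₚ α *ₚ ν *ₚ (α *ₚ ν))

  DD⁻¹ : D *ₚ D⁻¹ ≃ 1ₚ
  DD⁻¹ = PS.linear (α ∷ β ∷ ν ∷ μ ∷ t ∷ D ∷ proj₁ d-a ∷ proj₁ d-a′ ∷ [])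
    (λ α β ν μ t D k k′ → (D :* (α :* α :* α :* (k′ :- k :* ((t :+ # 2) :* ν :* ν :+ # 2 :* t :* ν :* μ :+ t :* t :* μ :* μ))
        :+ k :* β :* (# 1 :+ α :* ν :+ α :* ν :* (α :* ν))) := # 1) ,
      (:- (α :* α :* α) , Fₑ t ν μ := k′ :* D) ∷
      (α :* α :* α :* ((t :+ # 2) :* ν :* ν :+ # 2 :* t :* ν :* μ :+ t :* t :* μ :* μ) :- β :* (# 1 :+ α :* ν :+ α :* ν :* (α :* ν)) , μ := k :* D) ∷
      (# 1 :+ α :* ν :+ α :* ν :* (α :* ν) , α :* ν :+ β :* μ := # 1) ∷ [])
    (proj₂ d-a′ PS.∷ proj₂ d-a PS.∷ coprime PS.∷ PS.[])

  c c⁻¹ : Poly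
  c = U *ₚ D
  c⁻¹ = U⁻¹ *ₚ D⁻¹

  cc⁻¹ : c *ₚ c⁻¹ ≃ 1ₚ
  cc⁻¹ = PS.linear (U ∷ D ∷ U⁻¹ ∷ D⁻¹ ∷ []) (λ U D U′ D′ → (U :* D :* (U′ :* D′) := # 1) ,
    (D :* D′ , U :* U′ := # 1) ∷ (# 1 , D :* D′ := # 1) ∷ []) (unit-inv PS.∷ DD⁻¹ PS.∷ PS.[])

  k≄0 : ¬ k ≃ []
  k≄0 = ≄0-factor {μ} {c *ₚ k} {k} (≃-trans split (≃-sym (*ₚ-assoc c k k))) μ≄0

  opaque
    s-exists : ∃[ s ] w ≃ k *ₚ s
    s-exists = PD.square-divides bezout {k} {c *ₚ F} {w} (≄0⇒regular k≄0) (PS.linear (k ∷ U ∷ D ∷ F ∷ w ∷ μ ∷ [])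
      (λ k U D F w μ → (k :* k :* (U :* D :* F) := w :* w) , (# 1 , μ :* F := w :* w) ∷ (:- F , μ := U :* D :* (k :* k)) ∷ [])
      (μF PS.∷ split PS.∷ PS.[]))

  s X₀ Y₀ : Poly
  s = proj₁ s-exists
  X₀ = c⁻¹ *ₚ ν
  Y₀ = c⁻¹ *ₚ c⁻¹ *ₚ s

  split′ : ⌊ μ ⌋ ≈ᴷ ⌊ c ⌋ *ᴷ (⌊ k ⌋ *ᴷ ⌊ k ⌋)
  split′ = ⌊⌋-holds (μ ∷ c ∷ k ∷ []) (λ μ c k → μ := c :* (k :* k)) split

  cc⁻¹′ : ⌊ c ⌋ *ᴷ ⌊ c⁻¹ ⌋ ≈ᴷ constᴷ 1ℚ
  cc⁻¹′ = ⌊⌋-holds (c ∷ c⁻¹ ∷ []) (λ c i → c :* i := # 1) cc⁻¹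

  u-eq : u *ᴷ (⌊ k ⌋ *ᴷ ⌊ k ⌋) ≈ᴷ ⌊ X₀ ⌋
  u-eq = KS.linear (u ∷ ⌊ k ⌋ ∷ ⌊ μ ⌋ ∷ ⌊ ν ⌋ ∷ ⌊ c ⌋ ∷ ⌊ c⁻¹ ⌋ ∷ ⌊ X₀ ⌋ ∷ [])
    (λ u k μ ν c i X → (u :* (k :* k) := X) ,
      (:- # 1 , X := i :* ν) ∷ (i , u :* μ := ν) ∷ (:- (i :* u) , μ := c :* (k :* k)) ∷ (:- (u :* k :* k) , c :* i := # 1) ∷ [])
    (⌊⌋-value (c⁻¹ ∷ ν ∷ []) (λ i ν → i :* ν) KS.∷ uμ KS.∷ split′ KS.∷ cc⁻¹′ KS.∷ KS.[])

  v-eq : v *ᴷ (⌊ k ⌋ *ᴷ ⌊ k ⌋ *ᴷ ⌊ k ⌋) ≈ᴷ ⌊ Y₀ ⌋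
  v-eq = KS.x-y≈0⇒x≈y (integralᴷ (⌊⌋≉0 k≄0) (KS.linear (v ∷ ⌊ k ⌋ ∷ ⌊ μ ⌋ ∷ ⌊ w ⌋ ∷ ⌊ s ⌋ ∷ ⌊ c ⌋ ∷ ⌊ c⁻¹ ⌋ ∷ ⌊ Y₀ ⌋ ∷ [])
    (λ v k μ w s c i Y → (k :* (v :* (k :* k :* k) :- Y) := # 0) ,
      (:- k , Y := i :* i :* s) ∷ (i :* i , v :* (μ :* μ) := w) ∷ (i :* i , w := k :* s) ∷
      (:- (i :* i :* v :* (μ :+ c :* k :* k)) , μ := c :* (k :* k)) ∷ (:- (v :* k :* k :* k :* k :* (c :* i :+ # 1)) , c :* i := # 1) ∷ [])
    (⌊⌋-value (c⁻¹ ∷ s ∷ []) (λ i s → i :* i :* s) KS.∷ vμ² KS.∷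
     ⌊⌋-holds (w ∷ k ∷ s ∷ []) (λ w k s → w := k :* s) (proj₂ s-exists) KS.∷ split′ KS.∷ cc⁻¹′ KS.∷ KS.[])))

  v≉0 : ¬ v ≈ᴷ constᴷ 0ℚ
  v≉0 = CG.y≉0 curve′

  Y₀≄0 : ¬ Y₀ ≃ []
  Y₀≄0 z = v≉0 (integralᴷ (⌊⌋≉0 (≄0-* (≄0-* k≄0 k≄0) k≄0)) (KS.linear (v ∷ ⌊ k ⌋ ∷ ⌊ k *ₚ k *ₚ k ⌋ ∷ ⌊ Y₀ ⌋ ∷ [])
    (λ v k k³ Y → (k³ :* v := # 0) , (v , k³ := k :* k :* k) ∷ (# 1 , v :* (k :* k :* k) := Y) ∷ (# 1 , Y := # 0) ∷ [])
    (⌊⌋-value (k ∷ []) (λ k → k :* k :* k) KS.∷ v-eq KS.∷ num-zero z KS.∷ KS.[])))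

  polyPoint : PolyPoint
  polyPoint = record
    { x = X₀ ; y = Y₀ ; z′ = k ; α = α *ₚ c ; β = β *ₚ c *ₚ k
    ; coprime = PS.linear (α ∷ β ∷ c ∷ c⁻¹ ∷ k ∷ ν ∷ μ ∷ [])
        (λ α β c i k ν μ → (α :* c :* (i :* ν) :+ β :* c :* k :* k := # 1) ,
          (# 1 , α :* ν :+ β :* μ := # 1) ∷ (:- β , μ := c :* (k :* k)) ∷ (α :* ν , c :* i := # 1) ∷ [])
        (coprime PS.∷ split PS.∷ cc⁻¹ PS.∷ PS.[])
    ; z′≄0 = k≄0 ; y≄0 = Y₀≄0
    ; curve = ⌊⌋-reflects ⌊⌋-injective (X₀ ∷ Y₀ ∷ k ∷ t ∷ []) (λ x y z t → y :* y := x :* x :* x :+ (t :+ # 2) :* x :* x :* (z :* z)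
        :+ # 2 :* t :* x :* (z :* z) :* (z :* z) :+ t :* t :* (z :* z) :* (z :* z) :* (z :* z))
        (KS.linear (⌊ X₀ ⌋ ∷ ⌊ Y₀ ⌋ ∷ ⌊ k ⌋ ∷ tᴷ ∷ u ∷ v ∷ [])
          (λ x y z t u v → (y :* y := x :* x :* x :+ (t :+ # 2) :* x :* x :* (z :* z)
            :+ # 2 :* t :* x :* (z :* z) :* (z :* z) :+ t :* t :* (z :* z) :* (z :* z) :* (z :* z)) ,
            (:- (y :+ v :* (z :* z :* z)) , v :* (z :* z :* z) := y) ∷
            (z :* z :* z :* z :* z :* z , v :* v := u :* u :* u :+ (t :+ # 2) :* u :* u :+ # 2 :* t :* u :+ t :* t) ∷
            (x :* x :+ x :* (u :* z :* z) :+ u :* z :* z :* (u :* z :* z) :+ (t :+ # 2) :* z :* z :* (x :+ u :* z :* z) :+ # 2 :* t :* z :* z :* z :* z , u :* (z :* z) := x) ∷ [])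
          (v-eq KS.∷ curve′ KS.∷ u-eq KS.∷ KS.[])) }

  rep : Rep polyPoint u v
  rep = record { u-eq = u-eq ; v-eq = v-eq }

normalise : ∀ {u v} → v *ᴷ v ≈ᴷ CL.rhs u → ∃[ pp ] Rep pp u v
normalise {u} {v} c = Normalise.polyPoint u v c , Normalise.rep u v c

Deg<-factor : ∀ {n p q} → ¬ q ≃ [] → Deg< n (p *ₚ q) → Deg< n p
Deg<-factor {n} {p} {q} q≄0 d = from (zero? p)
  where
  from : Dec (p ≃ []) → Deg< n p
  from (yes z)  = Deg<-zero z
  from (no p≄0) = let (i , l) = lead p p≄0 ; (j , k) = lead q q≄0 in
    Deg<-mono (ℕP.≤-trans (s≤s (ℕP.m≤m+n i j)) (Lead-< d (Lead-* l k))) (bound l)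

-- Lowest terms are minimal: every other `x̃ / z̃²` for the same `u` arises by a factor `s²`. So
-- degree bounds found for an unreduced representative pass to the reduced one.
minimal : ∀ {pp u v} → Rep pp u v → ∀ x̃ z̃ → ¬ z̃ ≃ [] → u *ᴷ (⌊ z̃ ⌋ *ᴷ ⌊ z̃ ⌋) ≈ᴷ ⌊ x̃ ⌋ →
  ∃[ s ] (z̃ ≃ PolyPoint.z′ pp *ₚ s) × (x̃ ≃ PolyPoint.x pp *ₚ (s *ₚ s)) × ¬ s ≃ []
minimal {pp} {u} {v} rep x̃ z̃ z̃≄0 e = s , proj₂ s-exists , x̃-eq , s≄0
  where
  open PolyPoint pp
  open Rep rep
  cross-eq : x̃ *ₚ (z′ *ₚ z′) ≃ x *ₚ (z̃ *ₚ z̃)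
  cross-eq = ⌊⌋-reflects ⌊⌋-injective (x̃ ∷ z̃ ∷ x ∷ z′ ∷ []) (λ x̃ z̃ x z → x̃ :* (z :* z) := x :* (z̃ :* z̃))
    (KS.linear (⌊ x̃ ⌋ ∷ ⌊ z̃ ⌋ ∷ ⌊ x ⌋ ∷ ⌊ z′ ⌋ ∷ u ∷ [])
      (λ x̃ z̃ x z u → (x̃ :* (z :* z) := x :* (z̃ :* z̃)) , (:- (z :* z) , u :* (z̃ :* z̃) := x̃) ∷ (z̃ :* z̃ , u :* (z :* z) := x) ∷ [])
      (e KS.∷ u-eq KS.∷ KS.[]))
  cofactor : Poly
  cofactor = z̃ *ₚ z̃ *ₚ β *ₚ β +ₚ α *ₚ x̃ *ₚ (PS.fromℕ 2 -ₚ α *ₚ x)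
  -- z̃² = z̃² (α x + β z)², and x z̃² = x̃ z²
  z²-divides : z′ *ₚ z′ *ₚ cofactor ≃ z̃ *ₚ z̃
  z²-divides = PS.linear (x̃ ∷ z̃ ∷ x ∷ z′ ∷ α ∷ β ∷ [])
    (λ x̃ z̃ x z α β → (z :* z :* (z̃ :* z̃ :* β :* β :+ α :* x̃ :* (# 2 :- α :* x)) := z̃ :* z̃) ,
      (α :* (# 2 :- α :* x) , x̃ :* (z :* z) := x :* (z̃ :* z̃)) ∷ (z̃ :* z̃ :* (β :* z :+ # 1 :- α :* x) , α :* x :+ β :* z := # 1) ∷ [])
    (cross-eq PS.∷ coprime PS.∷ PS.[])
  opaque
    s-exists : ∃[ s ] z̃ ≃ z′ *ₚ s
    s-exists = PD.square-divides bezout {z′} {cofactor} {z̃} (≄0⇒regular z′≄0) z²-divides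
  s : Poly
  s = proj₁ s-exists
  s≄0 : ¬ s ≃ []
  s≄0 = ≄0-factor {z̃} {z′} {s} (proj₂ s-exists) z̃≄0
  x̃-eq : x̃ ≃ x *ₚ (s *ₚ s)
  x̃-eq = PD.cancel {z′ *ₚ z′} (≄0⇒regular (≄0-* z′≄0 z′≄0)) (PS.linear (x̃ ∷ z̃ ∷ x ∷ z′ ∷ s ∷ [])
    (λ x̃ z̃ x z s → (z :* z :* x̃ := z :* z :* (x :* (s :* s))) ,
      (# 1 , x̃ :* (z :* z) := x :* (z̃ :* z̃)) ∷ (x :* (z̃ :+ z :* s) , z̃ := z :* s) ∷ [])
    (cross-eq PS.∷ proj₂ s-exists PS.∷ PS.[]))

record Bounded (a b : ℕ) (pp : PolyPoint) : Set where
  constructor mkBounded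
  field
    z-bound : Deg< a (PolyPoint.z′ pp)
    x-bound : Deg< b (PolyPoint.x pp)
open Bounded public

minimal-bounded : ∀ {pp u v a b} → Rep pp u v → ∀ x̃ z̃ → ¬ z̃ ≃ [] → u *ᴷ (⌊ z̃ ⌋ *ᴷ ⌊ z̃ ⌋) ≈ᴷ ⌊ x̃ ⌋ →
  Deg< a z̃ → Deg< b x̃ → Bounded a b pp
minimal-bounded {pp} rep x̃ z̃ z̃≄0 e da db = let (s , ez , ex , s≄0) = minimal rep x̃ z̃ z̃≄0 e in
  mkBounded (Deg<-factor s≄0 (Deg<-cong ez da)) (Deg<-factor (≄0-* s≄0 s≄0) (Deg<-cong ex db))

-- Degrees of square roots in the order

open +-*-Solver using (solve) renaming (con to N:con; _:+_ to _N:+_; _:*_ to _N:*_; _:=_ to _N:=_) public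

-- The coordinates of `(p + q z + r z⁻¹)²`.
c₀ c₁ c₂ : Poly → Poly → Poly → Poly
c₀ p q r = p *ₚ p +ₚ (q *ₚ r +ₚ r *ₚ q) -ₚ q *ₚ q -ₚ (t +ₚ 1ₚ) *ₚ (r *ₚ r)
c₁ p q r = p *ₚ q +ₚ q *ₚ p -ₚ (t +ₚ 1ₚ) *ₚ (q *ₚ q) -ₚ r *ₚ r
c₂ p q r = p *ₚ r +ₚ r *ₚ p -ₚ q *ₚ q -ₚ r *ₚ r

C₀ C₁ C₂ : ∀ {n} → Expr n → Expr n → Expr n → Expr n → Expr n
C₀ t p q r = p :* p :+ (q :* r :+ r :* q) :- q :* q :- (t :+ # 1) :* (r :* r)
C₁ t p q r = p :* q :+ q :* p :- (t :+ # 1) :* (q :* q) :- r :* r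
C₂ t p q r = p :* r :+ r :* p :- q :* q :- r :* r

square-drop : ∀ k {p} → Deg< (suc k) p → Deg< (k ℕ.+ k) (p *ₚ p) → Deg< k p
square-drop k {p} d d² = Deg<-drop d (from (coeff p k ℚP.≟ 0ℚ))
  where
  from : Dec (coeff p k ≡ 0ℚ) → coeff p k ≡ 0ℚ
  from (yes z) = z
  from (no nz) = ℚ-domain (≡.trans (≡.sym (coeff-top p d d)) (vanish d² (k ℕ.+ k) ℕP.≤-refl)) nz

cancel-Deg< : ∀ {n p s} → Lead 1 s → Deg< (suc n) (s *ₚ p) → Deg< n p
cancel-Deg< {n} {p} {s} l d = from (zero? p)
  where
  from : Dec (p ≃ []) → Deg< n p
  from (yes z)  = Deg<-zero z
  from (no p≄0) = let (j , k) = lead p p≄0 in Deg<-mono (ℕP.≤-pred (Lead-< d (Lead-* l k))) (bound k)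

Deg<-square : ∀ {k p q} → Deg< (suc k) p → Deg< (suc k) q → Deg< (suc (k ℕ.+ k)) (p *ₚ q)
Deg<-square {k} {p} {q} d d′ = subst (λ j → Deg< j (p *ₚ q)) (ℕP.+-suc k k) (Deg<-* p d d′)

Deg<-t+1 : ∀ {k p} → Deg< k p → Deg< (suc k) ((t +ₚ 1ₚ) *ₚ p)
Deg<-t+1 d = Deg<-* (t +ₚ 1ₚ) (bound t+1-Lead) d

Deg<-t : ∀ {k p} → Deg< k p → Deg< (suc k) (t *ₚ p)
Deg<-t d = Deg<-* t (bound t-Lead) d

module _ (k : ℕ) (p q r : Poly) (dq : Deg< (suc k) q) (dr : Deg< (suc k) r) where
  drop-p : Deg< (suc (suc k)) p → Deg< (suc (suc (k ℕ.+ k))) (c₀ p q r) → Deg< (suc k) p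
  drop-p dp d₀ = square-drop (suc k) dp (subst (λ j → Deg< j (p *ₚ p)) (cong suc (≡.sym (ℕP.+-suc k k)))
    (Deg<-cong (PS.ringEq (t ∷ p ∷ q ∷ r ∷ []) (λ t p q r → C₀ t p q r :+ (q :* q :- (q :* r :+ r :* q)) :+ (t :+ # 1) :* (r :* r) := p :* p))
      (Deg<-+ (Deg<-+ d₀ (Deg<-mono (ℕP.n≤1+n _) (Deg<-minus (Deg<-square dq dq) (Deg<-+ (Deg<-square dq dr) (Deg<-square dr dq)))))
        (Deg<-t+1 (Deg<-square dr dr)))))

  drop-q : Deg< (suc k) p → Deg< (suc (k ℕ.+ k)) (c₁ p q r) → Deg< k q
  drop-q dp d₁ = square-drop k dq (cancel-Deg< t+1-Lead (Deg<-cong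
    (PS.ringEq (t ∷ p ∷ q ∷ r ∷ []) (λ t p q r → p :* q :+ q :* p :- r :* r :- C₁ t p q r := (t :+ # 1) :* (q :* q)))
    (Deg<-minus (Deg<-minus (Deg<-+ (Deg<-square dp dq) (Deg<-square dq dp)) (Deg<-square dr dr)) d₁)))

  drop-r : Deg< (suc k) p → Deg< (suc (k ℕ.+ k)) (c₀ p q r) → Deg< k r
  drop-r dp d₀ = square-drop k dr (cancel-Deg< t+1-Lead (Deg<-cong
    (PS.ringEq (t ∷ p ∷ q ∷ r ∷ []) (λ t p q r → p :* p :+ (q :* r :+ r :* q) :- q :* q :- C₀ t p q r := (t :+ # 1) :* (r :* r)))
    (Deg<-minus (Deg<-minus (Deg<-+ (Deg<-square dp dp) (Deg<-+ (Deg<-square dq dr) (Deg<-square dr dq))) (Deg<-square dq dq)) d₀)))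

-- Arbitrary initial bounds are lowered step by step. At each stage `p²` is the only term of `c₀`
-- that reaches the top degree; after `p` has dropped, the same holds of `(t + 1) q²` in `c₁` and of
-- `(t + 1) r²` in `c₀`. No cancellation can hide these terms.
module RootDegrees (n : ℕ) (p q r : Poly) (d₀ : Deg< (3 ℕ.+ (n ℕ.+ n)) (c₀ p q r)) (d₁ : Deg< (3 ℕ.+ (n ℕ.+ n)) (c₁ p q r)) where
  Bounds : ℕ → Set
  Bounds k = Deg< (suc k) p × Deg< k q × Deg< k r

  start : ∃[ j ] Bounds (j ℕ.+ suc n)
  start = a ℕ.+ (b ℕ.+ c) ,
    Deg<-mono (ℕP.≤-trans (ℕP.m≤m+n a (b ℕ.+ c)) (ℕP.≤-trans (ℕP.m≤m+n _ (suc n)) (ℕP.n≤1+n _))) (proj₂ (finite-degree p)) ,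
    Deg<-mono (ℕP.≤-trans (ℕP.≤-trans (ℕP.m≤m+n b c) (ℕP.m≤n+m _ a)) (ℕP.m≤m+n _ (suc n))) (proj₂ (finite-degree q)) ,
    Deg<-mono (ℕP.≤-trans (ℕP.≤-trans (ℕP.m≤n+m c b) (ℕP.m≤n+m _ a)) (ℕP.m≤m+n _ (suc n))) (proj₂ (finite-degree r))
    where
    a b c : ℕ
    a = proj₁ (finite-degree p)
    b = proj₁ (finite-degree q)
    c = proj₁ (finite-degree r)

  step : ∀ k → suc n ℕ.≤ k → Bounds (suc k) → Bounds k
  step k n<k (dp , dq , dr) = dp′ , drop-q k p q r dq dr dp′ (Deg<-mono le d₁) , drop-r k p q r dq dr dp′ (Deg<-mono le d₀)
    where
    le : 3 ℕ.+ (n ℕ.+ n) ℕ.≤ suc (k ℕ.+ k)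
    le = s≤s (ℕP.≤-trans (ℕP.≤-reflexive (cong suc (≡.sym (ℕP.+-suc n n)))) (ℕP.+-mono-≤ n<k n<k))
    dp′ : Deg< (suc k) p
    dp′ = drop-p k p q r dq dr dp (Deg<-mono (ℕP.≤-trans le (ℕP.n≤1+n _)) d₀)

  descend : ∀ j → Bounds (j ℕ.+ suc n) → Bounds (suc n)
  descend zero    b = b
  descend (suc j) b = descend j (step (j ℕ.+ suc n) (ℕP.m≤n+m (suc n) j) b)

  bounds : Bounds (suc n)
  bounds = descend (proj₁ start) (proj₂ start)

-- Halving a point in the trivial class

Deg<-fromℕ : ∀ {n} c {p} → Deg< n p → Deg< n (PS.fromℕ (suc (suc c)) *ₚ p)
Deg<-fromℕ zero    {p} d = Deg<-cong (PS.ringEq (p ∷ []) (λ p → p :+ p := # 2 :* p)) (Deg<-+ d d)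
Deg<-fromℕ (suc c) {p} d = Deg<-cong (PS.linear (p ∷ PS.fromℕ (suc (suc c)) ∷ []) (λ p m → (p :+ m :* p := (# 1 :+ m) :* p) , []) PS.[]) (Deg<-+ d (Deg<-fromℕ c d))

-- The denominator `ẑ` of the half satisfies `4 deg ẑ ≤ n`, and `n ≤ 3 + 4 m` is exactly what turns
-- this into `deg ẑ ≤ m`. In height 0 nothing can decrease, and `base` takes over.
record Halved (n : ℕ) (u : K) : Set where
  field
    x′ y′ v′ : K
    line     : CL.Line x′ y′ x′ y′ u v′
    smaller  : ∀ m → n ℕ.≤ 3 ℕ.+ 4 ℕ.* m → ∀ {pp} → Rep pp x′ y′ → Bounded (suc m) (3 ℕ.+ (m ℕ.+ m)) pp
    base     : n ≡ 0 → (x′ ≈ᴷ constᴷ 0ℚ) ⊎ (x′ ≈ᴷ -ᴷ tᴷ)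

module Halve (n : ℕ) (pp : PolyPoint) (u v : K) (rep : Rep pp u v) (bd : Bounded (suc n) (3 ℕ.+ (n ℕ.+ n)) pp) (p q r : Poly)
  (E₀ : PolyPoint.x pp ≃ c₀ p q r)
  (E₁ : negₚ (PolyPoint.z′ pp *ₚ PolyPoint.z′ pp) ≃ c₁ p q r)
  (E₂ : negₚ (PolyPoint.z′ pp *ₚ PolyPoint.z′ pp) ≃ c₂ p q r) where
  open PolyPoint pp
  open Rep rep

  dz² : Deg< (suc (n ℕ.+ n)) (negₚ (z′ *ₚ z′))
  dz² = Deg<-neg (Deg<-square (z-bound bd) (z-bound bd))

  bounds : Deg< (suc (suc n)) p × Deg< (suc n) q × Deg< (suc n) r
  bounds = RootDegrees.bounds n p q r (Deg<-cong E₀ (x-bound bd)) (Deg<-cong E₁ (Deg<-mono (ℕP.≤-trans (ℕP.n≤1+n _) (ℕP.n≤1+n _)) dz²))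

  w : Poly
  w = q -ₚ r

  -- Equality of the `z`- and `z⁻¹`-coordinates of the square. It reconciles the two expressions
  -- `-t q / (q - r)` and `-2 p / q` for the abscissa of the half.
  2pw : PS.fromℕ 2 *ₚ p *ₚ w ≃ t *ₚ q *ₚ q
  2pw = PS.linear (t ∷ p ∷ q ∷ r ∷ z′ ∷ []) (λ t p q r z → (# 2 :* p :* (q :- r) := t :* q :* q) ,
    (:- # 1 , :- (z :* z) := C₁ t p q r) ∷ (# 1 , :- (z :* z) := C₂ t p q r) ∷ []) (E₁ PS.∷ E₂ PS.∷ PS.[])

  w≄0 : ¬ w ≃ []
  w≄0 w≃0 = z′≄0 (square-zero (PS.linear (t ∷ p ∷ q ∷ r ∷ z′ ∷ [])
    (λ t p q r z → (z :* z := # 0) , (:- # 1 , :- (z :* z) := C₂ t p q r) ∷ (q , q := # 0) ∷ (r :- # 2 :* p , r := # 0) ∷ [])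
    (E₂ PS.∷ q≃0 PS.∷ r≃0 PS.∷ PS.[])))
    where
    q≃0 : q ≃ []
    q≃0 = square-zero (domain t (q *ₚ q) (PS.linear (t ∷ p ∷ q ∷ w ∷ [])
      (λ t p q w → (t :* (q :* q) := # 0) , (:- # 1 , # 2 :* p :* w := t :* q :* q) ∷ (# 2 :* p , w := # 0) ∷ []) (2pw PS.∷ w≃0 PS.∷ PS.[])) t≄0)
    r≃0 : r ≃ []
    r≃0 = PS.linear (q ∷ r ∷ []) (λ q r → (r := # 0) , (:- # 1 , q :- r := # 0) ∷ (# 1 , q := # 0) ∷ []) (w≃0 PS.∷ q≃0 PS.∷ PS.[])

  wᴷ≉0 : ¬ ⌊ w ⌋ ≈ᴷ constᴷ 0ℚ
  wᴷ≉0 = ⌊⌋≉0 w≄0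

  opaque
    root : ∃[ x′ ] x′ *ᴷ ⌊ w ⌋ ≈ᴷ -ᴷ (tᴷ *ᴷ ⌊ q ⌋)
    root = divᴷ (-ᴷ (tᴷ *ᴷ ⌊ q ⌋)) ⌊ w ⌋ wᴷ≉0 , div-* (-ᴷ (tᴷ *ᴷ ⌊ q ⌋)) ⌊ w ⌋ wᴷ≉0

    z⁻ : ∃[ i ] i *ᴷ ⌊ z′ ⌋ ≈ᴷ constᴷ 1ℚ
    z⁻ = inverseᴷ (⌊⌋≉0 z′≄0)

  x₁ : K
  x₁ = proj₁ root

  wᴷ : ⌊ w ⌋ ≈ᴷ ⌊ q ⌋ +ᴷ -ᴷ ⌊ r ⌋
  wᴷ = ⌊⌋-value (q ∷ r ∷ []) (λ q r → q :- r)

  hA : x₁ *ᴷ (⌊ q ⌋ +ᴷ -ᴷ ⌊ r ⌋) ≈ᴷ -ᴷ (tᴷ *ᴷ ⌊ q ⌋)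
  hA = KR.trans (KR.*-congˡ (KR.sym wᴷ)) (proj₂ root)

  hB : KS.fromℕ 2 *ᴷ ⌊ p ⌋ ≈ᴷ -ᴷ (⌊ q ⌋ *ᴷ x₁)
  hB = KS.x-y≈0⇒x≈y (integralᴷ wᴷ≉0 (KS.linear (⌊ w ⌋ ∷ ⌊ p ⌋ ∷ ⌊ q ⌋ ∷ x₁ ∷ tᴷ ∷ [])
    (λ w p q x t → (w :* (# 2 :* p :- :- (q :* x)) := # 0) , (# 1 , # 2 :* p :* w := t :* q :* q) ∷ (q , x :* w := :- (t :* q)) ∷ [])
    (⌊⌋-holds (p ∷ w ∷ t ∷ q ∷ []) (λ p w t q → # 2 :* p :* w := t :* q :* q) 2pw KS.∷ proj₂ root KS.∷ KS.[])))

  open Halving fieldRing tᴷ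

  slope₁ offset : K
  slope₁ = proj₁ z⁻ *ᴷ (⌊ p ⌋ +ᴷ -ᴷ ⌊ q ⌋ +ᴷ -ᴷ ⌊ r ⌋ +ᴷ -ᴷ (x₁ *ᴷ ⌊ r ⌋))
  offset = proj₁ z⁻ *ᴷ (-ᴷ (tᴷ *ᴷ ⌊ r ⌋) +ᴷ -ᴷ (x₁ *ᴷ ⌊ p ⌋))

  y₁ : K
  y₁ = slope₁ *ᴷ x₁ +ᴷ offset

  tangentLine : CL.Line x₁ y₁ x₁ y₁ u (slope₁ *ᴷ u +ᴷ offset)
  tangentLine = halving (proj₂ z⁻) hA hB
    (KS.linear (⌊ p ⌋ ∷ ⌊ q ⌋ ∷ ⌊ r ⌋ ∷ ⌊ z′ ⌋ ∷ tᴷ ∷ []) (λ p q r z t → (z :* z := q :* q :+ r :* r :- # 2 :* p :* r) ,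
      (:- # 1 , :- (z :* z) := C₂ t p q r) ∷ []) (⌊⌋-holds (z′ ∷ t ∷ p ∷ q ∷ r ∷ []) (λ z t p q r → :- (z :* z) := C₂ t p q r) E₂ KS.∷ KS.[]))
    (KS.linear (⌊ p ⌋ ∷ ⌊ q ⌋ ∷ ⌊ r ⌋ ∷ ⌊ z′ ⌋ ∷ tᴷ ∷ u ∷ ⌊ x ⌋ ∷ [])
      (λ p q r z t u x → (u :* (z :* z) := p :* p :+ # 2 :* q :* r :- q :* q :- (t :+ # 1) :* r :* r) ,
        (# 1 , u :* (z :* z) := x) ∷ (# 1 , x := C₀ t p q r) ∷ [])
      (u-eq KS.∷ ⌊⌋-holds (x ∷ t ∷ p ∷ q ∷ r ∷ []) (λ x t p q r → x := C₀ t p q r) E₀ KS.∷ KS.[]))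

  -- For `x₁ = x̂ / e` with `e = ẑ²`, coprimality makes `e` divide `q` and `e²` divide `w`; so
  -- `4 deg ẑ ≤ deg w ≤ n`. Then `x̂² w₂ = 2 t p` gives `2 deg x̂ ≤ n + 2`. This is where the height
  -- is quartered.
  module Smaller {pp′ : PolyPoint} (rep′ : Rep pp′ x₁ y₁) where
    open PolyPoint pp′ renaming (x to x̂; y to ŷ; z′ to ẑ; α to α̂; β to β̂; coprime to coprimê; z′≄0 to ẑ≄0; y≄0 to ŷ≄0; curve to curvê)

    e : Poly
    e = ẑ *ₚ ẑ

    e≄0 : ¬ e ≃ []
    e≄0 = ≄0-* ẑ≄0 ẑ≄0

    wx̂ : w *ₚ x̂ ≃ negₚ (t *ₚ q *ₚ e)
    wx̂ = ⌊⌋-reflects ⌊⌋-injective (w ∷ x̂ ∷ t ∷ q ∷ ẑ ∷ []) (λ w x t q z → w :* x := :- (t :* q :* (z :* z)))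
      (KS.linear (⌊ w ⌋ ∷ ⌊ x̂ ⌋ ∷ tᴷ ∷ ⌊ q ⌋ ∷ ⌊ ẑ ⌋ ∷ x₁ ∷ []) (λ w x t q z x₁ → (w :* x := :- (t :* q :* (z :* z))) ,
        (:- w , x₁ :* (z :* z) := x) ∷ (z :* z , x₁ :* w := :- (t :* q)) ∷ []) (Rep.u-eq rep′ KS.∷ proj₂ root KS.∷ KS.[]))

    2pe : PS.fromℕ 2 *ₚ p *ₚ e ≃ negₚ (q *ₚ x̂)
    2pe = ⌊⌋-reflects ⌊⌋-injective (p ∷ x̂ ∷ q ∷ ẑ ∷ []) (λ p x q z → # 2 :* p :* (z :* z) := :- (q :* x))
      (KS.linear (⌊ p ⌋ ∷ ⌊ x̂ ⌋ ∷ ⌊ q ⌋ ∷ ⌊ ẑ ⌋ ∷ x₁ ∷ []) (λ p x q z x₁ → (# 2 :* p :* (z :* z) := :- (q :* x)) ,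
        (:- q , x₁ :* (z :* z) := x) ∷ (z :* z , # 2 :* p := :- (q :* x₁)) ∷ []) (Rep.u-eq rep′ KS.∷ hB KS.∷ KS.[]))

    A : Poly
    A = α̂ *ₚ α̂ *ₚ x̂ +ₚ PS.fromℕ 2 *ₚ α̂ *ₚ β̂ *ₚ ẑ

    coprime-e : x̂ *ₚ A +ₚ β̂ *ₚ β̂ *ₚ e ≃ 1ₚ
    coprime-e = PS.linear (x̂ ∷ ẑ ∷ α̂ ∷ β̂ ∷ []) (λ x z α β → (x :* (α :* α :* x :+ # 2 :* α :* β :* z) :+ β :* β :* (z :* z) := # 1) ,
      (α :* x :+ β :* z :+ # 1 , α :* x :+ β :* z := # 1) ∷ []) (coprimê PS.∷ PS.[])

    -- The quotients `q / e` and `w / e²`, written with the Bézout coefficients of `x̂` and `e`.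
    q₁ w₂ : Poly
    q₁ = q *ₚ β̂ *ₚ β̂ -ₚ PS.fromℕ 2 *ₚ p *ₚ A
    w₂ = w *ₚ β̂ *ₚ β̂ *ₚ β̂ *ₚ β̂ -ₚ t *ₚ q₁ *ₚ (x̂ *ₚ A *ₚ A +ₚ PS.fromℕ 2 *ₚ A *ₚ β̂ *ₚ β̂ *ₚ e)

    q-eq : q ≃ e *ₚ q₁
    q-eq = PS.linear (p ∷ q ∷ x̂ ∷ e ∷ β̂ ∷ A ∷ []) (λ p q x e β A → (q := e :* (q :* β :* β :- # 2 :* p :* A)) ,
      (:- q , x :* A :+ β :* β :* e := # 1) ∷ (A , # 2 :* p :* e := :- (q :* x)) ∷ []) (coprime-e PS.∷ 2pe PS.∷ PS.[])

    2p : PS.fromℕ 2 *ₚ p ≃ negₚ (q₁ *ₚ x̂)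
    2p = PD.cancel {e} (≄0⇒regular e≄0) (PS.linear (p ∷ q ∷ x̂ ∷ e ∷ q₁ ∷ []) (λ p q x e q₁ → (e :* (# 2 :* p) := e :* :- (q₁ :* x)) ,
      (# 1 , # 2 :* p :* e := :- (q :* x)) ∷ (:- x , q := e :* q₁) ∷ []) (2pe PS.∷ q-eq PS.∷ PS.[]))

    w-eq : w ≃ w₂ *ₚ (e *ₚ e)
    w-eq = PS.linear (w ∷ q ∷ x̂ ∷ e ∷ β̂ ∷ A ∷ t ∷ q₁ ∷ [])
      (λ w q x e β A t q₁ → (w := (w :* β :* β :* β :* β :- t :* q₁ :* (x :* A :* A :+ # 2 :* A :* β :* β :* e)) :* (e :* e)) ,
        (:- (w :* (x :* A :+ β :* β :* e :+ # 1)) , x :* A :+ β :* β :* e := # 1) ∷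
        (x :* A :* A :+ # 2 :* A :* β :* β :* e , w :* x := :- (t :* q :* e)) ∷
        (:- (t :* e :* (x :* A :* A :+ # 2 :* A :* β :* β :* e)) , q := e :* q₁) ∷ [])
      (coprime-e PS.∷ wx̂ PS.∷ q-eq PS.∷ PS.[])

    x²w₂ : x̂ *ₚ x̂ *ₚ w₂ ≃ PS.fromℕ 2 *ₚ (t *ₚ p)
    x²w₂ = PD.cancel {e *ₚ e} (≄0⇒regular (≄0-* e≄0 e≄0)) (PS.linear (p ∷ q ∷ w ∷ x̂ ∷ e ∷ t ∷ q₁ ∷ w₂ ∷ [])
      (λ p q w x e t q₁ w₂ → (e :* e :* (x :* x :* w₂) := e :* e :* (# 2 :* (t :* p))) ,
        (:- (x :* x) , w := w₂ :* (e :* e)) ∷ (x , w :* x := :- (t :* q :* e)) ∷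
        (:- (x :* t :* e) , q := e :* q₁) ∷ (:- (t :* e :* e) , # 2 :* p := :- (q₁ :* x)) ∷ [])
      (w-eq PS.∷ wx̂ PS.∷ q-eq PS.∷ 2p PS.∷ PS.[]))

    w₂≄0 : ¬ w₂ ≃ []
    w₂≄0 = ≄0-factor {w} {e *ₚ e} {w₂} (≃-trans w-eq (*ₚ-comm w₂ (e *ₚ e))) w≄0

    dw : Deg< (suc n) w
    dw = Deg<-minus (proj₁ (proj₂ bounds)) (proj₂ (proj₂ bounds))

    smaller : ∀ m → n ℕ.≤ 3 ℕ.+ 4 ℕ.* m → Bounded (suc m) (3 ℕ.+ (m ℕ.+ m)) pp′
    smaller m n≤ = mkBounded (dz (lead ẑ ẑ≄0) (lead w₂ w₂≄0)) (dx (zero? x̂) (lead w₂ w₂≄0))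
      where
      dz : ∃[ a ] Lead a ẑ → ∃[ b ] Lead b w₂ → Deg< (suc m) ẑ
      dz (a , la) (b , lb) = Deg<-mono (s≤s (ℕP.≮⇒≥ λ m<a → ℕP.<-irrefl refl (begin-strict
        n                                            ≤⟨ n≤ ⟩
        3 ℕ.+ 4 ℕ.* m                                <⟨ ℕP.n<1+n _ ⟩
        4 ℕ.+ 4 ℕ.* m                                ≡⟨ ℕP.*-suc 4 m ⟨
        4 ℕ.* suc m                                  ≤⟨ ℕP.*-monoʳ-≤ 4 m<a ⟩
        4 ℕ.* a                                      ≡⟨ four-times a ⟩
        (a ℕ.+ a) ℕ.+ (a ℕ.+ a)                      ≤⟨ ℕP.m≤n+m _ b ⟩
        b ℕ.+ ((a ℕ.+ a) ℕ.+ (a ℕ.+ a))              ≤⟨ ℕP.≤-pred (Lead-< dw (Lead-cong (≃-sym w-eq) (Lead-* lb (Lead-* (Lead-* la la) (Lead-* la la))))) ⟩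
        n                                            ∎))) (bound la)
        where
        open ℕP.≤-Reasoning
        four-times : ∀ a → 4 ℕ.* a ≡ (a ℕ.+ a) ℕ.+ (a ℕ.+ a)
        four-times a = ≡.trans (cong (λ x → a ℕ.+ (a ℕ.+ (a ℕ.+ x))) (ℕP.+-identityʳ a)) (≡.sym (ℕP.+-assoc a a (a ℕ.+ a)))
      dx : Dec (x̂ ≃ []) → ∃[ b ] Lead b w₂ → Deg< (3 ℕ.+ (m ℕ.+ m)) x̂
      dx (yes z) _ = Deg<-zero z
      dx (no nz) (b , lb) = from (lead x̂ nz)
        where
        open ℕP.≤-Reasoning
        double : ∀ m → 6 ℕ.+ 4 ℕ.* m ≡ (3 ℕ.+ (m ℕ.+ m)) ℕ.+ (3 ℕ.+ (m ℕ.+ m))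
        double m = solve 1 (λ m → N:con 6 N:+ N:con 4 N:* m N:= (N:con 3 N:+ (m N:+ m)) N:+ (N:con 3 N:+ (m N:+ m))) refl m
        from : ∃[ c ] Lead c x̂ → Deg< (3 ℕ.+ (m ℕ.+ m)) x̂
        from (c , lc) = Deg<-mono (ℕP.≰⇒> λ le → ℕP.<-irrefl refl (begin-strict
          c ℕ.+ c ℕ.+ b                                  <⟨ Lead-< (Deg<-fromℕ 0 (Deg<-t (proj₁ bounds))) (Lead-cong x²w₂ (Lead-* (Lead-* lc lc) lb)) ⟩
          3 ℕ.+ n                                        ≤⟨ ℕP.+-monoʳ-≤ 3 n≤ ⟩
          6 ℕ.+ 4 ℕ.* m                                  ≡⟨ double m ⟩
          (3 ℕ.+ (m ℕ.+ m)) ℕ.+ (3 ℕ.+ (m ℕ.+ m))        ≤⟨ ℕP.+-mono-≤ le le ⟩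
          c ℕ.+ c                                        ≤⟨ ℕP.m≤m+n (c ℕ.+ c) b ⟩
          c ℕ.+ c ℕ.+ b                                  ∎)) (bound lc)

-- Points of minimal height in the trivial class

≢0-Lead : ∀ {p} → ¬ p ≃ [] → Deg< 1 p → Lead 0 p
≢0-Lead {p} p≄0 d = mkLead d λ e → p≄0 (≃-trans (Deg<-1⇒κ d) (≃-trans (κ-cong e) κ-zero))

odd≢even : ∀ j → ¬ j ℕ.+ j ≡ 1
odd≢even (suc j) e with ≡.trans (≡.sym (ℕP.+-suc j j)) (ℕP.suc-injective e)
... | ()

-- As `z` is constant, a nonzero `m` would give the square `s²` the odd degree 1.
even-degree : ∀ {s z m g} → ¬ z ≃ [] → Deg< 1 z → s *ₚ s ≃ z *ₚ z *ₚ (κ m *ₚ t +ₚ κ g) → m ≡ 0ℚ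
even-degree {s} {z} {m} {g} z≄0 dz e = from (m ℚP.≟ 0ℚ)
  where
  lead-z : Lead 0 z
  lead-z = ≢0-Lead z≄0 dz
  lead-rhs : ¬ m ≡ 0ℚ → Lead 1 (s *ₚ s)
  lead-rhs m≢0 = Lead-cong (≃-sym e) (Lead-* (Lead-* lead-z lead-z) (Lead-+ (Lead-* (Lead-κ m≢0) t-Lead) (Deg<-cons Deg<-[])))
  from : Dec (m ≡ 0ℚ) → m ≡ 0ℚ
  from (yes z) = z
  from (no nz) = ⊥-elim (contradiction (lead s s≄0))
    where
    s≄0 : ¬ s ≃ []
    s≄0 z = Lead-≄0 (lead-rhs nz) (*ₚ-cong {s} {[]} {s} {s} z ≃-refl)
    contradiction : ∃[ j ] Lead j s → ⊥
    contradiction (j , l) = odd≢even j (Lead-unique (Lead-* l l) (lead-rhs nz))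

-- In height 0 both `q` and `w` are constants, so `x₁ = f t` with constant `f`. The curve equation
-- divided by `t²` becomes `s² = z′² ((f³ + f²) t + 2 f² + 2 f + 1)`, and parity of degrees forces
-- `f² (f + 1) = 0`.
module Base (pp : PolyPoint) (u v : K) (rep : Rep pp u v) (bd : Bounded 1 3 pp) (p q r : Poly)
  (E₀ : PolyPoint.x pp ≃ c₀ p q r)
  (E₁ : negₚ (PolyPoint.z′ pp *ₚ PolyPoint.z′ pp) ≃ c₁ p q r)
  (E₂ : negₚ (PolyPoint.z′ pp *ₚ PolyPoint.z′ pp) ≃ c₂ p q r) where
  open PolyPoint pp using (z′; z′≄0)
  open Halve 0 pp u v rep bd p q r E₀ E₁ E₂

  b c i f : ℚ
  b = coeff w 0
  c = coeff q 0

  w-const : w ≃ κ b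
  w-const = Deg<-1⇒κ (Deg<-minus (proj₁ (proj₂ bounds)) (proj₂ (proj₂ bounds)))

  inverse-b : ∃[ i ] i ℚ.* b ≡ 1ℚ
  inverse-b = ≡-inverse λ z → w≄0 (≃-trans w-const (≃-trans (κ-cong z) κ-zero))

  i = proj₁ inverse-b
  f = ℚ.- (i ℚ.* c)

  F : Poly
  F = κ f

  F-def : F ≃ negₚ (κ i *ₚ q)
  F-def = ≃-trans (≃-sym (negₚ-cong (κ-mult i c))) (negₚ-cong (*ₚ-congʳ (κ i) (≃-sym (Deg<-1⇒κ (proj₁ (proj₂ bounds))))))

  iw : κ i *ₚ w ≃ 1ₚ
  iw = ≃-trans (*ₚ-congʳ (κ i) w-const) (≃-trans (κ-mult i b) (κ-cong (proj₂ inverse-b)))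

  x₁-eq : x₁ ≈ᴷ ⌊ F ⌋ *ᴷ tᴷ
  x₁-eq = KS.linear (x₁ ∷ ⌊ F ⌋ ∷ tᴷ ∷ ⌊ w ⌋ ∷ ⌊ q ⌋ ∷ ⌊ κ i ⌋ ∷ [])
    (λ x f t w q i → (x := f :* t) , (:- x , i :* w := # 1) ∷ (i , x :* w := :- (t :* q)) ∷ (:- t , f := :- (i :* q)) ∷ [])
    (⌊⌋-holds (κ i ∷ w ∷ []) (λ i w → i :* w := # 1) iw KS.∷ proj₂ root KS.∷
     ⌊⌋-holds (F ∷ κ i ∷ q ∷ []) (λ f i q → f := :- (i :* q)) F-def KS.∷ KS.[])

  s : Poly
  s = negₚ (F *ₚ q +ₚ F *ₚ r +ₚ r +ₚ F *ₚ F *ₚ r *ₚ t)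

  y₁-eq : y₁ *ᴷ ⌊ z′ ⌋ ≈ᴷ tᴷ *ᴷ ⌊ s ⌋
  y₁-eq = KS.linear (x₁ ∷ ⌊ F ⌋ ∷ tᴷ ∷ ⌊ p ⌋ ∷ ⌊ q ⌋ ∷ ⌊ r ⌋ ∷ ⌊ z′ ⌋ ∷ proj₁ z⁻ ∷ ⌊ s ⌋ ∷ [])
    (λ x f t p q r z i s → ((i :* (p :- q :- r :- x :* r) :* x :+ i :* (:- (t :* r) :- x :* p)) :* z := t :* s) ,
      ((p :- q :- r :- x :* r) :* x :- t :* r :- x :* p , i :* z := # 1) ∷
      (:- q :- r :- r :* (x :+ f :* t) , x := f :* t) ∷ (:- t , s := :- (f :* q :+ f :* r :+ r :+ f :* f :* r :* t)) ∷ [])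
    (proj₂ z⁻ KS.∷ x₁-eq KS.∷ ⌊⌋-value (F ∷ q ∷ r ∷ t ∷ []) (λ f q r t → :- (f :* q :+ f :* r :+ r :+ f :* f :* r :* t)) KS.∷ KS.[])

  y₁² : y₁ *ᴷ y₁ ≈ᴷ CL.rhs x₁
  y₁² = CL.on-curve tangentLine

  f₃ f₁ : ℚ
  f₃ = f ℚ.* f ℚ.* f ℚ.+ f ℚ.* f
  f₁ = f ℚ.* f ℚ.+ f ℚ.* f ℚ.+ (f ℚ.+ f) ℚ.+ 1ℚ

  s² : s *ₚ s ≃ z′ *ₚ z′ *ₚ ((F *ₚ F *ₚ F +ₚ F *ₚ F) *ₚ t +ₚ (F *ₚ F +ₚ F *ₚ F +ₚ (F +ₚ F) +ₚ 1ₚ))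
  s² = PD.cancel {t *ₚ t} (≄0⇒regular (≄0-* t≄0 t≄0)) (⌊⌋-reflects ⌊⌋-injective (t ∷ F ∷ z′ ∷ s ∷ [])
    (λ t f z s → t :* t :* (s :* s) := t :* t :* (z :* z :* ((f :* f :* f :+ f :* f) :* t :+ (f :* f :+ f :* f :+ (f :+ f) :+ # 1))))
    (KS.linear (x₁ ∷ y₁ ∷ ⌊ F ⌋ ∷ tᴷ ∷ ⌊ z′ ⌋ ∷ ⌊ s ⌋ ∷ [])
      (λ x y f t z s → (t :* t :* (s :* s) := t :* t :* (z :* z :* ((f :* f :* f :+ f :* f) :* t :+ (f :* f :+ f :* f :+ (f :+ f) :+ # 1)))) ,
        (:- (t :* s :+ y :* z) , y :* z := t :* s) ∷
        (z :* z , y :* y := x :* x :* x :+ (t :+ # 2) :* x :* x :+ # 2 :* t :* x :+ t :* t) ∷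
        (z :* z :* (x :* x :+ x :* (f :* t) :+ f :* t :* (f :* t) :+ (t :+ # 2) :* (x :+ f :* t) :+ # 2 :* t) , x := f :* t) ∷ [])
      (y₁-eq KS.∷ y₁² KS.∷ x₁-eq KS.∷ KS.[])))

  s²′ : s *ₚ s ≃ z′ *ₚ z′ *ₚ (κ f₃ *ₚ t +ₚ κ f₁)
  s²′ = ≃-trans s² (*ₚ-congʳ (z′ *ₚ z′) (+ₚ-cong (*ₚ-cong (+ₚ-cong FFF FF) (≃-refl {t})) (+ₚ-cong (+ₚ-cong (+ₚ-cong FF FF) (≃-refl {F +ₚ F})) (≃-refl {1ₚ}))))
    where
    FF : F *ₚ F ≃ κ (f ℚ.* f)
    FF = κ-mult f f
    FFF : F *ₚ F *ₚ F ≃ κ (f ℚ.* f ℚ.* f)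
    FFF = ≃-trans (*ₚ-cong FF (≃-refl {F})) (κ-mult (f ℚ.* f) f)

  f₃≡0 : f₃ ≡ 0ℚ
  f₃≡0 = even-degree {s} {z′} {f₃} {f₁} z′≄0 (z-bound bd) s²′

  f-cases : (f ≡ 0ℚ) ⊎ (f ≡ ℚ.- 1ℚ)
  f-cases = from (f ℚP.≟ 0ℚ)
    where
    from : Dec (f ≡ 0ℚ) → (f ≡ 0ℚ) ⊎ (f ≡ ℚ.- 1ℚ)
    from (yes z) = inj₁ z
    from (no nz) = inj₂ (ℚS.linear (f ∷ []) (λ f → (f := :- # 1) , (# 1 , f :+ # 1 := # 0) ∷ [])
      (ℚ-domain (ℚ-domain (ℚS.linear (f ∷ []) (λ f → (f :* (f :* (f :+ # 1)) := # 0) , (# 1 , f :* f :* f :+ f :* f := # 0) ∷ []) (f₃≡0 ℚS.∷ ℚS.[])) nz) nz ℚS.∷ ℚS.[]))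

  x₁-cases : (x₁ ≈ᴷ constᴷ 0ℚ) ⊎ (x₁ ≈ᴷ -ᴷ tᴷ)
  x₁-cases = from f-cases
    where
    from : (f ≡ 0ℚ) ⊎ (f ≡ ℚ.- 1ℚ) → (x₁ ≈ᴷ constᴷ 0ℚ) ⊎ (x₁ ≈ᴷ -ᴷ tᴷ)
    from (inj₁ z) = inj₁ (KS.linear (x₁ ∷ ⌊ F ⌋ ∷ tᴷ ∷ []) (λ x f t → (x := # 0) , (# 1 , x := f :* t) ∷ (t , f := # 0) ∷ [])
      (x₁-eq KS.∷ num-zero (≃-trans (κ-cong z) κ-zero) KS.∷ KS.[]))
    from (inj₂ z) = inj₂ (KS.linear (x₁ ∷ ⌊ F ⌋ ∷ tᴷ ∷ []) (λ x f t → (x := :- t) , (# 1 , x := f :* t) ∷ (t , f := :- # 1) ∷ [])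
      (x₁-eq KS.∷ KR.trans (⌊⌋-cong (κ-cong z)) (⌊⌋-value [] (:- # 1)) KS.∷ KS.[]))

halve : ∀ n pp u v → Rep pp u v → Bounded (suc n) (3 ℕ.+ (n ℕ.+ n)) pp → SquareClass (ι 1ₚ) (x-θ (PolyPoint.x pp) (PolyPoint.z′ pp *ₚ PolyPoint.z′ pp)) → Halved n u
halve n pp u v rep bd (elt p q r , e) = record
  { x′ = H.x₁ ; y′ = H.y₁ ; v′ = H.slope₁ *ᴷ u +ᴷ H.offset ; line = H.tangentLine
  ; smaller = λ m n≤ rep′ → H.Smaller.smaller rep′ m n≤
  ; base = base n rep bd }
  where
  open PolyPoint pp using (x; z′)
  e′ : x-θ x (z′ *ₚ z′) ≈ᴮ elt p q r *ᴮ elt p q r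
  e′ = B.trans e (B.*-identityˡ (elt p q r *ᴮ elt p q r))
  E₀ : x ≃ c₀ p q r
  E₀ = e₀ e′
  E₁ : negₚ (z′ *ₚ z′) ≃ c₁ p q r
  E₁ = e₁ e′
  E₂ : negₚ (z′ *ₚ z′) ≃ c₂ p q r
  E₂ = e₂ e′
  module H = Halve n pp u v rep bd p q r E₀ E₁ E₂
  base : ∀ n rep bd → n ≡ 0 → (Halve.x₁ n pp u v rep bd p q r E₀ E₁ E₂ ≈ᴷ constᴷ 0ℚ) ⊎ (Halve.x₁ n pp u v rep bd p q r E₀ E₁ E₂ ≈ᴷ -ᴷ tᴷ)
  base zero rep bd refl = Base.x₁-cases pp u v rep bd p q r E₀ E₁ E₂

-- The descent step for the nontrivial classes

-- R ↦ R + (c, t) for one of the points (c, t) with c ∈ {0, -2, -t}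
module Translate (pp : PolyPoint) (u v : K) (rep : Rep pp u v) (v² : v *ᴷ v ≈ᴷ CL.rhs u) (c : Poly)
  (root-c : c *ₚ c *ₚ c +ₚ (t +ₚ PS.fromℕ 2) *ₚ c *ₚ c +ₚ PS.fromℕ 2 *ₚ t *ₚ c ≃ [])
  (u≉c : ¬ u ≈ᴷ ⌊ c ⌋) where
  open PolyPoint pp
  open Rep rep

  W M N : Poly
  W = z′ *ₚ z′
  M = x -ₚ c *ₚ W
  -- The numerator over `M²` of the abscissa of the third point. Replacing `v²` by the cubic cancels
  -- the term `u³`, and with it every denominator other than `M²`.
  N = (x *ₚ c +ₚ PS.fromℕ 2 *ₚ t *ₚ W) *ₚ (x +ₚ c *ₚ W) +ₚ PS.fromℕ 2 *ₚ (t +ₚ PS.fromℕ 2) *ₚ c *ₚ x *ₚ W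
    +ₚ PS.fromℕ 2 *ₚ t *ₚ t *ₚ W *ₚ W -ₚ PS.fromℕ 2 *ₚ t *ₚ y *ₚ z′

  Nₑ : ∀ {n} → Expr n → Expr n → Expr n → Expr n → Expr n → Expr n
  Nₑ t c x y z = (x :* c :+ # 2 :* t :* (z :* z)) :* (x :+ c :* (z :* z)) :+ # 2 :* (t :+ # 2) :* c :* x :* (z :* z)
    :+ # 2 :* t :* t :* (z :* z) :* (z :* z) :- # 2 :* t :* y :* z

  root-cᴷ : ⌊ c ⌋ *ᴷ ⌊ c ⌋ *ᴷ ⌊ c ⌋ +ᴷ (tᴷ +ᴷ KS.fromℕ 2) *ᴷ ⌊ c ⌋ *ᴷ ⌊ c ⌋ +ᴷ KS.fromℕ 2 *ᴷ tᴷ *ᴷ ⌊ c ⌋ ≈ᴷ constᴷ 0ℚ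
  root-cᴷ = ⌊⌋-holds (t ∷ c ∷ []) (λ t c → c :* c :* c :+ (t :+ # 2) :* c :* c :+ # 2 :* t :* c := # 0) root-c

  c-curve : tᴷ *ᴷ tᴷ ≈ᴷ CL.rhs ⌊ c ⌋
  c-curve = KS.linear (tᴷ ∷ ⌊ c ⌋ ∷ []) (λ t c → (t :* t := c :* c :* c :+ (t :+ # 2) :* c :* c :+ # 2 :* t :* c :+ t :* t) ,
    (:- # 1 , c :* c :* c :+ (t :+ # 2) :* c :* c :+ # 2 :* t :* c := # 0) ∷ []) (root-cᴷ KS.∷ KS.[])

  opaque
    inverse-uc : ∃[ i ] i *ᴷ (⌊ c ⌋ +ᴷ -ᴷ u) ≈ᴷ constᴷ 1ℚ
    inverse-uc = inverseᴷ λ e → u≉c (KR.sym (KS.x-y≈0⇒x≈y e))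

  i l u₃ v₃ : K
  i  = proj₁ inverse-uc
  l  = i *ᴷ (tᴷ +ᴷ -ᴷ v)
  u₃ = l *ᴷ l +ᴷ -ᴷ a₂ᴷ +ᴷ -ᴷ u +ᴷ -ᴷ ⌊ c ⌋
  v₃ = l *ᴷ (u₃ +ᴷ -ᴷ u) +ᴷ v

  l-eq : l *ᴷ (⌊ c ⌋ +ᴷ -ᴷ u) ≈ᴷ tᴷ +ᴷ -ᴷ v
  l-eq = KS.linear (i ∷ ⌊ c ⌋ ∷ u ∷ v ∷ tᴷ ∷ []) (λ i c u v t → (i :* (t :- v) :* (c :- u) := t :- v) , (t :- v , i :* (c :- u) := # 1) ∷ []) (proj₂ inverse-uc KS.∷ KS.[])

  line : CL.Line u v ⌊ c ⌋ tᴷ u₃ v₃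
  line = CL.line-cong KR.refl KR.refl KR.refl
    (KS.linear (l ∷ ⌊ c ⌋ ∷ u ∷ v ∷ tᴷ ∷ []) (λ l c u v t → (l :* (c :- u) :+ v := t) , (# 1 , l :* (c :- u) := t :- v) ∷ []) (l-eq KS.∷ KS.[]))
    KR.refl KR.refl (CG.chord v² c-curve u≉c l-eq KR.refl)

  M-eq : ⌊ M ⌋ ≈ᴷ (u +ᴷ -ᴷ ⌊ c ⌋) *ᴷ (⌊ z′ ⌋ *ᴷ ⌊ z′ ⌋)
  M-eq = KS.linear (⌊ M ⌋ ∷ ⌊ x ⌋ ∷ ⌊ c ⌋ ∷ ⌊ z′ ⌋ ∷ u ∷ []) (λ M x c z u → (M := (u :- c) :* (z :* z)) ,
    (# 1 , M := x :- c :* (z :* z)) ∷ (:- # 1 , u :* (z :* z) := x) ∷ []) (⌊⌋-value (x ∷ c ∷ z′ ∷ []) (λ x c z → x :- c :* (z :* z)) KS.∷ u-eq KS.∷ KS.[])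

  M≄0 : ¬ M ≃ []
  M≄0 e = u≉c (KS.x-y≈0⇒x≈y (integralᴷ (⌊⌋≉0 (≄0-* z′≄0 z′≄0)) (KS.linear (⌊ M ⌋ ∷ ⌊ W ⌋ ∷ ⌊ c ⌋ ∷ ⌊ z′ ⌋ ∷ u ∷ [])
    (λ M W c z u → (W :* (u :- c) := # 0) , (u :- c , W := z :* z) ∷ (:- # 1 , M := (u :- c) :* (z :* z)) ∷ (# 1 , M := # 0) ∷ [])
    (⌊⌋-value (z′ ∷ []) (λ z → z :* z) KS.∷ M-eq KS.∷ num-zero e KS.∷ KS.[]))))

  u₃-eq : u₃ *ᴷ (⌊ M ⌋ *ᴷ ⌊ M ⌋) ≈ᴷ ⌊ N ⌋
  u₃-eq = KS.linear (⌊ M ⌋ ∷ ⌊ N ⌋ ∷ ⌊ x ⌋ ∷ ⌊ y ⌋ ∷ ⌊ c ⌋ ∷ ⌊ z′ ⌋ ∷ tᴷ ∷ u ∷ v ∷ l ∷ [])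
    (λ M N x y c z t u v l → ((l :* l :- (t :+ # 2) :- u :- c) :* (M :* M) := N) ,
      ((l :* l :- (t :+ # 2) :- u :- c) :* (M :+ (u :- c) :* (z :* z)) , M := (u :- c) :* (z :* z)) ∷
      (z :* z :* z :* z :* (l :* (c :- u) :+ (t :- v)) , l :* (c :- u) := t :- v) ∷
      (z :* z :* z :* z , v :* v := u :* u :* u :+ (t :+ # 2) :* u :* u :+ # 2 :* t :* u :+ t :* t) ∷
      (:- (z :* z :* z :* z) , c :* c :* c :+ (t :+ # 2) :* c :* c :+ # 2 :* t :* c := # 0) ∷
      (:- (# 2 :* t :* z) , v :* (z :* z :* z) := y) ∷
      (c :* (x :+ u :* z :* z) :+ c :* c :* z :* z :+ # 2 :* t :* z :* z :+ # 2 :* (t :+ # 2) :* c :* z :* z , u :* (z :* z) := x) ∷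
      (:- # 1 , N := Nₑ t c x y z) ∷ [])
    (M-eq KS.∷ l-eq KS.∷ v² KS.∷ root-cᴷ KS.∷ v-eq KS.∷ u-eq KS.∷ ⌊⌋-value (t ∷ c ∷ x ∷ y ∷ z′ ∷ []) Nₑ KS.∷ KS.[])

  v₃² : v₃ *ᴷ v₃ ≈ᴷ CL.rhs u₃
  v₃² = CL.on-curve (CL.swap₁₂ (CL.swap₂₃ line))

  -- The line through R, (c, t) and the third point, at θ and without denominators.
  Λ : Elt
  Λ = (ι y +ᴮ -ᴮ (ι t *ᴮ (ι z′ *ᴮ ι z′ *ᴮ ι z′))) *ᴮ (θ +ᴮ -ᴮ ι c) +ᴮ ι t *ᴮ ι z′ *ᴮ ι M

  module D = Descent pp

  -- At a root `θ` of the cubic the line identity becomes `(u - θ)(c - θ)(u₃ - θ) = (l θ + m)²`;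
  -- here it is cleared of denominators.
  Λ² : D.a *ᴮ (ι c +ᴮ -ᴮ θ) *ᴮ x-θ N (M *ₚ M) ≈ᴮ Λ *ᴮ Λ
  Λ² = BS.linear (ι x ∷ ι y ∷ ι z′ ∷ ι c ∷ ι t ∷ θ ∷ D.a ∷ x-θ N (M *ₚ M) ∷ ι M ∷ ι N ∷ ι (M *ₚ M) ∷ [])
    (λ x y z c t θ a b M N MM → (a :* (c :- θ) :* b := ((y :- t :* (z :* z :* z)) :* (θ :- c) :+ t :* z :* M) :* ((y :- t :* (z :* z :* z)) :* (θ :- c) :+ t :* z :* M)) ,
      ((c :- θ) :* b , a := x :+ :- ((z :* z) :* θ)) ∷
      ((x :- z :* z :* θ) :* (c :- θ) , b := N :+ :- (MM :* θ)) ∷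
      (:- ((x :- z :* z :* θ) :* (c :- θ) :* θ) , MM := M :* M) ∷
      ((x :- z :* z :* θ) :* (c :- θ) , N := Nₑ t c x y z) ∷
      (:- ((x :- z :* z :* θ) :* (c :- θ) :* θ :* (M :+ (x :- c :* (z :* z)))) :- # 2 :* (y :- t :* (z :* z :* z)) :* (θ :- c) :* t :* z :- t :* t :* z :* z :* (M :+ (x :- c :* (z :* z))) , M := x :- c :* (z :* z)) ∷
      (:- ((θ :- c) :* (θ :- c)) , y :* y := x :* x :* x :+ (t :+ # 2) :* x :* x :* (z :* z)
        :+ # 2 :* t :* x :* (z :* z) :* (z :* z) :+ t :* t :* (z :* z) :* (z :* z) :* (z :* z)) ∷
      (:- (z :* z :* (x :- c :* z :* z) :* (x :- c :* z :* z)) , θ :* θ :* θ :+ (t :+ # 2) :* θ :* θ :+ # 2 :* t :* θ :+ t :* t := # 0) ∷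
      (z :* z :* (x :- z :* z :* θ) :* (x :- z :* z :* θ) , c :* c :* c :+ (t :+ # 2) :* c :* c :+ # 2 :* t :* c := # 0) ∷ [])
    (D.a-def BS.∷ elt-x-θz N (M *ₚ M) BS.∷ ι-value (M ∷ []) (λ M → M :* M) BS.∷ ι-value (t ∷ c ∷ x ∷ y ∷ z′ ∷ []) Nₑ BS.∷
     ι-value (x ∷ c ∷ z′ ∷ []) (λ x c z → x :- c :* (z :* z)) BS.∷
     ι-holds (x ∷ y ∷ z′ ∷ t ∷ []) (λ x y z t → y :* y := x :* x :* x :+ (t :+ # 2) :* x :* x :* (z :* z)
        :+ # 2 :* t :* x :* (z :* z) :* (z :* z) :+ t :* t :* (z :* z) :* (z :* z) :* (z :* z)) curve BS.∷
     θ-rootᴮ BS.∷ ι-holds (t ∷ c ∷ []) (λ t c → c :* c :* c :+ (t :+ # 2) :* c :* c :+ # 2 :* t :* c := # 0) root-c BS.∷ BS.[])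

  -- The class of the translate: a b (c - θ) is a square, and so is a (c - θ) = G².
  translate-class : ∀ {G} → D.a *ᴮ (ι c +ᴮ -ᴮ θ) ≈ᴮ G *ᴮ G → ∀ {pp′} → Rep pp′ u₃ v₃ →
    SquareClass (ι 1ₚ) (x-θ (PolyPoint.x pp′) (PolyPoint.z′ pp′ *ₚ PolyPoint.z′ pp′))
  translate-class {G} G² {pp′} rep′ = k , BD.cancel {H *ᴮ H} (BD.regular-* regular-H regular-H)
      (BS.linear (G ∷ ι s ∷ k ∷ Λ ∷ a′ ∷ ι 1ₚ ∷ [])
        (λ G s k Λ a o → (G :* s :* (G :* s) :* a := G :* s :* (G :* s) :* (o :* (k :* k))) ,
          (# 1 , G :* s :* (G :* s) :* a := Λ :* Λ) ∷ (Λ :+ G :* s :* k , Λ := G :* s :* k) ∷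
          (:- (G :* s :* G :* s :* k :* k) , o := # 1) ∷ [])
        (H²a′ BS.∷ Λ-div BS.∷ B.refl BS.∷ BS.[]))
    where
    module P′ = PolyPoint pp′
    a′ : Elt
    a′ = x-θ P′.x (P′.z′ *ₚ P′.z′)
    opaque
      min : ∃[ s ] (M ≃ P′.z′ *ₚ s) × (N ≃ P′.x *ₚ (s *ₚ s)) × ¬ s ≃ []
      min = minimal rep′ N M M≄0 u₃-eq
    s : Poly
    s = proj₁ min
    H : Elt
    H = G *ᴮ ι s
    regular-c-θ : BD.Regular (ι c +ᴮ -ᴮ θ)
    regular-c-θ = BD.regular-cong (B.trans (elt-x-θz c 1ₚ) (B.+-congˡ (B.-‿cong (B.*-identityˡ θ))))
      (regular-norm (PD.regular-cong (≃-sym (≃-trans (norm-x-θz c 1ₚ)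
        (PS.linear (c ∷ t ∷ []) (λ c t → (c :* c :* c :+ (t :+ # 2) :* c :* c :* # 1 :+ # 2 :* t :* c :* # 1 :* # 1 :+ t :* t :* # 1 :* # 1 :* # 1 := t :* t) ,
          (# 1 , c :* c :* c :+ (t :+ # 2) :* c :* c :+ # 2 :* t :* c := # 0) ∷ []) (root-c PS.∷ PS.[]))))
        (≄0⇒regular (≄0-* t≄0 t≄0))))
    regular-G : BD.Regular G
    regular-G = BD.regular-factor {G *ᴮ G} {G} {G} B.refl (BD.regular-cong G² (BD.regular-* D.regular-a regular-c-θ))
    regular-s : BD.Regular (ι s)
    regular-s = regular-norm (PD.regular-cong (≃-sym (norm-ι s)) (≄0⇒regular (≄0-* (≄0-* s≄0 s≄0) s≄0)))
      where
      s≄0 : ¬ s ≃ []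
      s≄0 = proj₂ (proj₂ (proj₂ min))
    regular-H : BD.Regular H
    regular-H = BD.regular-* regular-G regular-s
    H²a′ : H *ᴮ H *ᴮ a′ ≈ᴮ Λ *ᴮ Λ
    H²a′ = BS.linear (G ∷ ι s ∷ a′ ∷ D.a ∷ ι c ∷ θ ∷ b ∷ Λ ∷ ι N ∷ ι (M *ₚ M) ∷ ι P′.x ∷ ι (P′.z′ *ₚ P′.z′) ∷ [])
      (λ G s a′ a c θ b Λ N MM x zz → (G :* s :* (G :* s) :* a′ := Λ :* Λ) ,
        (# 1 , a :* (c :- θ) :* b := Λ :* Λ) ∷ (:- b , a :* (c :- θ) := G :* G) ∷ (:- (G :* G) , b := N :+ :- (MM :* θ)) ∷
        (:- (G :* G) , N := x :* (s :* s)) ∷ (G :* G :* θ , MM := zz :* (s :* s)) ∷ (G :* G :* s :* s , a′ := x :+ :- (zz :* θ)) ∷ [])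
      (Λ² BS.∷ G² BS.∷ elt-x-θz N (M *ₚ M) BS.∷
       ι-holds (N ∷ P′.x ∷ s ∷ []) (λ N x s → N := x :* (s :* s)) (proj₁ (proj₂ (proj₂ min))) BS.∷
       ι-holds (M *ₚ M ∷ P′.z′ *ₚ P′.z′ ∷ s ∷ []) (λ MM zz s → MM := zz :* (s :* s)) (PS.linear (M ∷ P′.z′ ∷ s ∷ [])
         (λ M z s → (M :* M := z :* z :* (s :* s)) , (M :+ z :* s , M := z :* s) ∷ []) (proj₁ (proj₂ min) PS.∷ PS.[])) BS.∷
       elt-x-θz P′.x (P′.z′ *ₚ P′.z′) BS.∷ BS.[])
      where
      b : Elt
      b = x-θ N (M *ₚ M)
    opaque
      k-exists : ∃[ k ] Λ ≈ᴮ H *ᴮ k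
      k-exists = BD.square-divides bezoutᴮ {H} {a′} {Λ} regular-H H²a′
    k : Elt
    k = proj₁ k-exists
    Λ-div : Λ ≈ᴮ H *ᴮ k
    Λ-div = proj₂ k-exists

-- Every point lies in the subgroup

≤-by : ∀ k {a b} → a ℕ.+ k ≡ b → a ℕ.≤ b
≤-by k {a} e = ℕP.≤-trans (ℕP.m≤m+n a k) (ℕP.≤-reflexive e)

D-* : ∀ {a b p q} → Deg< (suc a) p → Deg< (suc b) q → Deg< (suc (a ℕ.+ b)) (p *ₚ q)
D-* {a} {b} {p} {q} d d′ = subst (λ j → Deg< j (p *ₚ q)) (ℕP.+-suc a b) (Deg<-* p d d′)

D-mono : ∀ {a b p} → a ℕ.≤ b → Deg< (suc a) p → Deg< (suc b) p
D-mono le = Deg<-mono (s≤s le)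

D-t : Deg< 2 t
D-t = bound t-Lead

D-2 : Deg< 1 (PS.fromℕ 2)
D-2 = mkDeg λ { (suc i) _ → refl }

D-t+2 : Deg< 2 (t +ₚ PS.fromℕ 2)
D-t+2 = Deg<-+ D-t (Deg<-mono (s≤s z≤n) D-2)

square-root-degree : ∀ b {y} → ¬ y ≃ [] → Deg< (suc (b ℕ.+ b)) (y *ₚ y) → Deg< (suc b) y
square-root-degree b {y} y≄0 d = from (lead y y≄0)
  where
  from : ∃[ j ] Lead j y → Deg< (suc b) y
  from (j , l) = Deg<-mono (ℕP.≰⇒> λ le → ℕP.<-irrefl refl (ℕP.<-≤-trans (Lead-< d (Lead-* l l)) (ℕP.+-mono-≤ le (ℕP.≤-trans (ℕP.n≤1+n b) le)))) (bound l)

half : ∀ n → ∃[ m ] (n ℕ.≤ suc (m ℕ.+ m)) × (m ℕ.≤ n) × ((n ≡ 0) ⊎ (m ℕ.< n))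
half zero    = 0 , z≤n , z≤n , inj₁ refl
half (suc zero) = 0 , s≤s z≤n , z≤n , inj₂ (s≤s z≤n)
half (suc (suc n)) = let (m , le , m≤n , _) = half n in
  suc m , s≤s (ℕP.≤-trans (s≤s le) (ℕP.≤-reflexive (cong suc (≡.sym (ℕP.+-suc m m))))) , s≤s (ℕP.≤-trans m≤n (ℕP.n≤1+n n)) , inj₂ (s≤s (s≤s m≤n))

member-base : ∀ {x y} → y *ᴷ y ≈ᴷ CL.rhs x → (x ≈ᴷ constᴷ 0ℚ) ⊎ (x ≈ᴷ -ᴷ tᴷ) → Member x y
member-base {x} {y} c (inj₁ e) = member-cong (KR.sym e) KR.refl (member-±
  (KS.linear (x ∷ y ∷ tᴷ ∷ []) (λ x y t → (t :* t := y :* y) , (:- # 1 , y :* y := x :* x :* x :+ (t :+ # 2) :* x :* x :+ # 2 :* t :* x :+ t :* t) ∷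
    (:- (x :* x :+ (t :+ # 2) :* x :+ # 2 :* t) , x := # 0) ∷ []) (c KS.∷ e KS.∷ KS.[])) member-P)
member-base {x} {y} c (inj₂ e) = member-cong (KR.sym e) KR.refl (member-±
  (KS.linear (x ∷ y ∷ tᴷ ∷ []) (λ x y t → (t :* t := y :* y) , (:- # 1 , y :* y := x :* x :* x :+ (t :+ # 2) :* x :* x :+ # 2 :* t :* x :+ t :* t) ∷
    (:- (x :* x :+ # 2 :* x) , x := :- t) ∷ []) (c KS.∷ e KS.∷ KS.[])) member-S)

member-halved : ∀ {n u v} → v *ᴷ v ≈ᴷ CL.rhs u → (h : Halved n u) → Member (Halved.x′ h) (Halved.y′ h) → Member u v
member-halved c h m = member-± (KR.trans (CL.on-curve (CL.swap₁₂ (CL.swap₂₃ (Halved.line h)))) (KR.sym c)) (member-line (Halved.line h) m m)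

-- The height n stands for deg z′ ≤ n and deg x ≤ 2 n + 2.
Generated : ℕ → Set
Generated n = ∀ {pp u v} → Rep pp u v → Bounded (suc n) (3 ℕ.+ (n ℕ.+ n)) pp → v *ᴷ v ≈ᴷ CL.rhs u → Member u v

-- Under `inj₁` the height is 0 and halving already names the abscissa; otherwise the half has
-- height `m`, to which the induction hypothesis applies.
generated-halved : ∀ {n u v} m → n ℕ.≤ 3 ℕ.+ 4 ℕ.* m → (n ≡ 0) ⊎ Generated m → Halved n u → v *ᴷ v ≈ᴷ CL.rhs u → Member u v
generated-halved m n≤ (inj₁ n≡0) h c = member-halved c h (member-base (CL.on-curve (Halved.line h)) (Halved.base h n≡0))
generated-halved m n≤ (inj₂ IH) h c = let (pp , rep) = normalise (CL.on-curve (Halved.line h)) in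
  member-halved c h (IH rep (Halved.smaller h m n≤ rep) (CL.on-curve (Halved.line h)))

module TranslateStep (pp : PolyPoint) (u v : K) (rep : Rep pp u v) (v² : v *ᴷ v ≈ᴷ CL.rhs u) (c : Poly)
  (root-c : c *ₚ c *ₚ c +ₚ (t +ₚ PS.fromℕ 2) *ₚ c *ₚ c +ₚ PS.fromℕ 2 *ₚ t *ₚ c ≃ [])
  (member-c : Member ⌊ c ⌋ tᴷ) where

  -- Here `n` is the height of the translate, which may exceed that of the given point; what counts
  -- is that the half of the translate has height `m`.
  step : ∀ {n} m → n ℕ.≤ 3 ℕ.+ 4 ℕ.* m → (n ≡ 0) ⊎ Generated m →
    ∀ {G} → Descent.a pp *ᴮ (ι c +ᴮ -ᴮ θ) ≈ᴮ G *ᴮ G →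
    (∀ u≉c → ∀ {pp′} → Rep pp′ (Translate.u₃ pp u v rep v² c root-c u≉c) (Translate.v₃ pp u v rep v² c root-c u≉c) → Bounded (suc n) (3 ℕ.+ (n ℕ.+ n)) pp′) →
    Member u v
  step {n} m n≤ IH {G} G² bd = from (u ≟ᴷ ⌊ c ⌋)
    where
    from : Dec (u ≈ᴷ ⌊ c ⌋) → Member u v
    from (yes e) = member-cong (KR.sym e) KR.refl (member-± (KS.linear (u ∷ v ∷ ⌊ c ⌋ ∷ tᴷ ∷ [])
      (λ u v c t → (t :* t := v :* v) , (:- # 1 , v :* v := u :* u :* u :+ (t :+ # 2) :* u :* u :+ # 2 :* t :* u :+ t :* t) ∷
        (:- (u :* u :+ u :* c :+ c :* c :+ (t :+ # 2) :* (u :+ c) :+ # 2 :* t) , u := c) ∷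
        (:- # 1 , c :* c :* c :+ (t :+ # 2) :* c :* c :+ # 2 :* t :* c := # 0) ∷ [])
      (v² KS.∷ e KS.∷ ⌊⌋-holds (t ∷ c ∷ []) (λ t c → c :* c :* c :+ (t :+ # 2) :* c :* c :+ # 2 :* t :* c := # 0) root-c KS.∷ KS.[])) member-c)
    from (no u≉c) = member-line (CL.swap₂₃ (CL.swap₁₂ T.line)) member-c (from-rep (normalise T.v₃²))
      where
      module T = Translate pp u v rep v² c root-c u≉c
      from-rep : ∃[ pp′ ] Rep pp′ T.u₃ T.v₃ → Member T.u₃ T.v₃
      from-rep (pp′ , rep′) = generated-halved m n≤ IH (halve n pp′ T.u₃ T.v₃ rep′ (bd u≉c rep′) (T.translate-class {G} G² rep′)) T.v₃²

  -- Serves `c = 0` and `c = -2`. The class supplies `deg x ≤ 2n` in place of `2n + 2`; then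
  -- `deg y ≤ 3n + 1`, `deg M ≤ 2n` and `deg N ≤ 4n + 2`, so the translate has height `2n`.
  module Constant (n : ℕ) (dc : Deg< 1 c) (dx : Deg< (suc (n ℕ.+ n)) (PolyPoint.x pp)) (dz : Deg< (suc n) (PolyPoint.z′ pp))
    (u≉c : ¬ u ≈ᴷ ⌊ c ⌋) where
    open PolyPoint pp
    module T = Translate pp u v rep v² c root-c u≉c
    e : ℕ
    e = n ℕ.+ n

    dW : Deg< (suc e) T.W
    dW = D-* dz dz

    d2t : Deg< 2 (PS.fromℕ 2 *ₚ t)
    d2t = D-* D-2 D-t

    dy : Deg< (suc (suc (n ℕ.+ e))) y
    dy = square-root-degree (suc (n ℕ.+ e)) y≄0 (Deg<-cong (≃-sym curve) (Deg<-+ (Deg<-+ (Deg<-+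
      (D-mono (≤-by 2 (solve 1 (λ n → (n N:+ n) N:+ (n N:+ n) N:+ (n N:+ n) N:+ N:con 2 N:= N:con 1 N:+ (n N:+ (n N:+ n)) N:+ (N:con 1 N:+ (n N:+ (n N:+ n)))) refl n)) (D-* (D-* dx dx) dx))
      (D-mono (≤-by 1 (solve 1 (λ n → N:con 1 N:+ (n N:+ n) N:+ (n N:+ n) N:+ (n N:+ n) N:+ N:con 1 N:= N:con 1 N:+ (n N:+ (n N:+ n)) N:+ (N:con 1 N:+ (n N:+ (n N:+ n)))) refl n)) (D-* (D-* (D-* D-t+2 dx) dx) dW)))
      (D-mono (≤-by 1 (solve 1 (λ n → N:con 1 N:+ (n N:+ n) N:+ (n N:+ n) N:+ (n N:+ n) N:+ N:con 1 N:= N:con 1 N:+ (n N:+ (n N:+ n)) N:+ (N:con 1 N:+ (n N:+ (n N:+ n)))) refl n)) (D-* (D-* (D-* d2t dx) dW) dW)))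
      (D-mono (≤-by 0 (solve 1 (λ n → N:con 2 N:+ (n N:+ n) N:+ (n N:+ n) N:+ (n N:+ n) N:+ N:con 0 N:= N:con 1 N:+ (n N:+ (n N:+ n)) N:+ (N:con 1 N:+ (n N:+ (n N:+ n)))) refl n)) (D-* (D-* (D-* (D-* D-t D-t) dW) dW) dW))))

    dM : Deg< (suc e) T.M
    dM = Deg<-minus dx (D-* dc dW)

    dN : Deg< (3 ℕ.+ (e ℕ.+ e)) T.N
    dN = Deg<-minus (Deg<-+ (Deg<-+
      (D-mono (ℕP.n≤1+n _) (D-* (Deg<-+ (D-mono (≤-by 1 (solve 1 (λ n → (n N:+ n) N:+ N:con 0 N:+ N:con 1 N:= N:con 1 N:+ (n N:+ n)) refl n)) (D-* dx dc)) (D-* d2t dW)) (Deg<-+ dx (D-* dc dW))))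
      (D-mono (≤-by 1 (solve 1 (λ n → N:con 0 N:+ N:con 1 N:+ N:con 0 N:+ (n N:+ n) N:+ (n N:+ n) N:+ N:con 1 N:= N:con 2 N:+ ((n N:+ n) N:+ (n N:+ n))) refl n)) (D-* (D-* (D-* (D-* D-2 D-t+2) dc) dx) dW)))
      (D-mono (≤-by 0 (solve 1 (λ n → N:con 0 N:+ N:con 1 N:+ N:con 1 N:+ (n N:+ n) N:+ (n N:+ n) N:+ N:con 0 N:= N:con 2 N:+ ((n N:+ n) N:+ (n N:+ n))) refl n)) (D-* (D-* (D-* d2t D-t) dW) dW)))
      (D-mono (≤-by 0 (solve 1 (λ n → N:con 1 N:+ (N:con 1 N:+ (n N:+ (n N:+ n))) N:+ n N:+ N:con 0 N:= N:con 2 N:+ ((n N:+ n) N:+ (n N:+ n))) refl n)) (D-* (D-* d2t dy) dz))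

    bounded : ∀ {pp′} → Rep pp′ T.u₃ T.v₃ → Bounded (suc e) (3 ℕ.+ (e ℕ.+ e)) pp′
    bounded rep′ = minimal-bounded rep′ T.N T.M T.M≄0 T.u₃-eq dM dN

-- Sharper degrees in the classes of P and Q

module Classes (n : ℕ) (pp : PolyPoint) (u v : K) (rep : Rep pp u v) (bd : Bounded (suc n) (3 ℕ.+ (n ℕ.+ n)) pp) where
  open PolyPoint pp
  open Descent pp using (a)

  W : Poly
  W = z′ *ₚ z′

  dW : Deg< (suc (n ℕ.+ n)) W
  dW = D-* (z-bound bd) (z-bound bd)

  -- The `z`- and `z⁻¹`-coordinates of `-θ h²` agree, which forces `c₁ = 0`; then `c₀ = W + c₂` and
  -- `x = t c₂`. With these relations the bounds on `p`, `q`, `r` each drop once more, leaving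
  -- `deg c₂ < 2n`.
  degree-P : ∀ {h} → a ≈ᴮ (-ᴮ θ) *ᴮ (h *ᴮ h) → Deg< (suc (n ℕ.+ n)) x
  degree-P {elt p q r} e = Deg<-cong (≃-sym E₀) (Deg<-t dC₂)
    where
    e′ : a ≈ᴮ elt (t *ₚ c₂ p q r) ((t +ₚ 1ₚ) *ₚ c₁ p q r +ₚ c₂ p q r -ₚ c₀ p q r) (c₁ p q r +ₚ c₂ p q r -ₚ c₀ p q r)
    e′ = B.trans e (-θ*-elt (c₀ p q r) (c₁ p q r) (c₂ p q r))
    E₀ : x ≃ t *ₚ c₂ p q r
    E₀ = e₀ e′
    C₁≃0 : c₁ p q r ≃ []
    C₁≃0 = domain t (c₁ p q r) (PS.linear (t ∷ c₀ p q r ∷ c₁ p q r ∷ c₂ p q r ∷ W ∷ [])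
      (λ t c₀ c₁ c₂ w → (t :* c₁ := # 0) , (:- # 1 , :- w := (t :+ # 1) :* c₁ :+ c₂ :- c₀) ∷ (# 1 , :- w := c₁ :+ c₂ :- c₀) ∷ [])
      (e₁ e′ PS.∷ e₂ e′ PS.∷ PS.[])) t≄0
    C₀-eq : W +ₚ c₂ p q r ≃ c₀ p q r
    C₀-eq = PS.linear (c₀ p q r ∷ c₁ p q r ∷ c₂ p q r ∷ W ∷ []) (λ c₀ c₁ c₂ w → (w :+ c₂ := c₀) ,
      (:- # 1 , :- w := c₁ :+ c₂ :- c₀) ∷ (:- # 1 , c₁ := # 0) ∷ []) (e₂ e′ PS.∷ C₁≃0 PS.∷ PS.[])
    d₀ : Deg< (2 ℕ.+ (n ℕ.+ n)) (c₀ p q r)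
    d₀ = Deg<-cong C₀-eq (Deg<-+ (Deg<-mono (ℕP.n≤1+n _) dW) (cancel-Deg< t-Lead (Deg<-cong E₀ (x-bound bd))))
    bounds : Deg< (suc (suc n)) p × Deg< (suc n) q × Deg< (suc n) r
    bounds = RootDegrees.bounds n p q r (Deg<-mono (ℕP.n≤1+n _) d₀) (Deg<-zero C₁≃0)
    dp : Deg< (suc n) p
    dp = drop-p n p q r (proj₁ (proj₂ bounds)) (proj₂ (proj₂ bounds)) (proj₁ bounds) d₀
    dq : Deg< n q
    dq = drop-q n p q r (proj₁ (proj₂ bounds)) (proj₂ (proj₂ bounds)) dp (Deg<-zero C₁≃0)
    dC₂′ : Deg< (suc (n ℕ.+ n)) (c₂ p q r)
    dC₂′ = Deg<-minus (Deg<-minus (Deg<-+ (D-* dp (proj₂ (proj₂ bounds))) (D-* (proj₂ (proj₂ bounds)) dp))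
      (D-* (proj₁ (proj₂ bounds)) (proj₁ (proj₂ bounds)))) (D-* (proj₂ (proj₂ bounds)) (proj₂ (proj₂ bounds)))
    dr : Deg< n r
    dr = drop-r n p q r (proj₁ (proj₂ bounds)) (proj₂ (proj₂ bounds)) dp (Deg<-cong C₀-eq (Deg<-+ dW dC₂′))
    dr′ : Deg< (suc n) r
    dr′ = proj₂ (proj₂ bounds)
    dC₂ : Deg< (n ℕ.+ n) (c₂ p q r)
    dC₂ = Deg<-minus (Deg<-minus (Deg<-+ (Deg<-* p dp dr) (Deg<-cong (*ₚ-comm p r) (Deg<-* p dp dr))) (Deg<-* q (proj₁ (proj₂ bounds)) dq)) (Deg<-* r dr′ dr)

  -- Comparing coordinates gives `c₁ = -W`, `c₀ = t c₁` and `x = c₁ - c₂`. The small `c₀` brings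
  -- `deg p` down to `n`, hence `deg c₂` to `2n`.
  degree-Q : ∀ {h} → a ≈ᴮ (-ᴮ z) *ᴮ (h *ᴮ h) → Deg< (suc (n ℕ.+ n)) x
  degree-Q {elt p q r} e = Deg<-cong (≃-sym E₀) (Deg<-minus dC₁ dC₂)
    where
    e′ : a ≈ᴮ elt (c₁ p q r -ₚ c₂ p q r) ((t +ₚ 1ₚ) *ₚ c₁ p q r -ₚ c₀ p q r) (c₁ p q r)
    e′ = B.trans e (-z*-elt (c₀ p q r) (c₁ p q r) (c₂ p q r))
    E₀ : x ≃ c₁ p q r -ₚ c₂ p q r
    E₀ = e₀ e′
    dC₁ : Deg< (suc (n ℕ.+ n)) (c₁ p q r)
    dC₁ = Deg<-cong (e₂ e′) (Deg<-neg dW)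
    d₀ : Deg< (2 ℕ.+ (n ℕ.+ n)) (c₀ p q r)
    d₀ = Deg<-cong (PS.linear (t ∷ c₀ p q r ∷ c₁ p q r ∷ W ∷ []) (λ t c₀ c₁ w → (t :* c₁ := c₀) ,
      (:- # 1 , :- w := (t :+ # 1) :* c₁ :- c₀) ∷ (# 1 , :- w := c₁) ∷ []) (e₁ e′ PS.∷ e₂ e′ PS.∷ PS.[])) (Deg<-t dC₁)
    bounds : Deg< (suc (suc n)) p × Deg< (suc n) q × Deg< (suc n) r
    bounds = RootDegrees.bounds n p q r (Deg<-mono (ℕP.n≤1+n _) d₀) (Deg<-mono (ℕP.≤-trans (ℕP.n≤1+n _) (ℕP.n≤1+n _)) dC₁)
    dq : Deg< (suc n) q
    dq = proj₁ (proj₂ bounds)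
    dr : Deg< (suc n) r
    dr = proj₂ (proj₂ bounds)
    dp : Deg< (suc n) p
    dp = drop-p n p q r dq dr (proj₁ bounds) d₀
    dC₂ : Deg< (suc (n ℕ.+ n)) (c₂ p q r)
    dC₂ = Deg<-minus (Deg<-minus (Deg<-+ (D-* dp dr) (D-* dr dp)) (D-* dq dq)) (D-* dr dr)

-- The class of P + Q

member-2P : Member (-ᴷ (tᴷ +ᴷ KS.fromℕ 1)) (-ᴷ KS.fromℕ 1)
member-2P = member-line (CL.mkLine (KS.fromℕ 1) tᴷ
  (KS.ringEq (tᴷ ∷ []) (λ t → t := # 1 :* # 0 :+ t)) (KS.ringEq (tᴷ ∷ []) (λ t → t := # 1 :* # 0 :+ t))
  (KS.ringEq (tᴷ ∷ []) (λ t → :- # 1 := # 1 :* :- (t :+ # 1) :+ t))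
  (KS.ringEq (tᴷ ∷ []) (λ t → # 0 :+ # 0 :+ :- (t :+ # 1) := # 1 :* # 1 :- (t :+ # 2)))
  (KS.ringEq (tᴷ ∷ []) (λ t → # 0 :* # 0 :+ # 0 :* :- (t :+ # 1) :+ # 0 :* :- (t :+ # 1) := # 2 :* t :- # 2 :* # 1 :* t))
  (KS.ringEq (tᴷ ∷ []) (λ t → # 0 :* # 0 :* :- (t :+ # 1) := t :* t :- t :* t))) member-P member-P

-- Together with `P - Q`, an exceptional point of height 0 in the class of `P + Q`. The points on
-- the line are `-(P + Q)`, `-2P` and hence `3P + Q`; with `2P` in place of `-2P` the third point is
-- `Q - P`, which has the abscissa of `P - Q`.
member-3P+Q : ∃[ v ] (v *ᴷ v ≈ᴷ CL.rhs (tᴷ *ᴷ tᴷ +ᴷ KS.fromℕ 3 *ᴷ tᴷ)) × Member (tᴷ *ᴷ tᴷ +ᴷ KS.fromℕ 3 *ᴷ tᴷ) v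
member-3P+Q = l *ᴷ (tᴷ *ᴷ tᴷ +ᴷ KS.fromℕ 3 *ᴷ tᴷ) +ᴷ m , CL.on-curve (CL.swap₁₂ (CL.swap₂₃ line)) , member-line line member-S member-2P
  where
  l m : K
  l = tᴷ +ᴷ KS.fromℕ 1
  m = tᴷ *ᴷ tᴷ +ᴷ KS.fromℕ 2 *ᴷ tᴷ
  line : CL.Line (-ᴷ tᴷ) tᴷ (-ᴷ (tᴷ +ᴷ KS.fromℕ 1)) (-ᴷ KS.fromℕ 1) (tᴷ *ᴷ tᴷ +ᴷ KS.fromℕ 3 *ᴷ tᴷ) (l *ᴷ (tᴷ *ᴷ tᴷ +ᴷ KS.fromℕ 3 *ᴷ tᴷ) +ᴷ m)
  line = CL.mkLine l m
    (KS.ringEq (tᴷ ∷ []) (λ t → t := (t :+ # 1) :* :- t :+ (t :* t :+ # 2 :* t)))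
    (KS.ringEq (tᴷ ∷ []) (λ t → :- # 1 := (t :+ # 1) :* :- (t :+ # 1) :+ (t :* t :+ # 2 :* t))) KR.refl
    (KS.ringEq (tᴷ ∷ []) (λ t → :- t :+ :- (t :+ # 1) :+ (t :* t :+ # 3 :* t) := (t :+ # 1) :* (t :+ # 1) :- (t :+ # 2)))
    (KS.ringEq (tᴷ ∷ []) (λ t → :- t :* :- (t :+ # 1) :+ :- t :* (t :* t :+ # 3 :* t) :+ :- (t :+ # 1) :* (t :* t :+ # 3 :* t) := # 2 :* t :- # 2 :* (t :+ # 1) :* (t :* t :+ # 2 :* t)))
    (KS.ringEq (tᴷ ∷ []) (λ t → :- t :* :- (t :+ # 1) :* (t :* t :+ # 3 :* t) := (t :* t :+ # 2 :* t) :* (t :* t :+ # 2 :* t) :- t :* t))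

member-P-Q : ∃[ v ] (v *ᴷ v ≈ᴷ CL.rhs (tᴷ *ᴷ tᴷ +ᴷ -ᴷ tᴷ)) × Member (tᴷ *ᴷ tᴷ +ᴷ -ᴷ tᴷ) v
member-P-Q = l *ᴷ (tᴷ *ᴷ tᴷ +ᴷ -ᴷ tᴷ) +ᴷ m , CL.on-curve (CL.swap₁₂ (CL.swap₂₃ line)) , member-line line member-S (member-neg member-2P)
  where
  l m : K
  l = tᴷ +ᴷ -ᴷ KS.fromℕ 1
  m = tᴷ *ᴷ tᴷ
  line : CL.Line (-ᴷ tᴷ) tᴷ (-ᴷ (tᴷ +ᴷ KS.fromℕ 1)) (-ᴷ -ᴷ KS.fromℕ 1) (tᴷ *ᴷ tᴷ +ᴷ -ᴷ tᴷ) (l *ᴷ (tᴷ *ᴷ tᴷ +ᴷ -ᴷ tᴷ) +ᴷ m)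
  line = CL.mkLine l m
    (KS.ringEq (tᴷ ∷ []) (λ t → t := (t :- # 1) :* :- t :+ t :* t))
    (KS.ringEq (tᴷ ∷ []) (λ t → :- :- # 1 := (t :- # 1) :* :- (t :+ # 1) :+ t :* t)) KR.refl
    (KS.ringEq (tᴷ ∷ []) (λ t → :- t :+ :- (t :+ # 1) :+ (t :* t :- t) := (t :- # 1) :* (t :- # 1) :- (t :+ # 2)))
    (KS.ringEq (tᴷ ∷ []) (λ t → :- t :* :- (t :+ # 1) :+ :- t :* (t :* t :- t) :+ :- (t :+ # 1) :* (t :* t :- t) := # 2 :* t :- # 2 :* (t :- # 1) :* (t :* t)))
    (KS.ringEq (tᴷ ∷ []) (λ t → :- t :* :- (t :+ # 1) :* (t :* t :- t) := (t :* t) :* (t :* t) :- t :* t))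

member-abscissa : ∀ {u u′ v} → v *ᴷ v ≈ᴷ CL.rhs u → u ≈ᴷ u′ → ∃[ v′ ] (v′ *ᴷ v′ ≈ᴷ CL.rhs u′) × Member u′ v′ → Member u v
member-abscissa {u} {u′} {v} c e (v′ , c′ , m) = member-cong (KR.sym e) KR.refl (member-± (KR.trans c′ (KR.trans (rhs-cong (KR.sym e)) (KR.sym c))) m)
  where
  rhs-cong : ∀ {x y} → x ≈ᴷ y → CL.rhs x ≈ᴷ CL.rhs y
  rhs-cong h = KR.+-congʳ (KR.+-cong (KR.+-cong (KR.*-cong (KR.*-cong h h) h) (KR.*-cong (KR.*-congˡ h) h)) (KR.*-congˡ h))

root-S : negₚ t *ₚ negₚ t *ₚ negₚ t +ₚ (t +ₚ PS.fromℕ 2) *ₚ negₚ t *ₚ negₚ t +ₚ PS.fromℕ 2 *ₚ t *ₚ negₚ t ≃ []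
root-S = PS.ringEq (t ∷ []) (λ t → :- t :* :- t :* :- t :+ (t :+ # 2) :* :- t :* :- t :+ # 2 :* t :* :- t := # 0)

-- In place of a better bound on `deg x`, this class gives `c₂ = 0` and `x = t X₁`, whence `t`
-- divides `y` too. In the translate by `c = -t` a factor `t` leaves `M` and `t²` leaves `N`, which
-- brings the height down to `2n + 1`.
module ClassS (n : ℕ) (pp : PolyPoint) (u v : K) (rep : Rep pp u v) (bd : Bounded (suc n) (3 ℕ.+ (n ℕ.+ n)) pp)
  (v² : v *ᴷ v ≈ᴷ CL.rhs u) (p q r : Poly) (e : Descent.a pp ≈ᴮ (-ᴮ (ι t +ᴮ θ)) *ᴮ (elt p q r *ᴮ elt p q r)) where
  open PolyPoint pp
  open Classes n pp u v rep bd using (W; dW)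

  X₁ : Poly
  X₁ = c₂ p q r -ₚ c₀ p q r

  e′ : Descent.a pp ≈ᴮ elt (t *ₚ X₁) (c₁ p q r +ₚ c₂ p q r -ₚ c₀ p q r) (c₁ p q r +ₚ c₂ p q r -ₚ c₀ p q r -ₚ t *ₚ c₂ p q r)
  e′ = B.trans e (-[t+θ]*-elt (c₀ p q r) (c₁ p q r) (c₂ p q r))

  x-eq : x ≃ t *ₚ X₁
  x-eq = e₀ e′

  C₂≃0 : c₂ p q r ≃ []
  C₂≃0 = domain t (c₂ p q r) (PS.linear (t ∷ c₀ p q r ∷ c₁ p q r ∷ c₂ p q r ∷ W ∷ [])
    (λ t c₀ c₁ c₂ w → (t :* c₂ := # 0) , (# 1 , :- w := c₁ :+ c₂ :- c₀ :- t :* c₂) ∷ (:- # 1 , :- w := c₁ :+ c₂ :- c₀) ∷ [])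
    (e₂ e′ PS.∷ e₁ e′ PS.∷ PS.[])) t≄0

  W-eq : W ≃ c₀ p q r -ₚ c₁ p q r
  W-eq = PS.linear (c₀ p q r ∷ c₁ p q r ∷ c₂ p q r ∷ W ∷ []) (λ c₀ c₁ c₂ w → (w := c₀ :- c₁) ,
    (:- # 1 , :- w := c₁ :+ c₂ :- c₀) ∷ (:- # 1 , c₂ := # 0) ∷ []) (e₁ e′ PS.∷ C₂≃0 PS.∷ PS.[])

  dX₁ : Deg< (2 ℕ.+ (n ℕ.+ n)) X₁
  dX₁ = cancel-Deg< t-Lead (Deg<-cong x-eq (x-bound bd))

  Y-poly : Poly
  Y-poly = t *ₚ X₁ *ₚ X₁ *ₚ X₁ +ₚ (t +ₚ PS.fromℕ 2) *ₚ X₁ *ₚ X₁ *ₚ W +ₚ PS.fromℕ 2 *ₚ X₁ *ₚ W *ₚ W +ₚ W *ₚ W *ₚ W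

  t²Y : t *ₚ t *ₚ Y-poly ≃ y *ₚ y
  t²Y = PS.linear (t ∷ x ∷ X₁ ∷ W ∷ y ∷ [])
    (λ t x X w y → (t :* t :* (t :* X :* X :* X :+ (t :+ # 2) :* X :* X :* w :+ # 2 :* X :* w :* w :+ w :* w :* w) := y :* y) ,
      (:- # 1 , y :* y := x :* x :* x :+ (t :+ # 2) :* x :* x :* w :+ # 2 :* t :* x :* w :* w :+ t :* t :* w :* w :* w) ∷
      (:- (x :* x :+ x :* (t :* X) :+ t :* X :* (t :* X) :+ (t :+ # 2) :* w :* (x :+ t :* X) :+ # 2 :* t :* w :* w) , x := t :* X) ∷ [])
    (curve PS.∷ x-eq PS.∷ PS.[])

  opaque
    Y-exists : ∃[ Y ] y ≃ t *ₚ Y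
    Y-exists = PD.square-divides bezout {t} {Y-poly} {y} (≄0⇒regular t≄0) t²Y

  Y₁ : Poly
  Y₁ = proj₁ Y-exists

  Y₁≄0 : ¬ Y₁ ≃ []
  Y₁≄0 = ≄0-factor {y} {t} {Y₁} (proj₂ Y-exists) y≄0

  Y₁² : Y₁ *ₚ Y₁ ≃ Y-poly
  Y₁² = PD.cancel {t *ₚ t} (≄0⇒regular (≄0-* t≄0 t≄0)) (PS.linear (t ∷ Y₁ ∷ y ∷ Y-poly ∷ [])
    (λ t Y y P → (t :* t :* (Y :* Y) := t :* t :* P) , (:- # 1 , t :* t :* P := y :* y) ∷ (:- (y :+ t :* Y) , y := t :* Y) ∷ [])
    (t²Y PS.∷ proj₂ Y-exists PS.∷ PS.[]))

  dW′ : Deg< (2 ℕ.+ (n ℕ.+ n)) W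
  dW′ = Deg<-mono (ℕP.n≤1+n _) dW

  dY₁ : Deg< (3 ℕ.+ (n ℕ.+ (n ℕ.+ n))) Y₁
  dY₁ = square-root-degree (2 ℕ.+ (n ℕ.+ (n ℕ.+ n))) Y₁≄0 (Deg<-cong (≃-sym Y₁²) (Deg<-+ (Deg<-+ (Deg<-+
    (D-mono le₁ (D-* (D-* (D-* D-t dX₁) dX₁) dX₁)) (D-mono le₁ (D-* (D-* (D-* D-t+2 dX₁) dX₁) dW′)))
    (D-mono le₀ (D-* (D-* (D-* D-2 dX₁) dW′) dW′))) (D-mono le₀ (D-* (D-* dW′ dW′) dW′))))
    where
    le₁ : 1 ℕ.+ suc (n ℕ.+ n) ℕ.+ suc (n ℕ.+ n) ℕ.+ suc (n ℕ.+ n) ℕ.≤ 2 ℕ.+ (n ℕ.+ (n ℕ.+ n)) ℕ.+ (2 ℕ.+ (n ℕ.+ (n ℕ.+ n)))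
    le₁ = ≤-by 0 (solve 1 (λ n → N:con 1 N:+ (N:con 1 N:+ (n N:+ n)) N:+ (N:con 1 N:+ (n N:+ n)) N:+ (N:con 1 N:+ (n N:+ n)) N:+ N:con 0
      N:= N:con 2 N:+ (n N:+ (n N:+ n)) N:+ (N:con 2 N:+ (n N:+ (n N:+ n)))) refl n)
    le₀ : suc (n ℕ.+ n) ℕ.+ suc (n ℕ.+ n) ℕ.+ suc (n ℕ.+ n) ℕ.≤ 2 ℕ.+ (n ℕ.+ (n ℕ.+ n)) ℕ.+ (2 ℕ.+ (n ℕ.+ (n ℕ.+ n)))
    le₀ = ℕP.≤-trans (ℕP.n≤1+n _) le₁

  module Translated (u≉c : ¬ u ≈ᴷ ⌊ negₚ t ⌋) where
    module T = Translate pp u v rep v² (negₚ t) root-S u≉c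
    M₁ N₁ : Poly
    M₁ = X₁ +ₚ W
    N₁ = (PS.fromℕ 2 *ₚ W -ₚ t *ₚ X₁) *ₚ (X₁ -ₚ W) -ₚ PS.fromℕ 2 *ₚ (t +ₚ PS.fromℕ 2) *ₚ X₁ *ₚ W +ₚ PS.fromℕ 2 *ₚ W *ₚ W -ₚ PS.fromℕ 2 *ₚ Y₁ *ₚ z′

    M-eq : T.M ≃ t *ₚ M₁
    M-eq = PS.linear (t ∷ x ∷ X₁ ∷ W ∷ []) (λ t x X w → (x :- :- t :* w := t :* (X :+ w)) , (# 1 , x := t :* X) ∷ []) (x-eq PS.∷ PS.[])

    N-eq : T.N ≃ t *ₚ t *ₚ N₁
    N-eq = PS.linear (t ∷ x ∷ X₁ ∷ W ∷ y ∷ Y₁ ∷ z′ ∷ [])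
      (λ t x X w y Y z → ((x :* :- t :+ # 2 :* t :* w) :* (x :+ :- t :* w) :+ # 2 :* (t :+ # 2) :* :- t :* x :* w :+ # 2 :* t :* t :* w :* w :- # 2 :* t :* y :* z
        := t :* t :* ((# 2 :* w :- t :* X) :* (X :- w) :- # 2 :* (t :+ # 2) :* X :* w :+ # 2 :* w :* w :- # 2 :* Y :* z)) ,
        (:- t :* (x :+ t :* X :- t :* w) :+ # 2 :* t :* w :- # 2 :* (t :+ # 2) :* t :* w , x := t :* X) ∷ (:- (# 2 :* t :* z) , y := t :* Y) ∷ [])
      (x-eq PS.∷ proj₂ Y-exists PS.∷ PS.[])

    M₁≄0 : ¬ M₁ ≃ []
    M₁≄0 = ≄0-factor {T.M} {t} {M₁} M-eq T.M≄0

    u₃-eq : T.u₃ *ᴷ (⌊ M₁ ⌋ *ᴷ ⌊ M₁ ⌋) ≈ᴷ ⌊ N₁ ⌋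
    u₃-eq = KS.x-y≈0⇒x≈y (integralᴷ (⌊⌋≉0 t≄0) (integralᴷ (⌊⌋≉0 t≄0) (KS.linear (tᴷ ∷ T.u₃ ∷ ⌊ T.M ⌋ ∷ ⌊ T.N ⌋ ∷ ⌊ M₁ ⌋ ∷ ⌊ N₁ ⌋ ∷ [])
      (λ t u M N M₁ N₁ → (t :* (t :* (u :* (M₁ :* M₁) :- N₁)) := # 0) ,
        (# 1 , u :* (M :* M) := N) ∷ (# 1 , N := t :* t :* N₁) ∷ (:- (u :* (M :+ t :* M₁)) , M := t :* M₁) ∷ [])
      (T.u₃-eq KS.∷ ⌊⌋-holds (T.N ∷ t ∷ N₁ ∷ []) (λ N t N₁ → N := t :* t :* N₁) N-eq KS.∷
       ⌊⌋-holds (T.M ∷ t ∷ M₁ ∷ []) (λ M t M₁ → M := t :* M₁) M-eq KS.∷ KS.[]))))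

    dN₁ : Deg< (3 ℕ.+ (suc (n ℕ.+ n) ℕ.+ suc (n ℕ.+ n))) N₁
    dN₁ = Deg<-minus (Deg<-+ (Deg<-minus
      (D-mono (≤-by 1 (solve 1 (λ n → N:con 1 N:+ (N:con 1 N:+ (n N:+ n)) N:+ (N:con 1 N:+ (n N:+ n)) N:+ N:con 1 N:= N:con 2 N:+ ((N:con 1 N:+ (n N:+ n)) N:+ (N:con 1 N:+ (n N:+ n)))) refl n))
        (D-* (Deg<-minus (D-mono (ℕP.n≤1+n _) (D-* D-2 dW′)) (D-* D-t dX₁)) (Deg<-minus dX₁ dW′)))
      (D-mono (≤-by 1 (solve 1 (λ n → N:con 1 N:+ (N:con 1 N:+ (n N:+ n)) N:+ (N:con 1 N:+ (n N:+ n)) N:+ N:con 1 N:= N:con 2 N:+ ((N:con 1 N:+ (n N:+ n)) N:+ (N:con 1 N:+ (n N:+ n)))) refl n)) (D-* (D-* (D-* D-2 D-t+2) dX₁) dW′)))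
      (D-mono (≤-by 2 (solve 1 (λ n → (N:con 1 N:+ (n N:+ n)) N:+ (N:con 1 N:+ (n N:+ n)) N:+ N:con 2 N:= N:con 2 N:+ ((N:con 1 N:+ (n N:+ n)) N:+ (N:con 1 N:+ (n N:+ n)))) refl n)) (D-* (D-* D-2 dW′) dW′)))
      (D-mono (≤-by 2 (solve 1 (λ n → N:con 2 N:+ (n N:+ (n N:+ n)) N:+ n N:+ N:con 2 N:= N:con 2 N:+ ((N:con 1 N:+ (n N:+ n)) N:+ (N:con 1 N:+ (n N:+ n)))) refl n)) (D-* (D-* D-2 dY₁) (z-bound bd)))

    bounded : ∀ {pp′} → Rep pp′ T.u₃ T.v₃ → Bounded (suc (suc (n ℕ.+ n))) (3 ℕ.+ (suc (n ℕ.+ n) ℕ.+ suc (n ℕ.+ n))) pp′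
    bounded rep′ = minimal-bounded rep′ N₁ M₁ M₁≄0 u₃-eq (Deg<-+ dX₁ dW′) dN₁

-- From height 0, translating leads to height 1 and halving only back to height 0, so the induction
-- would not progress. But `p`, `q`, `r` are constants here with `q² = r²` and `r (p - r) = 0`,
-- which leaves the abscissas `-t`, `t² - t` and `t² + 3 t`.
module ClassSBase (pp : PolyPoint) (u v : K) (rep : Rep pp u v) (bd : Bounded 1 3 pp)
  (v² : v *ᴷ v ≈ᴷ CL.rhs u) (p q r : Poly) (e : Descent.a pp ≈ᴮ (-ᴮ (ι t +ᴮ θ)) *ᴮ (elt p q r *ᴮ elt p q r)) where
  open PolyPoint pp
  open ClassS 0 pp u v rep bd v² p q r e
  open Classes 0 pp u v rep bd using (W; dW)

  d₀ : Deg< 2 (c₀ p q r)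
  d₀ = Deg<-cong (PS.linear (c₀ p q r ∷ c₂ p q r ∷ []) (λ c₀ c₂ → (:- (c₂ :- c₀) := c₀) , (:- # 1 , c₂ := # 0) ∷ []) (C₂≃0 PS.∷ PS.[])) (Deg<-neg dX₁)

  d₁ : Deg< 2 (c₁ p q r)
  d₁ = Deg<-cong (PS.linear (c₀ p q r ∷ c₁ p q r ∷ W ∷ []) (λ c₀ c₁ w → (c₀ :- w := c₁) , (:- # 1 , w := c₀ :- c₁) ∷ []) (W-eq PS.∷ PS.[])) (Deg<-minus d₀ dW′)

  bounds : Deg< 2 p × Deg< 1 q × Deg< 1 r
  bounds = RootDegrees.bounds 0 p q r (Deg<-mono (ℕP.n≤1+n _) d₀) (Deg<-mono (ℕP.n≤1+n _) d₁)

  dq : Deg< 1 q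
  dq = proj₁ (proj₂ bounds)
  dr : Deg< 1 r
  dr = proj₂ (proj₂ bounds)
  dp : Deg< 1 p
  dp = drop-p 0 p q r dq dr (proj₁ bounds) d₀

  -- `W = c₀ - c₁` is constant, and its only nonconstant contribution is `t (q² - r²)`.
  qq-rr : q *ₚ q -ₚ r *ₚ r ≃ []
  qq-rr = Deg<-0⇒≃ (cancel-Deg< t-Lead (Deg<-cong
    (PS.linear (t ∷ p ∷ q ∷ r ∷ W ∷ []) (λ t p q r w → (w :- (p :* p :+ # 2 :* (q :* r) :- # 2 :* (p :* q)) := t :* (q :* q :- r :* r)) ,
      (# 1 , w := C₀ t p q r :- C₁ t p q r) ∷ []) (W-eq PS.∷ PS.[]))
    (Deg<-minus dW (Deg<-minus (Deg<-+ (D-* dp dp) (D-* D-2 (D-* dq dr))) (D-* D-2 (D-* dp dq))))))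

  abscissa : ∀ k → x ≃ k *ₚ W → u ≈ᴷ ⌊ k ⌋
  abscissa k h = KS.x-y≈0⇒x≈y (integralᴷ (⌊⌋≉0 z′≄0) (integralᴷ (⌊⌋≉0 z′≄0) (KS.linear (⌊ z′ ⌋ ∷ u ∷ ⌊ k ⌋ ∷ ⌊ x ⌋ ∷ [])
    (λ z u k x → (z :* (z :* (u :- k)) := # 0) , (# 1 , u :* (z :* z) := x) ∷ (# 1 , x := k :* (z :* z)) ∷ [])
    (Rep.u-eq rep KS.∷ ⌊⌋-holds (x ∷ k ∷ z′ ∷ []) (λ x k z → x := k :* (z :* z)) h KS.∷ KS.[]))))

  rp-rr : r *ₚ (p -ₚ r) ≃ []
  rp-rr = domain (PS.fromℕ 2) (r *ₚ (p -ₚ r)) (PS.linear (t ∷ p ∷ q ∷ r ∷ [])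
    (λ t p q r → (# 2 :* (r :* (p :- r)) := # 0) , (# 1 , C₂ t p q r := # 0) ∷ (# 1 , q :* q :- r :* r := # 0) ∷ []) (C₂≃0 PS.∷ qq-rr PS.∷ PS.[]))
    λ z → absurd (at z 0)
    where
    absurd : ¬ coeff (PS.fromℕ 2) 0 ≡ 0ℚ
    absurd ()

  zero-product : ∀ {a b} → a *ₚ b ≃ [] → (a ≃ []) ⊎ (b ≃ [])
  zero-product {a} {b} h = from (zero? a)
    where
    from : Dec (a ≃ []) → (a ≃ []) ⊎ (b ≃ [])
    from (yes z) = inj₁ z
    from (no nz) = inj₂ (domain a b h nz)

  PlusMinus : Set
  PlusMinus = (q -ₚ r ≃ []) ⊎ (q +ₚ r ≃ [])

  plus-minus : PlusMinus
  plus-minus = zero-product (PS.linear (q ∷ r ∷ []) (λ q r → ((q :- r) :* (q :+ r) := # 0) , (# 1 , q :* q :- r :* r := # 0) ∷ []) (qq-rr PS.∷ PS.[]))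

  x-in-c₀ : x ≃ negₚ (t *ₚ c₀ p q r)
  x-in-c₀ = PS.linear (t ∷ x ∷ c₀ p q r ∷ c₂ p q r ∷ []) (λ t x c₀ c₂ → (x := :- (t :* c₀)) , (# 1 , x := t :* (c₂ :- c₀)) ∷ (t , c₂ := # 0) ∷ []) (x-eq PS.∷ C₂≃0 PS.∷ PS.[])

  case-r≃0 : r ≃ [] → PlusMinus → u ≈ᴷ ⌊ negₚ t ⌋
  case-r≃0 r≃0 pm = abscissa (negₚ t) (PS.linear (t ∷ x ∷ p ∷ q ∷ r ∷ W ∷ [])
    (λ t x p q r w → (x := :- t :* w) ,
      (# 1 , x := :- (t :* C₀ t p q r)) ∷ (t , w := C₀ t p q r :- C₁ t p q r) ∷
      (:- t :* (# 2 :* p :- (t :+ # 1) :* q) , q := # 0) ∷ (t :* r , r := # 0) ∷ [])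
    (x-in-c₀ PS.∷ W-eq PS.∷ q≃0 pm PS.∷ r≃0 PS.∷ PS.[]))
    where
    q≃0 : PlusMinus → q ≃ []
    q≃0 (inj₁ h) = PS.linear (q ∷ r ∷ []) (λ q r → (q := # 0) , (# 1 , q :- r := # 0) ∷ (# 1 , r := # 0) ∷ []) (h PS.∷ r≃0 PS.∷ PS.[])
    q≃0 (inj₂ h) = PS.linear (q ∷ r ∷ []) (λ q r → (q := # 0) , (# 1 , q :+ r := # 0) ∷ (:- # 1 , r := # 0) ∷ []) (h PS.∷ r≃0 PS.∷ PS.[])

  case-q≃r : p -ₚ r ≃ [] → q -ₚ r ≃ [] → u ≈ᴷ ⌊ t *ₚ t -ₚ t ⌋
  case-q≃r p≃r q≃r = abscissa (t *ₚ t -ₚ t) (PS.linear (t ∷ x ∷ p ∷ q ∷ r ∷ W ∷ [])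
    (λ t x p q r w → (x := (t :* t :- t) :* w) ,
      (# 1 , x := :- (t :* C₀ t p q r)) ∷ (:- (t :* t :- t) , w := C₀ t p q r :- C₁ t p q r) ∷
      (:- (t :* (p :+ r)) :- (t :* t :- t) :* (p :+ r) :+ # 2 :* (t :* t :- t) :* q , p :- r := # 0) ∷
      (:- (# 2 :* t :* r) :+ t :* (q :+ r) :- (t :* t :- t) :* t :* (q :+ r) , q :- r := # 0) ∷ [])
    (x-in-c₀ PS.∷ W-eq PS.∷ p≃r PS.∷ q≃r PS.∷ PS.[]))

  case-q≃-r : p -ₚ r ≃ [] → q +ₚ r ≃ [] → u ≈ᴷ ⌊ t *ₚ t +ₚ PS.fromℕ 3 *ₚ t ⌋
  case-q≃-r p≃r q≃-r = abscissa (t *ₚ t +ₚ PS.fromℕ 3 *ₚ t) (PS.linear (t ∷ x ∷ p ∷ q ∷ r ∷ W ∷ [])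
    (λ t x p q r w → (x := (t :* t :+ # 3 :* t) :* w) ,
      (# 1 , x := :- (t :* C₀ t p q r)) ∷ (:- (t :* t :+ # 3 :* t) , w := C₀ t p q r :- C₁ t p q r) ∷
      (:- (t :* (p :+ r)) :- (t :* t :+ # 3 :* t) :* (p :+ r) :+ # 2 :* (t :* t :+ # 3 :* t) :* q , p :- r := # 0) ∷
      (:- (# 2 :* t :* r) :+ t :* (q :- r) :- (t :* t :+ # 3 :* t) :* t :* (q :- r) , q :+ r := # 0) ∷ [])
    (x-in-c₀ PS.∷ W-eq PS.∷ p≃r PS.∷ q≃-r PS.∷ PS.[]))

-- Descent on the height

classS : ∀ n m → n ℕ.≤ suc (m ℕ.+ m) → (n ≡ 0) ⊎ Generated m → ∀ {pp u v} → Rep pp u v → Bounded (suc n) (3 ℕ.+ (n ℕ.+ n)) pp →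
  v *ᴷ v ≈ᴷ CL.rhs u → SquareClass (-ᴮ (ι t +ᴮ θ)) (Descent.a pp) → Member u v
classS n m n≤ (inj₁ refl) {pp} {u} {v} rep bd v² (elt p q r , e) = from-rp (Base₀.zero-product Base₀.rp-rr)
  where
  module Base₀ = ClassSBase pp u v rep bd v² p q r e
  from-pm : p -ₚ r ≃ [] → Base₀.PlusMinus → Member u v
  from-pm p≃r (inj₁ q≃r)  = member-abscissa v² (KR.trans (Base₀.case-q≃r p≃r q≃r) (⌊⌋-value (t ∷ []) (λ t → t :* t :- t))) member-P-Q
  from-pm p≃r (inj₂ q≃-r) = member-abscissa v² (KR.trans (Base₀.case-q≃-r p≃r q≃-r) (⌊⌋-value (t ∷ []) (λ t → t :* t :+ # 3 :* t))) member-3P+Q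
  from-rp : (r ≃ []) ⊎ (p -ₚ r ≃ []) → Member u v
  from-rp (inj₁ r≃0) = member-abscissa v² (KR.trans (Base₀.case-r≃0 r≃0 Base₀.plus-minus) (⌊⌋-neg t))
    (tᴷ , CL.on-curve (CL.swap₁₂ (CL.swap₂₃ line-PQ)) , member-S)
  from-rp (inj₂ p≃r) = from-pm p≃r Base₀.plus-minus
classS n m n≤ (inj₂ IH) {pp} {u} {v} rep bd v² (elt p q r , e) =
  TS.step {suc (n ℕ.+ n)} m height (inj₂ IH) {(ι t +ᴮ θ) *ᴮ h} G² (λ u≉c rep′ → S.Translated.bounded u≉c rep′)
  where
  module S = ClassS n pp u v rep bd v² p q r e
  module TS = TranslateStep pp u v rep v² (negₚ t) root-S (member-cong (KR.sym (⌊⌋-neg t)) KR.refl member-S)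
  h : Elt
  h = elt p q r
  -- Equality occurs for `n = 2m + 1`: the constant 3 in `Halved` leaves no slack.
  height : suc (n ℕ.+ n) ℕ.≤ 3 ℕ.+ 4 ℕ.* m
  height = ℕP.≤-trans (s≤s (ℕP.+-mono-≤ n≤ n≤))
    (ℕP.≤-reflexive (solve 1 (λ m → N:con 1 N:+ ((N:con 1 N:+ (m N:+ m)) N:+ (N:con 1 N:+ (m N:+ m))) N:= N:con 3 N:+ N:con 4 N:* m) refl m))
  G² : Descent.a pp *ᴮ (ι (negₚ t) +ᴮ -ᴮ θ) ≈ᴮ ((ι t +ᴮ θ) *ᴮ h) *ᴮ ((ι t +ᴮ θ) *ᴮ h)
  G² = BS.linear (Descent.a pp ∷ ι (negₚ t) ∷ ι t ∷ θ ∷ h ∷ [])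
    (λ a c t θ h → (a :* (c :- θ) := ((t :+ θ) :* h) :* ((t :+ θ) :* h)) ,
      (c :- θ , a := :- (t :+ θ) :* (h :* h)) ∷ (:- (t :+ θ) :* (h :* h) , c := :- t) ∷ [])
    (e BS.∷ ι-neg t BS.∷ BS.[])

root-P : [] *ₚ [] *ₚ [] +ₚ (t +ₚ PS.fromℕ 2) *ₚ [] *ₚ [] +ₚ PS.fromℕ 2 *ₚ t *ₚ [] ≃ []
root-P = PS.ringEq (t ∷ []) (λ t → # 0 :* # 0 :* # 0 :+ (t :+ # 2) :* # 0 :* # 0 :+ # 2 :* t :* # 0 := # 0)

root-Q : negₚ (PS.fromℕ 2) *ₚ negₚ (PS.fromℕ 2) *ₚ negₚ (PS.fromℕ 2) +ₚ (t +ₚ PS.fromℕ 2) *ₚ negₚ (PS.fromℕ 2) *ₚ negₚ (PS.fromℕ 2)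
  +ₚ PS.fromℕ 2 *ₚ t *ₚ negₚ (PS.fromℕ 2) ≃ []
root-Q = PS.ringEq (t ∷ []) (λ t → :- # 2 :* :- # 2 :* :- # 2 :+ (t :+ # 2) :* :- # 2 :* :- # 2 :+ # 2 :* t :* :- # 2 := # 0)

module Step (n m : ℕ) (n≤ : n ℕ.≤ suc (m ℕ.+ m)) (IH : (n ≡ 0) ⊎ Generated m) (pp : PolyPoint) (u v : K)
  (rep : Rep pp u v) (bd : Bounded (suc n) (3 ℕ.+ (n ℕ.+ n)) pp) (v² : v *ᴷ v ≈ᴷ CL.rhs u) where

  height : n ℕ.+ n ℕ.≤ 3 ℕ.+ 4 ℕ.* m
  height = ℕP.≤-trans (ℕP.+-mono-≤ n≤ n≤)
    (≤-by 1 (solve 1 (λ m → (N:con 1 N:+ (m N:+ m)) N:+ (N:con 1 N:+ (m N:+ m)) N:+ N:con 1 N:= N:con 3 N:+ N:con 4 N:* m) refl m))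

  double-zero : (n ≡ 0) ⊎ Generated m → (n ℕ.+ n ≡ 0) ⊎ Generated m
  double-zero (inj₁ refl) = inj₁ refl
  double-zero (inj₂ g) = inj₂ g

  open Classes n pp u v rep bd using (degree-P; degree-Q)

  classP : SquareClass (-ᴮ θ) (Descent.a pp) → Member u v
  classP (h , e) = TS.step {n ℕ.+ n} m height (double-zero IH) {θ *ᴮ h} G²
      (λ u≉c → TS.Constant.bounded n Deg<-[] (degree-P {h} e) (z-bound bd) u≉c)
    where
    module TS = TranslateStep pp u v rep v² [] root-P (member-cong (KR.sym (num-zero ≃-refl)) KR.refl member-P)
    G² : Descent.a pp *ᴮ (ι [] +ᴮ -ᴮ θ) ≈ᴮ (θ *ᴮ h) *ᴮ (θ *ᴮ h)
    G² = BS.linear (Descent.a pp ∷ θ ∷ h ∷ []) (λ a θ h → (a :* (# 0 :- θ) := (θ :* h) :* (θ :* h)) , (:- θ , a := (:- θ) :* (h :* h)) ∷ []) (e BS.∷ BS.[])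

  classQ : SquareClass (-ᴮ z) (Descent.a pp) → Member u v
  classQ (h , e) = TS.step {n ℕ.+ n} m height (double-zero IH) {(z +ᴮ BS.fromℕ 1) *ᴮ h} G²
      (λ u≉c → TS.Constant.bounded n (Deg<-neg D-2) (degree-Q {h} e) (z-bound bd) u≉c)
    where
    c : Poly
    c = negₚ (PS.fromℕ 2)
    module TS = TranslateStep pp u v rep v² c root-Q (member-cong (KR.sym (⌊⌋-value [] (:- # 2))) KR.refl member-Q)
    G² : Descent.a pp *ᴮ (ι c +ᴮ -ᴮ θ) ≈ᴮ ((z +ᴮ BS.fromℕ 1) *ᴮ h) *ᴮ ((z +ᴮ BS.fromℕ 1) *ᴮ h)
    G² = BS.linear (Descent.a pp ∷ ι c ∷ z ∷ z⁻¹ ∷ θ ∷ h ∷ [])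
      (λ a c z i θ h → (a :* (c :- θ) := ((z :+ # 1) :* h) :* ((z :+ # 1) :* h)) ,
        (c :- θ , a := (:- z) :* (h :* h)) ∷ (:- z :* (h :* h) , c := :- # 2) ∷ (z :* (h :* h) , θ := z :+ i) ∷ (h :* h , z :* i := # 1) ∷ [])
      (e BS.∷ ι-value [] (:- # 2) BS.∷ θ-def BS.∷ zz⁻¹ BS.∷ BS.[])

  member : DescentClass (Descent.a pp) → Member u v
  member (class-O c) = generated-halved m (ℕP.≤-trans (ℕP.m≤m+n n n) height) IH (halve n pp u v rep bd c) v²
  member (class-P c) = classP c
  member (class-Q c) = classQ c
  member (class-S c) = classS n m n≤ IH rep bd v² c

generated : ∀ n → Acc ℕ._<_ n → Generated n
generated n (acc smaller) {pp} {u} {v} rep bd v² = from (half n)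
  where
  from : ∃[ m ] (n ℕ.≤ suc (m ℕ.+ m)) × (m ℕ.≤ n) × ((n ≡ 0) ⊎ (m ℕ.< n)) → Member u v
  from (m , n≤ , _ , inj₁ n≡0) = Step.member n m n≤ (inj₁ n≡0) pp u v rep bd v² (Descent.classify pp)
  from (m , n≤ , _ , inj₂ m<n) = Step.member n m n≤ (inj₂ (generated m (smaller m<n))) pp u v rep bd v² (Descent.classify pp)

-- Spanning

member : ∀ {u v} → v *ᴷ v ≈ᴷ CL.rhs u → Member u v
member {u} {v} v² = from (normalise v²)
  where
  from : ∃[ pp ] Rep pp u v → Member u v
  from (pp , rep) = generated (m ℕ.+ n) (<-wellFounded (m ℕ.+ n)) rep
      (mkBounded (Deg<-mono (ℕP.≤-trans (ℕP.m≤m+n m n) (ℕP.n≤1+n _)) (proj₂ (finite-degree z′)))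
        (Deg<-mono (ℕP.≤-trans (ℕP.≤-trans (ℕP.m≤n+m n m) (ℕP.m≤m+n (m ℕ.+ n) (m ℕ.+ n))) (ℕP.m≤n+m _ 3)) (proj₂ (finite-degree x)))) v²
    where
    open PolyPoint pp using (x; z′)
    m n : ℕ
    m = proj₁ (finite-degree z′)
    n = proj₁ (finite-degree x)

clean-coordinates : ∀ {x y} → y *ᴷ y ≈ᴷ OL.rhs x → ∃[ u ] ∃[ v ] (v *ᴷ v ≈ᴷ CL.rhs u) × (pt x y ~ φ u v)
clean-coordinates {x} {y} c = u , v ,
    KS.linear (q ∷ y ∷ OL.rhs x ∷ CL.rhs u ∷ [])
      (λ q y r₀ r → (# 2 :* q :* q :* y :* (# 2 :* q :* q :* y) := r) , (# 4 :* q :* q :* q :* q , y :* y := r₀) ∷ (# 4 :* q :* q :* q :* q , r₀ := # 64 :* r) ∷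
        (r :* (# 64 :* q :* q :* q :+ # 16 :* q :* q :+ # 4 :* q :+ # 1) , q :* # 4 := # 1) ∷ [])
      (c KS.∷ rescale-rhs A₂-eq A₄-eq A₆-eq x-u KS.∷ proj₂ quarter KS.∷ KS.[]) ,
    pt x-u (KS.linear (q ∷ y ∷ []) (λ q y → (y := # 8 :* (# 2 :* q :* q :* y)) , (:- (y :* (# 4 :* q :+ # 1)) , q :* # 4 := # 1) ∷ []) (proj₂ quarter KS.∷ KS.[]))
  where
  q u v : K
  q = proj₁ quarter
  u = q *ᴷ (x +ᴷ sᴷ)
  v = KS.fromℕ 2 *ᴷ q *ᴷ q *ᴷ y
  x-u : x ≈ᴷ KS.fromℕ 4 *ᴷ u +ᴷ -ᴷ sᴷ
  x-u = KS.linear (x ∷ q ∷ sᴷ ∷ []) (λ x q s → (x := # 4 :* (q :* (x :+ s)) :- s) , (:- (x :+ s) , q :* # 4 := # 1) ∷ []) (proj₂ quarter KS.∷ KS.[])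

opaque
  unfolding _+ᴷ_

  clean : ∀ A → (⌜ A ⌝ ~ ∞) ⊎ (∃[ u ] ∃[ v ] (v *ᴷ v ≈ᴷ CL.rhs u) × (⌜ A ⌝ ~ φ u v))
  clean (mkElem O _) = inj₁ ∞
  clean (mkElem (aff x y) (vx , vy , c)) = inj₂ (clean-coordinates (from≈ {Y *ᴷ Y} {OL.rhs X′} c))
    where
    X′ Y : K
    X′ = mkK x (validᴷ x vx)
    Y = mkK y (validᴷ y vy)

span : ∀ A → PM.Span P Q A
span A = from (clean A)
  where
  from : (⌜ A ⌝ ~ ∞) ⊎ (∃[ u ] ∃[ v ] (v *ᴷ v ≈ᴷ CL.rhs u) × (⌜ A ⌝ ~ φ u v)) → PM.Span P Q A
  from (inj₁ e) = PM.span-cong (mk≋ (OG.~-sym e)) PM.span-0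
  from (inj₂ (u , v , v² , e)) = let (A′ , e′ , s) = member v² in PM.span-cong (mk≋ (OG.~-trans e′ (OG.~-sym e))) s

point-combination : ∀ m n → point (m ⊡ P ∙ n ⊡ Q) ≡ m · Pₐ ⊕ n · Qₐ
point-combination m n = ≡.trans (point-∙ (m ⊡ P) (n ⊡ Q)) (cong₂ _⊕_ (point-⊡ m P) (point-⊡ n Q))

spans : ∀ R → OnCurve R → ∃[ m ] ∃[ n ] (R ≈ₚₜ m · Pₐ ⊕ n · Qₐ)
spans R o = from (span (mkElem R o))
  where
  from : PM.Span P Q (mkElem R o) → ∃[ m ] ∃[ n ] (R ≈ₚₜ m · Pₐ ⊕ n · Qₐ)
  from (m , n , e) = m , n , subst (R ≈ₚₜ_) (point-combination m n) (~⇒≈ₚₜ (mkElem R o) (m ⊡ P ∙ n ⊡ Q) (same e))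

-- Points outside the doubles

-- If (c, t) = 2 W then c - θ is a square, so that halving (c, t) gives a point of
-- abscissa 0 or -t; the abscissa of its double differs from c.
module NotDouble (c : Poly) (dc : Deg< 2 c) (c+t+1≄0 : ¬ c +ₚ t +ₚ 1ₚ ≃ [])
  (root-c : c *ₚ c *ₚ c +ₚ (t +ₚ PS.fromℕ 2) *ₚ c *ₚ c +ₚ PS.fromℕ 2 *ₚ t *ₚ c ≃ []) where

  constantPoint : PolyPoint
  constantPoint = record
    { x = c ; y = t ; z′ = 1ₚ ; α = [] ; β = 1ₚ
    ; coprime = PS.ringEq (c ∷ []) (λ c → # 0 :* c :+ # 1 :* # 1 := # 1)
    ; z′≄0 = κ≄0
    ; y≄0 = t≄0
    ; curve = PS.linear (t ∷ c ∷ []) (λ t c → (t :* t := c :* c :* c :+ (t :+ # 2) :* c :* c :* (# 1 :* # 1) :+ # 2 :* t :* c :* (# 1 :* # 1) :* (# 1 :* # 1)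
        :+ t :* t :* (# 1 :* # 1) :* (# 1 :* # 1) :* (# 1 :* # 1)) ,
        (:- # 1 , c :* c :* c :+ (t :+ # 2) :* c :* c :+ # 2 :* t :* c := # 0) ∷ []) (root-c PS.∷ PS.[])
    }

  constantRep : Rep constantPoint ⌊ c ⌋ tᴷ
  constantRep = record
    { u-eq = KS.linear (⌊ c ⌋ ∷ ⌊ 1ₚ ⌋ ∷ []) (λ c o → (c :* (o :* o) := c) , (c :* (o :+ # 1) , o := # 1) ∷ []) (⌊⌋-1 KS.∷ KS.[])
    ; v-eq = KS.linear (tᴷ ∷ ⌊ 1ₚ ⌋ ∷ []) (λ c o → (c :* (o :* o :* o) := c) , (c :* (o :* o :+ o :+ # 1) , o := # 1) ∷ []) (⌊⌋-1 KS.∷ KS.[])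
    }

  not-halved : ¬ Halved 0 ⌊ c ⌋
  not-halved h = from (H.base refl)
    where
    module H = Halved h
    x y : K
    x = H.x′
    y = H.y′
    from : (x ≈ᴷ constᴷ 0ℚ) ⊎ (x ≈ᴷ -ᴷ tᴷ) → ⊥
    -- The double of `(0, ±t)` has abscissa `-(t + 1)`, which is excluded by `c+t+1≄0`.
    from (inj₁ e) = ⌊⌋≉0 (≄0-* (≄0-* t≄0 t≄0) c+t+1≄0) (KR.trans (⌊⌋-value (t ∷ c ∷ []) (λ t c → t :* t :* (c :+ t :+ # 1)))
      (KS.linear (q ∷ tᴷ ∷ ⌊ c ⌋ ∷ x ∷ y ∷ CL.Line.l H.line ∷ []) (λ q t c x y l → (t :* t :* (c :+ t :+ # 1) := # 0) ,
        (:- (t :* t :* (c :+ t :+ # 1)) , q :* # 4 := # 1) ∷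
        (q :* (# 4 :* t :* t) , x :+ x :+ c := l :* l :- (t :+ # 2)) ∷
        (q :* (# 2 :* l :* y :+ # 2 :* t) , # 2 :* y :* l := # 3 :* x :* x :+ # 2 :* (t :+ # 2) :* x :+ # 2 :* t :- (x :- x) :* (x :- c)) ∷
        (q :* (:- (# 4 :* l :* l)) , y :* y := x :* x :* x :+ (t :+ # 2) :* x :* x :+ # 2 :* t :* x :+ t :* t) ∷
        (q :* (# 4 :* l :* t :* y :+ # 6 :* l :* x :* y :+ # 8 :* l :* y :- # 8 :* l :* l :* t :- # 4 :* l :* l :* t :* x :- # 8 :* l :* l :* x
          :- # 4 :* l :* l :* x :* x :+ # 6 :* t :* x :+ # 8 :* t :- # 4 :* t :* t) , x := # 0) ∷ [])
        (proj₂ quarter KS.∷ CL.Line.s₁ H.line KS.∷ CL.slope H.line KS.∷ CL.on-curve H.line KS.∷ e KS.∷ KS.[])))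
      where
      q : K
      q = proj₁ quarter
    -- The double of `(-t, ±t)` has an abscissa `c` with `4 (c + 1) = t²`, of degree 2, whereas `c`
    -- has degree at most 1.
    from (inj₂ e) = ⌊⌋≉0 (≄0-* (≄0-* t≄0 t≄0) (Lead-≄0 (Lead-+ (Lead-neg (Lead-* t-Lead t-Lead)) (D-* {0} {1} {PS.fromℕ 4} {c +ₚ 1ₚ} D-4 (Deg<-+ dc (Deg<-mono (s≤s z≤n) (Deg<-cons Deg<-[])))))))
      (KR.trans (⌊⌋-value (t ∷ c ∷ []) (λ t c → t :* t :* (:- (t :* t) :+ # 4 :* (c :+ # 1))))
      (KS.linear (tᴷ ∷ ⌊ c ⌋ ∷ x ∷ y ∷ CL.Line.l H.line ∷ []) (λ t c x y l → (t :* t :* (:- (t :* t) :+ # 4 :* (c :+ # 1)) := # 0) ,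
        (# 4 :* t :* t , x :+ x :+ c := l :* l :- (t :+ # 2)) ∷
        (# 2 :* l :* y :- # 2 :* t :+ t :* t , # 2 :* y :* l := # 3 :* x :* x :+ # 2 :* (t :+ # 2) :* x :+ # 2 :* t :- (x :- x) :* (x :- c)) ∷
        (:- (# 4 :* l :* l) , y :* y := x :* x :* x :+ (t :+ # 2) :* x :* x :+ # 2 :* t :* x :+ t :* t) ∷
        (:- (# 2 :* l :* t :* y) :+ # 6 :* l :* x :* y :+ # 8 :* l :* y :- # 8 :* l :* l :* x :- # 4 :* l :* l :* x :* x
          :- # 6 :* t :* x :- # 8 :* t :+ # 3 :* t :* t :* x :- # 2 :* t :* t :- t :* t :* t , x := :- t) ∷ [])
        (CL.Line.s₁ H.line KS.∷ CL.slope H.line KS.∷ CL.on-curve H.line KS.∷ e KS.∷ KS.[])))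
      where
      D-4 : Deg< 1 (PS.fromℕ 4)
      D-4 = mkDeg λ { (suc i) _ → refl }

  not-square : ¬ SquareClass (ι 1ₚ) (x-θ c (1ₚ *ₚ 1ₚ))
  not-square s = not-halved (halve 0 constantPoint ⌊ c ⌋ tᴷ constantRep (mkBounded (Deg<-cons Deg<-[]) (Deg<-mono (s≤s (s≤s z≤n)) dc)) s)

  module Doubling (u v l : K) (l-eq : l *ᴷ (KS.fromℕ 2 *ᴷ v) ≈ᴷ KS.fromℕ 3 *ᴷ u *ᴷ u +ᴷ KS.fromℕ 2 *ᴷ a₂ᴷ *ᴷ u +ᴷ a₄ᴷ)
    (c-eq : ⌊ c ⌋ ≈ᴷ l *ᴷ l +ᴷ -ᴷ a₂ᴷ +ᴷ -ᴷ u +ᴷ -ᴷ u) (pp : PolyPoint) (rep : Rep pp u v) where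
    open PolyPoint pp
    open Rep rep
    open Descent pp using (a; a-def)

    Dₑ : ∀ {n} → Expr n → Expr n → Expr n → Expr n
    Dₑ t x w = # 3 :* x :* x :+ # 2 :* (t :+ # 2) :* x :* w :+ # 2 :* t :* w :* w

    duplication : PS.fromℕ 4 *ₚ y *ₚ y *ₚ (z′ *ₚ z′) *ₚ c ≃
      (PS.fromℕ 3 *ₚ x *ₚ x +ₚ PS.fromℕ 2 *ₚ (t +ₚ PS.fromℕ 2) *ₚ x *ₚ (z′ *ₚ z′) +ₚ PS.fromℕ 2 *ₚ t *ₚ (z′ *ₚ z′) *ₚ (z′ *ₚ z′)) *ₚ
      (PS.fromℕ 3 *ₚ x *ₚ x +ₚ PS.fromℕ 2 *ₚ (t +ₚ PS.fromℕ 2) *ₚ x *ₚ (z′ *ₚ z′) +ₚ PS.fromℕ 2 *ₚ t *ₚ (z′ *ₚ z′) *ₚ (z′ *ₚ z′))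
      -ₚ PS.fromℕ 4 *ₚ y *ₚ y *ₚ ((t +ₚ PS.fromℕ 2) *ₚ (z′ *ₚ z′) +ₚ PS.fromℕ 2 *ₚ x)
    duplication = ⌊⌋-reflects ⌊⌋-injective (t ∷ c ∷ x ∷ y ∷ z′ ∷ [])
      (λ t c x y z → # 4 :* y :* y :* (z :* z) :* c := Dₑ t x (z :* z) :* Dₑ t x (z :* z) :- # 4 :* y :* y :* ((t :+ # 2) :* (z :* z) :+ # 2 :* x))
      (KS.linear (tᴷ ∷ ⌊ c ⌋ ∷ ⌊ x ⌋ ∷ ⌊ y ⌋ ∷ ⌊ z′ ⌋ ∷ u ∷ v ∷ l ∷ [])
        (λ t c x y z u v l → (# 4 :* y :* y :* (z :* z) :* c := Dₑ t x (z :* z) :* Dₑ t x (z :* z) :- # 4 :* y :* y :* ((t :+ # 2) :* (z :* z) :+ # 2 :* x)) ,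
          (:- (# 4 :* ((z :* z) :* c :+ (t :+ # 2) :* (z :* z) :+ # 2 :* x)) :* (y :+ v :* (z :* z :* z)) , v :* (z :* z :* z) := y) ∷
          ((# 3 :* (x :+ u :* (z :* z)) :+ # 2 :* (t :+ # 2) :* (z :* z)) :* (Dₑ t x (z :* z) :+ Dₑ t (u :* (z :* z)) (z :* z))
            :- # 8 :* v :* v :* z :* z :* z :* z :* z :* z , u :* (z :* z) := x) ∷
          (# 4 :* v :* v :* z :* z :* z :* z :* z :* z :* z :* z , c := l :* l :- (t :+ # 2) :- u :- u) ∷
          (z :* z :* z :* z :* z :* z :* z :* z :* (l :* (# 2 :* v) :+ Dₑ t u (# 1)) ,
            l :* (# 2 :* v) := # 3 :* u :* u :+ # 2 :* (t :+ # 2) :* u :+ # 2 :* t) ∷ [])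
        (v-eq KS.∷ u-eq KS.∷ c-eq KS.∷ l-eq KS.∷ KS.[]))

    Λ n : Elt
    Λ = a *ᴮ a +ᴮ -ᴮ ((BS.fromℕ 3 *ᴮ θ *ᴮ θ +ᴮ BS.fromℕ 2 *ᴮ (ι t +ᴮ BS.fromℕ 2) *ᴮ θ +ᴮ BS.fromℕ 2 *ᴮ ι t) *ᴮ (ι z′ *ᴮ ι z′ *ᴮ ι z′ *ᴮ ι z′))
    n = ι (PS.fromℕ 2 *ₚ y *ₚ z′)

    -- The classical reason why doubles have trivial class,
    -- `x(2R) - θ = (((u - θ)² - f′(θ)) / 2v)²`, cleared of denominators.
    n²[c-θ] : n *ᴮ n *ᴮ (ι c +ᴮ -ᴮ θ) ≈ᴮ Λ *ᴮ Λ
    n²[c-θ] = BS.linear (n ∷ a ∷ ι t ∷ ι c ∷ ι x ∷ ι y ∷ ι z′ ∷ θ ∷ [])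
      (λ n a t c x y z θ → (n :* n :* (c :- θ) := Λₑ a t z θ :* Λₑ a t z θ) ,
        ((n :+ # 2 :* y :* z) :* (c :- θ) , n := # 2 :* y :* z) ∷
        (:- ((a :+ (x :- z :* z :* θ)) :* (Λₑ a t z θ :+ Λₑ (x :- z :* z :* θ) t z θ)) , a := x :- (z :* z) :* θ) ∷
        (# 1 , # 4 :* y :* y :* (z :* z) :* c := Dₑ t x (z :* z) :* Dₑ t x (z :* z) :- # 4 :* y :* y :* ((t :+ # 2) :* (z :* z) :+ # 2 :* x)) ∷
        (:- (# 4 :* t :* z :* z :+ # 8 :* x :+ # 4 :* z :* z :* θ :+ # 8 :* z :* z) ,
          y :* y := x :* x :* x :+ (t :+ # 2) :* x :* x :* (z :* z) :+ # 2 :* t :* x :* (z :* z) :* (z :* z) :+ t :* t :* (z :* z) :* (z :* z) :* (z :* z)) ∷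
        (:- (z :* z :* z :* z :* z :* z :* (# 4 :* t :* z :* z :+ # 8 :* x :+ # 4 :* z :* z :* θ :+ # 8 :* z :* z)) ,
          θ :* θ :* θ :+ (t :+ # 2) :* θ :* θ :+ # 2 :* t :* θ :+ t :* t := # 0) ∷ [])
      (ι-value (y ∷ z′ ∷ []) (λ y z → # 2 :* y :* z) BS.∷ a-def BS.∷
       ι-holds (t ∷ c ∷ x ∷ y ∷ z′ ∷ []) (λ t c x y z → # 4 :* y :* y :* (z :* z) :* c :=
         Dₑ t x (z :* z) :* Dₑ t x (z :* z) :- # 4 :* y :* y :* ((t :+ # 2) :* (z :* z) :+ # 2 :* x)) duplication BS.∷
       ι-holds (x ∷ y ∷ z′ ∷ t ∷ []) (λ x y z t → y :* y := x :* x :* x :+ (t :+ # 2) :* x :* x :* (z :* z)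
         :+ # 2 :* t :* x :* (z :* z) :* (z :* z) :+ t :* t :* (z :* z) :* (z :* z) :* (z :* z)) curve BS.∷
       θ-rootᴮ BS.∷ BS.[])
      where
      Λₑ : ∀ {n} → Expr n → Expr n → Expr n → Expr n → Expr n
      Λₑ a t z θ = a :* a :- (# 3 :* θ :* θ :+ # 2 :* (t :+ # 2) :* θ :+ # 2 :* t) :* (z :* z :* z :* z)

    regular-n : BD.Regular n
    regular-n = regular-norm (PD.regular-cong (≃-sym (norm-ι n₀)) (≄0⇒regular (≄0-* (≄0-* n₀≄0 n₀≄0) n₀≄0)))
      where
      n₀ : Poly
      n₀ = PS.fromℕ 2 *ₚ y *ₚ z′
      n₀≄0 : ¬ n₀ ≃ []
      n₀≄0 = ≄0-* {PS.fromℕ 2 *ₚ y} {z′} (≄0-* {PS.fromℕ 2} {y} (λ e → absurd (at e 0)) y≄0) z′≄0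
        where
        absurd : ¬ coeff (PS.fromℕ 2) 0 ≡ 0ℚ
        absurd ()

    opaque
      root-exists : ∃[ s ] Λ ≈ᴮ n *ᴮ s
      root-exists = BD.square-divides bezoutᴮ {n} {ι c +ᴮ -ᴮ θ} {Λ} regular-n n²[c-θ]

    s : Elt
    s = proj₁ root-exists

    c-θ : ι c +ᴮ -ᴮ θ ≈ᴮ s *ᴮ s
    c-θ = BD.cancel {n *ᴮ n} (BD.regular-* regular-n regular-n) (BS.linear (n ∷ ι c +ᴮ -ᴮ θ ∷ Λ ∷ s ∷ [])
      (λ n k L s → (n :* n :* k := n :* n :* (s :* s)) , (# 1 , n :* n :* k := L :* L) ∷ (L :+ n :* s , L := n :* s) ∷ [])
      (n²[c-θ] BS.∷ proj₂ root-exists BS.∷ BS.[]))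

    impossible : ⊥
    impossible = not-square (s , BS.linear (x-θ c (1ₚ *ₚ 1ₚ) ∷ ι c ∷ ι (1ₚ *ₚ 1ₚ) ∷ ι 1ₚ ∷ θ ∷ s ∷ [])
      (λ X c oo o θ s → (X := o :* (s :* s)) , (# 1 , X := c :- oo :* θ) ∷ (:- θ , oo := # 1) ∷ (# 1 , c :- θ := s :* s) ∷ (:- (s :* s) , o := # 1) ∷ [])
      (elt-x-θz c (1ₚ *ₚ 1ₚ) BS.∷ B.trans (B.sym (ι-homo-* 1ₚ 1ₚ)) (B.*-identityˡ (ι 1ₚ)) BS.∷ c-θ BS.∷ B.refl BS.∷ BS.[]))

  module _ (u v : K) (v² : v *ᴷ v ≈ᴷ CL.rhs u) where
    opaque
      inverse-2v : ∃[ i ] i *ᴷ (KS.fromℕ 2 *ᴷ v) ≈ᴷ constᴷ 1ℚ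
      inverse-2v = inverseᴷ (CG.2y≉0 v²)

    f′ l u₃ v₃ : K
    f′ = KS.fromℕ 3 *ᴷ u *ᴷ u +ᴷ KS.fromℕ 2 *ᴷ a₂ᴷ *ᴷ u +ᴷ a₄ᴷ
    l  = f′ *ᴷ proj₁ inverse-2v
    u₃ = l *ᴷ l +ᴷ -ᴷ a₂ᴷ +ᴷ -ᴷ u +ᴷ -ᴷ u
    v₃ = l *ᴷ (u₃ +ᴷ -ᴷ u) +ᴷ v

    l-eq : l *ᴷ (KS.fromℕ 2 *ᴷ v) ≈ᴷ f′
    l-eq = KS.linear (f′ ∷ proj₁ inverse-2v ∷ v ∷ []) (λ f i v → (f :* i :* (# 2 :* v) := f) , (f , i :* (# 2 :* v) := # 1) ∷ []) (proj₂ inverse-2v KS.∷ KS.[])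

    tangentLine : CL.Line u v u v u₃ v₃
    tangentLine = CL.line-cong KR.refl KR.refl KR.refl (KS.ringEq (l ∷ u ∷ v ∷ []) (λ l u v → l :* (u :- u) :+ v := v)) KR.refl KR.refl
      (CL.tangent v² l-eq KR.refl)

    third≉c : ¬ u₃ ≈ᴷ ⌊ c ⌋
    third≉c e = from (normalise v²)
      where
      from : ∃[ pp ] Rep pp u v → ⊥
      from (pp , rep) = Doubling.impossible u v l l-eq (KR.sym e) pp rep

  not-double : ∀ {T v} → ⌜ T ⌝ ~ φ ⌊ c ⌋ v → ∀ W → ¬ T ≋ W ∙ W
  not-double {T} {v} T~ W T≋ = from (clean W)
    where
    not-zero : ¬ ∞ ~ φ ⌊ c ⌋ v
    not-zero ()
    same-abscissa : ∀ {u v′} → neg (φ u v′) ~ φ ⌊ c ⌋ v → u ≈ᴷ ⌊ c ⌋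
    same-abscissa {u} (pt e _) = KS.linear (u ∷ ⌊ c ⌋ ∷ sᴷ ∷ proj₁ quarter ∷ [])
      (λ u c s q → (u := c) , (q , # 4 :* u :- s := # 4 :* c :- s) ∷ (c :- u , q :* # 4 := # 1) ∷ []) (e KS.∷ proj₂ quarter KS.∷ KS.[])
    from : (⌜ W ⌝ ~ ∞) ⊎ (∃[ u ] ∃[ v ] (v *ᴷ v ≈ᴷ CL.rhs u) × (⌜ W ⌝ ~ φ u v)) → ⊥
    from (inj₁ e) = not-zero (OG.~-trans (OG.~-sym (zero⇒~ W W (OG.zero-cong (OG.~-sym e) (OG.~-sym e) OG.~-refl OG.z₀)))
      (OG.~-trans (OG.~-sym (same T≋)) T~))
    from (inj₂ (u , v′ , v² , e)) = third≉c u v′ v² (same-abscissa {v′ = v₃ u v′ v²} (OG.~-trans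
      (OG.~-sym (zero⇒~ W W (OG.zero-cong (OG.~-sym e) (OG.~-sym e) OG.~-refl (φ-zero (tangentLine u v′ v²)))))
      (OG.~-trans (OG.~-sym (same T≋)) T~)))

-- Independence

-- The remainder is displayed even when it is 0, so that all four combinations of parities are
-- literal instances of `mx+ny-split`.
parity : ∀ m → (∃[ k ] m ≡ + 0 ℤ.+ (k ℤ.+ k)) ⊎ (∃[ k ] m ≡ + 1 ℤ.+ (k ℤ.+ k))
parity m = from (m %ℕ 2) (n%ℕd<d m 2) (a≡a%ℕn+[a/ℕn]*n m 2)
  where
  q : ℤ
  q = m /ℕ 2
  q*2 : q ℤ.* + 2 ≡ q ℤ.+ q
  q*2 = ≡.trans (ℤP.*-distribˡ-+ q (+ 1) (+ 1)) (cong₂ ℤ._+_ (ℤP.*-identityʳ q) (ℤP.*-identityʳ q))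
  from : ∀ r → r ℕ.< 2 → m ≡ + r ℤ.+ q ℤ.* + 2 → (∃[ k ] m ≡ + 0 ℤ.+ (k ℤ.+ k)) ⊎ (∃[ k ] m ≡ + 1 ℤ.+ (k ℤ.+ k))
  from zero _ e = inj₁ (q , ≡.trans e (cong (λ j → + 0 ℤ.+ j) q*2))
  from (suc zero) _ e = inj₂ (q , ≡.trans e (cong (λ j → + 1 ℤ.+ j) q*2))
  from (suc (suc r)) (s≤s (s≤s ())) e

∣k+k∣ : ∀ k → ℤ.∣ + 0 ℤ.+ (k ℤ.+ k) ∣ ≡ ℤ.∣ k ∣ ℕ.+ ℤ.∣ k ∣
∣k+k∣ (+ n)    = refl
∣k+k∣ -[1+ n ] = cong suc (≡.sym (ℕP.+-suc n n))

module Independent {c ℓ} (G : AbelianGroup c ℓ) where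
  open AbelianGroup G hiding (refl) renaming (_≈_ to _≈ᴳ_; _∙_ to _⊹_; ε to 0ᴳ; ∙-cong to ⊹-cong)
  open Multiples G renaming (_⊡_ to _⊙_)
  open Algebra.Properties.AbelianGroup G using (⁻¹-∙-comm; inverseˡ-unique)
  open Algebra.Properties.CommutativeSemigroup commutativeSemigroup using (interchange)
  open Relation.Binary.Reasoning.Setoid setoid

  module _ (torsion-free : ∀ w → w ⊹ w ≈ᴳ 0ᴳ → w ≈ᴳ 0ᴳ) (x y : Carrier)
    (x-odd : ∀ w → ¬ x ≈ᴳ w ⊹ w) (y-odd : ∀ w → ¬ y ≈ᴳ w ⊹ w) (x⊹y-odd : ∀ w → ¬ x ⊹ y ≈ᴳ w ⊹ w) where
    mx+ny : ℤ → ℤ → Carrier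
    mx+ny m n = m ⊙ x ⊹ n ⊙ y

    mx+ny-split : ∀ r s k l → mx+ny (r ℤ.+ (k ℤ.+ k)) (s ℤ.+ (l ℤ.+ l)) ≈ᴳ mx+ny r s ⊹ (mx+ny k l ⊹ mx+ny k l)
    mx+ny-split r s k l = begin
      mx+ny (r ℤ.+ (k ℤ.+ k)) (s ℤ.+ (l ℤ.+ l))
        ≈⟨ ⊹-cong (trans (⊡-+ r (k ℤ.+ k) x) (∙-congˡ (⊡-+ k k x))) (trans (⊡-+ s (l ℤ.+ l) y) (∙-congˡ (⊡-+ l l y))) ⟩
      (r ⊙ x ⊹ (k ⊙ x ⊹ k ⊙ x)) ⊹ (s ⊙ y ⊹ (l ⊙ y ⊹ l ⊙ y)) ≈⟨ interchange _ _ _ _ ⟩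
      mx+ny r s ⊹ ((k ⊙ x ⊹ k ⊙ x) ⊹ (l ⊙ y ⊹ l ⊙ y)) ≈⟨ ∙-congˡ (interchange _ _ _ _) ⟩
      mx+ny r s ⊹ (mx+ny k l ⊹ mx+ny k l) ∎

    double-inverse : ∀ r s k l → mx+ny (r ℤ.+ (k ℤ.+ k)) (s ℤ.+ (l ℤ.+ l)) ≈ᴳ 0ᴳ → mx+ny r s ≈ᴳ mx+ny k l ⁻¹ ⊹ mx+ny k l ⁻¹
    double-inverse r s k l e = trans (inverseˡ-unique _ _ (trans (sym (mx+ny-split r s k l)) e)) (sym (⁻¹-∙-comm _ _))

    independent-below : ∀ N m n → ℤ.∣ m ∣ ℕ.+ ℤ.∣ n ∣ ℕ.≤ N → mx+ny m n ≈ᴳ 0ᴳ → (m ≡ + 0) × (n ≡ + 0)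
    independent-below zero m n le e = ℤP.∣i∣≡0⇒i≡0 (ℕP.m+n≡0⇒m≡0 ℤ.∣ m ∣ (ℕP.n≤0⇒n≡0 le)) , ℤP.∣i∣≡0⇒i≡0 (ℕP.m+n≡0⇒n≡0 ℤ.∣ m ∣ (ℕP.n≤0⇒n≡0 le))
    independent-below (suc N) m n le e = from (parity m) (parity n) le e
      where
      halve-≤ : ∀ s → s ℕ.+ s ℕ.≤ suc N → s ℕ.≤ N
      halve-≤ zero    _        = z≤n
      halve-≤ (suc s) (s≤s le) = ℕP.≤-trans (ℕP.m≤n+m (suc s) s) le
      from : ∀ {m n} → (∃[ k ] m ≡ + 0 ℤ.+ (k ℤ.+ k)) ⊎ (∃[ k ] m ≡ + 1 ℤ.+ (k ℤ.+ k)) →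
        (∃[ k ] n ≡ + 0 ℤ.+ (k ℤ.+ k)) ⊎ (∃[ k ] n ≡ + 1 ℤ.+ (k ℤ.+ k)) →
        ℤ.∣ m ∣ ℕ.+ ℤ.∣ n ∣ ℕ.≤ suc N → mx+ny m n ≈ᴳ 0ᴳ → (m ≡ + 0) × (n ≡ + 0)
      from (inj₁ (k , refl)) (inj₁ (l , refl)) le e = doubled (independent-below N k l smaller (torsion-free _
          (trans (sym (identityˡ _)) (trans (∙-congʳ (sym (identityˡ 0ᴳ))) (trans (sym (mx+ny-split (+ 0) (+ 0) k l)) e)))))
        where
        smaller : ℤ.∣ k ∣ ℕ.+ ℤ.∣ l ∣ ℕ.≤ N
        smaller = halve-≤ _ (ℕP.≤-trans (ℕP.≤-reflexive (≡.sym (≡.trans (cong₂ ℕ._+_ (∣k+k∣ k) (∣k+k∣ l))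
          (solve 2 (λ a b → (a N:+ a) N:+ (b N:+ b) N:= (a N:+ b) N:+ (a N:+ b)) refl ℤ.∣ k ∣ ℤ.∣ l ∣)))) le)
        doubled : (k ≡ + 0) × (l ≡ + 0) → (+ 0 ℤ.+ (k ℤ.+ k) ≡ + 0) × (+ 0 ℤ.+ (l ℤ.+ l) ≡ + 0)
        doubled (refl , refl) = refl , refl
      from (inj₂ (k , refl)) (inj₁ (l , refl)) le e = ⊥-elim (x-odd _ (trans (proj₂ (proj₂ (span-x {x} {y}))) (double-inverse (+ 1) (+ 0) k l e)))
      from (inj₁ (k , refl)) (inj₂ (l , refl)) le e = ⊥-elim (y-odd _ (trans (proj₂ (proj₂ (span-y {x} {y}))) (double-inverse (+ 0) (+ 1) k l e)))
      from (inj₂ (k , refl)) (inj₂ (l , refl)) le e = ⊥-elim (x⊹y-odd _ (trans (⊹-cong (sym (identityʳ x)) (sym (identityʳ y))) (double-inverse (+ 1) (+ 1) k l e)))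

    independent : ∀ m n → mx+ny m n ≈ᴳ 0ᴳ → (m ≡ + 0) × (n ≡ + 0)
    independent m n = independent-below (ℤ.∣ m ∣ ℕ.+ ℤ.∣ n ∣) m n ℕP.≤-refl

no-2-torsion : ∀ W → W ∙ W ≋ ε → W ≋ ε
no-2-torsion W e = from (clean W)
  where
  absurd : ∀ {u v} → v *ᴷ v ≈ᴷ CL.rhs u → ¬ Zero (φ u v) (φ u v) ∞
  absurd {u} {v} v² (OG.z₃ _ h) = CG.y≉0 v² (KS.linear (v ∷ proj₁ quarter ∷ [])
    (λ v q → (v := # 0) , (q :* q , # 8 :* v := :- (# 8 :* v)) ∷ (:- (v :* (# 4 :* q :+ # 1)) , q :* # 4 := # 1) ∷ []) (h KS.∷ proj₂ quarter KS.∷ KS.[]))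
  from : (⌜ W ⌝ ~ ∞) ⊎ (∃[ u ] ∃[ v ] (v *ᴷ v ≈ᴷ CL.rhs u) × (⌜ W ⌝ ~ φ u v)) → W ≋ ε
  from (inj₁ h) = mk≋ h
  from (inj₂ (u , v , v² , h)) = ⊥-elim (absurd v² (OG.zero-cong h h (OG.neg-cong (same e)) (∙-zero W W)))

P-odd : ∀ W → ¬ P ≋ W ∙ W
P-odd = NotDouble.not-double [] Deg<-[] (Lead-≄0 t+1-Lead) root-P {P} {tᴷ}
  (OG.~-trans P~φ (φ-cong (KR.sym (num-zero ≃-refl)) KR.refl))

Q-odd : ∀ W → ¬ Q ≋ W ∙ W
Q-odd = NotDouble.not-double (negₚ (PS.fromℕ 2)) (Deg<-mono (s≤s z≤n) (Deg<-neg D-2))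
  (Lead-≄0 (Lead-cong (PS.ringEq (t ∷ []) (λ t → t :+ :- # 1 := :- # 2 :+ t :+ # 1)) (Lead-+ t-Lead (Deg<-neg {p = 1ₚ} (Deg<-cons Deg<-[]))))) root-Q {Q} {tᴷ}
  (OG.~-trans Q~φ (φ-cong (KR.sym (⌊⌋-value [] (:- # 2))) KR.refl))

P∙Q-odd : ∀ W → ¬ P ∙ Q ≋ W ∙ W
P∙Q-odd = NotDouble.not-double (negₚ t) (Deg<-neg D-t)
  (λ e → κ≄0 (≃-trans (PS.ringEq (t ∷ []) (λ t → # 1 := :- t :+ t :+ # 1)) e)) root-S {P ∙ Q} { -ᴷ tᴷ}
  (OG.~-trans (zero⇒~ P Q (OG.zero-cong (OG.~-sym P~φ) (OG.~-sym Q~φ) OG.~-refl (φ-zero line-PQ)))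
    (pt (KR.+-congʳ (KR.*-congˡ (KR.sym (⌊⌋-neg t)))) (KS.ringEq (tᴷ ∷ []) (λ t → :- (# 8 :* t) := # 8 :* :- t))))

independence : ∀ m n → m · Pₐ ⊕ n · Qₐ ≈ₚₜ O → (m ≡ + 0) × (n ≡ + 0)
independence m n e = Independent.independent pointGroup no-2-torsion P Q P-odd Q-odd P∙Q-odd m n
  (≈ₚₜ-ε⇒≋ (m ⊡ P ∙ n ⊡ Q) (subst (_≈ₚₜ O) (≡.sym (point-combination m n)) e))

theorem3p3 :
  OnCurve Pₐ × OnCurve Qₐ ×
  (∀ (R : Pt) → OnCurve R → ∃[ m ] ∃[ n ] (R ≈ₚₜ m · Pₐ ⊕ n · Qₐ)) ×
  (∀ (m n : ℤ) → m · Pₐ ⊕ n · Qₐ ≈ₚₜ O → (m ≡ + 0) × (n ≡ + 0))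
theorem3p3 = P-on-curve , Q-on-curve , spans , independence
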